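{- Fix an integer $r\ge 3$ and a sufficiently small $\eta>0$ (in terms of $r$). Then, there is $\varepsilon=\varepsilon(r,\eta)>0$ such that, for every sufficiently large $n$ and every tree $T$ on $n$ vertices with maximum degree $\Delta\le\varepsilon n$, every $\varepsilon$-balanced $\eta$-standard colouring of the edges of $K_n$ in $r$ colours contains a copy of $T$ where colour $1$ is given to at least $\frac{\eta^2}{10^6r^3}\,n$ more edges than any other colour.
   Context: Colours are $1,\dots,r$; $[2,r]=\{2,\dots,r\}$. An $r$-edge-colouring of a graph $G$ is $\varepsilon$-balanced if, for each colour, the proportion of edges of $G$ having that colour lies in $[1/r-\varepsilon,1/r+\varepsilon]$. For $\eta>0$, an $r$-edge-colouring of a graph $G$ on $n$ vertices is $\eta$-standard if, for every partition $V_1,V_2$ of its vertex set with $|V_1|-|V_2|\in\{0,1\}$ and every integer $i\in[2,r]$, $G[V_1]$ contains at least $\eta n^2$ edges with colour different from $1$ or $G[V_2]$ contains at least $\eta n^2$ edges with colour different from $i$. A copy of $T$ is a subgraph isomorphic to $T$. -}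

module Defs where

open import Data.Fin.Base using (Fin; zero; suc; inject₁; fromℕ; fromℕ<; _<_)
open import Data.Fin.Permutation using (Permutation′; _⟨$⟩ʳ_)
open import Data.Fin.Properties using (_≟_; _<?_)
open import Data.Fin.Subset using (Subset; ∁; ∣_∣; _∈_)
open import Data.Fin.Subset.Properties using (_∈?_)
open import Data.Integer.Base using (+_)
open import Data.List.Base using (List; allFin; cartesianProduct; filter; length; map)
open import Data.List.Extrema.Nat using (max)
open import Data.Nat.Base as ℕ using (ℕ; suc; NonZero; >-nonZero⁻¹)
open import Data.Nat.Properties using (m*n≢0; m^n≢0)
open import Data.Product.Base using (Σ; Σ-syntax; ∃; ∃-syntax; _×_; _,_; uncurry)
open import Data.Rational.Base as ℚ using (ℚ; 0ℚ; _/_)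
open import Data.Sum.Base using (_⊎_)
open import Function.Base using (_∘_)
open import Function.Bundles using (_⇔_)
open import Function.Definitions using (Injective)
open import Relation.Binary.Construct.Closure.ReflexiveTransitive using (Star)
open import Relation.Binary.Definitions using (Decidable; Symmetric)
open import Relation.Binary.PropositionalEquality using (_≡_; _≢_; refl; sym; ≢-sym)
open import Relation.Nullary using (¬_; ¬?; _×-dec_)
import Relation.Unary as U

------------------------------------------------------------------------
-- Numbers

-- Dedekind reals: `lower q` means q < x and `upper q` means x < q.
record ℝ : Set₁ where
  field
    lower upper     : ℚ → Set
    lower-inhabited : ∃ lower
    upper-inhabited : ∃ upper
    lower-rounded   : ∀ {p} → lower p ⇔ (∃[ q ] p ℚ.< q × lower q)
    upper-rounded   : ∀ {q} → upper q ⇔ (∃[ p ] p ℚ.< q × upper p)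
    disjoint        : ∀ {q} → ¬ (lower q × upper q)
    located         : ∀ {p q} → p ℚ.< q → lower p ⊎ upper q

open ℝ public using (lower; upper)

-- x · a ≤ b as an inequality of reals, for a rational a ≥ 0.
_·_≼_ : ℝ → ℚ → ℚ → Set
x · a ≼ b = ∀ q → lower x q → q ℚ.* a ℚ.≤ b

-- x² · a ≤ b as an inequality of reals, for x > 0 and a rational a ≥ 0:
-- x² is the supremum of q² over the rationals 0 ≤ q < x.
_²·_≼_ : ℝ → ℚ → ℚ → Set
x ²· a ≼ b = ∀ q → 0ℚ ℚ.≤ q → lower x q → q ℚ.* q ℚ.* a ℚ.≤ b

⌜_⌝ : ℕ → ℚ
⌜ n ⌝ = + n / 1

------------------------------------------------------------------------
-- Finite simple graphs on the vertex set Fin n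

record Graph (n : ℕ) : Set₁ where
  field
    Adj     : Fin n → Fin n → Set
    adj?    : Decidable Adj
    adj-sym : Symmetric Adj
    irrefl  : ∀ {u} → ¬ Adj u u

open Graph public

private
  variable
    n r : ℕ

K : ∀ n → Graph n
K n = record
  { Adj     = _≢_
  ; adj?    = λ u v → ¬? (u ≟ v)
  ; adj-sym = ≢-sym
  ; irrefl  = λ u≢u → u≢u refl
  }

-- Each edge is listed once, with its smaller endpoint first.
edges : Graph n → List (Fin n × Fin n)
edges {n} G =
  filter (λ (u , v) → (u <? v) ×-dec adj? G u v)
         (cartesianProduct (allFin n) (allFin n))

edgeCount : Graph n → ℕ
edgeCount G = length (edges G)

degree : Graph n → Fin n → ℕ
degree {n} G u = length (filter (adj? G u) (allFin n))

maxDegree : Graph n → ℕ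
maxDegree {n} G = max 0 (map (degree G) (allFin n))

-- The induced subgraph G[V], kept on the vertex set Fin n: the vertices
-- outside V become isolated, which does not affect its edges.
_[_] : Graph n → Subset n → Graph n
G [ V ] = record
  { Adj     = λ u v → u ∈ V × v ∈ V × Adj G u v
  ; adj?    = λ u v → (u ∈? V) ×-dec ((v ∈? V) ×-dec adj? G u v)
  ; adj-sym = λ (u∈V , v∈V , uv) → v∈V , u∈V , adj-sym G uv
  ; irrefl  = λ (_ , _ , uu) → irrefl G uu
  }

_⊆ᴳ_ : Graph n → Graph n → Set
H ⊆ᴳ G = ∀ {u v} → Adj H u v → Adj G u v

_≅_ : Graph n → Graph n → Set
_≅_ {n} G H =
  Σ[ π ∈ Permutation′ n ] (∀ u v → Adj G u v ⇔ Adj H (π ⟨$⟩ʳ u) (π ⟨$⟩ʳ v))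

-- Here T and G have equally many vertices, so every subgraph of G isomorphic
-- to T is spanning.
record Copy (T G : Graph n) : Set₁ where
  field
    graph    : Graph n
    subgraph : graph ⊆ᴳ G
    iso      : T ≅ graph

open Copy public using (graph)

Connected : Graph n → Set
Connected G = ∀ u v → Star (Adj G) u v

-- A cycle of length 3 + k, given by its distinct vertices in cyclic order.
record Cycle (G : Graph n) : Set where
  field
    k        : ℕ
    vertex   : Fin (3 ℕ.+ k) → Fin n
    distinct : Injective _≡_ _≡_ vertex
    step     : ∀ (i : Fin (2 ℕ.+ k)) → Adj G (vertex (inject₁ i)) (vertex (suc i))
    close    : Adj G (vertex (fromℕ (2 ℕ.+ k))) (vertex zero)

record IsTree (G : Graph n) : Set where
  field
    nonempty  : NonZero n
    connected : Connected G
    acyclic   : ¬ Cycle G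

------------------------------------------------------------------------
-- Edge-colourings; the colours 1, …, r are the elements of Fin r

-- The value of `colour` at a non-adjacent pair is irrelevant.
record Colouring (G : Graph n) (r : ℕ) : Set where
  field
    colour     : Fin n → Fin n → Fin r
    colour-sym : ∀ {u v} → Adj G u v → colour u v ≡ colour v u

open Colouring public

colour₁ : .{{NonZero r}} → Fin r
colour₁ {r} = fromℕ< (>-nonZero⁻¹ r)

-- The number of edges of H whose colour satisfies P, where H is a subgraph
-- of the coloured graph G.
countEdges : {G : Graph n} → Colouring G r → Graph n →
             {P : Fin r → Set} → U.Decidable P → ℕ
countEdges c H P? = length (filter (P? ∘ uncurry (colour c)) (edges H))

#_coloured_inside_ : {G : Graph n} → Fin r → Colouring G r → Graph n → ℕ
# i coloured c inside H = countEdges c H (_≟ i)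

#≢_coloured_inside_ : {G : Graph n} → Fin r → Colouring G r → Graph n → ℕ
#≢ i coloured c inside H = countEdges c H (λ j → ¬? (j ≟ i))

-- The bounds on the proportion of each colour, multiplied by the number of
-- edges.
Balanced : .{{NonZero r}} → ℚ → {G : Graph n} → Colouring G r → Set
Balanced {r} ε {G} c = ∀ (i : Fin r) →
  ((+ 1 / r) ℚ.- ε) ℚ.* ⌜ edgeCount G ⌝ ℚ.≤ ⌜ # i coloured c inside G ⌝ ×
  ⌜ # i coloured c inside G ⌝ ℚ.≤ ((+ 1 / r) ℚ.+ ε) ℚ.* ⌜ edgeCount G ⌝

-- A partition V₁, V₂ is given by V₁, with V₂ its complement.
Standard : .{{NonZero r}} → ℝ → {G : Graph n} → Colouring G r → Set
Standard {r} {n} η {G} c =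
  ∀ (V₁ : Subset n) → let V₂ = ∁ V₁ in
  ∣ V₁ ∣ ≡ ∣ V₂ ∣ ⊎ ∣ V₁ ∣ ≡ suc ∣ V₂ ∣ →
  ∀ (i : Fin r) → i ≢ colour₁ →
  (η · ⌜ n ℕ.^ 2 ⌝ ≼ ⌜ #≢ colour₁ coloured c inside (G [ V₁ ]) ⌝) ⊎
  (η · ⌜ n ℕ.^ 2 ⌝ ≼ ⌜ #≢ i coloured c inside (G [ V₂ ]) ⌝)

-- n / (10⁶ r³)
margin : (r : ℕ) .{{_ : NonZero r}} → ℕ → ℚ
margin r n =
  _/_ (+ n) (10 ℕ.^ 6 ℕ.* r ℕ.^ 3) {{m*n≢0 (10 ℕ.^ 6) (r ℕ.^ 3) {{_}} {{m^n≢0 r 3}}}}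

-- Embed T by a uniformly random bijection. Averaging over the continuations of a tuple shows that functions of
-- the images of disjoint tuples are almost uncorrelated, so by Chebyshev's inequality and Δ ≤ ε n all
-- relevant counts are close to their means: the colour counts of the copy are nearly equal, and many disjoint
-- gadgets behave as on average. A gadget is a pair of vertices of degree 1, or of degree 2, whose
-- images a, b may be exchanged; T has linearly many of one kind. The effect of the exchange is
-- governed by the colours of the 4-cycle a, p, b, q through the images of neighbours (for degree 2, only if the
-- other two edges at a, and at b, agree in colour).
--
-- Let w be the indicator of colour 1 minus that of colour i. If almost all 4-cycles were balanced for w,
-- then 2 w(x, y) = g(x) + g(y) for almost all x, y, and g would essentially be 0 everywhere, against the
-- frequency of colour 1, or ±1 everywhere; then {g = 1} and {g = -1} would have almost equal sizes and be almost
-- monochromatic in the colours 1 and i, against standardness. Hence many 4-cycles are unbalanced. Exchanging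
-- whenever this gains colour 1, and on a suitable share of the gadgets also when it loses colour i at no cost
-- to colour 1, makes colour 1 win against every other colour.
module Submission where

open import Level using (Level)
open import Data.Bool.Base using (Bool; true; false)
open import Data.Empty using (⊥; ⊥-elim)
open import Data.Fin.Base as Fin using (Fin; zero; suc; punchIn; combine; remQuot)
open import Data.Fin.Permutation as Perm using (Permutation′; _⟨$⟩ʳ_; _⟨$⟩ˡ_; _∘ₚ_)
import Data.Fin.Permutation.Components as PC
import Data.Fin.Properties as Fin
open import Data.Fin.Subset using (Subset; inside; outside; ∁; ∣_∣)
  renaming (_∈_ to _∈ˢ_; _⊆_ to _⊆ˢ_; ⊤ to ⊤ˢ; ⊥ to ⊥ˢ; _-_ to _-ˢ_)
open import Data.Fin.Subset.Properties as Subset using () renaming (_∈?_ to _∈ˢ?_)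
open import Data.Integer.Base as ℤ
  using (ℤ; +_; -[1+_]; -_; _+_; _-_; _*_; _^_; 0ℤ; 1ℤ; +≤+; -≤+; +<+; positive)
  renaming (_≤_ to _≤ᶻ_; _<_ to _<ᶻ_)
import Data.Integer.Properties as ℤ
open import Data.Integer.Tactic.RingSolver using (solve-∀)
open import Data.List.Base
  using (List; []; _∷_; _++_; map; length; lookup; filter; allFin; tabulate; concatMap; cartesianProductWith; cartesianProduct)
open import Data.List.Extrema.Nat using (xs≤max)
open import Data.List.Membership.DecPropositional as DecMembership using ()
open import Data.List.Membership.Propositional using (_∈_; _∉_; lose; find)
open import Data.List.Membership.Propositional.Properties
  using (∈-allFin; ∈-cartesianProductWith⁻; ∈-map⁺; ∈-map⁻; ∈-++⁺ˡ; ∈-++⁺ʳ; ∈-filter⁺; ∈-filter⁻; ∈-concatMap⁺; ∈-concatMap⁻; ∈-tabulate⁻)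
import Data.List.Properties as List
import Data.List.Relation.Unary.All as All
open import Data.List.Relation.Unary.Any using (here; there; index)
open import Data.List.Relation.Unary.Any.Properties using (lookup-index)
open import Data.Nat.Base as ℕ using (ℕ; zero; suc; NonZero; _≤_; z≤n; s≤s; _!)
import Data.Nat.DivMod as ℕ
import Data.Nat.Properties as ℕ
open import Data.Product.Base using (Σ-syntax; ∃-syntax; _×_; _,_; proj₁; proj₂; uncurry)
open import Data.Rational.Base as ℚ using (ℚ; 0ℚ; mkℚ; toℚᵘ; _/_)
import Data.Rational.Properties as ℚ
open import Data.Rational.Unnormalised.Base as ℚᵘ using (ℚᵘ; mkℚᵘ; ↥_; ↧_; _≃_; *≤*; *<*)
import Data.Rational.Unnormalised.Properties as ℚᵘ
open import Data.Sum.Base as Sum using (_⊎_; inj₁; inj₂)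
import Data.Vec.Base as Vec
import Data.Vec.Properties as Vec
open import Function.Base using (_∘_; _$_; id; case_of_)
open import Function.Bundles using (mk⇔; Equivalence)
open import Relation.Binary.Construct.Closure.ReflexiveTransitive using (Star; ε; _◅_)
open import Relation.Binary.Definitions using (tri<; tri≈; tri>)
open import Relation.Binary.PropositionalEquality
  using (_≡_; _≢_; refl; sym; trans; cong; cong₂; subst; subst₂; ≢-sym; module ≡-Reasoning)
open import Relation.Nullary using (¬_; Dec; yes; no; does; ¬?; _×-dec_)
open import Relation.Unary using (Decidable)
open import Algebra.Properties.CommutativeMonoid.Sum ℤ.+-0-commutativeMonoid using (sum; sum-permute)

open import Defs using (Graph; Adj; adj?; adj-sym; irrefl; IsTree; Cycle; Connected; degree; maxDegree)

-- The margin is quadratic in η because of the way g is found. A pair b, q is fixed for which the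
-- formula for 2 w fails on at most n²/K² pairs; s vertices with impossible values cause s²
-- failures, so there are at most n/K of them. Errors of order n²/K must stay below the η n² of
-- standardness, so K is a multiple of 1/η and the density of unbalanced cycles is only known to be
-- at least of order η². For the indicator of colour 1 itself, a multiple of r serves as K, and that
-- density is free of η.
--
-- The obstacle is to beat all colours at once. An exchange that gains colour 1 gains at least 1 in
-- total over any two other colours, so at most one colour i lags behind. Exchanges made against i
-- may favour the others, but the density free of η pays for this once η is small in terms of r.
-- Another factor r² is lost because the second edges at vertices of degree 2 must agree in colour.
--
-- Probabilities are counts over the n! bijections, and all estimates are cleared of denominators.
-- As reals cannot be compared decidably, η is only enclosed between 1/(l+3) and 1/(l+1).

private
  variable
    ℓ ℓ′ : Level
    X Y : Set ℓ
    n : ℕ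

-- Certified integer inequalities

gap : ∀ {a b} → a ≤ᶻ b → 0ℤ ≤ᶻ b - a
gap = ℤ.i≤j⇒0≤j-i

-- To show a ≤ b, exhibit b - a as an expression built from nonnegative ones.
≤-by : ∀ {a b e} → 0ℤ ≤ᶻ e → b - a ≡ e → a ≤ᶻ b
≤-by p q = ℤ.0≤i-j⇒j≤i (subst (0ℤ ≤ᶻ_) (sym q) p)

0≤+ : ∀ n → 0ℤ ≤ᶻ + n
0≤+ n = +≤+ z≤n

infixl 6 _⊕_
infixl 7 _⊗_

-- With `_⊗_` below, the proof of nonnegativity mirrors, term by term, the expression that `≤-by`
-- asks for; the ring solver checks the identity.
_⊕_ : ∀ {a b} → 0ℤ ≤ᶻ a → 0ℤ ≤ᶻ b → 0ℤ ≤ᶻ a + b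
_⊕_ = ℤ.+-mono-≤

_⊗_ : ∀ {a b} → 0ℤ ≤ᶻ a → 0ℤ ≤ᶻ b → 0ℤ ≤ᶻ a * b
_⊗_ {+ a} {+ b} p q = subst (0ℤ ≤ᶻ_) (ℤ.pos-* a b) (0≤+ (a ℕ.* b))

sq : ∀ a → 0ℤ ≤ᶻ a * a
sq (+ n)    = 0≤+ n ⊗ 0≤+ n
sq -[1+ n ] = +≤+ z≤n

<⇒0≤ : ∀ {a} → 0ℤ <ᶻ a → 0ℤ ≤ᶻ a
<⇒0≤ = ℤ.<⇒≤

*-monoˡ : ∀ {a b} c → 0ℤ ≤ᶻ c → a ≤ᶻ b → c * a ≤ᶻ c * b
*-monoˡ {a} {b} c p q = ≤-by (p ⊗ gap q) (e a b c)
  where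
  e : ∀ a b c → c * b - c * a ≡ c * (b - a)
  e = solve-∀

*-mono : ∀ {a b c d} → 0ℤ ≤ᶻ a → 0ℤ ≤ᶻ d → a ≤ᶻ b → c ≤ᶻ d → a * c ≤ᶻ b * d
*-mono {a} {b} {c} {d} p q r s = ≤-by (gap r ⊗ q ⊕ p ⊗ gap s) (e a b c d)
  where
  e : ∀ a b c d → b * d - a * c ≡ (b - a) * d + a * (d - c)
  e = solve-∀

*-cancel : ∀ c {a b} → 0ℤ <ᶻ c → c * a ≤ᶻ c * b → a ≤ᶻ b
*-cancel c 0<c p = ℤ.*-cancelˡ-≤-pos _ _ c {{positive 0<c}} p

sq-cancel : ∀ {a b} → 0ℤ ≤ᶻ b → a * a ≤ᶻ b * b → a ≤ᶻ b
sq-cancel {a} {b} 0≤b p with a ℤ.≤? b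
... | yes q = q
... | no ¬q = ⊥-elim (ℤ.≤⇒≯ p (ℤ.≤-<-trans
    (≤-by (0≤b ⊗ gap (ℤ.<⇒≤ b<a)) (e₁ a b))
    (ℤ.*-monoˡ-<-pos a {{positive (ℤ.≤-<-trans 0≤b b<a)}} b<a)))
  where
  b<a : b <ᶻ a
  b<a = ℤ.≰⇒> ¬q
  e₁ : ∀ a b → a * b - b * b ≡ b * (a - b)
  e₁ = solve-∀

≡⇒≤ : ∀ {a b} → a ≡ b → a ≤ᶻ b
≡⇒≤ = ℤ.≤-reflexive

-- Indicators

𝟙 : Bool → ℤ
𝟙 true  = 1ℤ
𝟙 false = 0ℤ

⟦_⟧ : {P : Set ℓ} → Dec P → ℤ
⟦ d ⟧ = 𝟙 (does d)

⟦⟧-yes : {P : Set ℓ} (d : Dec P) → P → ⟦ d ⟧ ≡ 1ℤ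
⟦⟧-yes (yes _) p = refl
⟦⟧-yes (no ¬p) p = ⊥-elim (¬p p)

⟦⟧-no : {P : Set ℓ} (d : Dec P) → ¬ P → ⟦ d ⟧ ≡ 0ℤ
⟦⟧-no (yes p) ¬p = ⊥-elim (¬p p)
⟦⟧-no (no _)  ¬p = refl

⟦⟧-≥0 : {P : Set ℓ} (d : Dec P) → 0ℤ ≤ᶻ ⟦ d ⟧
⟦⟧-≥0 (yes _) = 0≤+ 1
⟦⟧-≥0 (no _)  = 0≤+ 0

⟦⟧-≤1 : {P : Set ℓ} (d : Dec P) → ⟦ d ⟧ ≤ᶻ 1ℤ
⟦⟧-≤1 (yes _) = ℤ.≤-refl
⟦⟧-≤1 (no _)  = 0≤+ 1

⟦⟧-mono : {P : Set ℓ} {Q : Set ℓ′} (d : Dec P) (d′ : Dec Q) → (P → Q) → ⟦ d ⟧ ≤ᶻ ⟦ d′ ⟧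
⟦⟧-mono (yes p) d′ f = ≡⇒≤ (sym (⟦⟧-yes d′ (f p)))
⟦⟧-mono (no _)  d′ f = ⟦⟧-≥0 d′

⟦⟧-cong : {P : Set ℓ} {Q : Set ℓ′} (d : Dec P) (d′ : Dec Q) → (P → Q) → (Q → P) → ⟦ d ⟧ ≡ ⟦ d′ ⟧
⟦⟧-cong d d′ f g = ℤ.≤-antisym (⟦⟧-mono d d′ f) (⟦⟧-mono d′ d g)

⟦⟧-× : {P : Set ℓ} {Q : Set ℓ′} (d : Dec P) (d′ : Dec Q) → ⟦ d ×-dec d′ ⟧ ≡ ⟦ d ⟧ * ⟦ d′ ⟧
⟦⟧-× (yes _) (yes _) = refl
⟦⟧-× (yes _) (no _)  = refl
⟦⟧-× (no _)  d′      = refl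

⟦⟧-¬ : {P : Set ℓ} (d : Dec P) → ⟦ ¬? d ⟧ ≡ 1ℤ - ⟦ d ⟧
⟦⟧-¬ (yes _) = refl
⟦⟧-¬ (no _)  = refl

-- Sums over lists

∑ : List X → (X → ℤ) → ℤ
∑ []       F = 0ℤ
∑ (x ∷ xs) F = F x + ∑ xs F

∑-syntax : List X → (X → ℤ) → ℤ
∑-syntax = ∑

infix 5 ∑-syntax
syntax ∑-syntax xs (λ x → e) = ∑[ x ∈ xs ] e

∑-cong-∈ : ∀ (xs : List X) {F G : X → ℤ} → (∀ x → x ∈ xs → F x ≡ G x) → ∑ xs F ≡ ∑ xs G
∑-cong-∈ []       eq = refl
∑-cong-∈ (x ∷ xs) eq = cong₂ _+_ (eq x (here refl)) (∑-cong-∈ xs (λ y → eq y ∘ there))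

∑-cong : ∀ (xs : List X) {F G : X → ℤ} → (∀ x → F x ≡ G x) → ∑ xs F ≡ ∑ xs G
∑-cong xs eq = ∑-cong-∈ xs (λ x _ → eq x)

∑-mono-∈ : ∀ (xs : List X) {F G : X → ℤ} → (∀ x → x ∈ xs → F x ≤ᶻ G x) → ∑ xs F ≤ᶻ ∑ xs G
∑-mono-∈ []       le = ℤ.≤-refl
∑-mono-∈ (x ∷ xs) le = ℤ.+-mono-≤ (le x (here refl)) (∑-mono-∈ xs (λ y → le y ∘ there))

∑-mono : ∀ (xs : List X) {F G : X → ℤ} → (∀ x → F x ≤ᶻ G x) → ∑ xs F ≤ᶻ ∑ xs G
∑-mono xs le = ∑-mono-∈ xs (λ x _ → le x)

∑-0 : ∀ (xs : List X) → ∑ xs (λ _ → 0ℤ) ≡ 0ℤ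
∑-0 []       = refl
∑-0 (x ∷ xs) = trans (ℤ.+-identityˡ _) (∑-0 xs)

∑-≥0 : ∀ (xs : List X) {F : X → ℤ} → (∀ x → 0ℤ ≤ᶻ F x) → 0ℤ ≤ᶻ ∑ xs F
∑-≥0 xs {F} le = subst (_≤ᶻ ∑ xs F) (∑-0 xs) (∑-mono xs le)

∑-+ : ∀ (xs : List X) (F G : X → ℤ) → ∑ xs (λ x → F x + G x) ≡ ∑ xs F + ∑ xs G
∑-+ []       F G = refl
∑-+ (x ∷ xs) F G = trans (cong (λ s → F x + G x + s) (∑-+ xs F G)) (e (F x) (G x) (∑ xs F) (∑ xs G))
  where
  e : ∀ a b c d → a + b + (c + d) ≡ a + c + (b + d)
  e = solve-∀

∑-*ˡ : ∀ (xs : List X) c (F : X → ℤ) → ∑ xs (λ x → c * F x) ≡ c * ∑ xs F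
∑-*ˡ []       c F = sym (ℤ.*-zeroʳ c)
∑-*ˡ (x ∷ xs) c F = trans (cong (λ s → c * F x + s) (∑-*ˡ xs c F)) (sym (ℤ.*-distribˡ-+ c (F x) _))

∑-*ʳ : ∀ (xs : List X) c (F : X → ℤ) → ∑ xs (λ x → F x * c) ≡ ∑ xs F * c
∑-*ʳ xs c F = trans (∑-cong xs (λ x → ℤ.*-comm (F x) c)) (trans (∑-*ˡ xs c F) (ℤ.*-comm c _))

∑-- : ∀ (xs : List X) (F G : X → ℤ) → ∑ xs (λ x → F x - G x) ≡ ∑ xs F - ∑ xs G
∑-- []       F G = refl
∑-- (x ∷ xs) F G = trans (cong (λ s → F x - G x + s) (∑-- xs F G)) (e (F x) (G x) (∑ xs F) (∑ xs G))
  where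
  e : ∀ a b c d → a - b + (c - d) ≡ a + c - (b + d)
  e = solve-∀

∑-const : ∀ (xs : List X) c → ∑ xs (λ _ → c) ≡ + length xs * c
∑-const []       c = refl
∑-const (x ∷ xs) c = trans (cong (λ s → c + s) (∑-const xs c)) (e (+ length xs) c)
  where
  e : ∀ l c → c + l * c ≡ (1ℤ + l) * c
  e = solve-∀

∑-comm : ∀ (xs : List X) (ys : List Y) (F : X → Y → ℤ) →
         ∑[ x ∈ xs ] ∑[ y ∈ ys ] F x y ≡ ∑[ y ∈ ys ] ∑[ x ∈ xs ] F x y
∑-comm []       ys F = sym (∑-0 ys)
∑-comm (x ∷ xs) ys F =
  trans (cong (λ s → ∑ ys (F x) + s) (∑-comm xs ys F)) (sym (∑-+ ys (F x) (λ y → ∑[ z ∈ xs ] F z y)))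

∑-++ : ∀ (xs ys : List X) (F : X → ℤ) → ∑ (xs ++ ys) F ≡ ∑ xs F + ∑ ys F
∑-++ []       ys F = sym (ℤ.+-identityˡ _)
∑-++ (x ∷ xs) ys F = trans (cong (λ s → F x + s) (∑-++ xs ys F)) (sym (ℤ.+-assoc (F x) _ _))

∑-map : ∀ (f : X → Y) (xs : List X) (F : Y → ℤ) → ∑ (map f xs) F ≡ ∑ xs (F ∘ f)
∑-map f []       F = refl
∑-map f (x ∷ xs) F = cong (λ s → F (f x) + s) (∑-map f xs F)

∑-filter : ∀ {P : X → Set ℓ} (P? : Decidable P) (xs : List X) (F : X → ℤ) →
           ∑ (filter P? xs) F ≡ ∑[ x ∈ xs ] (⟦ P? x ⟧ * F x)
∑-filter P? []       F = refl
∑-filter P? (x ∷ xs) F with P? x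
... | yes _ = cong₂ _+_ (sym (ℤ.*-identityˡ (F x))) (∑-filter P? xs F)
... | no  _ = trans (∑-filter P? xs F) (sym (ℤ.+-identityˡ _))

∑-product : ∀ {Z : Set ℓ} (f : X → Y → Z) (xs : List X) (ys : List Y) (F : Z → ℤ) →
            ∑ (cartesianProductWith f xs ys) F ≡ ∑[ x ∈ xs ] ∑[ y ∈ ys ] F (f x y)
∑-product f []       ys F = refl
∑-product f (x ∷ xs) ys F =
  trans (∑-++ (map (f x) ys) _ F) (cong₂ _+_ (∑-map (f x) ys F) (∑-product f xs ys F))

length-filter≡∑ : ∀ {P : X → Set ℓ} (P? : Decidable P) (xs : List X) →
                  + length (filter P? xs) ≡ ∑[ x ∈ xs ] ⟦ P? x ⟧
length-filter≡∑ P? []       = refl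
length-filter≡∑ P? (x ∷ xs) with P? x
... | yes _ = cong (λ s → 1ℤ + s) (length-filter≡∑ P? xs)
... | no  _ = trans (length-filter≡∑ P? xs) (sym (ℤ.+-identityˡ _))

∑-*-∑ : ∀ (xs : List X) (ys : List Y) (F : X → ℤ) (G : Y → ℤ) →
        ∑[ x ∈ xs ] ∑[ y ∈ ys ] (F x * G y) ≡ ∑ xs F * ∑ ys G
∑-*-∑ xs ys F G = trans (∑-cong xs (λ x → ∑-*ˡ ys (F x) G)) (∑-*ʳ xs _ F)

∑-exists : ∀ (xs : List X) (F : X → ℤ) c → ∑ xs F <ᶻ + length xs * c → ∃[ x ] (x ∈ xs × F x <ᶻ c)
∑-exists []       F c p = ⊥-elim (ℤ.<-irrefl refl p)
∑-exists (x ∷ xs) F c p with F x ℤ.<? c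
... | yes q = x , here refl , q
... | no ¬q with ∑-exists xs F c (ℤ.≰⇒> λ le → ℤ.<⇒≱ p (≤-by (gap (ℤ.≮⇒≥ ¬q) ⊕ gap le) (e (+ length xs) c (F x) (∑ xs F))))
  where
  e : ∀ l c a s → a + s - (1ℤ + l) * c ≡ (a - c) + (s - l * c)
  e = solve-∀
...   | y , y∈ , r = y , there y∈ , r

∑-single≤ : ∀ (xs : List X) {F : X → ℤ} → (∀ x → 0ℤ ≤ᶻ F x) → ∀ {x} → x ∈ xs → F x ≤ᶻ ∑ xs F
∑-single≤ (x ∷ xs) {F} p (here refl) = ≤-by (∑-≥0 xs p) (e (F x) (∑ xs F))
  where
  e : ∀ a s → a + s - a ≡ s
  e = solve-∀
∑-single≤ (y ∷ xs) {F} p (there x∈) =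
  ℤ.≤-trans (∑-single≤ xs p x∈) (≤-by (p y) (e (F y) (∑ xs F)))
  where
  e : ∀ a s → a + s - s ≡ a
  e = solve-∀

-- Sums over Fin n

V : ∀ n → List (Fin n)
V = allFin

+length-V : ∀ n → + length (V n) ≡ + n
+length-V n = cong +_ (List.length-tabulate {n = n} id)

∑-V-const : ∀ n c → ∑ (V n) (λ _ → c) ≡ + n * c
∑-V-const n c = trans (∑-const (V n) c) (cong (λ s → s * c) (+length-V n))

∑-tabulate : ∀ (g : Fin n → X) (F : X → ℤ) → ∑ (tabulate g) F ≡ sum (F ∘ g)
∑-tabulate {n = zero}  g F = refl
∑-tabulate {n = suc n} g F = cong (λ s → F (g zero) + s) (∑-tabulate (g ∘ suc) F)

∑-permute : (π : Permutation′ n) (F : Fin n → ℤ) → ∑[ x ∈ V n ] F (π ⟨$⟩ʳ x) ≡ ∑ (V n) F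
∑-permute π F = trans (∑-tabulate id (λ x → F (π ⟨$⟩ʳ x))) (trans (sym (sum-permute F π)) (sym (∑-tabulate id F)))

∑-V-single : ∀ (y : Fin n) (F : Fin n → ℤ) → ∑[ x ∈ V n ] (⟦ x Fin.≟ y ⟧ * F x) ≡ F y
∑-V-single {n} y F = trans (∑-tabulate id (λ x → ⟦ x Fin.≟ y ⟧ * F x)) (go y F)
  where
  sum-0 : ∀ {n} (F : Fin n → ℤ) → (∀ x → F x ≡ 0ℤ) → sum F ≡ 0ℤ
  sum-0 {zero}  F p = refl
  sum-0 {suc n} F p = cong₂ _+_ (p zero) (sum-0 (F ∘ suc) (p ∘ suc))
  go : ∀ {n} (y : Fin n) (F : Fin n → ℤ) → sum (λ x → ⟦ x Fin.≟ y ⟧ * F x) ≡ F y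
  go {suc n} zero F = trans (cong₂ _+_ (ℤ.*-identityˡ (F zero))
      (sum-0 _ (λ x → cong (_* F (suc x)) (⟦⟧-no (suc x Fin.≟ zero) (λ ()))))) (ℤ.+-identityʳ _)
  go {suc n} (suc y) F = trans (ℤ.+-identityˡ _) (trans (cong-sum (λ x → cong (_* F (suc x))
      (⟦⟧-cong (suc x Fin.≟ suc y) (x Fin.≟ y) Fin.suc-injective (cong suc)))) (go y (F ∘ suc)))
    where
    cong-sum : ∀ {n} {F G : Fin n → ℤ} → (∀ x → F x ≡ G x) → sum F ≡ sum G
    cong-sum {zero}  p = refl
    cong-sum {suc n} p = cong₂ _+_ (p zero) (cong-sum (p ∘ suc))

∑-V-indicator : ∀ (y : Fin n) → ∑[ x ∈ V n ] ⟦ x Fin.≟ y ⟧ ≡ 1ℤ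
∑-V-indicator {n} y = trans (∑-cong (V n) (λ x → sym (ℤ.*-identityʳ _))) (∑-V-single y (λ _ → 1ℤ))

-- Averaging over permutations

⟪_⟫ : Permutation′ n → Fin n → Fin n
⟪ π ⟫ x = π ⟨$⟩ʳ x

⟪⟫-injective : ∀ (π : Permutation′ n) {x y} → ⟪ π ⟫ x ≡ ⟪ π ⟫ y → x ≡ y
⟪⟫-injective π eq = trans (sym (Perm.inverseˡ π)) (trans (cong (π ⟨$⟩ˡ_) eq) (Perm.inverseˡ π))

-- A permutation is coded by the image of `zero` and the code of what remains, so that a random
-- bijection becomes an index in `Fin (n !)`. Codes recover permutations only up to pointwise
-- equality, whence `Extensional` below.
decode : ∀ n → Fin (n !) → Permutation′ n
decode zero    _ = Perm.id
decode (suc n) i = uncurry (λ x j → Perm.insert zero x (decode n j)) (remQuot (n !) i)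

encode : ∀ n → Permutation′ n → Fin (n !)
encode zero    _ = zero
encode (suc n) π = combine (⟪ π ⟫ zero) (encode n (Perm.remove zero π))

remove-cong : (π ρ : Permutation′ (suc n)) → (∀ x → ⟪ π ⟫ x ≡ ⟪ ρ ⟫ x) →
              ∀ x → ⟪ Perm.remove zero π ⟫ x ≡ ⟪ Perm.remove zero ρ ⟫ x
remove-cong π ρ eq x = Fin.punchIn-injective (⟪ π ⟫ zero) _ _
  (trans (sym (Perm.punchIn-permute π zero x))
  (trans (eq (suc x))
  (trans (Perm.punchIn-permute ρ zero x)
         (cong (λ y → punchIn y (⟪ Perm.remove zero ρ ⟫ x)) (sym (eq zero))))))

encode-cong : ∀ n (π ρ : Permutation′ n) → (∀ x → ⟪ π ⟫ x ≡ ⟪ ρ ⟫ x) → encode n π ≡ encode n ρ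
encode-cong zero    π ρ eq = refl
encode-cong (suc n) π ρ eq = cong₂ combine (eq zero) (encode-cong n _ _ (remove-cong π ρ eq))

encode-decode : ∀ n i → encode n (decode n i) ≡ i
encode-decode zero    zero = refl
encode-decode (suc n) i    = trans
  (cong (combine x) (trans (encode-cong n _ _ (Perm.remove-insert zero x (decode n j))) (encode-decode n j)))
  (Fin.combine-remQuot {suc n} (n !) i)
  where
  x = proj₁ (remQuot {suc n} (n !) i)
  j = proj₂ (remQuot {suc n} (n !) i)

decode-encode : ∀ n (π : Permutation′ n) x → ⟪ decode n (encode n π) ⟫ x ≡ ⟪ π ⟫ x
decode-encode (suc n) π x = trans
  (cong (λ p → ⟪ uncurry (λ x j → Perm.insert zero x (decode n j)) p ⟫ x)
        (Fin.remQuot-combine {suc n} {n !} (⟪ π ⟫ zero) (encode n (Perm.remove zero π))))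
  (at x)
  where
  at : ∀ x → ⟪ Perm.insert zero (⟪ π ⟫ zero) (decode n (encode n (Perm.remove zero π))) ⟫ x ≡ ⟪ π ⟫ x
  at zero    = refl
  at (suc y) = trans (Perm.insert-punchIn zero (⟪ π ⟫ zero) (decode n (encode n (Perm.remove zero π))) y)
    (trans (cong (punchIn (⟪ π ⟫ zero)) (decode-encode n (Perm.remove zero π) y))
           (sym (Perm.punchIn-permute π zero y)))

-- This is `n !` times the expectation over a uniformly random bijection.
∑ₚ : ((Fin n → Fin n) → ℤ) → ℤ
∑ₚ {n} H = ∑[ i ∈ V (n !) ] H ⟪ decode n i ⟫

Extensional : ((Fin n → Fin n) → ℤ) → Set
Extensional H = ∀ {f g} → (∀ x → f x ≡ g x) → H f ≡ H g

-- Composition with `τ` permutes the codes, with composition by its inverse as inverse map, so the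
-- sum is merely reindexed.
∑ₚ-invariant : ∀ (τ : Permutation′ n) {H} → Extensional H → ∑ₚ (λ f → H (f ∘ ⟪ τ ⟫)) ≡ ∑ₚ H
∑ₚ-invariant {n} τ {H} ext = trans
  (∑-cong (V (n !)) (λ i → ext (λ x → sym (decode-encode n (τ ∘ₚ decode n i) x))))
  (∑-permute shift (λ i → H ⟪ decode n i ⟫))
  where
  inv : ∀ (σ ρ : Permutation′ n) → (∀ x → ⟪ ρ ⟫ (⟪ σ ⟫ x) ≡ x) →
        ∀ i → encode n (σ ∘ₚ decode n (encode n (ρ ∘ₚ decode n i))) ≡ i
  inv σ ρ eq i = trans
    (encode-cong n _ _ (λ x → trans (decode-encode n (ρ ∘ₚ decode n i) (⟪ σ ⟫ x)) (cong ⟪ decode n i ⟫ (eq x))))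
    (encode-decode n i)
  shift : Permutation′ (n !)
  shift = Perm.permutation
    (λ i → encode n (τ ∘ₚ decode n i))
    (λ i → encode n (Perm.flip τ ∘ₚ decode n i))
    (inv τ (Perm.flip τ) (λ x → Perm.inverseˡ τ))
    (inv (Perm.flip τ) τ (λ x → Perm.inverseʳ τ))

∑ₚ-const : ∀ n c → ∑ₚ {n} (λ _ → c) ≡ + (n !) * c
∑ₚ-const n c = ∑-V-const (n !) c

0<n! : ∀ n → 0ℤ <ᶻ + (n !)
0<n! n = +<+ (ℕ.>-nonZero⁻¹ (n !) {{ℕ._!≢0 n}})

-- Tuples of distinct vertices

infixl 8 _↑_

_↑_ : ℕ → ℕ → ℤ
n ↑ k = (+ n) ^ k

-- Repetitions are allowed, so that sums factor over the coordinates; the tuples that a bijection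
-- can reach are singled out by `Fresh []`.
tuples : ∀ n → ℕ → List (List (Fin n))
tuples n zero    = [] ∷ []
tuples n (suc k) = cartesianProductWith _∷_ (V n) (tuples n k)

∑-tuples-suc : ∀ n k (F : List (Fin n) → ℤ) →
               ∑ (tuples n (suc k)) F ≡ ∑[ x ∈ V n ] ∑[ v ∈ tuples n k ] F (x ∷ v)
∑-tuples-suc n k F = ∑-product _∷_ (V n) (tuples n k) F

tuples-length : ∀ n k {v} → v ∈ tuples n k → length v ≡ k
tuples-length n zero    (here refl) = refl
tuples-length n (suc k) v∈ with ∈-cartesianProductWith⁻ _∷_ (V n) (tuples n k) v∈
... | _ , _ , _ , w∈ , refl = cong suc (tuples-length n k w∈)

∑-tuples-const : ∀ n k c → ∑ (tuples n k) (λ _ → c) ≡ n ↑ k * c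
∑-tuples-const n zero    c = trans (ℤ.+-identityʳ c) (sym (ℤ.*-identityˡ c))
∑-tuples-const n (suc k) c = trans (∑-tuples-suc n k _)
  (trans (∑-cong (V n) (λ _ → ∑-tuples-const n k c))
  (trans (∑-V-const n _) (sym (ℤ.*-assoc (+ n) (n ↑ k) c))))

∑-tuples-permute : ∀ (π : Permutation′ n) k (F : List (Fin n) → ℤ) →
                   ∑[ v ∈ tuples n k ] F (map ⟪ π ⟫ v) ≡ ∑ (tuples n k) F
∑-tuples-permute π zero    F = refl
∑-tuples-permute {n} π (suc k) F = trans (∑-tuples-suc n k _)
  (trans (∑-cong (V n) (λ x → ∑-tuples-permute π k (λ v → F (⟪ π ⟫ x ∷ v))))
  (trans (∑-permute π (λ x → ∑[ v ∈ tuples n k ] F (x ∷ v))) (sym (∑-tuples-suc n k F))))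

_∈ᶠ?_ : (x : Fin n) (u : List (Fin n)) → Dec (x ∈ u)
_∈ᶠ?_ = DecMembership._∈?_ Fin._≟_

infixr 5 _∷_

-- The entries already read accumulate in the first argument. One relation thus says that `v` avoids
-- `u` and repeats nothing, and `Fresh []` is plain distinctness.
data Fresh {n} (u : List (Fin n)) : List (Fin n) → Set where
  []  : Fresh u []
  _∷_ : ∀ {x v} → x ∉ u → Fresh (x ∷ u) v → Fresh u (x ∷ v)

fresh? : ∀ (u v : List (Fin n)) → Dec (Fresh u v)
fresh? u []      = yes []
fresh? u (x ∷ v) with x ∈ᶠ? u | fresh? (x ∷ u) v
... | yes p | _     = no λ { (q ∷ _) → q p }
... | no p  | yes q = yes (p ∷ q)
... | no p  | no ¬q = no λ { (_ ∷ q) → ¬q q }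

transpose-at : ∀ (i j : Fin n) → PC.transpose i j i ≡ j
transpose-at i j with i Fin.≟ i
... | yes _ = refl
... | no ¬p = ⊥-elim (¬p refl)

transpose-off : ∀ (i j : Fin n) {x} → x ≢ i → x ≢ j → PC.transpose i j x ≡ x
transpose-off i j {x} p q with x Fin.≟ i
... | yes e = ⊥-elim (p e)
... | no _ with x Fin.≟ j
...   | yes e = ⊥-elim (q e)
...   | no _  = refl

map-cong-∈ : ∀ {B : Set} (f g : X → B) (u : List X) → (∀ {x} → x ∈ u → f x ≡ g x) → map f u ≡ map g u
map-cong-∈ f g []      eq = refl
map-cong-∈ f g (x ∷ u) eq = cong₂ _∷_ (eq (here refl)) (map-cong-∈ f g u (eq ∘ there))

∷-injective′ : ∀ {x y : X} {u v} → _≡_ {A = List X} (x ∷ u) (y ∷ v) → x ≡ y × u ≡ v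
∷-injective′ refl = refl , refl

-- Multiple transitivity of the symmetric group: each step composes with the transposition that
-- moves the current image of `x` to `x′`, and freshness keeps it away from the images of `u`.
extend : ∀ (τ : Permutation′ n) (u v v′ : List (Fin n)) → length v ≡ length v′ →
         Fresh u v → Fresh (map ⟪ τ ⟫ u) v′ →
         Σ[ σ ∈ Permutation′ n ] (map ⟪ σ ⟫ u ≡ map ⟪ τ ⟫ u × map ⟪ σ ⟫ v ≡ v′)
extend τ u []      []        len [] [] = τ , refl , refl
extend τ u (x ∷ v) (x′ ∷ v′) len (x∉u ∷ p) (x′∉ ∷ q) =
  let (σ , eq , eq′) = extend τ₁ (x ∷ u) v v′ (ℕ.suc-injective len) p
                         (subst (λ w → Fresh w v′) (sym (cong₂ _∷_ τ₁x τ₁u)) q)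
      (eqx , equ) = ∷-injective′ eq
  in σ , trans equ τ₁u , cong₂ _∷_ (trans eqx τ₁x) eq′
  where
  τ₁ = τ ∘ₚ Perm.transpose (⟪ τ ⟫ x) x′
  τ₁x : ⟪ τ₁ ⟫ x ≡ x′
  τ₁x = transpose-at (⟪ τ ⟫ x) x′
  τ₁u : map ⟪ τ₁ ⟫ u ≡ map ⟪ τ ⟫ u
  τ₁u = map-cong-∈ ⟪ τ₁ ⟫ ⟪ τ ⟫ u (λ {y} y∈u → transpose-off (⟪ τ ⟫ x) x′
    (λ eq → x∉u (subst (_∈ u) (⟪⟫-injective τ eq) y∈u))
    (λ eq → x′∉ (subst (_∈ map ⟪ τ ⟫ u) eq (∈-map⁺ ⟪ τ ⟫ y∈u))))

Fresh-map⁻ : ∀ (π : Permutation′ n) u {v} → Fresh (map ⟪ π ⟫ u) (map ⟪ π ⟫ v) → Fresh u v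
Fresh-map⁻ π u {[]}    []      = []
Fresh-map⁻ π u {x ∷ v} (p ∷ q) = (λ x∈u → p (∈-map⁺ ⟪ π ⟫ x∈u)) ∷ Fresh-map⁻ π (x ∷ u) q

Fresh-map⁺ : ∀ (π : Permutation′ n) u {v} → Fresh u v → Fresh (map ⟪ π ⟫ u) (map ⟪ π ⟫ v)
Fresh-map⁺ π u []      = []
Fresh-map⁺ π u (_∷_ {x} p q) = (λ m → case ∈-map⁻ ⟪ π ⟫ m of λ
  { (y , y∈ , eq) → p (subst (_∈ u) (sym (⟪⟫-injective π eq)) y∈) }) ∷ Fresh-map⁺ π (x ∷ u) q

stale : ℕ → List (Fin n) → ℤ
stale {n} k u = ∑[ v ∈ tuples n k ] (1ℤ - ⟦ fresh? u v ⟧)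

∑-∈≤length : ∀ (u : List (Fin n)) → ∑[ x ∈ V n ] ⟦ x ∈ᶠ? u ⟧ ≤ᶻ + length u
∑-∈≤length {n} []      = ≡⇒≤ (∑-0 (V n))
∑-∈≤length {n} (y ∷ u) = ℤ.≤-trans
  (∑-mono (V n) step)
  (subst (_≤ᶻ + length (y ∷ u)) (sym (∑-+ (V n) _ _))
    (ℤ.+-mono-≤ (≡⇒≤ (∑-V-indicator y)) (∑-∈≤length u)))
  where
  step : ∀ x → ⟦ x ∈ᶠ? (y ∷ u) ⟧ ≤ᶻ ⟦ x Fin.≟ y ⟧ + ⟦ x ∈ᶠ? u ⟧
  step x with x Fin.≟ y | x ∈ᶠ? u
  ... | yes _ | m     = ≤-by (⟦⟧-≥0 m) (e ⟦ m ⟧)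
    where
    e : ∀ a → 1ℤ + a - 1ℤ ≡ a
    e = solve-∀
  ... | no _  | yes _ = ℤ.≤-refl
  ... | no _  | no _  = ℤ.≤-refl

-- A union bound: each of the k entries must hit one of at most `length u + k` earlier values, which
-- fixes one coordinate. The factor `n` on the left avoids the exponent k - 1.
n*stale≤ : ∀ k (u : List (Fin n)) → + n * stale k u ≤ᶻ + k * (+ length u + + k) * n ↑ k
n*stale≤ {n} zero u = ≡⇒≤ (trans (ℤ.*-zeroʳ (+ n)) refl)
n*stale≤ {n} (suc k) u = begin
  + n * stale (suc k) u
    ≡⟨ cong (+ n *_) (∑-tuples-suc n k _) ⟩
  + n * (∑[ x ∈ V n ] ∑[ v ∈ tuples n k ] (1ℤ - ⟦ fresh? u (x ∷ v) ⟧))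
    ≤⟨ *-monoˡ (+ n) (0≤+ n) (∑-mono (V n) outer) ⟩
  + n * (∑[ x ∈ V n ] (⟦ x ∈ᶠ? u ⟧ * n ↑ k + stale k (x ∷ u)))
    ≡⟨ trans (cong (+ n *_) (∑-+ (V n) _ _)) (ℤ.*-distribˡ-+ (+ n) _ _) ⟩
  + n * (∑[ x ∈ V n ] (⟦ x ∈ᶠ? u ⟧ * n ↑ k)) + + n * (∑[ x ∈ V n ] stale k (x ∷ u))
    ≡⟨ cong₂ _+_ (cong (+ n *_) (∑-*ʳ (V n) (n ↑ k) _)) (sym (∑-*ˡ (V n) (+ n) _)) ⟩
  + n * ((∑[ x ∈ V n ] ⟦ x ∈ᶠ? u ⟧) * n ↑ k) + (∑[ x ∈ V n ] (+ n * stale k (x ∷ u)))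
    ≤⟨ ℤ.+-mono-≤ (*-monoˡ (+ n) (0≤+ n) (ℤ.*-monoʳ-≤-nonNeg (n ↑ k) {{ℤ.nonNegative (0≤^ k)}} (∑-∈≤length u)))
                  (∑-mono (V n) (λ x → n*stale≤ k (x ∷ u))) ⟩
  + n * (+ length u * n ↑ k) + (∑[ x ∈ V n ] (+ k * (1ℤ + + length u + + k) * n ↑ k))
    ≡⟨ cong (λ s → + n * (+ length u * n ↑ k) + s) (∑-V-const n _) ⟩
  + n * (+ length u * n ↑ k) + + n * (+ k * (1ℤ + + length u + + k) * n ↑ k)
    ≤⟨ ≤-by (0≤+ n ⊗ 0≤^ k ⊗ (0≤+ k ⊕ 0≤+ 1)) (e (+ n) (+ k) (+ length u) (n ↑ k)) ⟩
  + suc k * (+ length u + + suc k) * n ↑ suc k ∎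
  where
  open ℤ.≤-Reasoning
  0≤^ : ∀ k → 0ℤ ≤ᶻ n ↑ k
  0≤^ zero    = 0≤+ 1
  0≤^ (suc k) = 0≤+ n ⊗ 0≤^ k
  e : ∀ n k l p → (1ℤ + k) * (l + (1ℤ + k)) * (n * p) - (n * (l * p) + n * (k * (1ℤ + l + k) * p)) ≡ n * p * (k + 1ℤ)
  e = solve-∀
  outer : ∀ x → (∑[ v ∈ tuples n k ] (1ℤ - ⟦ fresh? u (x ∷ v) ⟧)) ≤ᶻ ⟦ x ∈ᶠ? u ⟧ * n ↑ k + stale k (x ∷ u)
  outer x = go (x ∈ᶠ? u)
    where
    e₂ : ∀ p s → 1ℤ * p + s - p ≡ s
    e₂ = solve-∀
    go : (d : Dec (x ∈ u)) → (∑[ v ∈ tuples n k ] (1ℤ - ⟦ fresh? u (x ∷ v) ⟧)) ≤ᶻ ⟦ d ⟧ * n ↑ k + stale k (x ∷ u)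
    go (yes p) = ℤ.≤-trans
      (∑-mono (tuples n k) {G = λ _ → 1ℤ} (λ v → ≤-by (⟦⟧-≥0 (fresh? u (x ∷ v))) (e₁ ⟦ fresh? u (x ∷ v) ⟧)))
      (≤-by (∑-≥0 (tuples n k) (λ v → gap (⟦⟧-≤1 (fresh? (x ∷ u) v))))
        (trans (cong (λ s → 1ℤ * n ↑ k + stale k (x ∷ u) - s) (trans (∑-tuples-const n k 1ℤ) (ℤ.*-identityʳ _)))
               (e₂ (n ↑ k) (stale k (x ∷ u)))))
      where
      e₁ : ∀ a → 1ℤ - (1ℤ - a) ≡ a
      e₁ = solve-∀
    go (no p) = ≡⇒≤ (trans
      (∑-cong (tuples n k) (λ v → cong (λ s → 1ℤ - s) (⟦⟧-cong (fresh? u (x ∷ v)) (fresh? (x ∷ u) v) (λ { (_ ∷ q) → q }) (p ∷_))))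
      (sym (ℤ.+-identityˡ _)))

-- Second moments

infixr 4 _∣_

-- The relation |a| ≤ b, kept as two sign conditions because these can be multiplied together in
-- certificates.
record Bounded (a b : ℤ) : Set where
  constructor _∣_
  field
    floor   : 0ℤ ≤ᶻ b + a
    ceiling : 0ℤ ≤ᶻ b - a

open Bounded

bounded-neg : ∀ {a b} → Bounded a b → Bounded (- a) b
bounded-neg {a} {b} (p ∣ q) = q ∣ subst (0ℤ ≤ᶻ_) (e a b) p
  where
  e : ∀ a b → b + a ≡ b - - a
  e = solve-∀

bounded-* : ∀ {a b c d} → Bounded a b → Bounded c d → a * c ≤ᶻ b * d
bounded-* {a} {b} {c} {d} (p ∣ p′) (q ∣ q′) =
  *-cancel (+ 2) (+<+ (s≤s z≤n)) (≤-by (p′ ⊗ q ⊕ p ⊗ q′) (e a b c d))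
  where
  e : ∀ a b c d → + 2 * (b * d) - + 2 * (a * c) ≡ (b - a) * (d + c) + (b + a) * (d - c)
  e = solve-∀

bounded-0 : ∀ b → 0ℤ ≤ᶻ b → Bounded 0ℤ b
bounded-0 b p = subst (0ℤ ≤ᶻ_) (sym (ℤ.+-identityʳ b)) p ∣ subst (0ℤ ≤ᶻ_) (sym (ℤ.+-identityʳ b)) p

∑-bounded : ∀ (xs : List X) {F G : X → ℤ} → (∀ x → Bounded (F x) (G x)) → Bounded (∑ xs F) (∑ xs G)
∑-bounded xs {F} {G} p =
  subst (0ℤ ≤ᶻ_) (∑-+ xs G F) (∑-≥0 xs (λ x → floor (p x))) ∣
  subst (0ℤ ≤ᶻ_) (∑-- xs G F) (∑-≥0 xs (λ x → ceiling (p x)))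

bounded-scale : ∀ {a b} c → 0ℤ ≤ᶻ c → Bounded a b → Bounded (c * a) (c * b)
bounded-scale {a} {b} c 0≤c (p ∣ q) = subst (0ℤ ≤ᶻ_) (e a b c) (0≤c ⊗ p) ∣ subst (0ℤ ≤ᶻ_) (e′ a b c) (0≤c ⊗ q)
  where
  e : ∀ a b c → c * (b + a) ≡ c * b + c * a
  e = solve-∀
  e′ : ∀ a b c → c * (b - a) ≡ c * b - c * a
  e′ = solve-∀

0≤↑ : ∀ n k → 0ℤ ≤ᶻ n ↑ k
0≤↑ n zero    = 0≤+ 1
0≤↑ n (suc k) = 0≤+ n ⊗ 0≤↑ n k

0<* : ∀ {a b} → 0ℤ <ᶻ a → 0ℤ <ᶻ b → 0ℤ <ᶻ a * b
0<* {a} {b} p q = subst (_<ᶻ a * b) (ℤ.*-zeroʳ a) (ℤ.*-monoˡ-<-pos a {{positive p}} q)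

0<↑ : ∀ n k → 0ℤ <ᶻ + n → 0ℤ <ᶻ n ↑ k
0<↑ n zero    p = +<+ (s≤s z≤n)
0<↑ n (suc k) p = 0<* p (0<↑ n k p)

map-extensional : ∀ (F : List (Fin n) → ℤ) u → Extensional (λ f → F (map f u))
map-extensional F u eq = cong F (List.map-cong eq u)

-- By transitivity, u′ may be replaced by the average of all v disjoint from u. Over all v the centred G
-- sums to zero, so the sum over disjoint v is minus the sum over the few v that meet u.
covariance : ∀ k {b} (F G : List (Fin n) → ℤ) → 0ℤ ≤ᶻ b →
             (∀ v → Bounded (F v) b) → (∀ v → Bounded (G v) b) → ∑ (tuples n k) G ≡ 0ℤ →
             ∀ u u′ → length u′ ≡ k → Fresh u u′ →
             (n ↑ k - stale k u) * ∑ₚ (λ f → F (map f u) * G (map f u′)) ≤ᶻ + (n !) * (b * (b * stale k u))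
covariance {n} k {b} F G 0≤b F≤ G≤ G-centred u u′ len fresh = begin
  (n ↑ k - stale k u) * T
    ≡⟨ cong (_* T) count ⟩
  (∑[ v ∈ tuples n k ] I v) * T
    ≡⟨ sym (∑-*ʳ (tuples n k) T I) ⟩
  (∑[ v ∈ tuples n k ] (I v * T))
    ≡⟨ ∑-cong-∈ (tuples n k) (λ v v∈ → move v (tuples-length n k v∈) (fresh? u v)) ⟩
  (∑[ v ∈ tuples n k ] ∑ₚ (λ f → F (map f u) * (I v * G (map f v))))
    ≡⟨ ∑-comm (tuples n k) (V (n !)) _ ⟩
  ∑ₚ (λ f → ∑[ v ∈ tuples n k ] (F (map f u) * (I v * G (map f v))))
    ≤⟨ ∑-mono (V (n !)) (λ i → bound (decode n i)) ⟩
  ∑ₚ {n} (λ _ → b * (b * stale k u))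
    ≡⟨ ∑ₚ-const n _ ⟩
  + (n !) * (b * (b * stale k u)) ∎
  where
  open ℤ.≤-Reasoning
  T = ∑ₚ (λ f → F (map f u) * G (map f u′))
  I = λ v → ⟦ fresh? u v ⟧
  count : n ↑ k - stale k u ≡ ∑ (tuples n k) I
  count = trans (cong (λ s → n ↑ k - s) (trans (∑-- (tuples n k) (λ _ → 1ℤ) I)
                  (cong (_- ∑ (tuples n k) I) (trans (∑-tuples-const n k 1ℤ) (ℤ.*-identityʳ (n ↑ k))))))
                (e (n ↑ k) (∑ (tuples n k) I))
    where
    e : ∀ a b → a - (a - b) ≡ b
    e = solve-∀
  move : ∀ v → length v ≡ k → (d : Dec (Fresh u v)) →
         ⟦ d ⟧ * T ≡ ∑ₚ (λ f → F (map f u) * (⟦ d ⟧ * G (map f v)))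
  move v len′ (no _) = sym (trans (∑-cong (V (n !)) (λ i → ℤ.*-zeroʳ (F (map ⟪ decode n i ⟫ u)))) (∑-0 (V (n !))))
  move v len′ (yes p) =
    let (σ , σu , σu′) = extend Perm.id u u′ v (trans len (sym len′)) fresh (subst (λ w → Fresh w v) (sym (List.map-id u)) p)
        σu = trans σu (List.map-id u)
        H : (Fin n → Fin n) → ℤ
        H f = F (map f u) * G (map f u′)
    in trans (ℤ.*-identityˡ T) (trans
      (sym (∑ₚ-invariant σ {H} (λ eq → cong₂ _*_ (map-extensional F u eq) (map-extensional G u′ eq))))
      (∑-cong (V (n !)) (λ i → cong₂ _*_
        (cong F (trans (List.map-∘ u) (cong (map ⟪ decode n i ⟫) σu)))
        (trans (cong G (trans (List.map-∘ u′) (cong (map ⟪ decode n i ⟫) σu′))) (sym (ℤ.*-identityˡ _))))))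
  bound : ∀ π → (∑[ v ∈ tuples n k ] (F (map ⟪ π ⟫ u) * (I v * G (map ⟪ π ⟫ v)))) ≤ᶻ b * (b * stale k u)
  bound π = begin
    (∑[ v ∈ tuples n k ] (F (map ⟪ π ⟫ u) * (I v * G (map ⟪ π ⟫ v))))
      ≡⟨ ∑-*ˡ (tuples n k) (F (map ⟪ π ⟫ u)) (λ v → I v * G (map ⟪ π ⟫ v)) ⟩
    F (map ⟪ π ⟫ u) * (∑[ v ∈ tuples n k ] (I v * G (map ⟪ π ⟫ v)))
      ≡⟨ cong (F (map ⟪ π ⟫ u) *_) complement ⟩
    F (map ⟪ π ⟫ u) * - (∑[ v ∈ tuples n k ] ((1ℤ - I v) * G (map ⟪ π ⟫ v)))
      ≤⟨ bounded-* (F≤ (map ⟪ π ⟫ u)) (bounded-neg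
           (∑-bounded (tuples n k) (λ v → bounded-scale (1ℤ - I v) (gap (⟦⟧-≤1 (fresh? u v))) (G≤ (map ⟪ π ⟫ v))))) ⟩
    b * (∑[ v ∈ tuples n k ] ((1ℤ - I v) * b))
      ≡⟨ cong (b *_) (trans (∑-*ʳ (tuples n k) b (λ v → 1ℤ - I v)) (ℤ.*-comm (stale k u) b)) ⟩
    b * (b * stale k u) ∎
    where
    complement : (∑[ v ∈ tuples n k ] (I v * G (map ⟪ π ⟫ v))) ≡ - (∑[ v ∈ tuples n k ] ((1ℤ - I v) * G (map ⟪ π ⟫ v)))
    complement = trans (∑-cong (tuples n k) (λ v → e (I v) (G (map ⟪ π ⟫ v))))
      (trans (∑-- (tuples n k) (λ v → G (map ⟪ π ⟫ v)) _)
      (trans (cong (_- S) (trans (∑-tuples-permute π k G) G-centred)) (ℤ.+-identityˡ (- S))))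
      where
      S = ∑[ v ∈ tuples n k ] ((1ℤ - I v) * G (map ⟪ π ⟫ v))
      e : ∀ i g → i * g ≡ g - (1ℤ - i) * g
      e = solve-∀

ψ-centred-identity : ∀ i p f c → i * (p * f - c) ≡ p * (i * f) - c * i
ψ-centred-identity = solve-∀

ψ-centred-identity₂ : ∀ p c → p * c - c * p ≡ 0ℤ
ψ-centred-identity₂ = solve-∀

ψ-bounded-identity : ∀ a f c → (a + f) + (a - c) ≡ + 2 * a + 1ℤ * (f - c)
ψ-bounded-identity = solve-∀

ψ-bounded-identity₂ : ∀ a f c → (a - f) + (a + c) ≡ + 2 * a - 1ℤ * (f - c)
ψ-bounded-identity₂ = solve-∀

decoupled-identity : ∀ n N b p s S κ → p * (N * (b * b) * (+ 2 * κ)) - p * (n * S) ≡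
    + 2 * n * (N * (b * (b * s)) - (p - s) * S) + + 2 * N * (b * b) * (κ * p - n * s) + n * S * (p - + 2 * s)
decoupled-identity = solve-∀

decoupled-identity₂ : ∀ n p s κ → n * p - n * (+ 2 * s) ≡ p * (n - + 2 * κ) + + 2 * (κ * p - n * s)
decoupled-identity₂ = solve-∀

pair-bound-identity : ∀ n N B κ S → N * (B * B) * (n * (1ℤ - 0ℤ) + + 2 * κ) - n * S ≡ n * (N * (B * B) - S) + N * (B * B) * (+ 2 * κ)
pair-bound-identity = solve-∀

pair-bound-identity₂ : ∀ n N B κ S → N * (B * B) * (n * (1ℤ - 1ℤ) + + 2 * κ) - n * S ≡ n * (0ℤ - S) + N * (B * B) * (+ 2 * κ)
pair-bound-identity₂ = solve-∀

pair-bound-identity₃ : ∀ n N B κ → N * (B * B) * (+ 2 * κ) ≡ N * (B * B) * (n * (1ℤ - 1ℤ) + + 2 * κ)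
pair-bound-identity₃ = solve-∀

second-moment-identity : ∀ l κ → l * (l * (+ 2 * κ)) ≡ + 2 * κ * (l * l)
second-moment-identity = solve-∀

module Concentration
  (n k : ℕ) (0<n : 0ℤ <ᶻ + n) (n-large : + 2 * (+ k * (+ k + + k)) ≤ᶻ + n)
  {X : Set} (xs : List X) (t : X → List (Fin n)) (φ : X → List (Fin n) → ℤ) (b : ℤ) (0≤b : 0ℤ ≤ᶻ b)
  (t-length : ∀ x → length (t x) ≡ k) (t-fresh : ∀ x → Fresh [] (t x))
  (φ-bounded : ∀ x v → Bounded (φ x v) b)
  where

  I : List (Fin n) → ℤ
  I v = ⟦ fresh? [] v ⟧

  P : ℤ
  P = ∑ (tuples n k) I

  total : X → ℤ
  total x = ∑[ v ∈ tuples n k ] (I v * φ x v)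

  overlaps : ℤ
  overlaps = ∑[ x ∈ xs ] ∑[ y ∈ xs ] (1ℤ - ⟦ fresh? (t x) (t y) ⟧)

  P≥0 : 0ℤ ≤ᶻ P
  P≥0 = ∑-≥0 (tuples n k) (λ v → ⟦⟧-≥0 (fresh? [] v))

  B : ℤ
  B = + 2 * (P * b)

  B≥0 : 0ℤ ≤ᶻ B
  B≥0 = 0≤+ 2 ⊗ (P≥0 ⊗ 0≤b)

  -- This is `P` times the deviation of `φ x` from its mean over the distinct tuples. The scaling
  -- avoids division, and the indicator makes the sum over all tuples vanish, as `covariance`
  -- requires.
  ψ : X → List (Fin n) → ℤ
  ψ x v = I v * (P * φ x v - total x)

  ψ-centred : ∀ x → ∑ (tuples n k) (ψ x) ≡ 0ℤ
  ψ-centred x = trans (∑-cong (tuples n k) (λ v → ψ-centred-identity (I v) P (φ x v) (total x)))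
    (trans (∑-- (tuples n k) _ _)
    (trans (cong₂ _-_ (∑-*ˡ (tuples n k) P _) (∑-*ˡ (tuples n k) (total x) I)) (ψ-centred-identity₂ P (total x))))

  total-bounded : ∀ x → Bounded (total x) (P * b)
  total-bounded x = subst (Bounded (total x)) (∑-*ʳ (tuples n k) b I)
    (∑-bounded (tuples n k) (λ v → bounded-scale (I v) (⟦⟧-≥0 (fresh? [] v)) (φ-bounded x v)))

  ψ-bounded : ∀ x v → Bounded (ψ x v) B
  ψ-bounded x v with fresh? [] v
  ... | no _ = bounded-0 B B≥0
  ... | yes _ =
    let (p ∣ q) = bounded-scale P P≥0 (φ-bounded x v)
        (p′ ∣ q′) = total-bounded x
    in subst (0ℤ ≤ᶻ_) (ψ-bounded-identity (P * b) (P * φ x v) (total x)) (p ⊕ q′)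
     ∣ subst (0ℤ ≤ᶻ_) (ψ-bounded-identity₂ (P * b) (P * φ x v) (total x)) (q ⊕ p′)

  κ : ℤ
  κ = + k * (+ k + + k)

  pair : X → X → ℤ
  pair x y = ∑ₚ (λ f → ψ x (map f (t x)) * ψ y (map f (t y)))

  private
    N = + (n !)

    κ≥0 : 0ℤ ≤ᶻ κ
    κ≥0 = 0≤+ k ⊗ (0≤+ k ⊕ 0≤+ k)

    -- For large n at most half of the tuples are stale, so dividing the covariance bound by `p - s`
    -- instead of `p` costs a factor of 2.
    decoupled : ∀ N b p s S → 0ℤ ≤ᶻ N → 0ℤ ≤ᶻ b → 0ℤ <ᶻ p → 0ℤ ≤ᶻ s → 0ℤ ≤ᶻ S →
                + n * s ≤ᶻ κ * p → (p - s) * S ≤ᶻ N * (b * (b * s)) → + n * S ≤ᶻ N * (b * b) * (+ 2 * κ)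
    decoupled N b p s S N≥0 b≥0 p>0 s≥0 S≥0 h₁ h₂ = *-cancel p p>0
      (≤-by (0≤+ 2 ⊗ 0≤+ n ⊗ gap h₂ ⊕ 0≤+ 2 ⊗ N≥0 ⊗ (b≥0 ⊗ b≥0) ⊗ gap h₁ ⊕ 0≤+ n ⊗ S≥0 ⊗ gap 2s≤p)
            (decoupled-identity (+ n) N b p s S κ))
      where
      2s≤p : + 2 * s ≤ᶻ p
      2s≤p = *-cancel (+ n) 0<n (≤-by (<⇒0≤ p>0 ⊗ gap n-large ⊕ 0≤+ 2 ⊗ gap h₁) (decoupled-identity₂ (+ n) p s κ))

  -- Tuples that overlap get the trivial bound `B * B`, disjoint ones the covariance, smaller by a
  -- factor of order n. A negative sum is treated apart because `decoupled` assumes `0ℤ ≤ᶻ S`.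
  pair-bound : ∀ x y → + n * pair x y ≤ᶻ N * (B * B) * (+ n * (1ℤ - ⟦ fresh? (t x) (t y) ⟧) + + 2 * κ)
  pair-bound x y with fresh? (t x) (t y)
  ... | no _ = ≤-by (0≤+ n ⊗ gap crude ⊕ 0≤+ (n !) ⊗ (B≥0 ⊗ B≥0) ⊗ (0≤+ 2 ⊗ κ≥0)) (pair-bound-identity (+ n) N B κ (pair x y))
    where
    crude : pair x y ≤ᶻ N * (B * B)
    crude = ℤ.≤-trans (∑-mono (V (n !)) (λ i → bounded-* {b = B} {d = B} (ψ-bounded x (map ⟪ decode n i ⟫ (t x))) (ψ-bounded y (map ⟪ decode n i ⟫ (t y))))) (≡⇒≤ (∑ₚ-const n (B * B)))
  ... | yes p with ℤ.≤-total 0ℤ (pair x y)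
  ...   | inj₂ S≤0 = ≤-by (0≤+ n ⊗ gap S≤0 ⊕ 0≤+ (n !) ⊗ (B≥0 ⊗ B≥0) ⊗ (0≤+ 2 ⊗ κ≥0)) (pair-bound-identity₂ (+ n) N B κ (pair x y))
  ...   | inj₁ 0≤S = ℤ.≤-trans
    (decoupled N B (n ↑ k) (stale k (t x)) (pair x y) (0≤+ (n !)) B≥0 (0<↑ n k 0<n)
      (∑-≥0 (tuples n k) (λ v → gap (⟦⟧-≤1 (fresh? (t x) v)))) 0≤S
      (subst (λ l → + n * stale k (t x) ≤ᶻ + k * (+ l + + k) * n ↑ k) (t-length x) (n*stale≤ k (t x)))
      (covariance k (ψ x) (ψ y) B≥0 (ψ-bounded x) (ψ-bounded y) (ψ-centred y) (t x) (t y) (t-length y) p))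
    (≡⇒≤ (pair-bound-identity₃ (+ n) N B κ))

  Z : (Fin n → Fin n) → ℤ
  Z f = ∑[ x ∈ xs ] φ x (map f (t x))

  deviation : (Fin n → Fin n) → ℤ
  deviation f = P * Z f - ∑ xs total

  -- The square expands into pairs. The deviation is a sum of values of `ψ` because a bijection
  -- keeps a fresh tuple fresh, so that the indicator in `ψ` is 1.
  second-moment : + n * (∑[ i ∈ V (n !) ] (deviation ⟪ decode n i ⟫ * deviation ⟪ decode n i ⟫)) ≤ᶻ
                  N * (B * B) * (+ n * overlaps + + 2 * κ * (+ length xs * + length xs))
  second-moment = begin
    + n * (∑[ i ∈ V (n !) ] (deviation ⟪ decode n i ⟫ * deviation ⟪ decode n i ⟫))
      ≡⟨ cong (+ n *_) (∑-cong (V (n !)) (λ i → trans (cong₂ _*_ (centre (decode n i)) (centre (decode n i)))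
           (sym (∑-*-∑ xs xs _ _)))) ⟩
    + n * ∑ₚ (λ f → ∑[ x ∈ xs ] ∑[ y ∈ xs ] (ψ x (map f (t x)) * ψ y (map f (t y))))
      ≡⟨ cong (+ n *_) (trans (∑-comm (V (n !)) xs _) (∑-cong xs (λ x → ∑-comm (V (n !)) xs _))) ⟩
    + n * (∑[ x ∈ xs ] ∑[ y ∈ xs ] pair x y)
      ≡⟨ trans (sym (∑-*ˡ xs (+ n) _)) (∑-cong xs (λ x → sym (∑-*ˡ xs (+ n) _))) ⟩
    (∑[ x ∈ xs ] ∑[ y ∈ xs ] (+ n * pair x y))
      ≤⟨ ∑-mono xs (λ x → ∑-mono xs (pair-bound x)) ⟩
    (∑[ x ∈ xs ] ∑[ y ∈ xs ] (N * (B * B) * (+ n * J x y + + 2 * κ)))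
      ≡⟨ trans (∑-cong xs (λ x → ∑-*ˡ xs (N * (B * B)) _)) (∑-*ˡ xs (N * (B * B)) _) ⟩
    N * (B * B) * (∑[ x ∈ xs ] ∑[ y ∈ xs ] (+ n * J x y + + 2 * κ))
      ≡⟨ cong (N * (B * B) *_) (trans (∑-cong xs (λ x → trans (∑-+ xs _ _) (cong₂ _+_ (∑-*ˡ xs (+ n) (J x)) (∑-const xs _))))
           (trans (∑-+ xs _ _) (cong₂ _+_ (∑-*ˡ xs (+ n) _) (trans (∑-const xs _) (second-moment-identity (+ length xs) κ))))) ⟩
    N * (B * B) * (+ n * overlaps + + 2 * κ * (+ length xs * + length xs)) ∎
    where
    open ℤ.≤-Reasoning
    J = λ x y → 1ℤ - ⟦ fresh? (t x) (t y) ⟧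
    centre : ∀ π → deviation ⟪ π ⟫ ≡ ∑[ x ∈ xs ] ψ x (map ⟪ π ⟫ (t x))
    centre π = trans (cong (_- ∑ xs total) (sym (∑-*ˡ xs P _)))
      (trans (sym (∑-- xs _ total))
      (∑-cong xs (λ x → sym (trans (cong (_* (P * φ x (map ⟪ π ⟫ (t x)) - total x))
          (⟦⟧-yes (fresh? [] _) (Fresh-map⁺ π [] (t-fresh x)))) (ℤ.*-identityˡ _)))))

-- Weightings with few unbalanced 4-cycles

⟦⟧≤ : {P : Set ℓ} (d : Dec P) {x : ℤ} → 0ℤ ≤ᶻ x → (P → 1ℤ ≤ᶻ x) → ⟦ d ⟧ ≤ᶻ x
⟦⟧≤ (yes p) _   f = f p
⟦⟧≤ (no _)  0≤x _ = 0≤x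

⟦⟧*⟦⟧≤ : {P : Set ℓ} {Q : Set ℓ′} (d : Dec P) (d′ : Dec Q) {x : ℤ} → 0ℤ ≤ᶻ x → (P → Q → 1ℤ ≤ᶻ x) → ⟦ d ⟧ * ⟦ d′ ⟧ ≤ᶻ x
⟦⟧*⟦⟧≤ (yes p) (yes q) _   f = f p q
⟦⟧*⟦⟧≤ (yes _) (no _)  0≤x _ = 0≤x
⟦⟧*⟦⟧≤ (no _)  (yes _) 0≤x _ = 0≤x
⟦⟧*⟦⟧≤ (no _)  (no _)  0≤x _ = 0≤x

1≤⟦⟧ : {P : Set ℓ} (d : Dec P) → P → 1ℤ ≤ᶻ ⟦ d ⟧
1≤⟦⟧ d p = ≡⇒≤ (sym (⟦⟧-yes d p))

data Sign₀ : ℤ → Set where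
  minus : Sign₀ (- 1ℤ)
  null  : Sign₀ 0ℤ
  plus  : Sign₀ 1ℤ

sign₀≤1 : ∀ {x} → Sign₀ x → x ≤ᶻ 1ℤ
sign₀≤1 minus = -≤+
sign₀≤1 null  = 0≤+ 1
sign₀≤1 plus  = ℤ.≤-refl

sign₀≥-1 : ∀ {x} → Sign₀ x → - 1ℤ ≤ᶻ x
sign₀≥-1 minus = ℤ.≤-refl
sign₀≥-1 null  = -≤+
sign₀≥-1 plus  = -≤+

1ᶻ -1ᶻ 0ᶻ high low rest : ℤ → ℤ
1ᶻ x   = ⟦ x ℤ.≟ 1ℤ ⟧
-1ᶻ x  = ⟦ x ℤ.≟ - 1ℤ ⟧
0ᶻ x   = ⟦ x ℤ.≟ 0ℤ ⟧
high x = ⟦ + 2 ℤ.≤? x ⟧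
low x  = ⟦ x ℤ.≤? - + 2 ⟧
rest x = 1ℤ - 1ᶻ x - -1ᶻ x

trichotomy : ∀ x → 1ᶻ x + -1ᶻ x + 0ᶻ x + high x + low x ≡ 1ℤ
trichotomy (+ 0)           = refl
trichotomy (+ 1)           = refl
trichotomy (+ suc (suc _)) = refl
trichotomy -[1+ 0 ]        = refl
trichotomy -[1+ suc _ ]    = refl

rest≥0 : ∀ x → 0ℤ ≤ᶻ rest x
rest≥0 x = subst (0ℤ ≤ᶻ_) (trans (e (1ᶻ x) (-1ᶻ x) (0ᶻ x) (high x) (low x)) (cong (λ s → s - 1ᶻ x - -1ᶻ x) (trichotomy x)))
  (⟦⟧-≥0 (x ℤ.≟ 0ℤ) ⊕ ⟦⟧-≥0 (+ 2 ℤ.≤? x) ⊕ ⟦⟧-≥0 (x ℤ.≤? - + 2))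
  where
  e : ∀ a b c d f → c + d + f ≡ a + b + c + d + f - a - b
  e = solve-∀

∑∑-split : ∀ (xs : List X) (F G : X → X → ℤ) →
           ∑[ a ∈ xs ] ∑[ b ∈ xs ] (F a b + G a b) ≡ (∑[ a ∈ xs ] ∑[ b ∈ xs ] F a b) + (∑[ a ∈ xs ] ∑[ b ∈ xs ] G a b)
∑∑-split xs F G = trans (∑-cong xs (λ a → ∑-+ xs (F a) (G a))) (∑-+ xs _ _)

∑∑-mono : ∀ (xs : List X) {F G : X → X → ℤ} → (∀ a b → F a b ≤ᶻ G a b) →
          (∑[ a ∈ xs ] ∑[ b ∈ xs ] F a b) ≤ᶻ (∑[ a ∈ xs ] ∑[ b ∈ xs ] G a b)
∑∑-mono xs le = ∑-mono xs (λ a → ∑-mono xs (le a))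

∑-exists≤ : ∀ (xs : List X) (F : X → ℤ) c → 0ℤ <ᶻ + length xs → ∑ xs F ≤ᶻ + length xs * c → ∃[ x ] (F x ≤ᶻ c)
∑-exists≤ xs F c 0<l p =
  let (x , _ , q) = ∑-exists xs F (ℤ.suc c) (ℤ.≤-<-trans p
        (ℤ.*-monoˡ-<-pos (+ length xs) {{positive 0<l}} (ℤ.suc[i]≤j⇒i<j ℤ.≤-refl)))
  in x , subst (F x ≤ᶻ_) (ℤ.pred-suc c) (ℤ.i<j⇒i≤pred[j] q)

module _ {n : ℕ} (w : Fin n → Fin n → ℤ) where

  -- The two perfect matchings of the 4-cycle a, p, b, q have different weights. Their difference is
  -- what changes when leaves placed at a and b, with neighbours placed at p and q, are exchanged.
  unbalanced : Fin n → Fin n → Fin n → Fin n → ℤ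
  unbalanced a b p q = ⟦ ¬? (w b p + w a q ℤ.≟ w a p + w b q) ⟧

  unbalancedCount : ℤ
  unbalancedCount = ∑[ a ∈ V n ] ∑[ b ∈ V n ] ∑[ p ∈ V n ] ∑[ q ∈ V n ] unbalanced a b p q

bad≤-identity : ∀ x → 1ℤ + x - 1ℤ ≡ x
bad≤-identity = solve-∀

bad≤-identity₂ : ∀ x b → + 2 * x ≡ (x + b) + (x + b) - b - b
bad≤-identity₂ = solve-∀

bad≤-identity₃ : ∀ β α bq γ δ → (β + α) + (γ + δ) - bq - bq ≡ δ + α - bq + (β + γ - bq)
bad≤-identity₃ = solve-∀

∑-badness-identity : ∀ x → x + x ≡ + 2 * x
∑-badness-identity = solve-∀

pivot-identity : ∀ m K b u → m * m - m * (K * K * b) ≡ (K * K) * (+ 2 * u - m * b) + (m * m - + 2 * (K * K) * u)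
pivot-identity = solve-∀

KB≤-identity : ∀ K B m → m - K * B ≡ (m - K * K * B) + K * B * (K - 1ℤ)
KB≤-identity = solve-∀

root-identity : ∀ K s B N → N * N - K * s * (K * s) ≡ K * K * (B - s * s) + (N * N - K * K * B)
root-identity = solve-∀

nonzero≡-identity : ∀ a b c d f → a + b + c + d + f - c ≡ a + b + d + f
nonzero≡-identity = solve-∀

other≡-identity : ∀ a b c d f → a + b + c + d + f - a - b ≡ c + d + f
other≡-identity = solve-∀

classes-identity : ∀ a b → a + b + (1ℤ - a - b) ≡ 1ℤ
classes-identity = solve-∀

dichotomy-identity : ∀ K a b c N → + 3 * N - K * (a + b + c) ≡ (N - K * a) + (N - K * b) + (N - K * c)
dichotomy-identity = solve-∀

dichotomy-identity₂ : ∀ K a a′ b c N → + 3 * N - K * (a + a′ + b + c) ≡ (N - K * (a + a′)) + (N - K * b) + (N - K * c)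
dichotomy-identity₂ = solve-∀

good⇒-identity : ∀ c → c + c ≡ + 2 * c
good⇒-identity = solve-∀

scaled-identity : ∀ K s t B m → K * K * t + m - K * K * s ≡ K * K * (B + t - s) + (m - K * K * B)
scaled-identity = solve-∀

covered-identity : ∀ a b → a + 1ℤ + b - 1ℤ ≡ a + b
covered-identity = solve-∀

covered-identity₂ : ∀ a b → a + b + 1ℤ - 1ℤ ≡ a + b
covered-identity₂ = solve-∀

covered-identity₃ : ∀ a b → a + b + 1ℤ - 1ℤ ≡ a + b
covered-identity₃ = solve-∀

level≤-identity : ∀ a b c d → a + b + c + d - 1ℤ ≡ a + (b + c + d - 1ℤ)
level≤-identity = solve-∀

level≤-identity₂ : ∀ a b c d → a + b + c + d - 1ℤ ≡ (a - 1ℤ) + b + c + d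
level≤-identity₂ = solve-∀

∑∑-outside≥0-identity : ∀ B S N R → B + S + N * R + N * R ≡ B + S + + 2 * N * R
∑∑-outside≥0-identity = solve-∀

level-sum-identity : ∀ K W S B N o → K * S + + 7 * (N * N) - K * W ≡ K * (B + S + + 2 * N * o - W) + (N * N - K * B) + + 2 * N * (+ 3 * N - K * o)
level-sum-identity = solve-∀

W₊-small-identity : ∀ a c d → a + 0ℤ + c + d - 1ℤ ≡ (a - 1ℤ) + c + d
W₊-small-identity = solve-∀

W₊-small-identity₂ : ∀ a c → a + 0ℤ + (1ℤ - 0ℤ) + c - 1ℤ ≡ a + c
W₊-small-identity₂ = solve-∀

W₊-small-identity₃ : ∀ a c → a + 0ℤ + c + (1ℤ - 0ℤ) - 1ℤ ≡ a + c
W₊-small-identity₃ = solve-∀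

W₊-small-identity₄ : ∀ K W B N o → + 7 * (N * N) - K * W ≡ K * (B + 0ℤ + + 2 * N * o - W) + (N * N - K * B) + + 2 * N * (+ 3 * N - K * o)
W₊-small-identity₄ = solve-∀

module Structure
  (n : ℕ) (0<n : 0ℤ <ᶻ + n) (w : Fin n → Fin n → ℤ)
  (w-sym : ∀ a b → w a b ≡ w b a) (w-sign : ∀ a b → Sign₀ (w a b))
  where

  private
    N = + n
    U = unbalancedCount w

  -- Balance of the cycles a, p, b, q and a, p, q, b gives 2 w a p = h b q a + h b q p.
  h : Fin n → Fin n → Fin n → ℤ
  h b q a = w a b + w a q - w b q

  bad : Fin n → Fin n → Fin n → Fin n → ℤ
  bad b q a p = ⟦ ¬? (+ 2 * w a p ℤ.≟ h b q a + h b q p) ⟧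

  bad≤ : ∀ b q a p → bad b q a p ≤ᶻ unbalanced w a b p q + unbalanced w a q p b
  bad≤ b q a p with w b p + w a q ℤ.≟ w a p + w b q | w q p + w a b ℤ.≟ w a p + w q b
  ... | no _ | d = ℤ.≤-trans (⟦⟧-≤1 (¬? (+ 2 * w a p ℤ.≟ h b q a + h b q p))) (≤-by (⟦⟧-≥0 (¬? d)) (bad≤-identity ⟦ ¬? d ⟧))
  ... | yes _ | no _ = ⟦⟧-≤1 (¬? (+ 2 * w a p ℤ.≟ h b q a + h b q p))
  ... | yes p₁ | yes p₂ = ≡⇒≤ (⟦⟧-no (¬? (+ 2 * w a p ℤ.≟ h b q a + h b q p)) (λ ¬eq → ¬eq eq))
    where
    e : ∀ x β α bq γ δ → β + α ≡ x + bq → γ + δ ≡ x + bq → + 2 * x ≡ δ + α - bq + (β + γ - bq)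
    e x β α bq γ δ h₁ h₂ = trans (bad≤-identity₂ x bq) (trans (cong₂ (λ s t → s + t - bq - bq) (sym h₁) (sym h₂)) (bad≤-identity₃ β α bq γ δ))
    eq : + 2 * w a p ≡ h b q a + h b q p
    eq = e (w a p) (w p b) (w a q) (w b q) (w p q) (w a b)
      (trans (cong (_+ w a q) (w-sym p b)) p₁)
      (trans (cong (_+ w a b) (w-sym p q)) (trans p₂ (cong (λ s → w a p + s) (w-sym q b))))

  badness : Fin n → Fin n → ℤ
  badness b q = ∑[ a ∈ V n ] ∑[ p ∈ V n ] bad b q a p

  ∑-badness : (∑[ b ∈ V n ] ∑[ q ∈ V n ] badness b q) ≤ᶻ + 2 * U
  ∑-badness = begin
    (∑[ b ∈ V n ] ∑[ q ∈ V n ] ∑[ a ∈ V n ] ∑[ p ∈ V n ] bad b q a p)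
      ≤⟨ ∑∑-mono (V n) (λ b q → ∑∑-mono (V n) (bad≤ b q)) ⟩
    (∑[ b ∈ V n ] ∑[ q ∈ V n ] ∑[ a ∈ V n ] ∑[ p ∈ V n ] (unbalanced w a b p q + unbalanced w a q p b))
      ≡⟨ trans (∑-cong (V n) (λ b → ∑-cong (V n) (λ q → ∑∑-split (V n) _ _))) (∑∑-split (V n) _ _) ⟩
    T₁ + (∑[ b ∈ V n ] ∑[ q ∈ V n ] ∑[ a ∈ V n ] ∑[ p ∈ V n ] unbalanced w a q p b)
      ≡⟨ cong (λ s → T₁ + s) (∑-comm (V n) (V n) (λ b q → ∑[ a ∈ V n ] ∑[ p ∈ V n ] unbalanced w a q p b)) ⟩
    T₁ + T₁
      ≡⟨ trans (∑-badness-identity T₁) (cong (+ 2 *_) (sym reorder)) ⟩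
    + 2 * U ∎
    where
    open ℤ.≤-Reasoning
    T₁ = ∑[ b ∈ V n ] ∑[ q ∈ V n ] ∑[ a ∈ V n ] ∑[ p ∈ V n ] unbalanced w a b p q
    reorder : U ≡ T₁
    reorder = trans (∑-comm (V n) (V n) (λ a b → ∑[ p ∈ V n ] ∑[ q ∈ V n ] unbalanced w a b p q)) (∑-cong (V n) (λ b →
      trans (∑-cong (V n) (λ a → ∑-comm (V n) (V n) (λ p q → unbalanced w a b p q)))
            (∑-comm (V n) (V n) (λ a q → ∑[ p ∈ V n ] unbalanced w a b p q))))

  -- By `∑-badness` the average of `badness` over the N² pairs is at most 2 U / N², and the
  -- hypothesis bounds this by N²/K².
  pivot : ∀ K → 0ℤ ≤ᶻ K → + 2 * (K * K) * unbalancedCount w ≤ᶻ N * N * (N * N) →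
          ∃[ b ] ∃[ q ] (K * K * badness b q ≤ᶻ N * N)
  pivot K 0≤K few =
    let (bq , le) = ∑-exists≤ pairs (λ bq → N * N * F bq) (+ 2 * U)
                      (subst (0ℤ <ᶻ_) (sym l) 0<NN)
                      (subst₂ _≤ᶻ_ (sym (∑-*ˡ pairs (N * N) F)) (cong (_* (+ 2 * U)) (sym l))
                        (*-monoˡ (N * N) (<⇒0≤ 0<NN)
                          (subst (_≤ᶻ + 2 * U) (sym (∑-product _,_ (V n) (V n) F)) ∑-badness)))
    in proj₁ bq , proj₂ bq , *-cancel (N * N) 0<NN
         (≤-by ((0≤K ⊗ 0≤K) ⊗ gap le ⊕ gap few) (pivot-identity (N * N) K (F bq) U))
    where
    pairs = cartesianProduct (V n) (V n)
    F : Fin n × Fin n → ℤ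
    F (b , q) = badness b q
    0<NN : 0ℤ <ᶻ N * N
    0<NN = subst (_<ᶻ N * N) (ℤ.*-zeroʳ N) (ℤ.*-monoˡ-<-pos N {{positive 0<n}} 0<n)
    l : + length pairs ≡ N * N
    l = trans (sym (trans (∑-const pairs 1ℤ) (ℤ.*-identityʳ _)))
      (trans (∑-product _,_ (V n) (V n) (λ _ → 1ℤ))
      (trans (∑-cong (V n) (λ _ → ∑-V-const n 1ℤ)) (trans (∑-V-const n _) (cong (N *_) (ℤ.*-identityʳ N)))))

  module Pivoted (K : ℤ) (1≤K : 1ℤ ≤ᶻ K) (b q : Fin n) (few : K * K * badness b q ≤ᶻ N * N) where

    0≤K : 0ℤ ≤ᶻ K
    0≤K = ℤ.≤-trans (0≤+ 1) 1≤K

    x : Fin n → ℤ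
    x = h b q

    B = badness b q

    B≥0 : 0ℤ ≤ᶻ B
    B≥0 = ∑-≥0 (V n) (λ a → ∑-≥0 (V n) (λ p → ⟦⟧-≥0 (¬? (+ 2 * w a p ℤ.≟ x a + x p))))

    KB≤ : K * B ≤ᶻ N * N
    KB≤ = ≤-by (gap few ⊕ 0≤K ⊗ B≥0 ⊗ gap 1≤K) (KB≤-identity K B (N * N))

    pos neg mid big small other nonzero : ℤ
    pos     = ∑[ a ∈ V n ] 1ᶻ (x a)
    neg     = ∑[ a ∈ V n ] -1ᶻ (x a)
    mid     = ∑[ a ∈ V n ] 0ᶻ (x a)
    big     = ∑[ a ∈ V n ] high (x a)
    small   = ∑[ a ∈ V n ] low (x a)
    other   = ∑[ a ∈ V n ] rest (x a)
    nonzero = ∑[ a ∈ V n ] (1ℤ - 0ᶻ (x a))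

    private
      product : ∀ (F G : Fin n → ℤ) (d : ∀ a p → F a * G p ≤ᶻ bad b q a p) → ∑ (V n) F * ∑ (V n) G ≤ᶻ B
      product F G d = subst (_≤ᶻ B) (∑-*-∑ (V n) (V n) F G) (∑∑-mono (V n) d)

      root : ∀ s → s * s ≤ᶻ B → K * s ≤ᶻ N
      root s le = sq-cancel (0≤+ n) (≤-by (0≤K ⊗ 0≤K ⊗ gap le ⊕ gap few) (root-identity K s B N))

      ¬2x≡ : ∀ {y z} → Sign₀ z → y ≡ 1ℤ ⊎ y ≡ - 1ℤ → + 2 * z ≢ y
      ¬2x≡ minus (inj₁ refl) ()
      ¬2x≡ minus (inj₂ refl) ()
      ¬2x≡ null  (inj₁ refl) ()
      ¬2x≡ null  (inj₂ refl) ()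
      ¬2x≡ plus  (inj₁ refl) ()
      ¬2x≡ plus  (inj₂ refl) ()

      -- Two values at least 2 would force 2 w ≥ 4 on a good pair, although w ≤ 1. Hence the square
      -- of `big` is at most `B`.
      high-high : ∀ a p → high (x a) * high (x p) ≤ᶻ bad b q a p
      high-high a p = ⟦⟧*⟦⟧≤ (+ 2 ℤ.≤? x a) (+ 2 ℤ.≤? x p) (⟦⟧-≥0 (¬? (+ 2 * w a p ℤ.≟ x a + x p)))
        (λ i j → 1≤⟦⟧ (¬? (+ 2 * w a p ℤ.≟ x a + x p)) (λ eq →
          ℤ.<⇒≱ {+ 2} {+ 4} (+<+ (s≤s (s≤s (s≤s z≤n))))
            (ℤ.≤-trans (ℤ.≤-trans (ℤ.+-mono-≤ i j) (≡⇒≤ (sym eq))) (*-monoˡ (+ 2) (0≤+ 2) (sign₀≤1 (w-sign a p))))))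

      low-low : ∀ a p → low (x a) * low (x p) ≤ᶻ bad b q a p
      low-low a p = ⟦⟧*⟦⟧≤ (x a ℤ.≤? - + 2) (x p ℤ.≤? - + 2) (⟦⟧-≥0 (¬? (+ 2 * w a p ℤ.≟ x a + x p)))
        (λ i j → 1≤⟦⟧ (¬? (+ 2 * w a p ℤ.≟ x a + x p)) (λ eq →
          ℤ.<⇒≱ { - + 4} { - + 2} (ℤ.-<- (s≤s (s≤s z≤n)))
            (ℤ.≤-trans (*-monoˡ (+ 2) (0≤+ 2) (sign₀≥-1 (w-sign a p))) (ℤ.≤-trans (≡⇒≤ eq) (ℤ.+-mono-≤ i j)))))

      mid-odd : ∀ a p → 0ᶻ (x a) * (1ᶻ (x p) + -1ᶻ (x p)) ≤ᶻ bad b q a p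
      mid-odd a p = subst (_≤ᶻ bad b q a p) (cong (0ᶻ (x a) *_) (odd (x p)))
        (⟦⟧*⟦⟧≤ (x a ℤ.≟ 0ℤ) (odd? (x p)) (⟦⟧-≥0 (¬? (+ 2 * w a p ℤ.≟ x a + x p)))
        (λ i j → 1≤⟦⟧ (¬? (+ 2 * w a p ℤ.≟ x a + x p)) (λ eq →
           ¬2x≡ (w-sign a p) j (trans eq (trans (cong (_+ x p) i) (ℤ.+-identityˡ (x p)))))))
        where
        odd? : ∀ y → Dec (y ≡ 1ℤ ⊎ y ≡ - 1ℤ)
        odd? (+ 0)           = no λ { (inj₁ ()) ; (inj₂ ()) }
        odd? (+ 1)           = yes (inj₁ refl)
        odd? (+ suc (suc _)) = no λ { (inj₁ ()) ; (inj₂ ()) }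
        odd? -[1+ 0 ]        = yes (inj₂ refl)
        odd? -[1+ suc _ ]    = no λ { (inj₁ ()) ; (inj₂ ()) }
        odd : ∀ y → ⟦ odd? y ⟧ ≡ 1ᶻ y + -1ᶻ y
        odd (+ 0)           = refl
        odd (+ 1)           = refl
        odd (+ suc (suc _)) = refl
        odd -[1+ 0 ]        = refl
        odd -[1+ suc _ ]    = refl

    K*big≤ : K * big ≤ᶻ N
    K*big≤ = root big (product _ _ high-high)

    K*small≤ : K * small ≤ᶻ N
    K*small≤ = root small (product _ _ low-low)

    mid*odd≤ : mid * (pos + neg) ≤ᶻ B
    mid*odd≤ = subst (λ s → mid * s ≤ᶻ B) (∑-+ (V n) _ _) (product _ _ mid-odd)

    nonzero≡ : nonzero ≡ pos + neg + big + small
    nonzero≡ = trans (∑-cong (V n) (λ a → trans (cong (_- 0ᶻ (x a)) (sym (trichotomy (x a))))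
                       (nonzero≡-identity (1ᶻ (x a)) (-1ᶻ (x a)) (0ᶻ (x a)) (high (x a)) (low (x a)))))
      (trans (∑-+ (V n) _ _) (cong (_+ small) (trans (∑-+ (V n) _ _) (cong (_+ big) (∑-+ (V n) _ _)))))

    other≡ : other ≡ mid + big + small
    other≡ = trans (∑-cong (V n) (λ a → trans (cong (λ s → s - 1ᶻ (x a) - -1ᶻ (x a)) (sym (trichotomy (x a))))
                       (other≡-identity (1ᶻ (x a)) (-1ᶻ (x a)) (0ᶻ (x a)) (high (x a)) (low (x a)))))
      (trans (∑-+ (V n) _ _) (cong (_+ small) (∑-+ (V n) _ _)))

    classes : pos + neg + other ≡ N
    classes = trans (sym (trans (∑-+ (V n) _ _) (cong (_+ other) (∑-+ (V n) _ _))))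
      (trans (∑-cong (V n) (λ a → classes-identity (1ᶻ (x a)) (-1ᶻ (x a)))) (trans (∑-V-const n 1ℤ) (ℤ.*-identityʳ N)))

    -- On a good pair 2 w is even, so a value 0 cannot meet a value 1 or -1, and the smaller of
    -- `mid` and `pos + neg` has square at most `B`. Together with `big` and `small` this gives
    -- three terms, each at most N/K.
    dichotomy : K * nonzero ≤ᶻ + 3 * N ⊎ K * other ≤ᶻ + 3 * N
    dichotomy with ℤ.≤-total mid (pos + neg)
    ... | inj₁ le = inj₂ (subst (λ s → K * s ≤ᶻ + 3 * N) (sym other≡)
            (≤-by (gap (root mid (ℤ.≤-trans (*-monoˡ mid (∑-≥0 (V n) (λ a → ⟦⟧-≥0 (x a ℤ.≟ 0ℤ))) le) mid*odd≤))
                   ⊕ gap K*big≤ ⊕ gap K*small≤) (dichotomy-identity K mid big small N)))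
    ... | inj₂ le = inj₁ (subst (λ s → K * s ≤ᶻ + 3 * N) (sym nonzero≡)
            (≤-by (gap (root (pos + neg) (ℤ.≤-trans (subst ((pos + neg) * (pos + neg) ≤ᶻ_) (ℤ.*-comm (pos + neg) mid)
                          (*-monoˡ (pos + neg) (∑-≥0 (V n) (λ a → ⟦⟧-≥0 (x a ℤ.≟ 1ℤ)) ⊕ ∑-≥0 (V n) (λ a → ⟦⟧-≥0 (x a ℤ.≟ - 1ℤ))) le)) mid*odd≤))
                   ⊕ gap K*big≤ ⊕ gap K*small≤) (dichotomy-identity₂ K pos neg big small N)))

    W₊ W₋ : ℤ
    W₊ = ∑[ a ∈ V n ] ∑[ p ∈ V n ] 1ᶻ (w a p)
    W₋ = ∑[ a ∈ V n ] ∑[ p ∈ V n ] -1ᶻ (w a p)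

    good⇒ : ∀ a p → + 2 * w a p ≡ x a + x p → ∀ c → x a ≡ c → x p ≡ c → w a p ≡ c
    good⇒ a p eq c refl eq′ = ℤ.*-cancelˡ-≡ (+ 2) (w a p) (x a) (trans eq (trans (cong (λ s → x a + s) eq′) (good⇒-identity (x a))))

    private
      nonneg₂ : ∀ {P Q : Set} (d : Dec P) (d′ : Dec Q) → 0ℤ ≤ᶻ ⟦ d ⟧ + ⟦ d′ ⟧
      nonneg₂ d d′ = ⟦⟧-≥0 d ⊕ ⟦⟧-≥0 d′

      right≥ : ∀ {P Q : Set} (d : Dec P) (d′ : Dec Q) → Q → 1ℤ ≤ᶻ ⟦ d ⟧ + ⟦ d′ ⟧
      right≥ d d′ q = ℤ.+-mono-≤ (⟦⟧-≥0 d) (1≤⟦⟧ d′ q)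

      left≥ : ∀ {P : Set} (d : Dec P) {y} → 0ℤ ≤ᶻ y → P → 1ℤ ≤ᶻ ⟦ d ⟧ + y
      left≥ d 0≤y p = ℤ.+-mono-≤ (1≤⟦⟧ d p) 0≤y

      inner≥ : ∀ c a p → ⟦ x a ℤ.≟ c ⟧ * ⟦ x p ℤ.≟ c ⟧ ≤ᶻ bad b q a p + ⟦ w a p ℤ.≟ c ⟧
      inner≥ c a p = ⟦⟧*⟦⟧≤ (x a ℤ.≟ c) (x p ℤ.≟ c) (nonneg₂ bad? (w a p ℤ.≟ c)) λ i j → go i j (+ 2 * w a p ℤ.≟ x a + x p)
        where
        bad? = ¬? (+ 2 * w a p ℤ.≟ x a + x p)
        go : x a ≡ c → x p ≡ c → Dec (+ 2 * w a p ≡ x a + x p) → 1ℤ ≤ᶻ ⟦ bad? ⟧ + ⟦ w a p ℤ.≟ c ⟧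
        go i j (yes eq) = right≥ bad? (w a p ℤ.≟ c) (good⇒ a p eq c i j)
        go i j (no neq) = left≥ bad? (⟦⟧-≥0 (w a p ℤ.≟ c)) neq

      ∑∑-class : ∀ c → (∑[ a ∈ V n ] ⟦ x a ℤ.≟ c ⟧) * (∑[ a ∈ V n ] ⟦ x a ℤ.≟ c ⟧) ≤ᶻ B + (∑[ a ∈ V n ] ∑[ p ∈ V n ] ⟦ w a p ℤ.≟ c ⟧)
      ∑∑-class c = subst₂ _≤ᶻ_ (∑-*-∑ (V n) (V n) _ _) (∑∑-split (V n) _ _) (∑∑-mono (V n) (inner≥ c))

      scaled : ∀ s t → s ≤ᶻ B + t → K * K * s ≤ᶻ K * K * t + N * N
      scaled s t le = ≤-by (0≤K ⊗ 0≤K ⊗ gap le ⊕ gap few) (scaled-identity K s t B (N * N))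

      outside≥0 : ∀ a p (r : ℤ → ℤ) → (∀ y → 0ℤ ≤ᶻ r y) → ∀ {y} → 0ℤ ≤ᶻ y → 0ℤ ≤ᶻ bad b q a p + y + r (x a) + r (x p)
      outside≥0 a p r r≥0 0≤y = ⟦⟧-≥0 (¬? (+ 2 * w a p ℤ.≟ x a + x p)) ⊕ 0≤y ⊕ r≥0 (x a) ⊕ r≥0 (x p)

    -- Two vertices of value 1 span a pair of weight 1, unless the pair is bad.
    pos²≤ : K * K * (pos * pos) ≤ᶻ K * K * W₊ + N * N
    pos²≤ = scaled (pos * pos) W₊ (∑∑-class 1ℤ)

    neg²≤ : K * K * (neg * neg) ≤ᶻ K * K * W₋ + N * N
    neg²≤ = scaled (neg * neg) W₋ (∑∑-class (- 1ℤ))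

    private
      -- On a good pair, 2 w a p = x a + x p forces x a = x p = c when w a p = c = ±1 and both values lie in {-1, 1}.
      covered : ∀ {v y z} → + 2 * v ≡ y + z → v ≡ 1ℤ ⊎ v ≡ - 1ℤ → 1ℤ ≤ᶻ ⟦ y ℤ.≟ v ⟧ * ⟦ z ℤ.≟ v ⟧ + rest y + rest z
      covered {v} {y} {z} eq c with class y | class z
        where
        class : ∀ y → y ≡ 1ℤ ⊎ y ≡ - 1ℤ ⊎ rest y ≡ 1ℤ
        class (+ 0)           = inj₂ (inj₂ refl)
        class (+ 1)           = inj₁ refl
        class (+ suc (suc _)) = inj₂ (inj₂ refl)
        class -[1+ 0 ]        = inj₂ (inj₁ refl)
        class -[1+ suc _ ]    = inj₂ (inj₂ refl)
      ... | inj₂ (inj₂ r) | _ = ≤-by (⟦⟧-≥0 (y ℤ.≟ v) ⊗ ⟦⟧-≥0 (z ℤ.≟ v) ⊕ rest≥0 z)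
              (trans (cong (λ s → ⟦ y ℤ.≟ v ⟧ * ⟦ z ℤ.≟ v ⟧ + s + rest z - 1ℤ) r) (covered-identity (⟦ y ℤ.≟ v ⟧ * ⟦ z ℤ.≟ v ⟧) (rest z)))
      ... | inj₁ _ | inj₂ (inj₂ r) = ≤-by (⟦⟧-≥0 (y ℤ.≟ v) ⊗ ⟦⟧-≥0 (z ℤ.≟ v) ⊕ rest≥0 y)
              (trans (cong (λ s → ⟦ y ℤ.≟ v ⟧ * ⟦ z ℤ.≟ v ⟧ + rest y + s - 1ℤ) r) (covered-identity₂ (⟦ y ℤ.≟ v ⟧ * ⟦ z ℤ.≟ v ⟧) (rest y)))
      ... | inj₂ (inj₁ _) | inj₂ (inj₂ r) = ≤-by (⟦⟧-≥0 (y ℤ.≟ v) ⊗ ⟦⟧-≥0 (z ℤ.≟ v) ⊕ rest≥0 y)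
              (trans (cong (λ s → ⟦ y ℤ.≟ v ⟧ * ⟦ z ℤ.≟ v ⟧ + rest y + s - 1ℤ) r) (covered-identity₃ (⟦ y ℤ.≟ v ⟧ * ⟦ z ℤ.≟ v ⟧) (rest y)))
      covered {v} eq (inj₁ refl) | inj₁ refl | inj₁ refl = ℤ.≤-refl
      covered {v} eq (inj₂ refl) | inj₂ (inj₁ refl) | inj₂ (inj₁ refl) = ℤ.≤-refl
      covered {v} () (inj₂ refl) | inj₁ refl | inj₁ refl
      covered {v} () (inj₁ refl) | inj₂ (inj₁ refl) | inj₂ (inj₁ refl)
      covered {v} () (inj₁ refl) | inj₁ refl | inj₂ (inj₁ refl)
      covered {v} () (inj₂ refl) | inj₁ refl | inj₂ (inj₁ refl)
      covered {v} () (inj₁ refl) | inj₂ (inj₁ refl) | inj₁ refl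
      covered {v} () (inj₂ refl) | inj₂ (inj₁ refl) | inj₁ refl

      level≤ : ∀ c → c ≡ 1ℤ ⊎ c ≡ - 1ℤ → ∀ a p →
               ⟦ w a p ℤ.≟ c ⟧ ≤ᶻ bad b q a p + ⟦ x a ℤ.≟ c ⟧ * ⟦ x p ℤ.≟ c ⟧ + rest (x a) + rest (x p)
      level≤ c cc a p = ⟦⟧≤ (w a p ℤ.≟ c) (outside≥0 a p rest rest≥0 (⟦⟧-≥0 (x a ℤ.≟ c) ⊗ ⟦⟧-≥0 (x p ℤ.≟ c))) (λ { refl → go cc (+ 2 * w a p ℤ.≟ x a + x p) })
        where
        s = ⟦ x a ℤ.≟ w a p ⟧ * ⟦ x p ℤ.≟ w a p ⟧
        s≥0 = ⟦⟧-≥0 (x a ℤ.≟ w a p) ⊗ ⟦⟧-≥0 (x p ℤ.≟ w a p)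
        go : w a p ≡ 1ℤ ⊎ w a p ≡ - 1ℤ → (d : Dec (+ 2 * w a p ≡ x a + x p)) → 1ℤ ≤ᶻ bad b q a p + s + rest (x a) + rest (x p)
        go cc (yes eq) = ≤-by (⟦⟧-≥0 (¬? (+ 2 * w a p ℤ.≟ x a + x p)) ⊕ gap (covered {w a p} {x a} {x p} eq cc)) (level≤-identity (bad b q a p) s (rest (x a)) (rest (x p)))
        go cc (no neq) = ≤-by (gap (1≤⟦⟧ (¬? (+ 2 * w a p ℤ.≟ x a + x p)) neq) ⊕ s≥0 ⊕ rest≥0 (x a) ⊕ rest≥0 (x p))
                           (level≤-identity₂ (bad b q a p) s (rest (x a)) (rest (x p)))

      ∑∑-outside≥0 : ∀ (F : Fin n → Fin n → ℤ) (r : ℤ → ℤ) →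
        (∑[ a ∈ V n ] ∑[ p ∈ V n ] (bad b q a p + F a p + r (x a) + r (x p))) ≡
        B + (∑[ a ∈ V n ] ∑[ p ∈ V n ] F a p) + + 2 * N * (∑[ a ∈ V n ] r (x a))
      ∑∑-outside≥0 F r = trans (trans (∑∑-split (V n) _ _) (cong₂ _+_
          (trans (∑∑-split (V n) _ _) (cong₂ _+_ (∑∑-split (V n) _ _)
            (trans (∑-cong (V n) (λ a → ∑-V-const n (r (x a)))) (∑-*ˡ (V n) N _))))
          (∑-V-const n R)))
        (∑∑-outside≥0-identity B S N R)
        where
        R = ∑[ a ∈ V n ] r (x a)
        S = ∑[ a ∈ V n ] ∑[ p ∈ V n ] F a p

      -- In units of N²/K, the 7 consists of 1 for the bad pairs and 2 · 3 for the pairs with an end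
      -- counted by `other`.
      level-sum : ∀ c → c ≡ 1ℤ ⊎ c ≡ - 1ℤ → K * other ≤ᶻ + 3 * N →
        K * (∑[ a ∈ V n ] ∑[ p ∈ V n ] ⟦ w a p ℤ.≟ c ⟧) ≤ᶻ K * ((∑[ a ∈ V n ] ⟦ x a ℤ.≟ c ⟧) * (∑[ a ∈ V n ] ⟦ x a ℤ.≟ c ⟧)) + + 7 * (N * N)
      level-sum c cc few-other = ≤-by (0≤K ⊗ gap total ⊕ gap KB≤ ⊕ 0≤+ 2 ⊗ 0≤+ n ⊗ gap few-other) (level-sum-identity K W S B N other)
        where
        W = ∑[ a ∈ V n ] ∑[ p ∈ V n ] ⟦ w a p ℤ.≟ c ⟧
        S = (∑[ a ∈ V n ] ⟦ x a ℤ.≟ c ⟧) * (∑[ a ∈ V n ] ⟦ x a ℤ.≟ c ⟧)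
        total : W ≤ᶻ B + S + + 2 * N * other
        total = subst (W ≤ᶻ_) (trans (∑∑-outside≥0 _ rest) (cong (λ s → B + s + + 2 * N * other) (∑-*-∑ (V n) (V n) _ _)))
                  (∑∑-mono (V n) (level≤ c cc))

    W₊≤ : K * other ≤ᶻ + 3 * N → K * W₊ ≤ᶻ K * (pos * pos) + + 7 * (N * N)
    W₊≤ = level-sum 1ℤ (inj₁ refl)

    W₋≤ : K * other ≤ᶻ + 3 * N → K * W₋ ≤ᶻ K * (neg * neg) + + 7 * (N * N)
    W₋≤ = level-sum (- 1ℤ) (inj₂ refl)

    -- A good pair with value 0 at both ends has weight 0. The 7 arises as in `level-sum`, with
    -- `nonzero` in the role of `other`.
    W₊-small : K * nonzero ≤ᶻ + 3 * N → K * W₊ ≤ᶻ + 7 * (N * N)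
    W₊-small few-nonzero = ≤-by (0≤K ⊗ gap total ⊕ gap KB≤ ⊕ 0≤+ 2 ⊗ 0≤+ n ⊗ gap few-nonzero) (W₊-small-identity₄ K W₊ B N nonzero)
      where
      r : ℤ → ℤ
      r y = 1ℤ - 0ᶻ y
      r≥0 : ∀ y → 0ℤ ≤ᶻ r y
      r≥0 y = gap (⟦⟧-≤1 (y ℤ.≟ 0ℤ))
      go : ∀ a p → w a p ≡ 1ℤ → (d : Dec (+ 2 * w a p ≡ x a + x p)) → Dec (x a ≡ 0ℤ) → Dec (x p ≡ 0ℤ) →
           1ℤ ≤ᶻ bad b q a p + 0ℤ + r (x a) + r (x p)
      go a p eq (no neq) _ _ = ≤-by (gap (1≤⟦⟧ (¬? (+ 2 * w a p ℤ.≟ x a + x p)) neq) ⊕ r≥0 (x a) ⊕ r≥0 (x p)) (W₊-small-identity (bad b q a p) (r (x a)) (r (x p)))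
      go a p eq (yes _) (no neq) _ = ≤-by (⟦⟧-≥0 (¬? (+ 2 * w a p ℤ.≟ x a + x p)) ⊕ r≥0 (x p))
          (trans (cong (λ s → bad b q a p + 0ℤ + (1ℤ - s) + r (x p) - 1ℤ) (⟦⟧-no (x a ℤ.≟ 0ℤ) neq)) (W₊-small-identity₂ (bad b q a p) (r (x p))))
      go a p eq (yes _) (yes _) (no neq) = ≤-by (⟦⟧-≥0 (¬? (+ 2 * w a p ℤ.≟ x a + x p)) ⊕ r≥0 (x a))
          (trans (cong (λ s → bad b q a p + 0ℤ + r (x a) + (1ℤ - s) - 1ℤ) (⟦⟧-no (x p ℤ.≟ 0ℤ) neq)) (W₊-small-identity₃ (bad b q a p) (r (x a))))
      go a p eq (yes good) (yes i) (yes j) with trans (sym eq) (good⇒ a p good 0ℤ i j)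
      ... | ()
      total : W₊ ≤ᶻ B + 0ℤ + + 2 * N * nonzero
      total = subst (W₊ ≤ᶻ_) (trans (∑∑-outside≥0 (λ _ _ → 0ℤ) r)
          (cong (λ s → B + s + + 2 * N * nonzero) (trans (∑-cong (V n) (λ _ → ∑-0 (V n))) (∑-0 (V n)))))
        (∑∑-mono (V n) (λ a p → ⟦⟧≤ (w a p ℤ.≟ 1ℤ) (outside≥0 a p r r≥0 ℤ.≤-refl)
          (λ eq → go a p eq (+ 2 * w a p ℤ.≟ x a + x p) (x a ℤ.≟ 0ℤ) (x p ℤ.≟ 0ℤ))))

-- Subsets of prescribed size

between : ∀ (A B : Subset n) {k} → A ⊆ˢ B → ∣ A ∣ ≤ k → k ≤ ∣ B ∣ →
          Σ[ S ∈ Subset n ] (A ⊆ˢ S × S ⊆ˢ B × ∣ S ∣ ≡ k)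
between Vec.[] Vec.[] A⊆B p q = Vec.[] , (λ ()) , (λ ()) , ℕ.≤-antisym z≤n q
between (inside Vec.∷ A) (outside Vec.∷ B) A⊆B p q = case A⊆B Vec.here of λ ()
between (inside Vec.∷ A) (inside Vec.∷ B) A⊆B (s≤s p) (s≤s q) =
  let (S , A⊆S , S⊆B , eq) = between A B (Subset.drop-∷-⊆ A⊆B) p q
  in inside Vec.∷ S , Subset.s⊆s A⊆S , Subset.s⊆s S⊆B , cong suc eq
between (outside Vec.∷ A) (outside Vec.∷ B) A⊆B p q =
  let (S , A⊆S , S⊆B , eq) = between A B (Subset.drop-∷-⊆ A⊆B) p q
  in outside Vec.∷ S , Subset.s⊆s A⊆S , Subset.s⊆s S⊆B , eq
between (outside Vec.∷ A) (inside Vec.∷ B) {k} A⊆B p q with k ℕ.≤? ∣ B ∣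
... | yes k≤ =
  let (S , A⊆S , S⊆B , eq) = between A B (Subset.drop-∷-⊆ A⊆B) p k≤
  in outside Vec.∷ S , Subset.s⊆s A⊆S , Subset.out⊆ S⊆B , eq
... | no k≰ = inside Vec.∷ B , A⊆B , Subset.⊆-refl , ℕ.≤-antisym (ℕ.≰⇒> k≰) q

∣∣≡∑ : ∀ (S : Subset n) → + ∣ S ∣ ≡ ∑[ x ∈ V n ] ⟦ x ∈ˢ? S ⟧
∣∣≡∑ {n} S = trans (go S) (sym (∑-tabulate id (λ x → ⟦ x ∈ˢ? S ⟧)))
  where
  go : ∀ {n} (S : Subset n) → + ∣ S ∣ ≡ sum (λ x → ⟦ x ∈ˢ? S ⟧)
  go Vec.[] = refl
  go (inside  Vec.∷ S) = cong (λ s → 1ℤ + s) (go S)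
  go (outside Vec.∷ S) = trans (go S) (sym (ℤ.+-identityˡ _))

subset : {P : Fin n → Set} → (∀ x → Dec (P x)) → Subset n
subset P? = Vec.tabulate (λ x → does (P? x))

module _ {P : Fin n → Set} (P? : ∀ x → Dec (P x)) where

  ∈-subset⁺ : ∀ {x} → P x → x ∈ˢ subset P?
  ∈-subset⁺ {x} p = Vec.lookup⇒[]= x _ (trans (Vec.lookup∘tabulate _ x) (eq (P? x)))
    where
    eq : (d : Dec (P x)) → does d ≡ true
    eq (yes _) = refl
    eq (no ¬p) = ⊥-elim (¬p p)

  ∈-subset⁻ : ∀ {x} → x ∈ˢ subset P? → P x
  ∈-subset⁻ {x} m = eq (P? x) (trans (sym (Vec.lookup∘tabulate _ x)) (Vec.[]=⇒lookup m))
    where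
    eq : (d : Dec (P x)) → does d ≡ true → P x
    eq (yes p) _ = p

-- Lower bounds on the number of unbalanced 4-cycles

absurd≤0 : ∀ {a} → 0ℤ <ᶻ a → a ≤ᶻ 0ℤ → ∀ {ℓ} {A : Set ℓ} → A
absurd≤0 p q = ⊥-elim (ℤ.<⇒≱ p q)

module Colours {n r : ℕ} (C : Fin n → Fin n → Fin r) (C-sym : ∀ a b → C a b ≡ C b a) where

  χ : Fin r → Fin n → Fin n → ℤ
  χ i a b = ⟦ C a b Fin.≟ i ⟧

  χ-sym : ∀ i a b → χ i a b ≡ χ i b a
  χ-sym i a b = cong (λ c → ⟦ c Fin.≟ i ⟧) (C-sym a b)

  -- Ordered pairs including the diagonal, hence twice the number of edges up to an error of at most
  -- n; leaving out the diagonal would spoil the products of sums.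
  count : Fin r → ℤ
  count i = ∑[ a ∈ V n ] ∑[ b ∈ V n ] χ i a b

  miscoloured : Fin r → Subset n → ℤ
  miscoloured i S = ∑[ a ∈ V n ] ∑[ b ∈ V n ] (⟦ a ∈ˢ? S ⟧ * ⟦ b ∈ˢ? S ⟧ * (1ℤ - χ i a b))

  w : Fin r → Fin r → Fin n → Fin n → ℤ
  w i j a b = χ i a b - χ j a b

  w-sym : ∀ i j a b → w i j a b ≡ w i j b a
  w-sym i j a b = cong₂ _-_ (χ-sym i a b) (χ-sym j a b)

contra-identity : ∀ m r c → 0ℤ - + 3 * m ≡ + 10 * (+ 2 * r * c - m) + (+ 7 * m - + 20 * r * c)
contra-identity = solve-∀

K*neg≤-identity : ∀ K a N → N * N - K * a * (K * a) ≡ K * K * 0ℤ + N * N - K * K * (a * a)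
K*neg≤-identity = solve-∀

14≤15-identity : ∀ K p q o → K * (+ 15 * p) - K * (+ 14 * (p + q + o)) ≡
    (p + q + o) * (K - + 60) + + 15 * (p + q + o - K * q) + + 15 * (+ 3 * (p + q + o) - K * o)
14≤15-identity = solve-∀

contra-identity₂ : ∀ N K c p → 0ℤ - + 1053 * (N * N) ≡
    + 450 * (K * K * c + N * N - K * K * (p * p)) + + 225 * (K * K) * (N * N - + 2 * c)
    + + 2 * (K * K) * ((+ 15 * p - + 14 * N) * (+ 15 * p + + 14 * N))
    + + 167 * (N * N) * ((K - + 60) * (K + + 60) + + 3591)
contra-identity₂ = solve-∀

nonzero-contra-identity : ∀ m r L c → 0ℤ - + 3 * m ≡ + 10 * (+ 2 * r * c - m) + (+ 7 * m - + 20 * L * c) + + 20 * c * (L - r)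
nonzero-contra-identity = solve-∀

s≥-identity : ∀ K p q o → K * (+ 10 * (p + q)) - K * (+ 9 * (p + q + o)) ≡ (p + q + o) * (K - + 30) + + 10 * (+ 3 * (p + q + o) - K * o)
s≥-identity = solve-∀

squares-identity : ∀ K p q W W′ N → K * (K * (q * q) + + 9 * (N * N)) - K * (K * (p * p)) ≡
    (K * K * W + N * N - K * K * (p * p)) + K * (K * W′ + N * N - K * W)
    + K * (K * (q * q) + + 7 * (N * N) - K * W′) + N * N * (K - 1ℤ)
squares-identity = solve-∀

s≤0-identity : ∀ K p q N → 0ℤ - (p + q) ≡ (K * (q * q) + + 9 * (N * N) - K * (p * p)) + (p + q) * (K * (p - q) - (1ℤ + + 10 * N))
    + N * (+ 10 * (p + q) - + 9 * N)
s≤0-identity = solve-∀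

half-identity : ∀ K p q o N → + 13 * N - K * (p + q + o - + 2 * q) ≡ (+ 3 * N - K * o) + (+ 10 * N - K * (p - q))
half-identity = solve-∀

excess-identity : ∀ K N s p → + 14 * N - + 2 * K * (s - p) ≡ K * (N + 1ℤ - + 2 * s) + (+ 13 * N - K * (N - + 2 * p)) + (N - K)
excess-identity = solve-∀

misses-identity : ∀ K M B N E → + 15 * (N * N) - K * M ≡ K * (B + N * E + N * E - M) + (N * N - K * B) + N * (+ 14 * N - + 2 * K * E)
misses-identity = solve-∀

too-few-identity : ∀ L M m → 0ℤ - + 5 * m ≡ (+ 15 * m - + 20 * L * M) + + 20 * (L * M - m)
too-few-identity = solve-∀

module ManyUnbalanced {n r : ℕ} (0<n : 0ℤ <ᶻ + n) (C : Fin n → Fin n → Fin r) (C-sym : ∀ a b → C a b ≡ C b a) where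

  open Colours C C-sym

  private
    N = + n

  0<NN : 0ℤ <ᶻ N * N
  0<NN = 0<* 0<n 0<n

  ⟦⟧-sign : {P : Set ℓ} (d : Dec P) → Sign₀ ⟦ d ⟧
  ⟦⟧-sign (yes _) = plus
  ⟦⟧-sign (no _)  = null

  module One (one : Fin r) = Structure n 0<n (χ one) (χ-sym one) (λ a b → ⟦⟧-sign (C a b Fin.≟ one))

  -- Otherwise the potential is mostly 0 or mostly 1 or -1. In the first case colour 1 has at most 7
  -- N²/(20 r) pairs, fewer than N²/(2 r). In the second, the value -1 is rare because the weight is
  -- never -1, so colour 1 would cover more than half of all pairs.
  many-unbalanced-one : ∀ one → + 3 ≤ᶻ + r → N * N ≤ᶻ + 2 * + r * count one → + 2 * count one ≤ᶻ N * N →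
    ¬ (+ 2 * ((+ 20 * + r) * (+ 20 * + r)) * unbalancedCount (χ one) ≤ᶻ N * N * (N * N))
  many-unbalanced-one one 3≤r lo hi few =
    let (b , q , few′) = One.pivot one K 0≤K few in contra b q few′
    where
    K = + 20 * + r
    0≤K : 0ℤ ≤ᶻ K
    0≤K = 0≤+ 20 ⊗ 0≤+ r
    60≤K : + 60 ≤ᶻ K
    60≤K = *-monoˡ (+ 20) (0≤+ 20) 3≤r
    contra : ∀ b q → K * K * One.badness one b q ≤ᶻ N * N → ⊥
    contra b q few′ with One.Pivoted.dichotomy one K (ℤ.≤-trans (+≤+ (s≤s z≤n)) 60≤K) b q few′
    ... | inj₁ A = absurd≤0 (0<* {+ 3} (+<+ (s≤s z≤n)) 0<NN)
            (≤-by (0≤+ 10 ⊗ gap lo ⊕ gap (subst (λ s → K * s ≤ᶻ + 7 * (N * N)) W₊≡ (W₊-small A))) (contra-identity (N * N) (+ r) (count one)))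
      where
      open One.Pivoted one K (ℤ.≤-trans (+≤+ (s≤s z≤n)) 60≤K) b q few′ hiding (0≤K)
      W₊≡ : W₊ ≡ count one
      W₊≡ = ∑-cong (V n) (λ a → ∑-cong (V n) (λ p → 1ᶻ-⟦⟧ (C a p Fin.≟ one)))
        where
        1ᶻ-⟦⟧ : {P : Set} (d : Dec P) → 1ᶻ ⟦ d ⟧ ≡ ⟦ d ⟧
        1ᶻ-⟦⟧ (yes _) = refl
        1ᶻ-⟦⟧ (no _)  = refl
    ... | inj₂ A = absurd≤0 (0<* {+ 1053} (+<+ (s≤s z≤n)) 0<NN)
            (≤-by (0≤+ 450 ⊗ gap (subst (λ s → K * K * (pos * pos) ≤ᶻ K * K * s + N * N) W₊≡ pos²≤)
                   ⊕ 0≤+ 225 ⊗ (0≤K ⊗ 0≤K) ⊗ gap hi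
                   ⊕ 0≤+ 2 ⊗ (0≤K ⊗ 0≤K) ⊗ (gap 14≤15 ⊗ (0≤+ 15 ⊗ pos≥0 ⊕ 0≤+ 14 ⊗ 0≤+ n))
                   ⊕ 0≤+ 167 ⊗ (sq N) ⊗ (gap 60≤K ⊗ (0≤K ⊕ 0≤+ 60) ⊕ 0≤+ 3591))
             (contra-identity₂ N K (count one) pos))
      where
      open One.Pivoted one K (ℤ.≤-trans (+≤+ (s≤s z≤n)) 60≤K) b q few′ hiding (0≤K)
      1ᶻ-⟦⟧ : {P : Set} (d : Dec P) → 1ᶻ ⟦ d ⟧ ≡ ⟦ d ⟧
      1ᶻ-⟦⟧ (yes _) = refl
      1ᶻ-⟦⟧ (no _)  = refl
      -1ᶻ-⟦⟧ : {P : Set} (d : Dec P) → -1ᶻ ⟦ d ⟧ ≡ 0ℤ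
      -1ᶻ-⟦⟧ (yes _) = refl
      -1ᶻ-⟦⟧ (no _)  = refl
      W₊≡ : W₊ ≡ count one
      W₊≡ = ∑-cong (V n) (λ a → ∑-cong (V n) (λ p → 1ᶻ-⟦⟧ (C a p Fin.≟ one)))
      W₋≡ : W₋ ≡ 0ℤ
      W₋≡ = trans (∑-cong (V n) (λ a → trans (∑-cong (V n) (λ p → -1ᶻ-⟦⟧ (C a p Fin.≟ one))) (∑-0 (V n)))) (∑-0 (V n))
      pos≥0 : 0ℤ ≤ᶻ pos
      pos≥0 = ∑-≥0 (V n) (λ a → ⟦⟧-≥0 (x a ℤ.≟ 1ℤ))
      K*neg≤ : K * neg ≤ᶻ N
      K*neg≤ = sq-cancel (0≤+ n) (≤-by (gap (subst (λ s → K * K * (neg * neg) ≤ᶻ K * K * s + N * N) W₋≡ neg²≤)) (K*neg≤-identity K neg N))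
      -- At most N/K vertices have value -1 and 3 N/K belong to `other`; as K ≥ 60 this leaves a
      -- share 1 - 4/60 = 14/15.
      14≤15 : + 14 * N ≤ᶻ + 15 * pos
      14≤15 = *-cancel K (ℤ.<-≤-trans (+<+ (s≤s z≤n)) 60≤K)
        (≤-by (0≤+ n ⊗ gap 60≤K ⊕ 0≤+ 15 ⊗ gap K*neg≤ ⊕ 0≤+ 15 ⊗ gap A)
          (trans (cong (λ s → K * (+ 15 * pos) - K * (+ 14 * s)) (sym classes))
                 (trans (14≤15-identity K pos neg other) (cong (λ s → s * (K - + 60) + + 15 * (s - K * neg) + + 15 * (+ 3 * s - K * other)) classes))))

  module Versus (one i : Fin r) (i≢one : i ≢ one) where

    private
      w₁ = w one i

    private
      values : ∀ c → Sign₀ (⟦ c Fin.≟ one ⟧ - ⟦ c Fin.≟ i ⟧) ×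
               1ᶻ (⟦ c Fin.≟ one ⟧ - ⟦ c Fin.≟ i ⟧) ≡ ⟦ c Fin.≟ one ⟧ × -1ᶻ (⟦ c Fin.≟ one ⟧ - ⟦ c Fin.≟ i ⟧) ≡ ⟦ c Fin.≟ i ⟧
      values c with c Fin.≟ one | c Fin.≟ i
      ... | yes p | yes q = ⊥-elim (i≢one (trans (sym q) p))
      ... | yes _ | no _  = plus , refl , refl
      ... | no _  | yes _ = minus , refl , refl
      ... | no _  | no _  = null , refl , refl

    open Structure n 0<n w₁ (w-sym one i) (λ a b → proj₁ (values (C a b))) public

    module Contradiction (L : ℕ) (2≤L : + 2 ≤ᶻ + L) (r≤L : + r ≤ᶻ + L) (K≤N : + 20 * + L ≤ᶻ N)
      (lo : N * N ≤ᶻ + 2 * + r * count one)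
      (b₁ : + 20 * + L * count one ≤ᶻ + 20 * + L * count i + N * N)
      (b₂ : + 20 * + L * count i ≤ᶻ + 20 * + L * count one + N * N)
      (standard : ∀ S → ∣ S ∣ ≡ ∣ ∁ S ∣ ⊎ ∣ S ∣ ≡ suc ∣ ∁ S ∣ →
                  N * N ≤ᶻ + L * miscoloured one S ⊎ N * N ≤ᶻ + L * miscoloured i (∁ S))
      where

      K = + 20 * + L

      0≤K : 0ℤ ≤ᶻ K
      0≤K = 0≤+ 20 ⊗ 0≤+ L

      30≤K : + 30 ≤ᶻ K
      30≤K = ℤ.≤-trans (+≤+ (ℕ.m≤m+n 30 10)) (*-monoˡ (+ 20) (0≤+ 20) 2≤L)

      1≤K : 1ℤ ≤ᶻ K
      1≤K = ℤ.≤-trans (+≤+ (s≤s z≤n)) 30≤K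

      0<K : 0ℤ <ᶻ K
      0<K = ℤ.<-≤-trans (+<+ (s≤s z≤n)) 1≤K

      module _ (b q : Fin n) (few : K * K * badness b q ≤ᶻ N * N) where

        open Pivoted K 1≤K b q few hiding (0≤K)

        W₊≡ : W₊ ≡ count one
        W₊≡ = ∑-cong (V n) (λ a → ∑-cong (V n) (λ p → proj₁ (proj₂ (values (C a p)))))

        W₋≡ : W₋ ≡ count i
        W₋≡ = ∑-cong (V n) (λ a → ∑-cong (V n) (λ p → proj₂ (proj₂ (values (C a p)))))

        nonzero-contra : K * nonzero ≤ᶻ + 3 * N → ⊥
        nonzero-contra A = absurd≤0 (0<* {+ 3} (+<+ (s≤s z≤n)) 0<NN)
            (≤-by (0≤+ 10 ⊗ gap lo ⊕ gap (subst (λ s → K * s ≤ᶻ + 7 * (N * N)) W₊≡ (W₊-small A))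
                   ⊕ 0≤+ 20 ⊗ count≥0 ⊗ gap r≤L) (nonzero-contra-identity (N * N) (+ r) (+ L) (count one)))
          where
          count≥0 : 0ℤ ≤ᶻ count one
          count≥0 = ∑-≥0 (V n) (λ a → ∑-≥0 (V n) (λ p → ⟦⟧-≥0 (C a p Fin.≟ one)))

        module _ (A : K * other ≤ᶻ + 3 * N) where

          s≥ : + 9 * N ≤ᶻ + 10 * (pos + neg)
          s≥ = *-cancel K 0<K (≤-by (0≤+ n ⊗ gap 30≤K ⊕ 0≤+ 10 ⊗ gap A)
            (trans (cong (λ s → K * (+ 10 * (pos + neg)) - K * (+ 9 * s)) (sym classes))
              (trans (s≥-identity K pos neg other) (cong (λ s → s * (K - + 30) + + 10 * (+ 3 * s - K * other)) classes))))

          -- In units of N²/K, 9 = 1 + 1 + 7: the bad pairs, the difference of the two colour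
          -- counts, and the error of `level-sum`.
          squares : ∀ p q W W′ → K * K * (p * p) ≤ᶻ K * K * W + N * N → K * W ≤ᶻ K * W′ + N * N →
                    K * W′ ≤ᶻ K * (q * q) + + 7 * (N * N) → K * (p * p) ≤ᶻ K * (q * q) + + 9 * (N * N)
          squares p q W W′ h₁ h₂ h₃ = *-cancel K 0<K
            (≤-by (gap h₁ ⊕ 0≤K ⊗ gap h₂ ⊕ 0≤K ⊗ gap h₃ ⊕ sq N ⊗ gap 1≤K) (squares-identity K p q W W′ N))

          -- The difference of squares is (p - q)(p + q), and p + q ≥ 9 N/10, so division turns the
          -- 9 of `squares` into 10.
          close : ∀ p q → K * (p * p) ≤ᶻ K * (q * q) + + 9 * (N * N) → + 9 * N ≤ᶻ + 10 * (p + q) → K * (p - q) ≤ᶻ + 10 * N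
          close p q h s≥ with K * (p - q) ℤ.≤? + 10 * N
          ... | yes le = le
          ... | no ¬le = absurd≤0 (0<* {+ 9} (+<+ (s≤s z≤n)) 0<n) (ℤ.≤-trans s≥ (*-monoˡ (+ 10) (0≤+ 10) s≤0))
            where
            far : 1ℤ + + 10 * N ≤ᶻ K * (p - q)
            far = ℤ.i<j⇒suc[i]≤j (ℤ.≰⇒> ¬le)
            s≥0 : 0ℤ ≤ᶻ p + q
            s≥0 = *-cancel (+ 10) (+<+ (s≤s z≤n)) (ℤ.≤-trans (0≤+ 9 ⊗ 0≤+ n) s≥)
            s≤0 : p + q ≤ᶻ 0ℤ
            s≤0 = ≤-by (gap h ⊕ s≥0 ⊗ gap far ⊕ 0≤+ n ⊗ gap s≥) (s≤0-identity K p q N)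

          half : ∀ p q → p + q + other ≡ N → K * (p - q) ≤ᶻ + 10 * N → K * (N - + 2 * q) ≤ᶻ + 13 * N
          half p q eq h = ≤-by (gap A ⊕ gap h)
            (trans (cong (λ s → + 13 * N - K * (s - + 2 * q)) (sym eq)) (half-identity K p q other N))

          half-neg : K * (N - + 2 * neg) ≤ᶻ + 13 * N
          half-neg = half pos neg classes (close pos neg (squares pos neg W₊ W₋ pos²≤
            (subst₂ (λ s t → K * s ≤ᶻ K * t + N * N) (sym W₊≡) (sym W₋≡) b₁) (W₋≤ A)) s≥)

          half-pos : K * (N - + 2 * pos) ≤ᶻ + 13 * N
          half-pos = half neg pos (trans (cong (_+ other) (ℤ.+-comm neg pos)) classes)
            (close neg pos (squares neg pos W₋ W₊ neg²≤
              (subst₂ (λ s t → K * s ≤ᶻ K * t + N * N) (sym W₋≡) (sym W₊≡) b₂) (W₊≤ A))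
              (subst (λ s → + 9 * N ≤ᶻ + 10 * s) (ℤ.+-comm pos neg) s≥))

          V₊ V₋ : Subset n
          V₊ = subset (λ a → x a ℤ.≟ 1ℤ)
          V₋ = subset (λ a → x a ℤ.≟ - 1ℤ)

          V₊⊆∁V₋ : V₊ ⊆ˢ ∁ V₋
          V₊⊆∁V₋ m = Subset.x∉p⇒x∈∁p (λ m′ → case trans (sym (∈-subset⁻ (λ a → x a ℤ.≟ 1ℤ) m)) (∈-subset⁻ (λ a → x a ℤ.≟ - 1ℤ) m′) of λ ())

          k = ℕ.⌈ n /2⌉

          -- The prescribed size is compared with the chain `V₊` ⊆ `∁ V₋`: `S` is taken inside `V₊`,
          -- between the two sets, or around `∁ V₋`. Each half is then comparable by inclusion with
          -- its own class.
          split : Σ[ S ∈ Subset n ] (∣ S ∣ ≡ k × (V₊ ⊆ˢ S ⊎ S ⊆ˢ V₊) × (V₋ ⊆ˢ ∁ S ⊎ ∁ S ⊆ˢ V₋))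
          split with k ℕ.≤? ∣ V₊ ∣ | k ℕ.≤? ∣ ∁ V₋ ∣
          ... | yes k≤ | _ =
            let (S , _ , S⊆ , eq) = between ⊥ˢ V₊ (λ m → ⊥-elim (Subset.∉⊥ m)) (subst (_≤ k) (sym (Subset.∣⊥∣≡0 n)) z≤n) k≤
            in S , eq , inj₂ S⊆ , inj₁ (λ m → Subset.x∉p⇒x∈∁p (λ m′ → Subset.x∈∁p⇒x∉p (V₊⊆∁V₋ (S⊆ m′)) m))
          ... | no k≰ | yes k≤ =
            let (S , ⊆S , S⊆ , eq) = between V₊ (∁ V₋) V₊⊆∁V₋ (ℕ.<⇒≤ (ℕ.≰⇒> k≰)) k≤
            in S , eq , inj₁ ⊆S , inj₁ (λ m → Subset.x∉p⇒x∈∁p (λ m′ → Subset.x∈∁p⇒x∉p (S⊆ m′) m))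
          ... | no _ | no k≰ =
            let (S , ⊆S , _ , eq) = between (∁ V₋) ⊤ˢ Subset.⊆⊤ (ℕ.<⇒≤ (ℕ.≰⇒> k≰)) (subst (k ≤_) (sym (Subset.∣⊤∣≡n n)) (ℕ.⌈n/2⌉≤n n))
            in S , eq , inj₁ (⊆S ∘ V₊⊆∁V₋) , inj₂ (λ m → Subset.x∉∁p⇒x∈p (λ m′ → Subset.x∈∁p⇒x∉p m (⊆S m′)))

          -- If the class lies in `S`, the surplus vertices are counted by subtraction, and 14 = 13
          -- + 1, where the 1 pays for rounding n/2 up, by `K≤N`. If `S` lies in the class, nothing
          -- is in excess.
          excess : ∀ {P : Fin n → Set} (P? : ∀ a → Dec (P a)) (S : Subset n) →
                   subset P? ⊆ˢ S ⊎ S ⊆ˢ subset P? → + 2 * + ∣ S ∣ ≤ᶻ N + 1ℤ → K * (N - + 2 * (∑[ a ∈ V n ] ⟦ P? a ⟧)) ≤ᶻ + 13 * N →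
                   + 2 * K * (∑[ a ∈ V n ] (⟦ a ∈ˢ? S ⟧ * (1ℤ - ⟦ P? a ⟧))) ≤ᶻ + 14 * N
          excess P? S (inj₁ ⊆S) size h = ≤-by (0≤K ⊗ gap size ⊕ gap h ⊕ gap K≤N)
            (trans (cong (λ s → + 14 * N - + 2 * K * s) eq) (excess-identity K N (+ ∣ S ∣) (∑[ a ∈ V n ] ⟦ P? a ⟧)))
            where
            at : ∀ a → ⟦ a ∈ˢ? S ⟧ * (1ℤ - ⟦ P? a ⟧) ≡ ⟦ a ∈ˢ? S ⟧ - ⟦ P? a ⟧
            at a with P? a
            ... | yes p = trans (ℤ.*-zeroʳ ⟦ a ∈ˢ? S ⟧) (sym (cong (_- 1ℤ) (⟦⟧-yes (a ∈ˢ? S) (⊆S (∈-subset⁺ P? p)))))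
            ... | no _  = trans (ℤ.*-identityʳ ⟦ a ∈ˢ? S ⟧) (sym (ℤ.+-identityʳ _))
            eq : (∑[ a ∈ V n ] (⟦ a ∈ˢ? S ⟧ * (1ℤ - ⟦ P? a ⟧))) ≡ + ∣ S ∣ - (∑[ a ∈ V n ] ⟦ P? a ⟧)
            eq = trans (∑-cong (V n) at) (trans (∑-- (V n) _ _) (cong (_- (∑[ a ∈ V n ] ⟦ P? a ⟧)) (sym (∣∣≡∑ S))))
          excess P? S (inj₂ S⊆) size h = ℤ.≤-trans
            (≡⇒≤ (trans (cong (+ 2 * K *_) (trans (∑-cong (V n) at) (∑-0 (V n)))) (ℤ.*-zeroʳ (+ 2 * K)))) (0≤+ 14 ⊗ 0≤+ n)
            where
            at : ∀ a → ⟦ a ∈ˢ? S ⟧ * (1ℤ - ⟦ P? a ⟧) ≡ 0ℤ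
            at a with a ∈ˢ? S
            ... | no _  = refl
            ... | yes m = cong (λ s → 1ℤ * (1ℤ - s)) (⟦⟧-yes (P? a) (∈-subset⁻ P? (S⊆ m)))

          miss≤ : ∀ c S a p → ⟦ a ∈ˢ? S ⟧ * ⟦ p ∈ˢ? S ⟧ * (1ℤ - ⟦ w₁ a p ℤ.≟ c ⟧) ≤ᶻ
                  bad b q a p + ⟦ a ∈ˢ? S ⟧ * (1ℤ - ⟦ x a ℤ.≟ c ⟧) + ⟦ p ∈ˢ? S ⟧ * (1ℤ - ⟦ x p ℤ.≟ c ⟧)
          miss≤ c S a p = go (a ∈ˢ? S) (p ∈ˢ? S) (w₁ a p ℤ.≟ c) (x a ℤ.≟ c) (x p ℤ.≟ c) (+ 2 * w₁ a p ℤ.≟ x a + x p)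
            where
            go : ∀ {P Q : Set} (d₁ : Dec P) (d₂ : Dec Q) (d₃ : Dec (w₁ a p ≡ c)) (d₄ : Dec (x a ≡ c)) (d₅ : Dec (x p ≡ c))
                 (d₆ : Dec (+ 2 * w₁ a p ≡ x a + x p)) →
                 ⟦ d₁ ⟧ * ⟦ d₂ ⟧ * (1ℤ - ⟦ d₃ ⟧) ≤ᶻ ⟦ ¬? d₆ ⟧ + ⟦ d₁ ⟧ * (1ℤ - ⟦ d₄ ⟧) + ⟦ d₂ ⟧ * (1ℤ - ⟦ d₅ ⟧)
            nonneg : ∀ {P Q R S : Set} (d₁ : Dec P) (d₂ : Dec Q) (d₄ : Dec R) (d₅ : Dec S) {y} → 0ℤ ≤ᶻ y →
                     0ℤ ≤ᶻ y + ⟦ d₁ ⟧ * (1ℤ - ⟦ d₄ ⟧) + ⟦ d₂ ⟧ * (1ℤ - ⟦ d₅ ⟧)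
            nonneg d₁ d₂ d₄ d₅ 0≤y = 0≤y ⊕ ⟦⟧-≥0 d₁ ⊗ gap (⟦⟧-≤1 d₄) ⊕ ⟦⟧-≥0 d₂ ⊗ gap (⟦⟧-≤1 d₅)
            go (no n₁)  d₂       d₃       d₄       d₅       d₆       = nonneg (no n₁) d₂ d₄ d₅ (⟦⟧-≥0 (¬? d₆))
            go (yes y₁) (no n₂)  d₃       d₄       d₅       d₆       = nonneg (yes y₁) (no n₂) d₄ d₅ (⟦⟧-≥0 (¬? d₆))
            go (yes y₁) (yes y₂) (yes y₃) d₄       d₅       d₆       = nonneg (yes y₁) (yes y₂) d₄ d₅ (⟦⟧-≥0 (¬? d₆))
            go (yes y₁) (yes y₂) (no n₃)  (yes y₄) (yes y₅) (yes y₆) = ⊥-elim (n₃ (good⇒ a p y₆ c y₄ y₅))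
            go (yes y₁) (yes y₂) (no n₃)  (yes y₄) (yes y₅) (no n₆)  = ℤ.≤-refl
            go (yes y₁) (yes y₂) (no n₃)  (yes y₄) (no n₅)  (yes y₆) = ℤ.≤-refl
            go (yes y₁) (yes y₂) (no n₃)  (yes y₄) (no n₅)  (no n₆)  = +≤+ (s≤s z≤n)
            go (yes y₁) (yes y₂) (no n₃)  (no n₄)  (yes y₅) (yes y₆) = ℤ.≤-refl
            go (yes y₁) (yes y₂) (no n₃)  (no n₄)  (yes y₅) (no n₆)  = +≤+ (s≤s z≤n)
            go (yes y₁) (yes y₂) (no n₃)  (no n₄)  (no n₅)  (yes y₆) = +≤+ (s≤s z≤n)
            go (yes y₁) (yes y₂) (no n₃)  (no n₄)  (no n₅)  (no n₆)  = +≤+ (s≤s z≤n)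

          -- A pair of `S` with the wrong weight is bad or has an end outside the class, whence 15 =
          -- 1 + 14.
          misses : ∀ c S → + 2 * K * (∑[ a ∈ V n ] (⟦ a ∈ˢ? S ⟧ * (1ℤ - ⟦ x a ℤ.≟ c ⟧))) ≤ᶻ + 14 * N →
                   K * (∑[ a ∈ V n ] ∑[ p ∈ V n ] (⟦ a ∈ˢ? S ⟧ * ⟦ p ∈ˢ? S ⟧ * (1ℤ - ⟦ w₁ a p ℤ.≟ c ⟧))) ≤ᶻ + 15 * (N * N)
          misses c S h = ≤-by (0≤K ⊗ gap total ⊕ gap KB≤ ⊕ 0≤+ n ⊗ gap h) (misses-identity K M B N E)
            where
            M = ∑[ a ∈ V n ] ∑[ p ∈ V n ] (⟦ a ∈ˢ? S ⟧ * ⟦ p ∈ˢ? S ⟧ * (1ℤ - ⟦ w₁ a p ℤ.≟ c ⟧))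
            E = ∑[ a ∈ V n ] (⟦ a ∈ˢ? S ⟧ * (1ℤ - ⟦ x a ℤ.≟ c ⟧))
            total : M ≤ᶻ B + N * E + N * E
            total = subst (M ≤ᶻ_) (trans (∑∑-split (V n) _ _) (cong₂ _+_
                (trans (∑∑-split (V n) _ _) (cong (λ s → B + s) (trans (∑-cong (V n) (λ a → ∑-V-const n _)) (∑-*ˡ (V n) N _))))
                (∑-V-const n E)))
              (∑∑-mono (V n) (miss≤ c S))

          -- As K = 20 L, standardness demands 20 units of N²/K, but only 15 are available; this is
          -- why the factor 20 was chosen.
          too-few : ∀ M → K * M ≤ᶻ + 15 * (N * N) → N * N ≤ᶻ + L * M → ⊥
          too-few M h h′ = absurd≤0 (0<* {+ 5} (+<+ (s≤s z≤n)) 0<NN) (≤-by (gap h ⊕ 0≤+ 20 ⊗ gap h′) (too-few-identity (+ L) M (N * N)))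

          other-contra : ⊥
          other-contra =
            let (S , ∣S∣ , pos? , neg?) = split
                ∣∁S∣ : ∣ ∁ S ∣ ≡ ℕ.⌊ n /2⌋
                ∣∁S∣ = trans (Subset.∣∁p∣≡n∸∣p∣ S) (trans (cong₂ ℕ._∸_ (sym (ℕ.⌊n/2⌋+⌈n/2⌉≡n n)) ∣S∣) (ℕ.m+n∸n≡m ℕ.⌊ n /2⌋ k))
                recolour : ∀ c j T → (∀ a p → ⟦ w₁ a p ℤ.≟ c ⟧ ≡ χ j a p) →
                  (∑[ a ∈ V n ] ∑[ p ∈ V n ] (⟦ a ∈ˢ? T ⟧ * ⟦ p ∈ˢ? T ⟧ * (1ℤ - ⟦ w₁ a p ℤ.≟ c ⟧))) ≡ miscoloured j T
                recolour c j T eq = ∑-cong (V n) (λ a → ∑-cong (V n) (λ p → cong (λ s → ⟦ a ∈ˢ? T ⟧ * ⟦ p ∈ˢ? T ⟧ * (1ℤ - s)) (eq a p)))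
            in case standard S (halves n ∣S∣ ∣∁S∣) of λ
              { (inj₁ h) → too-few (miscoloured one S) (subst (λ s → K * s ≤ᶻ + 15 * (N * N)) (recolour 1ℤ one S (λ a p → proj₁ (proj₂ (values (C a p)))))
                             (misses 1ℤ S (excess (λ a → x a ℤ.≟ 1ℤ) S pos? (subst (λ s → + 2 * + s ≤ᶻ N + 1ℤ) (sym ∣S∣) (2⌈⌉≤ n)) half-pos))) h
              ; (inj₂ h) → too-few (miscoloured i (∁ S)) (subst (λ s → K * s ≤ᶻ + 15 * (N * N)) (recolour (- 1ℤ) i (∁ S) (λ a p → proj₂ (proj₂ (values (C a p)))))
                             (misses (- 1ℤ) (∁ S) (excess (λ a → x a ℤ.≟ - 1ℤ) (∁ S) neg? (subst (λ s → + 2 * + s ≤ᶻ N + 1ℤ) (sym ∣∁S∣) (2⌊⌋≤ n)) half-neg))) h }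
            where
            halves : ∀ n {s t} → s ≡ ℕ.⌈ n /2⌉ → t ≡ ℕ.⌊ n /2⌋ → s ≡ t ⊎ s ≡ suc t
            halves zero          refl refl = inj₁ refl
            halves (suc zero)    refl refl = inj₂ refl
            halves (suc (suc n)) refl refl with halves n refl refl
            ... | inj₁ eq = inj₁ (cong suc eq)
            ... | inj₂ eq = inj₂ (cong suc eq)
            2⌈⌉≤ : ∀ n → + 2 * + ℕ.⌈ n /2⌉ ≤ᶻ + n + 1ℤ
            2⌈⌉≤ n = subst₂ _≤ᶻ_ (ℤ.pos-* 2 ℕ.⌈ n /2⌉) refl (+≤+ (go n))
              where
              go : ∀ n → 2 ℕ.* ℕ.⌈ n /2⌉ ≤ n ℕ.+ 1
              go zero          = z≤n
              go (suc zero)    = ℕ.≤-refl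
              go (suc (suc n)) = subst (_≤ suc (suc n) ℕ.+ 1) (sym (ℕ.*-suc 2 ℕ.⌈ n /2⌉)) (s≤s (s≤s (go n)))
            2⌊⌋≤ : ∀ n → + 2 * + ℕ.⌊ n /2⌋ ≤ᶻ + n + 1ℤ
            2⌊⌋≤ n = ℤ.≤-trans (*-monoˡ (+ 2) (0≤+ 2) (+≤+ (ℕ.⌊n/2⌋≤⌈n/2⌉ n))) (2⌈⌉≤ n)

      many-unbalanced : ¬ (+ 2 * (K * K) * unbalancedCount w₁ ≤ᶻ N * N * (N * N))
      many-unbalanced few =
        let (b , q , few′) = pivot K 0≤K few
        in case Pivoted.dichotomy K 1≤K b q few′ of λ
          { (inj₁ A) → nonzero-contra b q few′ A
          ; (inj₂ A) → other-contra b q few′ A }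

-- Choosing which gadgets to swap

choice-identity : ∀ κ m a d → m * a + 0ℤ * d - κ * m ≡ m * (a - κ)
choice-identity = solve-∀

κ≤ν-identity : ∀ κ a v → v - κ ≡ (a + v - + 2 * κ) + (κ - a)
κ≤ν-identity = solve-∀

choice-identity₂ : ∀ κ m a d v → m * a + m * d - κ * m ≡ m * (a + (d - v) + (v - κ))
choice-identity₂ = solve-∀

choice-identity₃ : ∀ κ m a a′ d v M → m * a′ + m * d - κ * m ≡ m * ((a + a′ - M) + (κ - a) + (d - - (+ 2 * v)) + (M - + 2 * κ - + 2 * v))
choice-identity₃ = solve-∀

m≤2tm₂-identity : ∀ t m → + 2 * t * m - (t + m * t) ≡ t * (m - 1ℤ)
m≤2tm₂-identity = solve-∀

choice-identity₄ : ∀ κ m m₂ t a d v M → + 2 * (m * a + m₂ * d) - + 2 * (κ * m) ≡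
    + 2 * m * a + + 2 * m₂ * (d - v) + m₂ * (+ 2 * v - (M - + 2 * κ)) + m₂ * (M - (+ 4 * t * κ + + 2 * κ))
    + + 2 * κ * (+ 2 * t * m₂ - m)
choice-identity₄ = solve-∀

M-2κ≥0-identity : ∀ κ M t → (M - (+ 4 * t * κ + + 2 * κ)) + + 4 * t * κ ≡ M - + 2 * κ
M-2κ≥0-identity = solve-∀

choice-identity₅ : ∀ κ m m₂ t a a′ d v M T → m * a′ + m₂ * d - κ * m ≡
    m * ((a + a′ - M) + (κ - a)) + m₂ * ((d - - (+ 2 * v)) + + 2 * (T - v) + (t * (M - + 2 * κ) - + 2 * T))
    + (M - + 2 * κ) * (m - t * m₂)
choice-identity₅ = solve-∀

module Choice {r : ℕ} (one i₀ : Fin r) (α ν : Fin r → ℤ) (δ : Fin r → Fin r → ℤ) (M T κ : ℤ) (m t : ℕ)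
  (0<t : 1 ≤ t) (t≤m : t ≤ m) (0≤κ : 0ℤ ≤ᶻ κ)
  (α≥0 : ∀ j → j ≢ one → 0ℤ ≤ᶻ α j)
  (α+α : ∀ i j → i ≢ one → j ≢ one → i ≢ j → M ≤ᶻ α i + α j)
  (δ-same : ∀ i → i ≢ one → ν i ≤ᶻ δ i i)
  (δ-other : ∀ i j → - (+ 2 * ν i) ≤ᶻ δ i j)
  (ν≤T : ∀ i → ν i ≤ᶻ T)
  (α+ν : ∀ i → i ≢ one → + 2 * κ ≤ᶻ α i + ν i)
  (big : + 4 * + t * κ + + 2 * κ ≤ᶻ M)
  (bound : + 2 * T ≤ᶻ + t * (M - + 2 * κ))
  where

  0≤m : 0ℤ ≤ᶻ + m
  0≤m = 0≤+ m

  -- If colour i profits too little from the swaps of gain α, then all others profit by almost M or more, and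
  -- i can be served by further swaps at their expense: at every gadget if ν i is small against M, and
  -- at a fraction 1/t of the gadgets otherwise.
  choice : ∃[ i ] ∃[ m₂ ] (m₂ ≤ m × (∀ j → j ≢ one → κ * + m ≤ᶻ + m * α j + + m₂ * δ i j))
  choice with Fin.any? (λ i → ¬? (i Fin.≟ one) ×-dec (α i ℤ.<? κ))
  ... | no none = i₀ , 0 , z≤n , λ j j≢ →
        ≤-by (0≤m ⊗ gap (ℤ.≮⇒≥ (λ lt → none (j , j≢ , lt)))) (choice-identity κ (+ m) (α j) (δ i₀ j))
  ... | yes (i , i≢ , α<κ) with + 2 * ν i ℤ.≤? M - + 2 * κ
  ...   | yes cheap = i , m , ℕ.≤-refl , λ j j≢ → go j j≢ (j Fin.≟ i)
    where
    κ≤ν : κ ≤ᶻ ν i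
    κ≤ν = ≤-by (gap (α+ν i i≢) ⊕ gap (ℤ.<⇒≤ α<κ)) (κ≤ν-identity κ (α i) (ν i))
    go : ∀ j → j ≢ one → Dec (j ≡ i) → κ * + m ≤ᶻ + m * α j + + m * δ i j
    go j j≢ (yes refl) = ≤-by (0≤m ⊗ (α≥0 i i≢ ⊕ gap (δ-same i i≢) ⊕ gap κ≤ν)) (choice-identity₂ κ (+ m) (α i) (δ i i) (ν i))
    go j j≢ (no j≢i) = ≤-by (0≤m ⊗ (gap (α+α i j i≢ j≢ (≢-sym j≢i)) ⊕ gap (ℤ.<⇒≤ α<κ) ⊕ gap (δ-other i j) ⊕ gap cheap))
        (choice-identity₃ κ (+ m) (α i) (α j) (δ i j) (ν i) M)
  ...   | no dear = i , m₂ , m₂≤m , λ j j≢ → go j j≢ (j Fin.≟ i)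
    where
    instance
      t≢0 : NonZero t
      t≢0 = ℕ.>-nonZero 0<t
    m₂ = m ℕ./ t
    m₂≤m : m₂ ≤ m
    m₂≤m = ℕ.m/n≤m m t
    tm₂≤m : + t * + m₂ ≤ᶻ + m
    tm₂≤m = subst (_≤ᶻ + m) (trans (ℤ.pos-* m₂ t) (ℤ.*-comm (+ m₂) (+ t))) (+≤+ (ℕ.m/n*n≤m m t))
    1≤m₂ : 1 ≤ m₂
    1≤m₂ = subst (_≤ m₂) (ℕ.n/n≡1 t) (ℕ./-monoˡ-≤ t t≤m)
    -- Since `t ≤ m`, the quotient is at least 1, and rounding down costs at most a factor of 2.
    m≤2tm₂ : + m ≤ᶻ + 2 * + t * + m₂
    m≤2tm₂ = ℤ.≤-trans (+≤+ (ℕ.≤-trans (ℕ.≤-reflexive (ℕ.m≡m%n+[m/n]*n m t)) (ℕ.+-monoˡ-≤ (m₂ ℕ.* t) (ℕ.<⇒≤ (ℕ.m%n<n m t)))))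
      (≤-by (0≤+ t ⊗ gap (+≤+ 1≤m₂)) (trans (cong (λ s → + 2 * + t * + m₂ - (+ t + s)) (ℤ.pos-* m₂ t)) (m≤2tm₂-identity (+ t) (+ m₂))))
    go : ∀ j → j ≢ one → Dec (j ≡ i) → κ * + m ≤ᶻ + m * α j + + m₂ * δ i j
    go j j≢ (yes refl) = *-cancel (+ 2) (+<+ (s≤s z≤n))
        (≤-by (0≤+ 2 ⊗ 0≤m ⊗ α≥0 i i≢ ⊕ 0≤+ 2 ⊗ 0≤+ m₂ ⊗ gap (δ-same i i≢) ⊕ 0≤+ m₂ ⊗ gap (ℤ.<⇒≤ (ℤ.≰⇒> dear))
               ⊕ 0≤+ m₂ ⊗ gap big ⊕ 0≤+ 2 ⊗ 0≤κ ⊗ gap m≤2tm₂)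
        (choice-identity₄ κ (+ m) (+ m₂) (+ t) (α i) (δ i i) (ν i) M))
    go j j≢ (no j≢i) = ≤-by
        (0≤m ⊗ (gap (α+α i j i≢ j≢ (≢-sym j≢i)) ⊕ gap (ℤ.<⇒≤ α<κ)) ⊕ 0≤+ m₂ ⊗ (gap (δ-other i j) ⊕ 0≤+ 2 ⊗ gap (ν≤T i) ⊕ gap bound)
         ⊕ M-2κ≥0 ⊗ gap tm₂≤m)
        (choice-identity₅ κ (+ m) (+ m₂) (+ t) (α i) (α j) (δ i j) (ν i) M T)
      where
      M-2κ≥0 : 0ℤ ≤ᶻ M - + 2 * κ
      M-2κ≥0 = subst (0ℤ ≤ᶻ_) (M-2κ≥0-identity κ M (+ t)) (gap big ⊕ 0≤+ 4 ⊗ 0≤+ t ⊗ 0≤κ)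

-- Swapping the images of two vertices

-- Cauchy-Schwarz for the sizes of the fibres of `f`, read off from the sum of all squares of their
-- differences.
square-root-count : ∀ {n r : ℕ} (f : Fin n → Fin r) →
  + n * + n ≤ᶻ + r * (∑[ p ∈ V n ] ∑[ q ∈ V n ] ⟦ f p Fin.≟ f q ⟧)
square-root-count {n} {r} f = *-cancel (+ 2) (+<+ (s≤s z≤n))
  (≤-by (∑-≥0 (V r) (λ c → ∑-≥0 (V r) (λ d → sq (x c - x d))))
    (trans (cong₂ (λ s t → + 2 * (+ r * s) - + 2 * (t * t)) S≡ (sym ∑x)) (sym expand)))
  where
  x : Fin r → ℤ
  x c = ∑[ p ∈ V n ] ⟦ f p Fin.≟ c ⟧
  Σx = ∑ (V r) x
  Q = ∑[ c ∈ V r ] (x c * x c)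
  ∑x : Σx ≡ + n
  ∑x = trans (∑-comm (V r) (V n) _) (trans (∑-cong (V n) (λ p →
        trans (∑-cong (V r) (λ c → ⟦⟧-cong (f p Fin.≟ c) (c Fin.≟ f p) sym sym)) (∑-V-indicator (f p))))
      (trans (∑-V-const n 1ℤ) (ℤ.*-identityʳ (+ n))))
  S≡ : (∑[ p ∈ V n ] ∑[ q ∈ V n ] ⟦ f p Fin.≟ f q ⟧) ≡ Q
  S≡ = sym (trans (∑-cong (V r) (λ c → sym (∑-*-∑ (V n) (V n) _ _)))
    (trans (∑-comm (V r) (V n) _) (∑-cong (V n) (λ p → trans (∑-comm (V r) (V n) _) (∑-cong (V n) (λ q →
      trans (∑-cong (V r) (λ c → cong (_* ⟦ f q Fin.≟ c ⟧) (⟦⟧-cong (f p Fin.≟ c) (c Fin.≟ f p) sym sym)))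
        (trans (∑-V-single (f p) (λ c → ⟦ f q Fin.≟ c ⟧)) (⟦⟧-cong (f q Fin.≟ f p) (f p Fin.≟ f q) sym sym))))))))
  expand : (∑[ c ∈ V r ] ∑[ d ∈ V r ] ((x c - x d) * (x c - x d))) ≡ + 2 * (+ r * Q) - + 2 * (Σx * Σx)
  expand = trans (∑-cong (V r) (λ c → trans (∑-cong (V r) (λ d → e (x c) (x d)))
      (trans (∑-- (V r) _ _) (cong₂ _-_ (trans (∑-+ (V r) _ _) (cong (λ s → s + Q) (∑-V-const r (x c * x c)))) (∑-*ˡ (V r) (+ 2 * x c) x)))))
    (trans (∑-- (V r) _ _) (trans (cong₂ _-_
      (trans (∑-+ (V r) _ _) (cong₂ _+_ (∑-*ˡ (V r) (+ r) _) (∑-V-const r Q)))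
      (trans (∑-*ʳ (V r) Σx _) (cong (_* Σx) (∑-*ˡ (V r) (+ 2) x)))) (e′ (+ r) Q Σx)))
    where
    e : ∀ a b → (a - b) * (a - b) ≡ a * a + b * b - + 2 * a * b
    e = solve-∀
    e′ : ∀ r Q Σx → (r * Q + r * Q) - + 2 * Σx * Σx ≡ + 2 * (r * Q) - + 2 * (Σx * Σx)
    e′ = solve-∀

G-swap-identity : ∀ x y z w → z + w - x - y ≡ - (x + y - z - w)
G-swap-identity = solve-∀

G-≤2-identity : ∀ x y z w → + 2 - (x + y - z - w) ≡ (1ℤ - x) + (1ℤ - y) + z + w
G-≤2-identity = solve-∀

G-≥-2-identity : ∀ x y z w → (x + y - z - w) - - + 2 ≡ (1ℤ - z) + (1ℤ - w) + x + y
G-≥-2-identity = solve-∀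

G+G≤2-identity : ∀ x y z w x′ y′ z′ w′ → + 2 - ((x + y - z - w) + (x′ + y′ - z′ - w′)) ≡
    (1ℤ - (x + x′)) + (1ℤ - (y + y′)) + z + w + z′ + w′
G+G≤2-identity = solve-∀

G+G+G≤2-identity : ∀ x₀ y₀ z₀ w₀ x y z w x′ y′ z′ w′ → + 2 - ((x₀ + y₀ - z₀ - w₀) + (x + y - z - w) + (x′ + y′ - z′ - w′)) ≡
    (1ℤ - (x₀ + x + x′)) + (1ℤ - (y₀ + y + y′)) + z₀ + w₀ + z + w + z′ + w′
G+G+G≤2-identity = solve-∀

γ≥0-identity : ∀ g h → + 2 * (g - 1ℤ) + (+ 2 - (g + h)) ≡ g - h
γ≥0-identity = solve-∀

σ₁≤-identity : ∀ g h k → g - h + (g - k) - 1ℤ ≡ + 3 * (g - 1ℤ) + (+ 2 - (g + h + k))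
σ₁≤-identity = solve-∀

σ₂≤-identity : ∀ h → 0ℤ - h - 1ℤ ≡ - 1ℤ - h
σ₂≤-identity = solve-∀

-2σ₂≤-identity : ∀ h → 0ℤ - h - - + 2 ≡ + 2 - h
-2σ₂≤-identity = solve-∀

-2σ₂≤-identity₂ : ∀ s → s * - + 2 ≡ - (+ 2 * s)
-2σ₂≤-identity₂ = solve-∀

unbalanced-one≤-identity : ∀ x y z w → x + y - (z + w) ≡ x + y - z - w
unbalanced-one≤-identity = solve-∀

gain₊≥1-identity : ∀ g s → 1ℤ * g + s - 1ℤ ≡ (g - 1ℤ) + s
gain₊≥1-identity = solve-∀

balanced-identity : ∀ x y z w x′ y′ z′ w′ → x - x′ + (y - y′) - (z - z′ + (w - w′)) ≡ (x + y - z - w) - (x′ + y′ - z′ - w′)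
balanced-identity = solve-∀

module Gains {n r : ℕ} (C : Fin n → Fin n → Fin r) (C-sym : ∀ a b → C a b ≡ C b a) (one : Fin r) where

  open Colours C C-sym

  -- Change in the number of edges of colour j when leaves at a and b, attached to p and q, are exchanged.
  G : Fin r → Fin n → Fin n → Fin n → Fin n → ℤ
  G j a b p q = χ j b p + χ j a q - χ j a p - χ j b q

  γ : Fin r → Fin n → Fin n → Fin n → Fin n → ℤ
  γ j a b p q = G one a b p q - G j a b p q

  σ₁ : Fin n → Fin n → Fin n → Fin n → ℤ
  σ₁ a b p q = ⟦ 1ℤ ℤ.≤? G one a b p q ⟧

  σ₂ : Fin r → Fin n → Fin n → Fin n → Fin n → ℤ
  σ₂ i a b p q = ⟦ (G one a b p q ℤ.≟ 0ℤ) ×-dec (G i a b p q ℤ.≤? - 1ℤ) ⟧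

  private
    variable
      a b p q : Fin n
      i j : Fin r

  G-swap : ∀ j a b p q → G j b a p q ≡ - G j a b p q
  G-swap j a b p q = G-swap-identity (χ j b p) (χ j a q) (χ j a p) (χ j b q)

  single : ∀ (c : Fin r) {i j : Fin r} → i ≢ j → ⟦ c Fin.≟ i ⟧ + ⟦ c Fin.≟ j ⟧ ≤ᶻ 1ℤ
  single c {i} {j} i≢j with c Fin.≟ i | c Fin.≟ j
  ... | yes p | yes q = ⊥-elim (i≢j (trans (sym p) q))
  ... | yes _ | no _  = ℤ.≤-refl
  ... | no _  | yes _ = ℤ.≤-refl
  ... | no _  | no _  = 0≤+ 1

  single₃ : ∀ (c : Fin r) {h i j : Fin r} → h ≢ i → h ≢ j → i ≢ j → ⟦ c Fin.≟ h ⟧ + ⟦ c Fin.≟ i ⟧ + ⟦ c Fin.≟ j ⟧ ≤ᶻ 1ℤ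
  single₃ c {h} {i} {j} h≢i h≢j i≢j with c Fin.≟ h | c Fin.≟ i | c Fin.≟ j
  ... | yes p | yes q | _     = ⊥-elim (h≢i (trans (sym p) q))
  ... | yes p | no _  | yes q = ⊥-elim (h≢j (trans (sym p) q))
  ... | no _  | yes p | yes q = ⊥-elim (i≢j (trans (sym p) q))
  ... | yes _ | no _  | no _  = ℤ.≤-refl
  ... | no _  | yes _ | no _  = ℤ.≤-refl
  ... | no _  | no _  | yes _ = ℤ.≤-refl
  ... | no _  | no _  | no _  = 0≤+ 1

  χ≥0 : ∀ j a b → 0ℤ ≤ᶻ χ j a b
  χ≥0 j a b = ⟦⟧-≥0 (C a b Fin.≟ j)

  χ≤1 : ∀ j a b → χ j a b ≤ᶻ 1ℤ
  χ≤1 j a b = ⟦⟧-≤1 (C a b Fin.≟ j)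

  G-≤2 : ∀ j a b p q → G j a b p q ≤ᶻ + 2
  G-≤2 j a b p q = ≤-by (gap (χ≤1 j b p) ⊕ gap (χ≤1 j a q) ⊕ χ≥0 j a p ⊕ χ≥0 j b q) (G-≤2-identity (χ j b p) (χ j a q) (χ j a p) (χ j b q))

  G-≥-2 : ∀ j a b p q → - + 2 ≤ᶻ G j a b p q
  G-≥-2 j a b p q = ≤-by (gap (χ≤1 j a p) ⊕ gap (χ≤1 j b q) ⊕ χ≥0 j b p ⊕ χ≥0 j a q) (G-≥-2-identity (χ j b p) (χ j a q) (χ j a p) (χ j b q))

  G+G≤2 : i ≢ j → ∀ a b p q → G i a b p q + G j a b p q ≤ᶻ + 2
  G+G≤2 {i} {j} i≢j a b p q = ≤-by
      (gap (single (C b p) i≢j) ⊕ gap (single (C a q) i≢j) ⊕ χ≥0 i a p ⊕ χ≥0 i b q ⊕ χ≥0 j a p ⊕ χ≥0 j b q)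
      (G+G≤2-identity (χ i b p) (χ i a q) (χ i a p) (χ i b q) (χ j b p) (χ j a q) (χ j a p) (χ j b q))

  G+G+G≤2 : i ≢ one → j ≢ one → i ≢ j → ∀ a b p q → G one a b p q + G i a b p q + G j a b p q ≤ᶻ + 2
  G+G+G≤2 {i} {j} i≢ j≢ i≢j a b p q = ≤-by
      (gap (single₃ (C b p) (≢-sym i≢) (≢-sym j≢) i≢j) ⊕ gap (single₃ (C a q) (≢-sym i≢) (≢-sym j≢) i≢j)
       ⊕ χ≥0 one a p ⊕ χ≥0 one b q ⊕ χ≥0 i a p ⊕ χ≥0 i b q ⊕ χ≥0 j a p ⊕ χ≥0 j b q)
      (G+G+G≤2-identity (χ one b p) (χ one a q) (χ one a p) (χ one b q) (χ i b p) (χ i a q) (χ i a p) (χ i b q) (χ j b p) (χ j a q) (χ j a p) (χ j b q))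

  ⟦⟧*-mono : {P : Set ℓ} (d : Dec P) {x y : ℤ} → (P → x ≤ᶻ y) → ⟦ d ⟧ * x ≤ᶻ ⟦ d ⟧ * y
  ⟦⟧*-mono (yes p) {x} {y} f = subst₂ _≤ᶻ_ (sym (ℤ.*-identityˡ x)) (sym (ℤ.*-identityˡ y)) (f p)
  ⟦⟧*-mono (no _)  f = ℤ.≤-refl

  -- Each of the two new edges has only one colour, so the gains of colours 1 and j add up to at
  -- most 2; if colour 1 gains at least 1, then j gains no more than colour 1 does.
  γ≥0 : j ≢ one → ∀ a b p q → 1ℤ ≤ᶻ G one a b p q → 0ℤ ≤ᶻ γ j a b p q
  γ≥0 {j} j≢ a b p q 1≤G = subst (0ℤ ≤ᶻ_) (γ≥0-identity (G one a b p q) (G j a b p q))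
      (0≤+ 2 ⊗ gap 1≤G ⊕ gap (G+G≤2 {one} {j} (≢-sym j≢) a b p q))

  σ₁γ≥0 : j ≢ one → ∀ a b p q → 0ℤ ≤ᶻ σ₁ a b p q * γ j a b p q
  σ₁γ≥0 {j} j≢ a b p q = subst (_≤ᶻ σ₁ a b p q * γ j a b p q) (ℤ.*-zeroʳ (σ₁ a b p q))
    (⟦⟧*-mono (1ℤ ℤ.≤? G one a b p q) (γ≥0 j≢ a b p q))

  -- The gains of three distinct colours also add up to at most 2. Hence no exchange that gains
  -- colour 1 is without profit against both i and j, and at most one colour can lag behind on
  -- average.
  σ₁≤ : i ≢ one → j ≢ one → i ≢ j → ∀ a b p q → σ₁ a b p q ≤ᶻ σ₁ a b p q * γ i a b p q + σ₁ a b p q * γ j a b p q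
  σ₁≤ {i} {j} i≢ j≢ i≢j a b p q = subst₂ _≤ᶻ_ (ℤ.*-identityʳ s) (ℤ.*-distribˡ-+ s (γ i a b p q) (γ j a b p q))
    (⟦⟧*-mono (1ℤ ℤ.≤? G one a b p q) (λ 1≤G → ≤-by (0≤+ 3 ⊗ gap 1≤G ⊕ gap (G+G+G≤2 {i} {j} i≢ j≢ i≢j a b p q))
      (σ₁≤-identity (G one a b p q) (G i a b p q) (G j a b p q))))
    where
    s = σ₁ a b p q

  σ₂≤ : ∀ i a b p q → σ₂ i a b p q ≤ᶻ σ₂ i a b p q * γ i a b p q
  σ₂≤ i a b p q = subst (_≤ᶻ σ₂ i a b p q * γ i a b p q) (ℤ.*-identityʳ (σ₂ i a b p q))
    (⟦⟧*-mono ((G one a b p q ℤ.≟ 0ℤ) ×-dec (G i a b p q ℤ.≤? - 1ℤ)) (λ { (eq , le) →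
      ≤-by (gap le) (trans (cong (λ s → s - G i a b p q - 1ℤ) eq) (σ₂≤-identity (G i a b p q))) }))

  -2σ₂≤ : ∀ i j a b p q → - (+ 2 * σ₂ i a b p q) ≤ᶻ σ₂ i a b p q * γ j a b p q
  -2σ₂≤ i j a b p q = subst (_≤ᶻ σ₂ i a b p q * γ j a b p q) (-2σ₂≤-identity₂ (σ₂ i a b p q))
    (⟦⟧*-mono ((G one a b p q ℤ.≟ 0ℤ) ×-dec (G i a b p q ℤ.≤? - 1ℤ)) (λ { (eq , _) →
      ≤-by (gap (G-≤2 j a b p q)) (trans (cong (λ s → s - G j a b p q - - + 2) eq) (-2σ₂≤-identity (G j a b p q))) }))

  -- Interchanging a and b negates `G one`, so a nonzero change is a gain in one of the two orders.
  unbalanced-one≤ : ∀ a b p q → unbalanced (χ one) a b p q ≤ᶻ σ₁ a b p q + σ₁ b a p q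
  unbalanced-one≤ a b p q = subst (λ g → unbalanced (χ one) a b p q ≤ᶻ σ₁ a b p q + ⟦ 1ℤ ℤ.≤? g ⟧) (sym (G-swap one a b p q))
    (go (G one a b p q) refl)
    where
    go : ∀ g → G one a b p q ≡ g → unbalanced (χ one) a b p q ≤ᶻ ⟦ 1ℤ ℤ.≤? g ⟧ + ⟦ 1ℤ ℤ.≤? - g ⟧
    go (+ 0) eq = ≡⇒≤ (⟦⟧-no (¬? (χ one b p + χ one a q ℤ.≟ χ one a p + χ one b q)) (λ ¬eq → ¬eq
      (ℤ.i-j≡0⇒i≡j _ _ (trans (unbalanced-one≤-identity (χ one b p) (χ one a q) (χ one a p) (χ one b q)) eq))))
    go (+ suc g) eq = ⟦⟧-≤1 (¬? (χ one b p + χ one a q ℤ.≟ χ one a p + χ one b q))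
    go -[1+ g ]  eq = ⟦⟧-≤1 (¬? (χ one b p + χ one a q ℤ.≟ χ one a p + χ one b q))

  gain₊ : Fin r → Fin n → Fin n → Fin n → Fin n → ℤ
  gain₊ i a b p q = σ₁ a b p q * γ i a b p q + σ₂ i a b p q

  gain₊≥0 : i ≢ one → ∀ a b p q → 0ℤ ≤ᶻ gain₊ i a b p q
  gain₊≥0 {i} i≢ a b p q = σ₁γ≥0 i≢ a b p q ⊕ ⟦⟧-≥0 ((G one a b p q ℤ.≟ 0ℤ) ×-dec (G i a b p q ℤ.≤? - 1ℤ))

  gain₊≥1 : i ≢ one → ∀ a b p q → 0ℤ ≤ᶻ G one a b p q → G one a b p q ≢ G i a b p q →
            (G one a b p q ≡ 0ℤ → G i a b p q ≤ᶻ 0ℤ) → 1ℤ ≤ᶻ gain₊ i a b p q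
  gain₊≥1 {i} i≢ a b p q 0≤g g≢h zero-case with 1ℤ ℤ.≤? G one a b p q
  ... | yes 1≤g = ≤-by (gap (ℤ.i<j⇒suc[i]≤j {0ℤ} (ℤ.≤∧≢⇒< (γ≥0 i≢ a b p q 1≤g) (λ eq → g≢h (ℤ.i-j≡0⇒i≡j _ _ (sym eq)))))
                        ⊕ ⟦⟧-≥0 ((G one a b p q ℤ.≟ 0ℤ) ×-dec (G i a b p q ℤ.≤? - 1ℤ)))
                     (gain₊≥1-identity (γ i a b p q) (σ₂ i a b p q))
  ... | no ¬1≤g = ≡⇒≤ (sym (trans (ℤ.+-identityˡ (σ₂ i a b p q)) (⟦⟧-yes ((G one a b p q ℤ.≟ 0ℤ) ×-dec (G i a b p q ℤ.≤? - 1ℤ)) (g≡0 ,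
        ℤ.i<j⇒i≤pred[j] (ℤ.≤∧≢⇒< (zero-case g≡0) (λ eq → g≢h (trans g≡0 (sym eq))))))))
    where
    g≡0 : G one a b p q ≡ 0ℤ
    g≡0 = ℤ.≤-antisym (ℤ.i<j⇒i≤pred[j] (ℤ.≰⇒> ¬1≤g)) 0≤g

  module _ {i : Fin r} (i≢ : i ≢ one) where

    private
      balanced : ∀ a b p q → G one a b p q ≡ G i a b p q → w one i b p + w one i a q ≡ w one i a p + w one i b q
      balanced a b p q eq = ℤ.i-j≡0⇒i≡j _ _ (trans
        (balanced-identity (χ one b p) (χ one a q) (χ one a p) (χ one b q) (χ i b p) (χ i a q) (χ i a p) (χ i b q)) (ℤ.i≡j⇒i-j≡0 eq))

    -- Unbalanced means that the gains of colours 1 and i differ. Both change sign with the order of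
    -- a and b, so in one order colour 1 gains, or it is unaffected and colour i loses.
    unbalanced≤ : ∀ a b p q → unbalanced (w one i) a b p q ≤ᶻ gain₊ i a b p q + gain₊ i b a p q
    unbalanced≤ a b p q = ⟦⟧≤ (¬? (w one i b p + w one i a q ℤ.≟ w one i a p + w one i b q)) (gain₊≥0 i≢ a b p q ⊕ gain₊≥0 i≢ b a p q) λ ¬eq →
      go (λ eq → ¬eq (balanced a b p q eq)) (ℤ.≤-total 0ℤ g) (ℤ.≤-total h 0ℤ) (g ℤ.≟ 0ℤ)
      where
      g = G one a b p q
      h = G i a b p q
      g-swap = G-swap one a b p q
      h-swap = G-swap i a b p q
      go : g ≢ h → 0ℤ ≤ᶻ g ⊎ g ≤ᶻ 0ℤ → h ≤ᶻ 0ℤ ⊎ 0ℤ ≤ᶻ h → Dec (g ≡ 0ℤ) → 1ℤ ≤ᶻ gain₊ i a b p q + gain₊ i b a p q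
      go g≢h = λ
        { (inj₁ 0≤g) (inj₁ h≤0) _        → left 0≤g (λ _ → h≤0)
        ; (inj₁ 0≤g) (inj₂ _)   (no ¬0)  → left 0≤g (λ eq → ⊥-elim (¬0 eq))
        ; (inj₁ _)   (inj₂ 0≤h) (yes 0≡) → right (ℤ.≤-reflexive (sym (trans g-swap (cong -_ 0≡)))) (λ _ → neg-h 0≤h)
        ; (inj₂ g≤0) _          (no ¬0)  → right (subst (0ℤ ≤ᶻ_) (sym g-swap) (ℤ.neg-mono-≤ g≤0))
                                             (λ eq → ⊥-elim (¬0 (ℤ.neg-injective (trans (sym g-swap) eq))))
        ; (inj₂ _)   (inj₁ h≤0) (yes 0≡) → left (ℤ.≤-reflexive (sym 0≡)) (λ _ → h≤0)
        ; (inj₂ _)   (inj₂ 0≤h) (yes 0≡) → right (ℤ.≤-reflexive (sym (trans g-swap (cong -_ 0≡)))) (λ _ → neg-h 0≤h) }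
        where
        neg-h : 0ℤ ≤ᶻ h → G i b a p q ≤ᶻ 0ℤ
        neg-h 0≤h = subst (_≤ᶻ 0ℤ) (sym h-swap) (ℤ.neg-mono-≤ 0≤h)
        left : 0ℤ ≤ᶻ g → (g ≡ 0ℤ → h ≤ᶻ 0ℤ) → 1ℤ ≤ᶻ gain₊ i a b p q + gain₊ i b a p q
        left 0≤g z = ℤ.+-mono-≤ (gain₊≥1 i≢ a b p q 0≤g g≢h z) (gain₊≥0 i≢ b a p q)
        right : 0ℤ ≤ᶻ G one b a p q → (G one b a p q ≡ 0ℤ → G i b a p q ≤ᶻ 0ℤ) → 1ℤ ≤ᶻ gain₊ i a b p q + gain₊ i b a p q
        right 0≤g z = ℤ.+-mono-≤ (gain₊≥0 i≢ a b p q)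
          (gain₊≥1 i≢ b a p q 0≤g (λ eq → g≢h (ℤ.neg-injective (trans (sym g-swap) (trans eq h-swap)))) z)

-- Tuples of gadgets and their averages

data Kind : Set where
  leaf path : Kind

arity : Kind → ℕ
arity leaf = 4
arity path = 6

scale≤weight-identity : ∀ R → R * R * 1ℤ - 1ℤ ≡ (R - 1ℤ) * (R + 1ℤ)
scale≤weight-identity = solve-∀

scale-arity-identity : ∀ N → 1ℤ * (N * N * (N * N)) ≡ N * (N * (N * (N * 1ℤ)))
scale-arity-identity = solve-∀

scale-arity-identity₂ : ∀ N → N * N * (N * N * (N * N)) ≡ N * (N * (N * (N * (N * (N * 1ℤ)))))
scale-arity-identity₂ = solve-∀

module Tuples {n r : ℕ} (C : Fin n → Fin n → Fin r) where

  private
    N = + n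
    R = + r

  Quad : Set
  Quad = Fin n → Fin n → Fin n → Fin n → ℤ

  ∑ʷ : (Fin n → Fin n → ℤ) → Quad → ℤ
  ∑ʷ A F = ∑[ a ∈ V n ] ∑[ b ∈ V n ] (A a b * (∑[ p ∈ V n ] ∑[ q ∈ V n ] F a b p q))

  ∑ʷ-+ : ∀ A (F G : Quad) → ∑ʷ A (λ a b p q → F a b p q + G a b p q) ≡ ∑ʷ A F + ∑ʷ A G
  ∑ʷ-+ A F G = trans (∑-cong (V n) (λ a → ∑-cong (V n) (λ b → trans (cong (A a b *_) (∑∑-split (V n) _ _))
    (ℤ.*-distribˡ-+ (A a b) _ _)))) (∑∑-split (V n) _ _)

  -- Exchanging vertices of degree two at a and b leaves the colours of their aligned second edges, to p and
  -- q, in place as a multiset, so that the gain is that of the first edges alone.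
  aligned : Fin n → Fin n → Fin n → Fin n → ℤ
  aligned a b p q = ⟦ C a p Fin.≟ C a q ⟧ * ⟦ C b p Fin.≟ C b q ⟧

  -- Lists of any other length get the value 0, so that the bounds on the statistic hold for all
  -- lists, as `Concentration` requires.
  lift : Kind → Quad → List (Fin n) → ℤ
  lift leaf F (a ∷ b ∷ p ∷ q ∷ [])            = F a b p q
  lift path F (a ∷ b ∷ p ∷ q ∷ p′ ∷ q′ ∷ []) = aligned a b p′ q′ * F a b p q
  lift _    F _                               = 0ℤ

  weight : Kind → Fin n → Fin n → ℤ
  weight leaf a b = 1ℤ
  weight path a b = ∑[ p ∈ V n ] ∑[ q ∈ V n ] aligned a b p q

  -- The number of choices of the coordinates p′ and q′, which is the largest value that `weight`
  -- could take.
  scale : Kind → ℤ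
  scale leaf = 1ℤ
  scale path = N * N

  aligned≥0 : ∀ a b p q → 0ℤ ≤ᶻ aligned a b p q
  aligned≥0 a b p q = ⟦⟧-≥0 (C a p Fin.≟ C a q) ⊗ ⟦⟧-≥0 (C b p Fin.≟ C b q)

  weight≥0 : ∀ d a b → 0ℤ ≤ᶻ weight d a b
  weight≥0 leaf a b = 0≤+ 1
  weight≥0 path a b = ∑-≥0 (V n) (λ p → ∑-≥0 (V n) (aligned≥0 a b p))

  weight-sym : ∀ d a b → weight d a b ≡ weight d b a
  weight-sym leaf a b = refl
  weight-sym path a b = ∑-cong (V n) (λ p → ∑-cong (V n) (λ q → ℤ.*-comm ⟦ C a p Fin.≟ C a q ⟧ ⟦ C b p Fin.≟ C b q ⟧))

  scale≥0 : ∀ d → 0ℤ ≤ᶻ scale d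
  scale≥0 leaf = 0≤+ 1
  scale≥0 path = 0≤+ n ⊗ 0≤+ n

  -- The pair of colours of the edges from p to a and to b takes at most r² values, so by
  -- Cauchy-Schwarz a share 1/r² of all pairs p, q is aligned. The factor `R * R` in `c` originates
  -- here.
  scale≤weight : 1 ≤ r → ∀ d a b → scale d ≤ᶻ R * R * weight d a b
  scale≤weight 1≤r leaf a b = ≤-by (gap (+≤+ 1≤r) ⊗ (0≤+ r ⊕ 0≤+ 1)) (scale≤weight-identity R)
  scale≤weight 1≤r path a b = ℤ.≤-trans (square-root-count (λ p → combine (C a p) (C b p)))
    (≡⇒≤ (cong₂ _*_ (ℤ.pos-* r r) (∑-cong (V n) (λ p → ∑-cong (V n) (λ q → trans
      (⟦⟧-cong (combine (C a p) (C b p) Fin.≟ combine (C a q) (C b q)) ((C a p Fin.≟ C a q) ×-dec (C b p Fin.≟ C b q))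
        (Fin.combine-injective (C a p) (C b p) (C a q) (C b q)) (uncurry (cong₂ combine)))
      (⟦⟧-× (C a p Fin.≟ C a q) (C b p Fin.≟ C b q)))))))

  weight≤scale : ∀ d a b → weight d a b ≤ᶻ scale d
  weight≤scale leaf a b = ℤ.≤-refl
  weight≤scale path a b = ℤ.≤-trans
    (∑∑-mono (V n) {G = λ _ _ → 1ℤ} (λ p q → *-mono {⟦ C a p Fin.≟ C a q ⟧} {1ℤ} {⟦ C b p Fin.≟ C b q ⟧} {1ℤ}
      (⟦⟧-≥0 (C a p Fin.≟ C a q)) (0≤+ 1) (⟦⟧-≤1 (C a p Fin.≟ C a q)) (⟦⟧-≤1 (C b p Fin.≟ C b q))))
    (≡⇒≤ (trans (∑-cong (V n) (λ _ → ∑-V-const n 1ℤ)) (trans (∑-V-const n _) (cong (N *_) (ℤ.*-identityʳ N)))))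

  scale-arity : ∀ d → scale d * (N * N * (N * N)) ≡ n ↑ arity d
  scale-arity leaf = scale-arity-identity N
  scale-arity path = scale-arity-identity₂ N

  lift-bounded : ∀ d (F : Quad) {b} → 0ℤ ≤ᶻ b → (∀ x y p q → Bounded (F x y p q) b) → ∀ v → Bounded (lift d F v) b
  lift-bounded leaf F 0≤b h []                          = bounded-0 _ 0≤b
  lift-bounded leaf F 0≤b h (_ ∷ [])                    = bounded-0 _ 0≤b
  lift-bounded leaf F 0≤b h (_ ∷ _ ∷ [])                = bounded-0 _ 0≤b
  lift-bounded leaf F 0≤b h (_ ∷ _ ∷ _ ∷ [])            = bounded-0 _ 0≤b
  lift-bounded leaf F 0≤b h (x ∷ y ∷ p ∷ q ∷ [])        = h x y p q
  lift-bounded leaf F 0≤b h (_ ∷ _ ∷ _ ∷ _ ∷ _ ∷ _)     = bounded-0 _ 0≤b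
  lift-bounded path F 0≤b h []                          = bounded-0 _ 0≤b
  lift-bounded path F 0≤b h (_ ∷ [])                    = bounded-0 _ 0≤b
  lift-bounded path F 0≤b h (_ ∷ _ ∷ [])                = bounded-0 _ 0≤b
  lift-bounded path F 0≤b h (_ ∷ _ ∷ _ ∷ [])            = bounded-0 _ 0≤b
  lift-bounded path F 0≤b h (_ ∷ _ ∷ _ ∷ _ ∷ [])        = bounded-0 _ 0≤b
  lift-bounded path F 0≤b h (_ ∷ _ ∷ _ ∷ _ ∷ _ ∷ [])    = bounded-0 _ 0≤b
  lift-bounded path F {bd} 0≤b h (a ∷ b ∷ p ∷ q ∷ p′ ∷ q′ ∷ []) with C a p′ Fin.≟ C a q′ | C b p′ Fin.≟ C b q′
  ... | yes _ | yes _ = subst (λ s → Bounded s bd) (sym (ℤ.*-identityˡ (F a b p q))) (h a b p q)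
  ... | yes _ | no _  = bounded-0 _ 0≤b
  ... | no _  | yes _ = bounded-0 _ 0≤b
  ... | no _  | no _  = bounded-0 _ 0≤b
  lift-bounded path F 0≤b h (_ ∷ _ ∷ _ ∷ _ ∷ _ ∷ _ ∷ _ ∷ _) = bounded-0 _ 0≤b

  ∑-tuples₂ : ∀ k (F : List (Fin n) → ℤ) → ∑ (tuples n (suc (suc k))) F ≡ ∑[ a ∈ V n ] ∑[ b ∈ V n ] ∑[ v ∈ tuples n k ] F (a ∷ b ∷ v)
  ∑-tuples₂ k F = trans (∑-tuples-suc n (suc k) F) (∑-cong (V n) (λ a → ∑-tuples-suc n k (λ v → F (a ∷ v))))

  ∑-lift : ∀ d (F : Quad) → ∑ (tuples n (arity d)) (lift d F) ≡
           ∑ʷ (weight d) F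
  ∑-lift leaf F = trans (∑-tuples₂ 2 (lift leaf F)) (∑-cong (V n) (λ a → ∑-cong (V n) (λ b →
    trans (∑-tuples₂ 0 (λ v → lift leaf F (a ∷ b ∷ v))) (trans (∑-cong (V n) (λ p → ∑-cong (V n) (λ q → ℤ.+-identityʳ (F a b p q))))
      (sym (ℤ.*-identityˡ _))))))
  ∑-lift path F = trans (∑-tuples₂ 4 (lift path F)) (∑-cong (V n) (λ a → ∑-cong (V n) (λ b →
    trans (∑-tuples₂ 2 (λ v → lift path F (a ∷ b ∷ v))) (trans (∑-cong (V n) (λ p → trans (∑-cong (V n) (λ q →
      trans (∑-tuples₂ 0 (λ v → lift path F (a ∷ b ∷ p ∷ q ∷ v))) (trans (∑-cong (V n) (λ p′ → trans (∑-cong (V n) (λ q′ →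
        ℤ.+-identityʳ (aligned a b p′ q′ * F a b p q))) (∑-*ʳ (V n) (F a b p q) _))) (∑-*ʳ (V n) (F a b p q) _))))
      (∑-*ˡ (V n) (weight path a b) (F a b p)))) (∑-*ˡ (V n) (weight path a b) _)))))

-- Average gains and the choice of a policy

S-*-identity : ∀ a c x → a * (c * x) ≡ c * (a * x)
S-*-identity = solve-∀

S≥-identity : ∀ x z q → x * q - z * q ≡ (x - z) * q
S≥-identity = solve-∀

S≤-identity : ∀ a z N → z * (N * N) - a * (N * N) ≡ (z - a) * (N * N)
S≤-identity = solve-∀

S≤-identity₂ : ∀ z N → N * (N * (z * (N * N))) ≡ z * (N * N * (N * N))
S≤-identity₂ = solve-∀

S-unb-one≤-identity : ∀ x → x + x ≡ + 2 * x
S-unb-one≤-identity = solve-∀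

M-large-identity : ∀ u R L z n4 M S U → R * R * (+ 8 * (u * u) * (R * R) * (L * L) * M) - + 2 * (L * L) * (z * n4) ≡
    + 4 * (u * u) * (R * R * (R * R)) * (L * L) * (+ 2 * M - S) + + 4 * (u * u) * (R * R) * (L * L) * (R * R * S - z * U)
    + + 2 * (L * L) * z * (+ 2 * ((u * R) * (u * R)) * U - n4)
M-large-identity = solve-∀

α+α-identity : ∀ c a b M → c * a + c * b - c * M ≡ c * (a + b - M)
α+α-identity = solve-∀

neg-identity : ∀ s → - (+ 2 * s) ≡ - + 2 * s
neg-identity = solve-∀

δ-other-identity : ∀ c d v → c * d - - (+ 2 * (v * c)) ≡ c * (d - - + 2 * v)
δ-other-identity = solve-∀

upper-identity : ∀ x → x + x ≡ + 2 * x
upper-identity = solve-∀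

α+ν-identity : ∀ u R L z n4 a v S U → + 8 * (u * u) * (R * R) * (L * L) * a + + 8 * (u * u) * (R * R) * (L * L) * v - + 2 * (z * n4) ≡
    + 4 * (u * u) * (R * R) * (L * L) * (+ 2 * (a + v) - S) + + 4 * (u * u) * (L * L) * (R * R * S - z * U)
    + + 2 * z * (+ 2 * ((u * L) * (u * L)) * U - n4)
α+ν-identity = solve-∀

big-identity : ∀ R L t κ M → R * M - R * (+ 4 * t * κ + + 2 * κ) ≡ (R * M - + 2 * L * κ) + + 2 * κ * (L - (+ 2 * t * R + R))
big-identity = solve-∀

bound-identity : ∀ R c κ x → R * x - R * (+ 2 * (c * κ)) ≡ R * x - + 2 * (R * c) * κ
bound-identity = solve-∀

bound-identity₂ : ∀ u R L → + 2 * (R * R * (+ 8 * (u * u) * (R * R) * (L * L))) ≡ + 16 * (u * u) * (R * R * (R * R)) * (L * L)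
bound-identity₂ = solve-∀

bound-identity₃ : ∀ R L t κ M → R * (t * (M - + 2 * κ)) - t * L * κ ≡
    t * (R * M - + 2 * L * κ) + κ * t * ((L - (+ 2 * t * R + R)) + R * (+ 2 * (t - 1ℤ) + 1ℤ))
bound-identity₃ = solve-∀

selection-identity : ∀ c m m₂ a d → m * (c * a) + m₂ * (c * d) ≡ c * (m * a + m₂ * d)
selection-identity = solve-∀

module Policy {n r : ℕ} (C : Fin n → Fin n → Fin r) (C-sym : ∀ a b → C a b ≡ C b a) (one : Fin r) where

  open Colours C C-sym
  open Gains C C-sym one
  open Tuples C using (Quad; ∑ʷ; ∑ʷ-+)

  private
    N = + n
    R = + r

  ∑⁴ : Quad → ℤ
  ∑⁴ F = ∑[ a ∈ V n ] ∑[ b ∈ V n ] ∑[ p ∈ V n ] ∑[ q ∈ V n ] F a b p q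

  module Weighted (A : Fin n → Fin n → ℤ) (z : ℤ) (A≥0 : ∀ a b → 0ℤ ≤ᶻ A a b) (A-sym : ∀ a b → A a b ≡ A b a)
    (z≤A : ∀ a b → z ≤ᶻ R * R * A a b) (A≤z : ∀ a b → A a b ≤ᶻ z) (0≤z : 0ℤ ≤ᶻ z) where

    S : Quad → ℤ
    S = ∑ʷ A

    S-mono : ∀ {F G : Quad} → (∀ a b p q → F a b p q ≤ᶻ G a b p q) → S F ≤ᶻ S G
    S-mono le = ∑∑-mono (V n) (λ a b → *-monoˡ (A a b) (A≥0 a b) (∑∑-mono (V n) (le a b)))

    S-* : ∀ c (F : Quad) → S (λ a b p q → c * F a b p q) ≡ c * S F
    S-* c F = trans (∑-cong (V n) (λ a → trans (∑-cong (V n) (λ b →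
        trans (cong (A a b *_) (trans (∑-cong (V n) (λ p → ∑-*ˡ (V n) c (F a b p))) (∑-*ˡ (V n) c _)))
              (S-*-identity (A a b) c _))) (∑-*ˡ (V n) c _))) (∑-*ˡ (V n) c _)

    S-swap : ∀ (F : Quad) → S (λ a b p q → F b a p q) ≡ S F
    S-swap F = trans (∑-comm (V n) (V n) _) (∑-cong (V n) (λ b → ∑-cong (V n) (λ a → cong (_* (∑[ p ∈ V n ] ∑[ q ∈ V n ] F b a p q)) (A-sym a b))))

    S-≥0 : ∀ {F : Quad} → (∀ a b p q → 0ℤ ≤ᶻ F a b p q) → 0ℤ ≤ᶻ S F
    S-≥0 p = ∑-≥0 (V n) (λ a → ∑-≥0 (V n) (λ b → A≥0 a b ⊗ ∑-≥0 (V n) (λ c → ∑-≥0 (V n) (p a b c))))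

    S≥ : ∀ (F : Quad) → (∀ a b p q → 0ℤ ≤ᶻ F a b p q) → z * ∑⁴ F ≤ᶻ R * R * S F
    S≥ F F≥0 = subst₂ _≤ᶻ_
      (trans (∑-cong (V n) (λ a → ∑-*ˡ (V n) z _)) (∑-*ˡ (V n) z _))
      (trans (∑-cong (V n) (λ a → trans (∑-cong (V n) (λ b → ℤ.*-assoc (R * R) (A a b) (Q a b))) (∑-*ˡ (V n) (R * R) _))) (∑-*ˡ (V n) (R * R) _))
      (∑∑-mono (V n) (λ a b → ≤-by (gap (z≤A a b) ⊗ ∑-≥0 (V n) (λ p → ∑-≥0 (V n) (F≥0 a b p))) (S≥-identity (R * R * A a b) z (Q a b))))
      where
      Q = λ a b → ∑[ p ∈ V n ] ∑[ q ∈ V n ] F a b p q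

    S≤ : ∀ (F : Quad) → (∀ a b p q → F a b p q ≤ᶻ 1ℤ) → S F ≤ᶻ z * (N * N * (N * N))
    S≤ F F≤1 = ℤ.≤-trans
      (∑∑-mono (V n) {G = λ _ _ → z * (N * N)} (λ a b → ℤ.≤-trans (*-monoˡ (A a b) (A≥0 a b)
        (ℤ.≤-trans (∑∑-mono (V n) (F≤1 a b)) (≡⇒≤ all)))
        (≤-by (gap (A≤z a b) ⊗ (0≤+ n ⊗ 0≤+ n)) (S≤-identity (A a b) z N))))
      (≡⇒≤ (trans (∑-cong (V n) (λ _ → ∑-V-const n _)) (trans (∑-V-const n _) (S≤-identity₂ z N))))
      where
      all : (∑[ p ∈ V n ] ∑[ q ∈ V n ] 1ℤ) ≡ N * N
      all = trans (∑-cong (V n) (λ _ → ∑-V-const n 1ℤ)) (trans (∑-V-const n _) (cong (N *_) (ℤ.*-identityʳ N)))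

    α ν : Fin r → ℤ
    α j = S (λ a b p q → σ₁ a b p q * γ j a b p q)
    ν i = S (σ₂ i)

    δ : Fin r → Fin r → ℤ
    δ i j = S (λ a b p q → σ₂ i a b p q * γ j a b p q)

    M : ℤ
    M = S σ₁

    module Select (u L m t : ℕ) (1≤r : 1 ≤ r) (1≤t : 1 ≤ t) (t≤m : t ≤ m) (t≡ : + t ≡ + 16 * (+ u * + u) * (R * R * (R * R)))
      (L-large : + 2 * + t * (R * R) + R * R ≤ᶻ + L * + L)
      (U₁ : N * N * (N * N) ≤ᶻ + 2 * ((+ u * R) * (+ u * R)) * unbalancedCount (χ one))
      (Uᵢ : ∀ i (i≢ : i ≢ one) → N * N * (N * N) ≤ᶻ + 2 * ((+ u * + L) * (+ u * + L)) * unbalancedCount (w one i))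
      where

      c κ : ℤ
      c = + 8 * (+ u * + u) * (R * R) * (+ L * + L)
      κ = z * (N * N * (N * N))

      private
        RR = R * R
        LL = + L * + L
        RR≥0 = 0≤+ r ⊗ 0≤+ r
        LL≥0 = 0≤+ L ⊗ 0≤+ L
        uu≥0 = 0≤+ u ⊗ 0≤+ u

        0<RR : 0ℤ <ᶻ RR
        0<RR = 0<* {R} {R} (+<+ 1≤r) (+<+ 1≤r)

        0≤c : 0ℤ ≤ᶻ c
        0≤c = 0≤+ 8 ⊗ uu≥0 ⊗ RR≥0 ⊗ LL≥0

        0≤κ : 0ℤ ≤ᶻ κ
        0≤κ = 0≤z ⊗ (0≤+ n ⊗ 0≤+ n ⊗ (0≤+ n ⊗ 0≤+ n))

        S-unb-one : z * unbalancedCount (χ one) ≤ᶻ RR * S (unbalanced (χ one))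
        S-unb-one = S≥ (unbalanced (χ one)) (λ a b p q → ⟦⟧-≥0 (¬? (χ one b p + χ one a q ℤ.≟ χ one a p + χ one b q)))

        S-unb-one≤ : S (unbalanced (χ one)) ≤ᶻ + 2 * M
        S-unb-one≤ = ℤ.≤-trans (S-mono unbalanced-one≤) (≡⇒≤ (trans (∑ʷ-+ A _ _) (trans (cong (λ s → M + s) (S-swap σ₁)) (S-unb-one≤-identity M))))

        -- Half of the unbalanced cycles for colour 1 enter `M`, at a loss of `RR`, and by `U₁`
        -- their density does not involve `L`. Thus `c * M` exceeds `κ` by a factor of order L²/r²,
        -- the reserve that pays for exchanges made against colour i.
        M-large : + 2 * LL * κ ≤ᶻ RR * (c * M)
        M-large = ≤-by (0≤+ 4 ⊗ uu≥0 ⊗ (RR≥0 ⊗ RR≥0) ⊗ LL≥0 ⊗ gap S-unb-one≤ ⊕ 0≤+ 4 ⊗ uu≥0 ⊗ RR≥0 ⊗ LL≥0 ⊗ gap S-unb-one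
                        ⊕ 0≤+ 2 ⊗ LL≥0 ⊗ 0≤z ⊗ gap U₁) (M-large-identity (+ u) R (+ L) z (N * N * (N * N)) M (S (unbalanced (χ one))) (unbalancedCount (χ one)))

        α+α : ∀ i j → i ≢ one → j ≢ one → i ≢ j → c * M ≤ᶻ c * α i + c * α j
        α+α i j i≢ j≢ i≢j = ≤-by (0≤c ⊗ gap (ℤ.≤-trans (S-mono (σ₁≤ {i} {j} i≢ j≢ i≢j)) (≡⇒≤ (∑ʷ-+ A _ _)))) (α+α-identity c (α i) (α j) M)

        δ-other : ∀ i j → - (+ 2 * (c * ν i)) ≤ᶻ c * δ i j
        δ-other i j = ≤-by (0≤c ⊗ gap (S-mono (-2σ₂≤ i j)))
          (trans (cong (λ s → c * δ i j - - (+ 2 * s)) (ℤ.*-comm c (ν i))) (trans (δ-other-identity c (δ i j) (ν i)) (cong (λ s → c * (δ i j - s)) (sym neg))))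
          where
          neg : S (λ a b p q → - (+ 2 * σ₂ i a b p q)) ≡ - + 2 * ν i
          neg = trans (∑-cong (V n) (λ a → ∑-cong (V n) (λ b → cong (A a b *_) (∑-cong (V n) (λ p → ∑-cong (V n) (λ q → neg-identity (σ₂ i a b p q)))))))
                      (S-* (- + 2) (σ₂ i))

        α+ν : ∀ i → i ≢ one → + 2 * κ ≤ᶻ c * α i + c * ν i
        α+ν i i≢ = ≤-by (0≤+ 4 ⊗ uu≥0 ⊗ RR≥0 ⊗ LL≥0 ⊗ gap upper ⊕ 0≤+ 4 ⊗ uu≥0 ⊗ LL≥0 ⊗ gap lower ⊕ 0≤+ 2 ⊗ 0≤z ⊗ gap (Uᵢ i i≢))
            (α+ν-identity (+ u) R (+ L) z (N * N * (N * N)) (α i) (ν i) (S unb) U)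
          where
          U = unbalancedCount (w one i)
          unb = unbalanced (w one i)
          lower : z * U ≤ᶻ RR * S unb
          lower = S≥ unb (λ a b p q → ⟦⟧-≥0 (¬? (w one i b p + w one i a q ℤ.≟ w one i a p + w one i b q)))
          upper : S unb ≤ᶻ + 2 * (α i + ν i)
          upper = ℤ.≤-trans (S-mono (unbalanced≤ {i} i≢)) (≡⇒≤ (trans (∑ʷ-+ A (gain₊ i) _)
            (trans (cong₂ _+_ (∑ʷ-+ A _ (σ₂ i)) (trans (S-swap (gain₊ i)) (∑ʷ-+ A _ (σ₂ i)))) (upper-identity (α i + ν i)))))

        big : + 4 * + t * κ + + 2 * κ ≤ᶻ c * M
        big = *-cancel RR 0<RR (≤-by (gap M-large ⊕ 0≤+ 2 ⊗ 0≤κ ⊗ gap L-large) (big-identity RR LL (+ t) κ (c * M)))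

        -- The harm is at most 2 c κ, and by `M-large` the reserve `c * M - + 2 * κ` is at least LL
        -- κ / RR. Their ratio 2 RR c / LL is exactly `t`; `L` cancels, so `t` depends on r only and
        -- `L` can be taken large after it.
        bound : + 2 * (c * κ) ≤ᶻ + t * (c * M - + 2 * κ)
        bound = *-cancel RR 0<RR (≤-by
          (0≤+ t ⊗ gap M-large ⊕ 0≤κ ⊗ 0≤+ t ⊗ (gap L-large ⊕ RR≥0 ⊗ (0≤+ 2 ⊗ gap (+≤+ 1≤t) ⊕ 0≤+ 1)))
          (trans (bound-identity RR c κ (+ t * (c * M - + 2 * κ))) (trans (cong (λ s → RR * (+ t * (c * M - + 2 * κ)) - s * κ) tLL)
                 (bound-identity₃ RR LL (+ t) κ (c * M)))))
          where
          tLL : + 2 * (RR * c) ≡ + t * LL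
          tLL = trans (bound-identity₂ (+ u) R (+ L)) (cong (_* LL) (sym t≡))

      selection : ∃[ i ] ∃[ m₂ ] (m₂ ≤ m × (∀ j → j ≢ one → κ * + m ≤ᶻ c * (+ m * α j + + m₂ * δ i j)))
      selection =
        let (i , m₂ , m₂≤m , h) = Choice.choice one one (λ j → c * α j) (λ i → c * ν i) (λ i j → c * δ i j) (c * M) (c * κ) κ m t
              1≤t t≤m 0≤κ
              (λ j j≢ → 0≤c ⊗ S-≥0 (σ₁γ≥0 {j} j≢)) α+α
              (λ i i≢ → *-monoˡ c 0≤c (S-mono (σ₂≤ i)))
              δ-other
              (λ i → *-monoˡ c 0≤c (S≤ (σ₂ i) (λ a b p q → ⟦⟧-≤1 ((G one a b p q ℤ.≟ 0ℤ) ×-dec (G i a b p q ℤ.≤? - 1ℤ)))))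
              α+ν big bound
        in i , m₂ , m₂≤m , λ j j≢ → ℤ.≤-trans (h j j≢) (≡⇒≤ (selection-identity c (+ m) (+ m₂) (α j) (δ i j)))

-- Lists of distinct vertices

data Distinct {X : Set} : List X → Set where
  []  : Distinct []
  _∷_ : ∀ {x xs} → x ∉ xs → Distinct xs → Distinct (x ∷ xs)

distinct⇒fresh : ∀ {u v : List (Fin n)} → Distinct v → (∀ {x} → x ∈ v → x ∉ u) → Fresh u v
distinct⇒fresh []      dis = []
distinct⇒fresh (p ∷ d) dis = dis (here refl) ∷ distinct⇒fresh d λ
  { y∈ (here refl) → p y∈ ; y∈ (there y∈u) → dis (there y∈) y∈u }

occurrences : Fin n → List (Fin n) → ℤ
occurrences x v = ∑[ y ∈ v ] ⟦ x Fin.≟ y ⟧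

occurrences≥0 : ∀ (x : Fin n) v → 0ℤ ≤ᶻ occurrences x v
occurrences≥0 x v = ∑-≥0 v (λ y → ⟦⟧-≥0 (x Fin.≟ y))

∉⇒occurrences≡0 : ∀ {x : Fin n} {v} → x ∉ v → occurrences x v ≡ 0ℤ
∉⇒occurrences≡0 {x = x} {v} x∉ = trans (∑-cong-∈ v (λ y y∈ → ⟦⟧-no (x Fin.≟ y) (λ { refl → x∉ y∈ }))) (∑-0 v)

occurrences≤1 : ∀ (x : Fin n) {v} → Distinct v → occurrences x v ≤ᶻ 1ℤ
occurrences≤1 x []              = 0≤+ 1
occurrences≤1 x (_∷_ {y} {v} p d) with x Fin.≟ y
... | yes refl = ≡⇒≤ (cong (λ s → 1ℤ + s) (∉⇒occurrences≡0 p))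
... | no _     = ℤ.≤-trans (≡⇒≤ (ℤ.+-identityˡ _)) (occurrences≤1 x d)

∑-distinct≤ : ∀ {v : List (Fin n)} → Distinct v → (F : Fin n → ℤ) → (∀ x → 0ℤ ≤ᶻ F x) → ∑ v F ≤ᶻ ∑ (V n) F
∑-distinct≤ {n} {v} d F F≥0 = begin
  ∑ v F                                                ≡⟨ ∑-cong v (λ z → sym (∑-V-single z F)) ⟩
  (∑[ z ∈ v ] ∑[ y ∈ V n ] (⟦ y Fin.≟ z ⟧ * F y))      ≡⟨ ∑-comm v (V n) _ ⟩
  (∑[ y ∈ V n ] ∑[ z ∈ v ] (⟦ y Fin.≟ z ⟧ * F y))      ≡⟨ ∑-cong (V n) (λ y → ∑-*ʳ v (F y) _) ⟩
  (∑[ y ∈ V n ] (occurrences y v * F y))               ≤⟨ ∑-mono (V n) (λ y → ≤-by (gap (occurrences≤1 y d) ⊗ F≥0 y) (e (occurrences y v) (F y))) ⟩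
  ∑ (V n) F                                            ∎
  where
  open ℤ.≤-Reasoning
  e : ∀ o f → f - o * f ≡ (1ℤ - o) * f
  e = solve-∀

distinct-length : ∀ {v : List (Fin n)} → Distinct v → length v ≤ n
distinct-length {n} {v} d = ℤ.drop‿+≤+ (subst₂ _≤ᶻ_ (trans (∑-const v 1ℤ) (ℤ.*-identityʳ _)) (trans (∑-V-const n 1ℤ) (ℤ.*-identityʳ _))
  (∑-distinct≤ d (λ _ → 1ℤ) (λ _ → 0≤+ 1)))

∈⇒occurrences≥1 : ∀ {x : Fin n} {v} → x ∈ v → 1ℤ ≤ᶻ occurrences x v
∈⇒occurrences≥1 {x = x} {v} x∈ = ℤ.≤-trans (1≤⟦⟧ (x Fin.≟ x) refl) (∑-single≤ v (λ y → ⟦⟧-≥0 (x Fin.≟ y)) x∈)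

-- This converts overlaps of tuples into multiplicities of vertices, which the degrees control.
stale≤common : ∀ (u v : List (Fin n)) → Distinct v → 1ℤ - ⟦ fresh? u v ⟧ ≤ᶻ ∑[ x ∈ u ] occurrences x v
stale≤common u v d with fresh? u v
... | yes _ = ∑-≥0 u (λ x → occurrences≥0 x v)
... | no ¬f = go u (λ dis → ¬f (distinct⇒fresh d (λ x∈v x∈u → dis x∈u x∈v)))
  where
  go : ∀ u → ¬ (∀ {x} → x ∈ u → x ∉ v) → 1ℤ ≤ᶻ ∑[ x ∈ u ] occurrences x v
  go []      ¬dis = ⊥-elim (¬dis (λ ()))
  go (x ∷ u) ¬dis with x ∈ᶠ? v
  ... | yes x∈ = ℤ.+-mono-≤ (∈⇒occurrences≥1 x∈) (∑-≥0 u (λ y → occurrences≥0 y v))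
  ... | no x∉  = ℤ.+-mono-≤ (occurrences≥0 x v) (go u (λ dis → ¬dis (λ { (here refl) → x∉ ; (there m) → dis m })))

lookup-distinct : ∀ {v : List X} → Distinct v → ∀ i j → lookup v i ≡ lookup v j → i ≡ j
lookup-distinct (p ∷ d) zero    zero    eq = refl
lookup-distinct {v = x ∷ v} (p ∷ d) zero (suc j) eq = ⊥-elim (p (subst (_∈ v) (sym eq) (∈-lookup′ v j)))
  where
  ∈-lookup′ : ∀ (v : List X) j → lookup v j ∈ v
  ∈-lookup′ (x ∷ v) zero    = here refl
  ∈-lookup′ (x ∷ v) (suc j) = there (∈-lookup′ v j)
lookup-distinct {v = x ∷ v} (p ∷ d) (suc i) zero eq = ⊥-elim (p (subst (_∈ v) eq (∈-lookup′ v i)))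
  where
  ∈-lookup′ : ∀ (v : List X) j → lookup v j ∈ v
  ∈-lookup′ (x ∷ v) zero    = here refl
  ∈-lookup′ (x ∷ v) (suc j) = there (∈-lookup′ v j)
lookup-distinct (p ∷ d) (suc i) (suc j) eq = cong suc (lookup-distinct d i j eq)

-- Trees

x∉S-x : ∀ (S : Subset n) x → ¬ (x ∈ˢ S -ˢ x)
x∉S-x (_ Vec.∷ S) (suc x) (Vec.there m) = x∉S-x S x m

module Trees {n : ℕ} (T : Graph n) where

  τ : Fin n → Fin n → ℤ
  τ x y = ⟦ adj? T x y ⟧

  τ≥0 : ∀ x y → 0ℤ ≤ᶻ τ x y
  τ≥0 x y = ⟦⟧-≥0 (adj? T x y)

  τ-sym : ∀ x y → τ x y ≡ τ y x
  τ-sym x y = ⟦⟧-cong (adj? T x y) (adj? T y x) (adj-sym T) (adj-sym T)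

  nbrs : Fin n → List (Fin n)
  nbrs x = filter (adj? T x) (V n)

  deg : Fin n → ℤ
  deg x = ∑ (V n) (τ x)

  length-nbrs : ∀ x → + length (nbrs x) ≡ deg x
  length-nbrs x = length-filter≡∑ (adj? T x) (V n)

  ∑-nbrs : ∀ x (F : Fin n → ℤ) → ∑ (nbrs x) F ≡ ∑[ y ∈ V n ] (τ x y * F y)
  ∑-nbrs x F = ∑-filter (adj? T x) (V n) F

  ∈-nbrs⁺ : ∀ {x y} → Adj T x y → y ∈ nbrs x
  ∈-nbrs⁺ {x} {y} a = ∈-filter⁺ (adj? T x) (∈-allFin y) a

  ∈-nbrs⁻ : ∀ {x y} → y ∈ nbrs x → Adj T x y
  ∈-nbrs⁻ {x} m = proj₂ (∈-filter⁻ (adj? T x) {xs = V n} m)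

  data Path : Fin n → List (Fin n) → Set where
    [_] : ∀ x → Path x []
    _∷_ : ∀ {x y xs} → Adj T x y → Path y xs → Path x (y ∷ xs)

  path-step : ∀ {x xs} → Path x xs → ∀ i j → Fin.toℕ j ≡ suc (Fin.toℕ i) → Adj T (lookup (x ∷ xs) i) (lookup (x ∷ xs) j)
  path-step (a ∷ p) zero    (suc zero)    eq = a
  path-step [ x ]   zero    (suc ())      eq
  path-step [ x ]   (suc ()) _             eq
  path-step (a ∷ p) (suc i) (suc j)       eq = path-step p i j (ℕ.suc-injective eq)

  -- The cycle is the initial segment of the path up to `z`. As `z` comes after `y`, it has at least
  -- three vertices.
  close-cycle : ∀ {x y xs} → Path x (y ∷ xs) → Distinct (x ∷ y ∷ xs) → ∀ {z} → z ∈ xs → Adj T x z → Cycle T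
  close-cycle {x} {y} {xs} p d {z} z∈ a = record
    { k        = Fin.toℕ i
    ; vertex   = vertex
    ; distinct = λ {s} {t} eq → Fin.inject≤-injective k≤ k≤ s t (lookup-distinct d _ _ eq)
    ; step     = λ s → path-step p _ _ (trans (Fin.toℕ-inject≤ (suc s) k≤) (cong suc (sym (trans (Fin.toℕ-inject≤ (Fin.inject₁ s) k≤) (Fin.toℕ-inject₁ s)))))
    ; close    = adj-sym T (subst (Adj T x) (trans (lookup-index z∈) (cong (lookup (x ∷ y ∷ xs)) (sym last))) a)
    }
    where
    i = index z∈
    k≤ : 3 ℕ.+ Fin.toℕ i ≤ length (x ∷ y ∷ xs)
    k≤ = s≤s (s≤s (Fin.toℕ<n i))
    vertex : Fin (3 ℕ.+ Fin.toℕ i) → Fin n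
    vertex s = lookup (x ∷ y ∷ xs) (Fin.inject≤ s k≤)
    last : Fin.inject≤ (Fin.fromℕ (2 ℕ.+ Fin.toℕ i)) k≤ ≡ suc (suc i)
    last = Fin.toℕ-injective (trans (Fin.toℕ-inject≤ (Fin.fromℕ (2 ℕ.+ Fin.toℕ i)) k≤) (Fin.toℕ-fromℕ (2 ℕ.+ Fin.toℕ i)))

  degIn : Subset n → Fin n → ℤ
  degIn S x = ∑[ y ∈ V n ] (⟦ y ∈ˢ? S ⟧ * τ x y)

  edgesIn : Subset n → ℤ
  edgesIn S = ∑[ x ∈ V n ] (⟦ x ∈ˢ? S ⟧ * degIn S x)

  module Acyclic (acyclic : ¬ Cycle T) where

    private
      another : ∀ (S : Subset n) x z → + 2 ≤ᶻ degIn S x → ∃[ y ] (y ∈ˢ S × Adj T x y × y ≢ z)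
      another S x z 2≤ with Fin.any? (λ y → (y ∈ˢ? S) ×-dec (adj? T x y ×-dec ¬? (y Fin.≟ z)))
      ... | yes found = found
      ... | no none = ⊥-elim (ℤ.<⇒≱ {1ℤ} {+ 2} (+<+ (s≤s (s≤s z≤n))) (ℤ.≤-trans 2≤ (ℤ.≤-trans (∑-mono (V n) at) (≡⇒≤ (∑-V-indicator z)))))
        where
        at : ∀ y → ⟦ y ∈ˢ? S ⟧ * τ x y ≤ᶻ ⟦ y Fin.≟ z ⟧
        at y = ⟦⟧*⟦⟧≤ (y ∈ˢ? S) (adj? T x y) (⟦⟧-≥0 (y Fin.≟ z)) (λ y∈ a → go y∈ a (y Fin.≟ z))
          where
          go : y ∈ˢ S → Adj T x y → (d : Dec (y ≡ z)) → 1ℤ ≤ᶻ ⟦ d ⟧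
          go y∈ a (yes _) = ℤ.≤-refl
          go y∈ a (no y≢) = ⊥-elim (none (y , y∈ , a , y≢))

      -- The first vertex of the path has a neighbour in `S` other than its successor. It either
      -- lies on the path and closes a cycle, or prolongs the path; when the fuel is spent, the path
      -- has more than n distinct vertices.
      grow : ∀ (S : Subset n) → (∀ x → x ∈ˢ S → + 2 ≤ᶻ degIn S x) → ∀ fuel x xs → Path x xs → Distinct (x ∷ xs) → x ∈ˢ S →
             suc n ≤ fuel ℕ.+ length (x ∷ xs) → ⊥
      grow S dense zero x xs p d x∈ long = ℕ.<⇒≱ long (distinct-length d)
      grow S dense (suc fuel) x [] p d x∈ long with another S x x (dense x x∈)
      ... | y , y∈ , a , y≢x = grow S dense fuel y (x ∷ []) (adj-sym T a ∷ p) ((λ { (here eq) → y≢x eq }) ∷ d) y∈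
              (ℕ.≤-trans long (ℕ.≤-reflexive (sym (ℕ.+-suc fuel 1))))
      grow S dense (suc fuel) x (z ∷ xs) p d x∈ long with another S x z (dense x x∈)
      ... | y , y∈ , a , y≢z with y ∈ᶠ? (x ∷ z ∷ xs)
      ...   | yes (here refl)         = irrefl T a
      ...   | yes (there (here eq))   = y≢z eq
      ...   | yes (there (there y∈′)) = acyclic (close-cycle p d y∈′ a)
      ...   | no y∉ = grow S dense fuel y (x ∷ z ∷ xs) (adj-sym T a ∷ p) (y∉ ∷ d) y∈
              (ℕ.≤-trans long (ℕ.≤-reflexive (sym (ℕ.+-suc fuel (suc (suc (length xs)))))))

    sparse-vertex : ∀ (S : Subset n) {x} → x ∈ˢ S → ∃[ y ] (y ∈ˢ S × degIn S y ≤ᶻ 1ℤ)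
    sparse-vertex S {x} x∈ with Fin.any? (λ y → (y ∈ˢ? S) ×-dec (degIn S y ℤ.≤? 1ℤ))
    ... | yes found = found
    ... | no none = ⊥-elim (grow S (λ y y∈ → ℤ.i<j⇒suc[i]≤j (ℤ.≰⇒> (λ le → none (y , y∈ , le)))) (suc n) x [] [ x ] ((λ ()) ∷ []) x∈
                      (ℕ.m≤m+n (suc n) 1))

    private
      remove-split : ∀ (S : Subset n) {x} → x ∈ˢ S → ∀ y → ⟦ y ∈ˢ? S ⟧ ≡ ⟦ y ∈ˢ? (S -ˢ x) ⟧ + ⟦ y Fin.≟ x ⟧
      remove-split S {x} x∈ y with y Fin.≟ x
      ... | yes refl = trans (⟦⟧-yes (x ∈ˢ? S) x∈) (cong (_+ 1ℤ) (sym (⟦⟧-no (x ∈ˢ? (S -ˢ x)) (x∉S-x S x))))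
      ... | no y≢x = trans (⟦⟧-cong (y ∈ˢ? S) (y ∈ˢ? (S -ˢ x)) (λ m → Subset.x∈p∧x≢y⇒x∈p-y m y≢x) (Subset.p─q⊆p S _)) (sym (ℤ.+-identityʳ _))

    edgesIn-remove : ∀ (S : Subset n) {x} → x ∈ˢ S → edgesIn S ≡ edgesIn (S -ˢ x) + + 2 * degIn (S -ˢ x) x
    edgesIn-remove S {x} x∈ = begin
      edgesIn S
        ≡⟨ ∑-cong (V n) (λ a → cong₂ _*_ (remove-split S x∈ a) (degIn-remove a)) ⟩
      (∑[ a ∈ V n ] ((ι a + ⟦ a Fin.≟ x ⟧) * (degIn S′ a + τ a x)))
        ≡⟨ ∑-cong (V n) (λ a → e (ι a) ⟦ a Fin.≟ x ⟧ (degIn S′ a) (τ a x)) ⟩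
      (∑[ a ∈ V n ] (ι a * degIn S′ a + ι a * τ a x + ⟦ a Fin.≟ x ⟧ * (degIn S′ a + τ a x)))
        ≡⟨ trans (∑-+ (V n) _ _) (cong₂ _+_ (∑-+ (V n) _ _) (∑-V-single x (λ a → degIn S′ a + τ a x))) ⟩
      edgesIn S′ + (∑[ a ∈ V n ] (ι a * τ a x)) + (degIn S′ x + τ x x)
        ≡⟨ cong₂ (λ s t → edgesIn S′ + s + (degIn S′ x + t)) (∑-cong (V n) (λ a → cong (ι a *_) (τ-sym a x))) (⟦⟧-no (adj? T x x) (irrefl T)) ⟩
      edgesIn S′ + degIn S′ x + (degIn S′ x + 0ℤ)
        ≡⟨ e′ (edgesIn S′) (degIn S′ x) ⟩
      edgesIn S′ + + 2 * degIn S′ x ∎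
      where
      open ≡-Reasoning
      S′ = S -ˢ x
      ι = λ a → ⟦ a ∈ˢ? S′ ⟧
      degIn-remove : ∀ a → degIn S a ≡ degIn S′ a + τ a x
      degIn-remove a = trans (∑-cong (V n) (λ y → trans (cong (_* τ a y) (remove-split S x∈ y)) (ℤ.*-distribʳ-+ (τ a y) (ι y) ⟦ y Fin.≟ x ⟧)))
        (trans (∑-+ (V n) _ _) (cong (λ s → degIn S′ a + s) (∑-V-single x (τ a))))
      e : ∀ i j d t → (i + j) * (d + t) ≡ i * d + i * t + j * (d + t)
      e = solve-∀
      e′ : ∀ a d → a + d + (d + 0ℤ) ≡ a + + 2 * d
      e′ = solve-∀

    degIn-remove≤ : ∀ (S : Subset n) {x} → x ∈ˢ S → degIn (S -ˢ x) x ≤ᶻ degIn S x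
    degIn-remove≤ S {x} x∈ = ∑-mono (V n) (λ y → ≤-by (⟦⟧-≥0 (y Fin.≟ x) ⊗ τ≥0 x y)
      (trans (cong (λ s → s * τ x y - ⟦ y ∈ˢ? (S -ˢ x) ⟧ * τ x y) (remove-split S x∈ y)) (e ⟦ y ∈ˢ? (S -ˢ x) ⟧ ⟦ y Fin.≟ x ⟧ (τ x y))))
      where
      e : ∀ i j t → (i + j) * t - i * t ≡ j * t
      e = solve-∀

    -- Every nonempty set has a vertex of inner degree at most 1. Deleting it removes at most one
    -- edge, which `edgesIn` counts twice.
    edgesIn≤ : ∀ k S → ∣ S ∣ ≤ k → edgesIn S ≤ᶻ + 2 * + k
    edgesIn≤ zero S le = ≡⇒≤ (trans (∑-cong (V n) (λ x → cong (_* degIn S x) (⟦⟧-no (x ∈ˢ? S) (λ x∈ →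
      ℕ.<⇒≱ (Subset.x∈p⇒∣p-x∣<∣p∣ x∈) (ℕ.≤-trans le z≤n))))) (∑-0 (V n)))
    edgesIn≤ (suc k) S le with Fin.any? (λ x → x ∈ˢ? S)
    ... | no none = ℤ.≤-trans (≡⇒≤ (trans (∑-cong (V n) (λ x → cong (_* degIn S x) (⟦⟧-no (x ∈ˢ? S) (λ x∈ → none (x , x∈))))) (∑-0 (V n)))) (0≤+ 2 ⊗ 0≤+ (suc k))
    ... | yes (x , x∈) with sparse-vertex S x∈
    ...   | y , y∈ , d≤1 = ≤-by (gap (edgesIn≤ k (S -ˢ y) (ℕ.s≤s⁻¹ (ℕ.<-≤-trans (Subset.x∈p⇒∣p-x∣<∣p∣ y∈) le)))
                                 ⊕ 0≤+ 2 ⊗ (gap d≤1 ⊕ gap (degIn-remove≤ S y∈)))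
            (trans (cong (λ s → + 2 * + suc k - s) (edgesIn-remove S y∈)) (e (+ k) (edgesIn (S -ˢ y)) (degIn (S -ˢ y) y) (degIn S y)))
      where
      e : ∀ k E d d′ → + 2 * (1ℤ + k) - (E + + 2 * d) ≡ (+ 2 * k - E) + + 2 * ((1ℤ - d′) + (d′ - d))
      e = solve-∀

    ∑-deg≤ : ∑ (V n) deg ≤ᶻ + 2 * + n
    ∑-deg≤ = subst (_≤ᶻ + 2 * + n) (∑-cong (V n) (λ x → trans (⊤-drop x (degIn ⊤ˢ x)) (∑-cong (V n) (λ y → ⊤-drop y (τ x y)))))
        (edgesIn≤ n ⊤ˢ (ℕ.≤-reflexive (Subset.∣⊤∣≡n n)))
      where
      ⊤-drop : ∀ (x : Fin n) z → ⟦ x ∈ˢ? ⊤ˢ ⟧ * z ≡ z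
      ⊤-drop x z = trans (cong (_* z) (⟦⟧-yes (x ∈ˢ? ⊤ˢ) Subset.∈⊤)) (ℤ.*-identityˡ z)

  deg≥1 : Connected T → 2 ≤ n → ∀ x → 1ℤ ≤ᶻ deg x
  deg≥1 conn 2≤n x = let (z , z≢x) = other 2≤n x in go z≢x (conn x z)
    where
    other : ∀ {n} → 2 ≤ n → (x : Fin n) → ∃[ z ] (z ≢ x)
    other (s≤s (s≤s _)) zero    = suc zero , λ ()
    other (s≤s (s≤s _)) (suc x) = zero , λ ()
    go : ∀ {z} → z ≢ x → Star (Adj T) x z → 1ℤ ≤ᶻ deg x
    go z≢x ε       = ⊥-elim (z≢x refl)
    go z≢x (_◅_ {j = y} a _) = ℤ.≤-trans (1≤⟦⟧ (adj? T x y) a) (∑-single≤ (V n) (τ≥0 x) (∈-allFin y))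

  valency : Kind → ℕ
  valency leaf = 1
  valency path = 2

  ofKind : Kind → ℤ
  ofKind d = ∑[ x ∈ V n ] ⟦ length (nbrs x) ℕ.≟ valency d ⟧

  -- A degree d ≥ 1 satisfies d + 2 [d = 1] + [d = 2] ≥ 3. Summing, with total degree at most 2 n,
  -- shows that twice the number of leaves plus the number of vertices of degree 2 is at least n.
  low-degree-vertices : ¬ Cycle T → Connected T → 2 ≤ n → ∃[ d ] (+ n ≤ᶻ + 4 * ofKind d)
  low-degree-vertices acyclic conn 2≤n with + n ℤ.≤? + 4 * ofKind leaf
  ... | yes many = leaf , many
  ... | no few = path , ≤-by (0≤+ 4 ⊗ gap total ⊕ 0≤+ 2 ⊗ gap (ℤ.<⇒≤ (ℤ.≰⇒> few)) ⊕ 0≤+ n) (e (+ n) (ofKind leaf) (ofKind path))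
    where
    e : ∀ n l p → + 4 * p - n ≡ + 4 * (p - (n - + 2 * l)) + + 2 * (n - + 4 * l) + n
    e = solve-∀
    pointwise : ∀ k → 1ℤ ≤ᶻ + k → + 3 ≤ᶻ + k + + 2 * ⟦ k ℕ.≟ 1 ⟧ + ⟦ k ℕ.≟ 2 ⟧
    pointwise zero                (+≤+ ())
    pointwise (suc zero)          _ = ℤ.≤-refl
    pointwise (suc (suc zero))    _ = ℤ.≤-refl
    pointwise (suc (suc (suc k))) _ = +≤+ (s≤s (s≤s (s≤s z≤n)))
    total : + n - + 2 * ofKind leaf ≤ᶻ ofKind path
    total = ≤-by (gap (subst₂ _≤ᶻ_ (∑-V-const n (+ 3)) sum≡ (∑-mono (V n) (λ x →
                     pointwise (length (nbrs x)) (subst (1ℤ ≤ᶻ_) (sym (length-nbrs x)) (deg≥1 conn 2≤n x)))))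
                  ⊕ gap (Acyclic.∑-deg≤ acyclic)) (e′ (+ n) (ofKind leaf) (ofKind path) (∑ (V n) deg))
      where
      sum≡ : (∑[ x ∈ V n ] (+ length (nbrs x) + + 2 * ⟦ length (nbrs x) ℕ.≟ 1 ⟧ + ⟦ length (nbrs x) ℕ.≟ 2 ⟧)) ≡ ∑ (V n) deg + + 2 * ofKind leaf + ofKind path
      sum≡ = trans (∑-+ (V n) _ _) (cong (_+ ofKind path) (trans (∑-+ (V n) _ _) (cong₂ _+_ (∑-cong (V n) length-nbrs) (∑-*ˡ (V n) (+ 2) _))))
      e′ : ∀ n l p D → p - (n - + 2 * l) ≡ (D + + 2 * l + p - n * + 3) + (+ 2 * n - D)
      e′ = solve-∀

∑-concatMap : ∀ (f : X → List Y) xs (F : Y → ℤ) → ∑ (concatMap f xs) F ≡ ∑[ x ∈ xs ] ∑ (f x) F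
∑-concatMap f []       F = refl
∑-concatMap f (x ∷ xs) F = trans (∑-++ (f x) (concatMap f xs) F) (cong (λ s → ∑ (f x) F + s) (∑-concatMap f xs F))

length≡∑ : ∀ (xs : List X) → + length xs ≡ ∑ xs (λ _ → 1ℤ)
length≡∑ xs = sym (trans (∑-const xs 1ℤ) (ℤ.*-identityʳ _))

length-concatMap≤ : ∀ (f : X → List Y) xs b → (∀ x → + length (f x) ≤ᶻ b) → + length (concatMap f xs) ≤ᶻ + length xs * b
length-concatMap≤ f xs b le = subst₂ _≤ᶻ_
  (sym (trans (length≡∑ (concatMap f xs)) (trans (∑-concatMap f xs _) (∑-cong xs (λ x → sym (length≡∑ (f x)))))))
  (∑-const xs b) (∑-mono xs le)

-- Gadgets: pairs of low-degree vertices whose images may be swapped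

module Gadgets {n : ℕ} (T : Graph n) where

  open Trees T

  -- The full lists of neighbours are stored because an exchange alters all edges at u and v, and
  -- because multiplicities in the tuple are computed from them.
  data Gadget : Kind → Set where
    leaves : ∀ u v p q → nbrs u ≡ p ∷ [] → nbrs v ≡ q ∷ [] → u ≢ v → ¬ Adj T u v → p ≢ q → Gadget leaf
    paths  : ∀ u v p q p′ q′ → nbrs u ≡ p ∷ p′ ∷ [] → nbrs v ≡ q ∷ q′ ∷ [] → u ≢ v → ¬ Adj T u v →
             p ≢ p′ → q ≢ q′ → p ≢ q → p ≢ q′ → p′ ≢ q → p′ ≢ q′ → Gadget path

  left right : ∀ {d} → Gadget d → Fin n
  left (leaves u v p q _ _ _ _ _)                = u
  left (paths u v p q p′ q′ _ _ _ _ _ _ _ _ _ _)  = u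
  right (leaves u v p q _ _ _ _ _)               = v
  right (paths u v p q p′ q′ _ _ _ _ _ _ _ _ _ _) = v

  tuple : ∀ {d} → Gadget d → List (Fin n)
  tuple (leaves u v p q _ _ _ _ _)                = u ∷ v ∷ p ∷ q ∷ []
  tuple (paths u v p q p′ q′ _ _ _ _ _ _ _ _ _ _)  = u ∷ v ∷ p ∷ q ∷ p′ ∷ q′ ∷ []

  tuple-length : ∀ {d} (g : Gadget d) → length (tuple g) ≡ arity d
  tuple-length (leaves _ _ _ _ _ _ _ _ _)                = refl
  tuple-length (paths _ _ _ _ _ _ _ _ _ _ _ _ _ _ _ _)    = refl

  left∈ : ∀ {d} (g : Gadget d) → left g ∈ tuple g
  left∈ (leaves _ _ _ _ _ _ _ _ _)                = here refl
  left∈ (paths _ _ _ _ _ _ _ _ _ _ _ _ _ _ _ _)    = here refl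

  right∈ : ∀ {d} (g : Gadget d) → right g ∈ tuple g
  right∈ (leaves _ _ _ _ _ _ _ _ _)                = there (here refl)
  right∈ (paths _ _ _ _ _ _ _ _ _ _ _ _ _ _ _ _)    = there (here refl)

  left≢right : ∀ {d} (g : Gadget d) → left g ≢ right g
  left≢right (leaves _ _ _ _ _ _ p _ _)                = p
  left≢right (paths _ _ _ _ _ _ _ _ p _ _ _ _ _ _ _)    = p

  left≁right : ∀ {d} (g : Gadget d) → ¬ Adj T (left g) (right g)
  left≁right (leaves _ _ _ _ _ _ _ p _)                = p
  left≁right (paths _ _ _ _ _ _ _ _ _ p _ _ _ _ _ _)    = p

  private
    adj-of : ∀ {u y ys} → nbrs u ≡ ys → y ∈ ys → Adj T u y
    adj-of eq m = ∈-nbrs⁻ (subst (_ ∈_) (sym eq) m)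

    adj⇒≢ : ∀ {u y} → Adj T u y → u ≢ y
    adj⇒≢ a refl = irrefl T a

    non-adj⇒≢ : ∀ {u v y} → ¬ Adj T u v → Adj T v y → u ≢ y
    non-adj⇒≢ ¬a a refl = ¬a (adj-sym T a)

  tuple-distinct : ∀ {d} (g : Gadget d) → Distinct (tuple g)
  tuple-distinct (leaves u v p q eu ev u≢v u≁v p≢q) =
      (λ { (here e) → u≢v e ; (there (here e)) → adj⇒≢ up e ; (there (there (here e))) → non-adj⇒≢ u≁v vq e })
    ∷ (λ { (here e) → non-adj⇒≢ (u≁v ∘ adj-sym T) up e ; (there (here e)) → adj⇒≢ vq e })
    ∷ (λ { (here e) → p≢q e }) ∷ (λ ()) ∷ []
    where
    up = adj-of eu (here refl)
    vq = adj-of ev (here refl)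
  tuple-distinct (paths u v p q p′ q′ eu ev u≢v u≁v p≢p′ q≢q′ p≢q p≢q′ p′≢q p′≢q′) =
      (λ { (here e) → u≢v e ; (there (here e)) → adj⇒≢ up e ; (there (there (here e))) → non-adj⇒≢ u≁v vq e
         ; (there (there (there (here e)))) → adj⇒≢ up′ e ; (there (there (there (there (here e))))) → non-adj⇒≢ u≁v vq′ e })
    ∷ (λ { (here e) → non-adj⇒≢ (u≁v ∘ adj-sym T) up e ; (there (here e)) → adj⇒≢ vq e
         ; (there (there (here e))) → non-adj⇒≢ (u≁v ∘ adj-sym T) up′ e ; (there (there (there (here e)))) → adj⇒≢ vq′ e })
    ∷ (λ { (here e) → p≢q e ; (there (here e)) → p≢p′ e ; (there (there (here e))) → p≢q′ e })
    ∷ (λ { (here e) → p′≢q (sym e) ; (there (here e)) → q≢q′ e })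
    ∷ (λ { (here e) → p′≢q′ e }) ∷ (λ ()) ∷ []
    where
    up  = adj-of eu (here refl)
    up′ = adj-of eu (there (here refl))
    vq  = adj-of ev (here refl)
    vq′ = adj-of ev (there (here refl))

  occurrences-tuple : ∀ {d} (g : Gadget d) x →
    occurrences x (tuple g) ≡ ⟦ x Fin.≟ left g ⟧ + τ (left g) x + (⟦ x Fin.≟ right g ⟧ + τ (right g) x)
  occurrences-tuple g x = trans (split g) (cong₂ (λ s t → ⟦ x Fin.≟ left g ⟧ + s + (⟦ x Fin.≟ right g ⟧ + t)) (at (left g)) (at (right g)))
    where
    at : ∀ u → occurrences x (nbrs u) ≡ τ u x
    at u = trans (∑-nbrs u _) (trans (∑-cong (V n) (λ y → trans (ℤ.*-comm (τ u y) ⟦ x Fin.≟ y ⟧)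
      (cong (_* τ u y) (⟦⟧-cong (x Fin.≟ y) (y Fin.≟ x) sym sym)))) (∑-V-single x (τ u)))
    split : ∀ {d} (g : Gadget d) → occurrences x (tuple g) ≡
      ⟦ x Fin.≟ left g ⟧ + occurrences x (nbrs (left g)) + (⟦ x Fin.≟ right g ⟧ + occurrences x (nbrs (right g)))
    split (leaves u v p q eu ev _ _ _) = trans (e ⟦ x Fin.≟ u ⟧ ⟦ x Fin.≟ v ⟧ ⟦ x Fin.≟ p ⟧ ⟦ x Fin.≟ q ⟧)
      (sym (cong₂ (λ s t → ⟦ x Fin.≟ u ⟧ + occurrences x s + (⟦ x Fin.≟ v ⟧ + occurrences x t)) eu ev))
      where
      e : ∀ u v p q → u + (v + (p + (q + 0ℤ))) ≡ u + (p + 0ℤ) + (v + (q + 0ℤ))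
      e = solve-∀
    split (paths u v p q p′ q′ eu ev _ _ _ _ _ _ _ _) = trans (e ⟦ x Fin.≟ u ⟧ ⟦ x Fin.≟ v ⟧ ⟦ x Fin.≟ p ⟧ ⟦ x Fin.≟ q ⟧ ⟦ x Fin.≟ p′ ⟧ ⟦ x Fin.≟ q′ ⟧)
      (sym (cong₂ (λ s t → ⟦ x Fin.≟ u ⟧ + occurrences x s + (⟦ x Fin.≟ v ⟧ + occurrences x t)) eu ev))
      where
      e : ∀ u v p q p′ q′ → u + (v + (p + (q + (p′ + (q′ + 0ℤ))))) ≡ u + (p + (p′ + 0ℤ)) + (v + (q + (q′ + 0ℤ)))
      e = solve-∀

  -- Only the exchanged vertices must avoid the later tuples: exchanging at `g` first then leaves
  -- the images of those tuples alone. Neighbours may be shared, as they must be when few vertices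
  -- carry all the leaves.
  data Independent {d} : List (Gadget d) → Set where
    []  : Independent []
    _∷_ : ∀ {g gs} → (∀ {g′} → g′ ∈ gs → left g ∉ tuple g′ × right g ∉ tuple g′) → Independent gs → Independent (g ∷ gs)

  ends : ∀ {d} → List (Gadget d) → List (Fin n)
  ends = concatMap (λ g → left g ∷ right g ∷ [])

  ends-distinct : ∀ {d} {gs : List (Gadget d)} → Independent gs → Distinct (ends gs)
  ends-distinct []                    = []
  ends-distinct {gs = g ∷ gs} (h ∷ i) =
    (λ { (here e) → left≢right g e ; (there m) → avoid (λ g′∈ → proj₁ (h g′∈)) m }) ∷ (avoid (λ g′∈ → proj₂ (h g′∈))) ∷ ends-distinct i
    where
    avoid : ∀ {x} → (∀ {g′} → g′ ∈ gs → x ∉ tuple g′) → x ∉ ends gs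
    avoid {x} h m with find (∈-concatMap⁻ (λ g → left g ∷ right g ∷ []) {xs = gs} m)
    ... | g′ , g′∈ , here e         = h g′∈ (subst (_∈ tuple g′) (sym e) (left∈ g′))
    ... | g′ , g′∈ , there (here e) = h g′∈ (subst (_∈ tuple g′) (sym e) (right∈ g′))

  -- The ends of independent gadgets are distinct, and x occurs in a tuple either as an end or as a
  -- neighbour of an end.
  multiplicity≤ : ∀ {d} {gs : List (Gadget d)} → Independent gs → ∀ x → (∑[ g ∈ gs ] occurrences x (tuple g)) ≤ᶻ 1ℤ + deg x
  multiplicity≤ {gs = gs} i x = begin
    (∑[ g ∈ gs ] occurrences x (tuple g))
      ≡⟨ ∑-cong gs (λ g → trans (occurrences-tuple g x) (cong (λ s → ⟦ x Fin.≟ left g ⟧ + τ (left g) x + s) (sym (ℤ.+-identityʳ _)))) ⟩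
    (∑[ g ∈ gs ] ∑ (left g ∷ right g ∷ []) F)
      ≡⟨ sym (∑-concatMap _ gs F) ⟩
    ∑ (ends gs) F
      ≤⟨ ∑-distinct≤ (ends-distinct i) F (λ z → ⟦⟧-≥0 (x Fin.≟ z) ⊕ τ≥0 z x) ⟩
    ∑ (V n) F
      ≡⟨ trans (∑-+ (V n) _ _) (cong₂ _+_ (trans (∑-cong (V n) (λ z → ⟦⟧-cong (x Fin.≟ z) (z Fin.≟ x) sym sym)) (∑-V-indicator x))
           (∑-cong (V n) (λ z → τ-sym z x))) ⟩
    1ℤ + deg x ∎
    where
    open ℤ.≤-Reasoning
    F = λ z → ⟦ x Fin.≟ z ⟧ + τ z x

  private
    ≢-sep : ∀ {u v p q} → Adj T u p → (∀ {y} → Adj T u y → ¬ Adj T v y) → Adj T v q → p ≢ q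
    ≢-sep up sep vq refl = sep up vq

  private
    tabulate-distinct : ∀ {m} (f : Fin m → Fin n) → (∀ {i j} → f i ≡ f j → i ≡ j) → Distinct (tabulate f)
    tabulate-distinct {zero}  f inj = []
    tabulate-distinct {suc m} f inj = (λ m∈ → let (j , eq) = ∈-tabulate⁻ m∈ in case inj eq of λ ()) ∷ tabulate-distinct (f ∘ suc) (Fin.suc-injective ∘ inj)

    filter-distinct : ∀ u xs → Distinct xs → Distinct (filter (adj? T u) xs)
    filter-distinct u []       d       = []
    filter-distinct u (x ∷ xs) (p ∷ d) with adj? T u x
    ... | yes _ = (λ m → p (proj₁ (∈-filter⁻ (adj? T u) m))) ∷ filter-distinct u xs d
    ... | no _  = filter-distinct u xs d

  nbrs-distinct : ∀ u → Distinct (nbrs u)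
  nbrs-distinct u = filter-distinct u (V n) (tabulate-distinct id id)

  make : ∀ d u v → length (nbrs u) ≡ valency d → length (nbrs v) ≡ valency d → u ≢ v → ¬ Adj T u v →
         (∀ {y} → Adj T u y → ¬ Adj T v y) → Σ[ g ∈ Gadget d ] (left g ≡ u × right g ≡ v)
  make leaf u v lu lv u≢v u≁v sep with nbrs u in eu | nbrs v in ev
  ... | p ∷ [] | q ∷ [] = leaves u v p q eu ev u≢v u≁v (≢-sep (adj-of eu (here refl)) sep (adj-of ev (here refl))) , refl , refl
  make path u v lu lv u≢v u≁v sep with nbrs u in eu | nbrs-distinct u | nbrs v in ev | nbrs-distinct v
  ... | p ∷ p′ ∷ [] | p∉ ∷ _ | q ∷ q′ ∷ [] | q∉ ∷ _ =
    paths u v p q p′ q′ eu ev u≢v u≁v (λ e → p∉ (here e)) (λ e → q∉ (here e))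
      (≢-sep up sep vq) (≢-sep up sep vq′) (≢-sep up′ sep vq) (≢-sep up′ sep vq′) , refl , refl
    where
    up  = adj-of eu (here refl)
    up′ = adj-of eu (there (here refl))
    vq  = adj-of ev (here refl)
    vq′ = adj-of ev (there (here refl))

  avoiding : ∀ d (F : List (Fin n)) → + length F <ᶻ ofKind d → ∃[ x ] (length (nbrs x) ≡ valency d × x ∉ F)
  avoiding d F few with Fin.any? (λ x → (length (nbrs x) ℕ.≟ valency d) ×-dec ¬? (x ∈ᶠ? F))
  ... | yes found = found
  ... | no none = ⊥-elim (ℤ.<⇒≱ few (ℤ.≤-trans (∑-mono (V n) at) (∑-∈≤length F)))
    where
    at : ∀ x → ⟦ length (nbrs x) ℕ.≟ valency d ⟧ ≤ᶻ ⟦ x ∈ᶠ? F ⟧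
    at x = ⟦⟧≤ (length (nbrs x) ℕ.≟ valency d) (⟦⟧-≥0 (x ∈ᶠ? F)) (λ eq → go eq (x ∈ᶠ? F))
      where
      go : length (nbrs x) ≡ valency d → (m : Dec (x ∈ F)) → 1ℤ ≤ᶻ ⟦ m ⟧
      go eq (yes _) = ℤ.≤-refl
      go eq (no x∉) = ⊥-elim (none (x , eq , x∉))

  module Greedy (Δ : ℤ) (deg≤Δ : ∀ x → deg x ≤ᶻ Δ) (40Δ≤n : + 40 * Δ ≤ᶻ + n) (d : Kind) (many : + n ≤ᶻ + 4 * ofKind d) where

    private
      arity≤6 : + arity d ≤ᶻ + 6
      arity≤6 = go d
        where
        go : ∀ d → + arity d ≤ᶻ + 6
        go leaf = +≤+ (s≤s (s≤s (s≤s (s≤s z≤n))))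
        go path = ℤ.≤-refl

      valency≤2 : + valency d ≤ᶻ + 2
      valency≤2 = go d
        where
        go : ∀ d → + valency d ≤ᶻ + 2
        go leaf = +≤+ (s≤s z≤n)
        go path = ℤ.≤-refl

    -- Earlier tuples exclude at most 6 m vertices, and u with its first and second neighbourhoods
    -- at most 3 + 2 Δ more; both fit into the n/4 vertices of the right degree. Avoiding the second
    -- neighbourhood of u gives u and v no common neighbour.
    greedy : ∀ m → + 40 * + m ≤ᶻ + n → Σ[ gs ∈ List (Gadget d) ] (length gs ≡ m × Independent gs)
    greedy zero    _    = [] , refl , []
    greedy (suc m) 40m≤ = step (greedy m (ℤ.≤-trans (*-monoˡ (+ 40) (0≤+ 40) (+≤+ (ℕ.n≤1+n m))) 40m≤))
      where
      Goal = Σ[ gs ∈ List (Gadget d) ] (length gs ≡ suc m × Independent gs)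
      lengths : ∀ F₁ u → + length (F₁ ++ u ∷ nbrs u ++ concatMap nbrs (nbrs u)) ≡
                + length F₁ + (1ℤ + (+ length (nbrs u) + + length (concatMap nbrs (nbrs u))))
      lengths F₁ u = trans (cong +_ (List.length-++ F₁)) (cong (λ s → + length F₁ + (1ℤ + s)) (cong +_ (List.length-++ (nbrs u))))
      valency≤ : ∀ u → length (nbrs u) ≡ valency d → + length (nbrs u) ≤ᶻ + 2
      valency≤ u eq = subst (λ l → + l ≤ᶻ + 2) (sym eq) valency≤2
      0≤Δ : Fin n → 0ℤ ≤ᶻ Δ
      0≤Δ x = ℤ.≤-trans (∑-≥0 (V n) (τ≥0 x)) (deg≤Δ x)
      second : ∀ u → length (nbrs u) ≡ valency d → + length (concatMap nbrs (nbrs u)) ≤ᶻ + 2 * Δ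
      second u eq = ℤ.≤-trans (length-concatMap≤ nbrs (nbrs u) Δ (λ x → subst (_≤ᶻ Δ) (sym (length-nbrs x)) (deg≤Δ x)))
        (ℤ.*-monoʳ-≤-nonNeg Δ {{ℤ.nonNegative (0≤Δ u)}} (valency≤ u eq))
      room₁ : ∀ k → + n ≤ᶻ + 4 * k → ℤ.suc (+ m * + 6) ≤ᶻ k
      room₁ k h = *-cancel (+ 40) (+<+ (s≤s z≤n)) (≤-by (0≤+ 10 ⊗ gap h ⊕ 0≤+ 10 ⊗ gap 40m≤ ⊕ 0≤+ 160 ⊗ 0≤+ m ⊕ 0≤+ 360) (e (+ n) k (+ m)))
        where
        e : ∀ n k m → + 40 * k - + 40 * (1ℤ + m * + 6) ≡ + 10 * (+ 4 * k - n) + + 10 * (n - + 40 * (1ℤ + m)) + + 160 * m + + 360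
        e = solve-∀
      room₂ : ∀ k → + n ≤ᶻ + 4 * k → ℤ.suc (+ m * + 6 + (1ℤ + (+ 2 + + 2 * Δ))) ≤ᶻ k
      room₂ k h = *-cancel (+ 40) (+<+ (s≤s z≤n)) (≤-by (0≤+ 10 ⊗ gap h ⊕ 0≤+ 2 ⊗ gap 40Δ≤n ⊕ 0≤+ 8 ⊗ gap 40m≤ ⊕ 0≤+ 80 ⊗ 0≤+ m ⊕ 0≤+ 160) (e (+ n) k (+ m) Δ))
        where
        e : ∀ n k m Δ → + 40 * k - + 40 * (1ℤ + (m * + 6 + (1ℤ + (+ 2 + + 2 * Δ)))) ≡
            + 10 * (+ 4 * k - n) + + 2 * (n - + 40 * Δ) + + 8 * (n - + 40 * (1ℤ + m)) + + 80 * m + + 160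
        e = solve-∀

      module Extend (gs : List (Gadget d)) (len : length gs ≡ m) (ind : Independent gs) where
        F₁ = concatMap tuple gs
        F₁≤ : + length F₁ ≤ᶻ + m * + 6
        F₁≤ = subst (λ l → + length F₁ ≤ᶻ + l * + 6) len (length-concatMap≤ tuple gs (+ 6) (λ g → subst (λ l → + l ≤ᶻ + 6) (sym (tuple-length g)) arity≤6))

        F₂ : Fin n → List (Fin n)
        F₂ u = F₁ ++ u ∷ nbrs u ++ concatMap nbrs (nbrs u)
        F₂≤ : ∀ u → length (nbrs u) ≡ valency d → + length (F₂ u) ≤ᶻ + m * + 6 + (1ℤ + (+ 2 + + 2 * Δ))
        F₂≤ u lu = subst (_≤ᶻ + m * + 6 + (1ℤ + (+ 2 + + 2 * Δ))) (sym (lengths F₁ u))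
                     (ℤ.+-mono-≤ F₁≤ (ℤ.+-monoʳ-≤ 1ℤ (ℤ.+-mono-≤ (valency≤ u lu) (second u lu))))

        second-vertex : ∀ u → u ∉ F₁ → ∀ v → v ∉ F₂ u → Σ[ g ∈ Gadget d ] (left g ≡ u × right g ≡ v) → Goal
        second-vertex u u∉ v v∉ (g , lg , rg) = g ∷ gs , cong suc len ,
          (λ {g′} g′∈ → subst (_∉ tuple g′) (sym lg) (λ m → u∉ (∈-concatMap⁺ tuple (lose g′∈ m)))
                      , subst (_∉ tuple g′) (sym rg) (λ m → v∉ (∈-++⁺ˡ (∈-concatMap⁺ tuple (lose g′∈ m))))) ∷ ind

        first-vertex : ∃[ u ] (length (nbrs u) ≡ valency d × u ∉ F₁) → Goal
        first-vertex (u , lu , u∉) = pick (avoiding d (F₂ u) (ℤ.≤-<-trans (F₂≤ u lu) (ℤ.suc[i]≤j⇒i<j (room₂ (ofKind d) many))))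
          where
          pick : ∃[ v ] (length (nbrs v) ≡ valency d × v ∉ F₂ u) → Goal
          pick (v , lv , v∉) = second-vertex u u∉ v v∉ (make d u v lu lv
            (λ u≡v → v∉ (∈-++⁺ʳ F₁ (here (sym u≡v))))
            (λ a → v∉ (∈-++⁺ʳ F₁ (there (∈-++⁺ˡ (∈-nbrs⁺ a)))))
            (λ ua va → v∉ (∈-++⁺ʳ F₁ (there (∈-++⁺ʳ (nbrs u) (∈-concatMap⁺ nbrs (lose (∈-nbrs⁺ ua) (∈-nbrs⁺ (adj-sym T va)))))))))

      step : Σ[ gs ∈ List (Gadget d) ] (length gs ≡ m × Independent gs) → Goal
      step (gs , len , ind) = first-vertex (avoiding d F₁ (ℤ.≤-<-trans F₁≤ (ℤ.suc[i]≤j⇒i<j (room₁ (ofKind d) many))))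
        where open Extend gs len ind

transpose-at′ : ∀ (i j : Fin n) → i ≢ j → PC.transpose i j j ≡ i
transpose-at′ i j i≢j with j Fin.≟ i
... | yes e = e
... | no _ with j Fin.≟ j
...   | yes _ = refl
...   | no ¬p = ⊥-elim (¬p refl)

-- The effect of swaps on the number of edges of each colour

module Swap {n : ℕ} (T : Graph n) (W : Fin n → Fin n → ℤ) (W-sym : ∀ a b → W a b ≡ W b a) where

  open Trees T

  total : (Fin n → Fin n) → ℤ
  total f = ∑[ x ∈ V n ] ∑[ y ∈ V n ] (τ x y * W (f x) (f y))

  exchange : Fin n → Fin n → (Fin n → Fin n) → ℤ
  exchange u v f = ∑[ y ∈ nbrs u ] (W (f v) (f y) - W (f u) (f y))

  -- As u and v are not adjacent, no edge joins the two exchanged vertices, and every entry that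
  -- changes lies in a row or a column of one of them. Rows and columns contribute equally, whence
  -- the factor 2.
  swap-total : ∀ f u v → u ≢ v → ¬ Adj T u v →
               total (f ∘ PC.transpose u v) ≡ total f + + 2 * (exchange u v f + exchange v u f)
  swap-total f u v u≢v u≁v = trans
    (trans (∑-cong (V n) (λ x → ∑-cong (V n) (λ y → trans (e (τ x y) (W (f (σ x)) (f (σ y))) (W (f x) (f y)))
       (cong (λ s → τ x y * W (f x) (f y) + s) (changes x y (x Fin.≟ u) (x Fin.≟ v) (y Fin.≟ u) (y Fin.≟ v))))))
       (∑∑-split (V n) _ _))
    (cong (λ s → total f + s) collect)
    where
    σ = PC.transpose u v
    A B : Fin n → ℤ
    A y = τ u y * (W (f v) (f y) - W (f u) (f y))
    B y = τ v y * (W (f u) (f y) - W (f v) (f y))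
    e : ∀ t a b → t * a ≡ t * b + t * (a - b)
    e = solve-∀
    A0 : ∀ y → ¬ Adj T u y → A y ≡ 0ℤ
    A0 y ¬a = trans (cong (_* (W (f v) (f y) - W (f u) (f y))) (⟦⟧-no (adj? T u y) ¬a)) refl
    B0 : ∀ y → ¬ Adj T v y → B y ≡ 0ℤ
    B0 y ¬a = trans (cong (_* (W (f u) (f y) - W (f v) (f y))) (⟦⟧-no (adj? T v y) ¬a)) refl
    τ0 : ∀ x y z → ¬ Adj T x y → τ x y * z ≡ 0ℤ
    τ0 x y z ¬a = trans (cong (_* z) (⟦⟧-no (adj? T x y) ¬a)) refl
    v≁u : ¬ Adj T v u
    v≁u a = u≁v (adj-sym T a)
    σu = transpose-at u v
    σv = transpose-at′ u v u≢v
    changes : ∀ x y (xu : Dec (x ≡ u)) (xv : Dec (x ≡ v)) (yu : Dec (y ≡ u)) (yv : Dec (y ≡ v)) →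
      τ x y * (W (f (σ x)) (f (σ y)) - W (f x) (f y)) ≡
      ⟦ xu ⟧ * A y + ⟦ xv ⟧ * B y + (⟦ yu ⟧ * A x + ⟦ yv ⟧ * B x)
    changes x y (yes refl) (yes e) _ _ = ⊥-elim (u≢v e)
    changes x y _ _ (yes refl) (yes e) = ⊥-elim (u≢v e)
    changes x y (yes refl) (no _) (yes refl) (no _) = trans (τ0 u u _ (irrefl T)) (sym (cong (λ s → 1ℤ * s + 0ℤ + (1ℤ * s + 0ℤ)) (A0 u (irrefl T))))
    changes x y (yes refl) (no _) (no _) (yes refl) = trans (τ0 u v _ u≁v) (sym (cong₂ (λ s t → 1ℤ * s + 0ℤ + (0ℤ + 1ℤ * t)) (A0 v u≁v) (B0 u v≁u)))
    changes x y (no _) (yes refl) (yes refl) (no _) = trans (τ0 v u _ v≁u) (sym (cong₂ (λ s t → 0ℤ + 1ℤ * t + (1ℤ * s + 0ℤ)) (A0 v u≁v) (B0 u v≁u)))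
    changes x y (no _) (yes refl) (no _) (yes refl) = trans (τ0 v v _ (irrefl T)) (sym (cong (λ s → 0ℤ + 1ℤ * s + (0ℤ + 1ℤ * s)) (B0 v (irrefl T))))
    changes x y (yes refl) (no _) (no y≢u) (no y≢v) = trans
      (cong₂ (λ a b → τ u y * (W (f a) (f b) - W (f u) (f y))) σu (transpose-off u v y≢u y≢v)) (e′ (A y))
      where
      e′ : ∀ a → a ≡ 1ℤ * a + 0ℤ + (0ℤ + 0ℤ)
      e′ = solve-∀
    changes x y (no _) (yes refl) (no y≢u) (no y≢v) = trans
      (cong₂ (λ a b → τ v y * (W (f a) (f b) - W (f v) (f y))) σv (transpose-off u v y≢u y≢v)) (e′ (B y))
      where
      e′ : ∀ a → a ≡ 0ℤ + 1ℤ * a + (0ℤ + 0ℤ)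
      e′ = solve-∀
    changes x y (no x≢u) (no x≢v) (yes refl) (no _) = trans
      (cong₂ (λ a b → τ x u * (W (f a) (f b) - W (f x) (f u))) (transpose-off u v x≢u x≢v) σu)
      (trans (cong₂ _*_ (τ-sym x u) (cong₂ _-_ (W-sym (f x) (f v)) (W-sym (f x) (f u)))) (e′ (A x)))
      where
      e′ : ∀ a → a ≡ 0ℤ + 0ℤ + (1ℤ * a + 0ℤ)
      e′ = solve-∀
    changes x y (no x≢u) (no x≢v) (no _) (yes refl) = trans
      (cong₂ (λ a b → τ x v * (W (f a) (f b) - W (f x) (f v))) (transpose-off u v x≢u x≢v) σv)
      (trans (cong₂ _*_ (τ-sym x v) (cong₂ _-_ (W-sym (f x) (f u)) (W-sym (f x) (f v)))) (e′ (B x)))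
      where
      e′ : ∀ a → a ≡ 0ℤ + 0ℤ + (0ℤ + 1ℤ * a)
      e′ = solve-∀
    changes x y (no x≢u) (no x≢v) (no y≢u) (no y≢v) = trans
      (cong₂ (λ a b → τ x y * (W (f a) (f b) - W (f x) (f y))) (transpose-off u v x≢u x≢v) (transpose-off u v y≢u y≢v))
      (trans (cong (τ x y *_) (ℤ.+-inverseʳ (W (f x) (f y)))) (ℤ.*-zeroʳ (τ x y)))
    collect : (∑[ x ∈ V n ] ∑[ y ∈ V n ] (⟦ x Fin.≟ u ⟧ * A y + ⟦ x Fin.≟ v ⟧ * B y + (⟦ y Fin.≟ u ⟧ * A x + ⟦ y Fin.≟ v ⟧ * B x))) ≡
              + 2 * (exchange u v f + exchange v u f)
    collect = trans (∑∑-split (V n) _ _) (trans (cong₂ _+_ (trans (∑∑-split (V n) _ _) (cong₂ _+_ (rows u A) (rows v B)))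
        (trans (∑∑-split (V n) _ _) (cong₂ _+_ (columns u A) (columns v B))))
      (trans (e′ (∑ (V n) A) (∑ (V n) B)) (cong₂ (λ s t → + 2 * (s + t)) (sym (∑-nbrs u _)) (sym (∑-nbrs v _)))))
      where
      e′ : ∀ a b → a + b + (a + b) ≡ + 2 * (a + b)
      e′ = solve-∀
      columns : ∀ u F → (∑[ x ∈ V n ] ∑[ y ∈ V n ] (⟦ y Fin.≟ u ⟧ * F x)) ≡ ∑ (V n) F
      columns u F = ∑-cong (V n) (λ x → ∑-V-single u (λ _ → F x))
      rows : ∀ u F → (∑[ x ∈ V n ] ∑[ y ∈ V n ] (⟦ x Fin.≟ u ⟧ * F y)) ≡ ∑ (V n) F
      rows u F = trans (∑-comm (V n) (V n) _) (columns u F)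

module Swaps {n r : ℕ} (C : Fin n → Fin n → Fin r) (C-sym : ∀ a b → C a b ≡ C b a) (one i : Fin r) (T : Graph n) where

  open Colours C C-sym using (χ; w; w-sym)
  open Gains C C-sym one using (G; γ; σ₁; σ₂)
  open Tuples C using (Quad; aligned; lift)
  open Trees T using (nbrs)
  open Gadgets T using (Gadget; leaves; paths; left; right; tuple; left≢right; left≁right; Independent; []; _∷_)

  surplus : Fin r → (Fin n → Fin n) → ℤ
  surplus j = Swap.total T (w one j) (w-sym one j)

  -- The decision to exchange: `false` asks that colour 1 gain, `true` also accepts a loss of colour
  -- i at no cost to colour 1. The two events exclude each other, so the sum is still 0 or 1.
  ω : Bool → Quad
  ω false = σ₁
  ω true  = λ a b p q → σ₁ a b p q + σ₂ i a b p q

  ω-values : ∀ s a b p q → ω s a b p q ≡ 0ℤ ⊎ ω s a b p q ≡ 1ℤ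
  ω-values s a b p q = go s (1ℤ ℤ.≤? G one a b p q) (G one a b p q ℤ.≟ 0ℤ) (G i a b p q ℤ.≤? - 1ℤ) refl refl
    where
    go : ∀ s (d₁ : Dec (1ℤ ≤ᶻ G one a b p q)) (d₂ : Dec (G one a b p q ≡ 0ℤ)) (d₃ : Dec (G i a b p q ≤ᶻ - 1ℤ)) →
         σ₁ a b p q ≡ ⟦ d₁ ⟧ → σ₂ i a b p q ≡ ⟦ d₂ ×-dec d₃ ⟧ → ω s a b p q ≡ 0ℤ ⊎ ω s a b p q ≡ 1ℤ
    go false (yes _) d₂ d₃ e₁ e₂ = inj₂ e₁
    go false (no _)  d₂ d₃ e₁ e₂ = inj₁ e₁
    go true (yes p) (yes e) d₃ e₁ e₂ = ⊥-elim (ℤ.<⇒≱ {0ℤ} {1ℤ} (+<+ (s≤s z≤n)) (subst (1ℤ ≤ᶻ_) e p))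
    go true (yes p) (no _)  d₃ e₁ e₂ = inj₂ (cong₂ _+_ e₁ e₂)
    go true (no _) (yes _) (yes _) e₁ e₂ = inj₂ (cong₂ _+_ e₁ e₂)
    go true (no _) (yes _) (no _)  e₁ e₂ = inj₁ (cong₂ _+_ e₁ e₂)
    go true (no _) (no _)  d₃      e₁ e₂ = inj₁ (cong₂ _+_ e₁ e₂)

  φ : Kind → Bool → Fin r → List (Fin n) → ℤ
  φ d s j = lift d (λ a b p q → ω s a b p q * γ j a b p q)

  record Improved {d} (s : Bool) (g : Gadget d) (π : Permutation′ n) : Set where
    field
      π′       : Permutation′ n
      off      : ∀ x → x ≢ left g → x ≢ right g → ⟪ π′ ⟫ x ≡ ⟪ π ⟫ x
      surplus≡ : ∀ j → surplus j ⟪ π′ ⟫ ≡ surplus j ⟪ π ⟫ + + 2 * φ d s j (map ⟪ π ⟫ (tuple g))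

  private
    unchanged : ∀ {d} s (g : Gadget d) π → (∀ j → φ d s j (map ⟪ π ⟫ (tuple g)) ≡ 0ℤ) → Improved s g π
    unchanged s g π eq = record
      { π′ = π ; off = λ _ _ _ → refl
      ; surplus≡ = λ j → sym (trans (cong (λ t → surplus j ⟪ π ⟫ + + 2 * t) (eq j)) (ℤ.+-identityʳ _)) }

    swapped : ∀ {d} s (g : Gadget d) π → (∀ j → φ d s j (map ⟪ π ⟫ (tuple g)) ≡
                Swap.exchange T (w one j) (w-sym one j) (left g) (right g) ⟪ π ⟫ + Swap.exchange T (w one j) (w-sym one j) (right g) (left g) ⟪ π ⟫) → Improved s g π
    swapped s g π eq = record
      { π′ = Perm.transpose (left g) (right g) ∘ₚ π
      ; off = λ x p q → cong ⟪ π ⟫ (transpose-off (left g) (right g) p q)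
      ; surplus≡ = λ j → trans (Swap.swap-total T (w one j) (w-sym one j) ⟪ π ⟫ (left g) (right g) (left≢right g) (left≁right g))
          (cong (λ t → surplus j ⟪ π ⟫ + + 2 * t) (sym (eq j))) }

    Γ : Fin r → Fin n → Fin n → Fin n → Fin n → ℤ
    Γ j a b p q = (w one j b p - w one j a p) + (w one j a q - w one j b q)

    γ≡Γ : ∀ j a b p q → γ j a b p q ≡ Γ j a b p q
    γ≡Γ j a b p q = e (χ one b p) (χ one a q) (χ one a p) (χ one b q) (χ j b p) (χ j a q) (χ j a p) (χ j b q)
      where
      e : ∀ x y z w x′ y′ z′ w′ → (x + y - z - w) - (x′ + y′ - z′ - w′) ≡ ((x - x′) - (z - z′)) + ((y - y′) - (w - w′))
      e = solve-∀

  improve : ∀ {d} s (g : Gadget d) π → Improved s g π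
  improve s g@(leaves u v p q eu ev _ _ _) π = go (ω-values s a b p′ q′)
    where
    f = ⟪ π ⟫
    a = f u
    b = f v
    p′ = f p
    q′ = f q
    go : ω s a b p′ q′ ≡ 0ℤ ⊎ ω s a b p′ q′ ≡ 1ℤ → Improved s g π
    go (inj₁ eq) = unchanged s g π (λ j → cong (_* γ j a b p′ q′) eq)
    go (inj₂ eq) = swapped s g π (λ j → trans (cong (_* γ j a b p′ q′) eq) (trans (ℤ.*-identityˡ _) (trans (γ≡Γ j a b p′ q′)
      (trans (e (w one j b p′ - w one j a p′) (w one j a q′ - w one j b q′))
        (sym (cong₂ (λ ys zs → (∑[ y ∈ ys ] (w one j b (f y) - w one j a (f y))) + (∑[ y ∈ zs ] (w one j a (f y) - w one j b (f y)))) eu ev))))))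
      where
      e : ∀ x y → x + y ≡ (x + 0ℤ) + (y + 0ℤ)
      e = solve-∀
  improve s g@(paths u v p q p′ q′ eu ev _ _ _ _ _ _ _ _) π = go (C a (f p′) Fin.≟ C a (f q′)) (C b (f p′) Fin.≟ C b (f q′)) refl (ω-values s a b (f p) (f q))
    where
    f = ⟪ π ⟫
    a = f u
    b = f v
    go : (d₁ : Dec (C a (f p′) ≡ C a (f q′))) (d₂ : Dec (C b (f p′) ≡ C b (f q′))) → aligned a b (f p′) (f q′) ≡ ⟦ d₁ ⟧ * ⟦ d₂ ⟧ →
         ω s a b (f p) (f q) ≡ 0ℤ ⊎ ω s a b (f p) (f q) ≡ 1ℤ → Improved s g π
    go (no _)  (yes _) al _ = unchanged s g π (λ j → cong (_* (ω s a b (f p) (f q) * γ j a b (f p) (f q))) al)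
    go (no _)  (no _)  al _ = unchanged s g π (λ j → cong (_* (ω s a b (f p) (f q) * γ j a b (f p) (f q))) al)
    go (yes _) (no _)  al _ = unchanged s g π (λ j → cong (_* (ω s a b (f p) (f q) * γ j a b (f p) (f q))) al)
    go (yes _) (yes _) al (inj₁ eq) = unchanged s g π (λ j → cong₂ (λ x y → x * (y * γ j a b (f p) (f q))) al eq)
    go (yes e₁) (yes e₂) al (inj₂ eq) = swapped s g π (λ j → trans (cong₂ (λ x y → x * (y * γ j a b (f p) (f q))) al eq)
      (trans (ℤ.*-identityˡ _) (trans (ℤ.*-identityˡ _) (trans (γ≡Γ j a b (f p) (f q))
      (trans (sym (trans (cong (λ s → Γ j a b (f p) (f q) + s) (Γ0 j)) (ℤ.+-identityʳ (Γ j a b (f p) (f q)))))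
      (trans (e (w one j b (f p) - w one j a (f p)) (w one j a (f q) - w one j b (f q)) (w one j b (f p′) - w one j a (f p′)) (w one j a (f q′) - w one j b (f q′)))
        (sym (cong₂ (λ ys zs → (∑[ y ∈ ys ] (w one j b (f y) - w one j a (f y))) + (∑[ y ∈ zs ] (w one j a (f y) - w one j b (f y)))) eu ev))))))))
      where
      e : ∀ x y x′ y′ → (x + y) + (x′ + y′) ≡ (x + (x′ + 0ℤ)) + (y + (y′ + 0ℤ))
      e = solve-∀
      -- Alignment gives the edges from a to the images of p′ and q′ equal colours, and likewise at
      -- b, so the two changes cancel.
      Γ0 : ∀ j → Γ j a b (f p′) (f q′) ≡ 0ℤ
      Γ0 j = trans (cong₂ (λ c c′ → ((⟦ c′ Fin.≟ one ⟧ - ⟦ c′ Fin.≟ j ⟧) - (⟦ c Fin.≟ one ⟧ - ⟦ c Fin.≟ j ⟧)) + (w one j a (f q′) - w one j b (f q′))) e₁ e₂)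
                   (e₀ (w one j b (f q′)) (w one j a (f q′)))
        where
        e₀ : ∀ x y → (x - y) + (y - x) ≡ 0ℤ
        e₀ = solve-∀

  -- All gains are evaluated at the initial permutation: the exchange at the first gadget moves only
  -- the images of its ends, which no later tuple contains.
  improve-all : ∀ {d} (gs : List (Bool × Gadget d)) → Independent (map proj₂ gs) → ∀ π →
    Σ[ π′ ∈ Permutation′ n ] (∀ j → surplus j ⟪ π′ ⟫ ≡ surplus j ⟪ π ⟫ + + 2 * (∑[ g ∈ gs ] φ d (proj₁ g) j (map ⟪ π ⟫ (tuple (proj₂ g)))))
  improve-all []             ind     π = π , λ j → sym (ℤ.+-identityʳ _)
  improve-all {d} ((s , g) ∷ gs) (h ∷ ind) π = continue (improve-all gs ind π₁)
    where
    open Improved (improve s g π) renaming (π′ to π₁)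
    gains : Permutation′ n → Fin r → ℤ
    gains π j = ∑[ g ∈ gs ] φ d (proj₁ g) j (map ⟪ π ⟫ (tuple (proj₂ g)))
    same : ∀ j → gains π₁ j ≡ gains π j
    same j = ∑-cong-∈ gs (λ { (s′ , g′) m → cong (φ d s′ j) (map-cong-∈ ⟪ π₁ ⟫ ⟪ π ⟫ (tuple g′) (λ {x} x∈ →
      off x (λ e → proj₁ (h (∈-map⁺ proj₂ m)) (subst (_∈ tuple g′) e x∈)) (λ e → proj₂ (h (∈-map⁺ proj₂ m)) (subst (_∈ tuple g′) e x∈)))) })
    e : ∀ a b c → a + + 2 * b + + 2 * c ≡ a + + 2 * (b + c)
    e = solve-∀
    continue : Σ[ π₂ ∈ Permutation′ n ] (∀ j → surplus j ⟪ π₂ ⟫ ≡ surplus j ⟪ π₁ ⟫ + + 2 * gains π₁ j) →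
      Σ[ π₂ ∈ Permutation′ n ] (∀ j → surplus j ⟪ π₂ ⟫ ≡ surplus j ⟪ π ⟫ + + 2 * (φ d s j (map ⟪ π ⟫ (tuple g)) + gains π j))
    continue (π₂ , eq) = π₂ , λ j → trans (eq j) (trans (cong₂ (λ x y → x + + 2 * y) (surplus≡ j) (same j))
      (e (surplus j ⟪ π ⟫) (φ d s j (map ⟪ π ⟫ (tuple g))) (gains π j)))

-- Families of tuples with few overlaps

P≡-identity : ∀ a p → a - (a - p) ≡ p
P≡-identity = solve-∀

P≤-identity : ∀ a s → a - (a - s) ≡ s
P≤-identity = solve-∀

2P≥-identity : ∀ n k p s → n * (+ 2 * (p - s)) - n * p ≡ + 2 * (k * k * p - n * s) + p * (n - + 2 * (k * (k + k))) + + 2 * (k * k) * p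
2P≥-identity = solve-∀

module FreshCount (n k : ℕ) (0<n : 0ℤ <ᶻ + n) (n-large : + 2 * (+ k * (+ k + + k)) ≤ᶻ + n) where

  stale₀ : ℤ
  stale₀ = stale {n} k []

  n*stale₀≤ : + n * stale₀ ≤ᶻ + k * + k * n ↑ k
  n*stale₀≤ = subst (λ s → + n * stale₀ ≤ᶻ + k * s * n ↑ k) (ℤ.+-identityˡ (+ k)) (n*stale≤ {n} k [])

  P : ℤ
  P = ∑[ v ∈ tuples n k ] ⟦ fresh? {n} [] v ⟧

  P≡ : P ≡ n ↑ k - stale₀
  P≡ = sym (trans (cong (λ s → n ↑ k - s) (trans (∑-- (tuples n k) (λ _ → 1ℤ) _) (cong (_- P) (trans (∑-tuples-const n k 1ℤ) (ℤ.*-identityʳ (n ↑ k)))))) (P≡-identity (n ↑ k) P))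

  stale₀≥0 : 0ℤ ≤ᶻ stale₀
  stale₀≥0 = ∑-≥0 (tuples n k) (λ v → gap (⟦⟧-≤1 (fresh? {n} [] v)))

  P≤ : P ≤ᶻ n ↑ k
  P≤ = ≤-by stale₀≥0 (trans (cong (λ s → n ↑ k - s) P≡) (P≤-identity (n ↑ k) stale₀))

  2P≥ : n ↑ k ≤ᶻ + 2 * P
  2P≥ = *-cancel (+ n) 0<n (≤-by (0≤+ 2 ⊗ gap n*stale₀≤ ⊕ 0≤↑ n k ⊗ gap n-large ⊕ 0≤+ 2 ⊗ (0≤+ k ⊗ 0≤+ k) ⊗ 0≤↑ n k)
    (trans (cong (λ s → + n * (+ 2 * s) - + n * n ↑ k) P≡) (2P≥-identity (+ n) (+ k) (n ↑ k) stale₀)))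

  0<P : 0ℤ <ᶻ P
  0<P = ℤ.≰⇒> (λ P≤0 → ℤ.<⇒≱ (0<↑ n k 0<n) (ℤ.≤-trans 2P≥ (*-monoˡ (+ 2) (0≤+ 2) P≤0)))

moment≤-identity : ∀ n N B k D M J S →
    n * (N * (B * B) * (n * (+ 2 * k * D + + 16 * (k * k)))) - n * S ≡
    (N * (B * B) * (n * J + + 2 * (k * (k + k)) * (M * M)) - n * S)
    + N * (B * B) * (n * (M * (k * D) - J) + n * (k * D) * (+ 2 * n - M) + + 4 * (k * k) * ((+ 2 * n - M) * (+ 2 * n + M)))
moment≤-identity = solve-∀

∑-spread-identity : ∀ H r m x → r * (+ 2 * (H * H)) * x - + 2 * (H * H * m) ≡ + 2 * (H * H) * (r * x - m)
∑-spread-identity = solve-∀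

∑-spread-identity₂ : ∀ N P b H r q n → N * (P * P) * n * (+ 8 * (H * H) * r * (b * b) * q) ≡
     r * (+ 2 * (H * H)) * (N * (+ 2 * (P * b) * (+ 2 * (P * b))) * (n * q))
∑-spread-identity₂ = solve-∀

∑-spread-identity₃ : ∀ N P n → N * (P * P) * n * n ≡ N * (P * n * (P * n))
∑-spread-identity₃ = solve-∀

spread<⇒-identity : ∀ H d s → H * H * s - - (H * d) * - (H * d) ≡ H * H * (s - d * d)
spread<⇒-identity = solve-∀

module Family
  (n k : ℕ) (0<n : 0ℤ <ᶻ + n) (n-large : + 2 * (+ k * (+ k + + k)) ≤ᶻ + n)
  {X : Set} (xs : List X) (t : X → List (Fin n)) (b D : ℤ) (0≤b : 0ℤ ≤ᶻ b)
  (t-length : ∀ x → length (t x) ≡ k) (t-distinct : ∀ x → Distinct (t x))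
  (few : + length xs ≤ᶻ + 2 * + n) (0≤D : 0ℤ ≤ᶻ D)
  (multiplicity : ∀ z → (∑[ x ∈ xs ] occurrences z (t x)) ≤ᶻ D)
  where

  private
    N = + (n !)
    M = + length xs

  open FreshCount n k 0<n n-large using (P; 0<P)

  -- The first summand comes from overlapping pairs, at most 2 n k D in number, and the second from
  -- the covariance of the disjoint ones, with at most 2 n tuples in the family.
  q : ℤ
  q = + 2 * + k * D + + 16 * (+ k * + k)

  module Member (φ : X → List (Fin n) → ℤ) (φ-bounded : ∀ x v → Bounded (φ x v) b) where

    open Concentration n k 0<n n-large xs t φ b 0≤b t-length (λ x → distinct⇒fresh (t-distinct x) (λ _ ())) φ-bounded public

    overlaps≤ : overlaps ≤ᶻ M * (+ k * D)
    overlaps≤ = begin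
      overlaps
        ≤⟨ ∑∑-mono xs (λ x y → stale≤common (t x) (t y) (t-distinct y)) ⟩
      (∑[ x ∈ xs ] ∑[ y ∈ xs ] ∑[ z ∈ t x ] occurrences z (t y))
        ≡⟨ ∑-cong xs (λ x → ∑-comm xs (t x) (λ y z → occurrences z (t y))) ⟩
      (∑[ x ∈ xs ] ∑[ z ∈ t x ] ∑[ y ∈ xs ] occurrences z (t y))
        ≤⟨ ∑-mono xs (λ x → ∑-mono (t x) multiplicity) ⟩
      (∑[ x ∈ xs ] ∑[ z ∈ t x ] D)
        ≡⟨ ∑-cong xs (λ x → trans (∑-const (t x) D) (cong (λ l → + l * D) (t-length x))) ⟩
      (∑[ x ∈ xs ] (+ k * D))
        ≡⟨ ∑-const xs (+ k * D) ⟩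
      M * (+ k * D) ∎
      where open ℤ.≤-Reasoning

    moment : ℤ
    moment = ∑[ i ∈ V (n !) ] (deviation ⟪ decode n i ⟫ * deviation ⟪ decode n i ⟫)

    moment≤ : moment ≤ᶻ N * (B * B) * (+ n * q)
    moment≤ = *-cancel (+ n) 0<n (≤-by
      (gap second-moment ⊕ NBB≥0 ⊗ (0≤+ n ⊗ gap overlaps≤ ⊕ 0≤+ n ⊗ (0≤+ k ⊗ 0≤D) ⊗ gap few
         ⊕ 0≤+ 4 ⊗ (0≤+ k ⊗ 0≤+ k) ⊗ (gap few ⊗ (0≤+ 2 ⊗ 0≤+ n ⊕ 0≤+ (length xs)))))
      (moment≤-identity (+ n) N B (+ k) D M overlaps moment))
      where
      NBB≥0 : 0ℤ ≤ᶻ N * (B * B)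
      NBB≥0 = 0≤+ (n !) ⊗ (B≥0 ⊗ B≥0)

  module Simultaneous (r : ℕ) (φ : Fin r → X → List (Fin n) → ℤ) (φ-bounded : ∀ j x v → Bounded (φ j x v) b)
    (H : ℤ) (0≤H : 0ℤ ≤ᶻ H) (n-huge : + 8 * (H * H) * + r * (b * b) * q <ᶻ + n) where

    open module M j = Member (φ j) (φ-bounded j) using (deviation; moment; moment≤)

    -- Adding the squared deviations of all colours lets a single application of Markov's inequality
    -- control every colour.
    spread : Fin (n !) → ℤ
    spread i = H * H * (∑[ j ∈ V r ] (deviation j ⟪ decode n i ⟫ * deviation j ⟪ decode n i ⟫))

    spread≥0 : ∀ i → 0ℤ ≤ᶻ spread i
    spread≥0 i = 0≤H ⊗ 0≤H ⊗ ∑-≥0 (V r) (λ j → sq (deviation j ⟪ decode n i ⟫))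

    -- The average is below half of the threshold used in `spread<⇒`, which leaves room for a second
    -- family at the same permutation.
    ∑-spread : + 2 * ∑ (V (n !)) spread <ᶻ N * (P * + n * (P * + n))
    ∑-spread = ℤ.≤-<-trans
      (≤-by (0≤+ 2 ⊗ (0≤H ⊗ 0≤H) ⊗ gap rows) (trans (cong (λ s → + r * (+ 2 * (H * H)) * x - + 2 * s) collect) (∑-spread-identity H (+ r) (∑[ j ∈ V r ] moment j) x)))
      (subst₂ _<ᶻ_ (∑-spread-identity₂ N P b H (+ r) q (+ n)) (∑-spread-identity₃ N P (+ n))
        (ℤ.*-monoˡ-<-pos (N * (P * P) * + n) {{positive (0<* (0<* (0<n! n) (0<* 0<P 0<P)) 0<n)}} n-huge))
      where
      x = N * (+ 2 * (P * b) * (+ 2 * (P * b))) * (+ n * q)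
      rows : (∑[ j ∈ V r ] moment j) ≤ᶻ + r * x
      rows = ℤ.≤-trans (∑-mono (V r) moment≤) (≡⇒≤ (∑-V-const r x))
      collect : ∑ (V (n !)) spread ≡ H * H * (∑[ j ∈ V r ] moment j)
      collect = trans (∑-*ˡ (V (n !)) (H * H) _) (cong (H * H *_) (∑-comm (V (n !)) (V r) _))

    spread<⇒ : ∀ i → spread i <ᶻ P * + n * (P * + n) → ∀ j → - (P * + n) ≤ᶻ H * deviation j ⟪ decode n i ⟫
    spread<⇒ i lt j = subst₂ _≤ᶻ_ refl (ℤ.neg-involutive _) (ℤ.neg-mono-≤
      (sq-cancel {a = - (H * d)} (<⇒0≤ (0<* 0<P 0<n)) (ℤ.≤-trans (≤-by (0≤H ⊗ 0≤H ⊗ gap one-term) (spread<⇒-identity H d (∑[ j ∈ V r ] (deviation j ⟪ decode n i ⟫ * deviation j ⟪ decode n i ⟫)))) (ℤ.<⇒≤ lt))))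
      where
      d = deviation j ⟪ decode n i ⟫
      one-term : d * d ≤ᶻ ∑[ j ∈ V r ] (deviation j ⟪ decode n i ⟫ * deviation j ⟪ decode n i ⟫)
      one-term = ∑-single≤ (V r) (λ j → sq (deviation j ⟪ decode n i ⟫)) (∈-allFin j)

    summary : Σ[ σ ∈ (Fin (n !) → ℤ) ] ((∀ i → 0ℤ ≤ᶻ σ i) × + 2 * ∑ (V (n !)) σ <ᶻ N * (P * + n * (P * + n)) ×
      (∀ i → σ i <ᶻ P * + n * (P * + n) → ∀ j → - (P * + n) ≤ᶻ
        H * (P * (∑[ x ∈ xs ] φ j x (map ⟪ decode n i ⟫ (t x))) - (∑[ x ∈ xs ] ∑[ v ∈ tuples n k ] (⟦ fresh? [] v ⟧ * φ j x v)))))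
    summary = spread , spread≥0 , ∑-spread , spread<⇒

-- Markov's inequality for A/a + B/b, whose average is below 1, cleared of denominators.
two-averages : ∀ {X : Set} (xs : List X) (A B : X → ℤ) (a b : ℤ) → (∀ x → 0ℤ ≤ᶻ A x) → (∀ x → 0ℤ ≤ᶻ B x) →
  0ℤ <ᶻ a → 0ℤ <ᶻ b → + 2 * ∑ xs A <ᶻ + length xs * a → + 2 * ∑ xs B <ᶻ + length xs * b → ∃[ x ] (A x <ᶻ a × B x <ᶻ b)
two-averages xs A B a b A≥0 B≥0 0<a 0<b hA hB =
  let (x , _ , lt) = ∑-exists xs (λ x → b * A x + a * B x) (a * b) small
  in x , below b a (A x) (a * B x) 0<b (<⇒0≤ 0<a ⊗ B≥0 x) (subst (b * A x + a * B x <ᶻ_) (ℤ.*-comm a b) lt)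
       , below a b (B x) (b * A x) 0<a (<⇒0≤ 0<b ⊗ A≥0 x) (subst (_<ᶻ a * b) (ℤ.+-comm (b * A x) (a * B x)) lt)
  where
  l = + length xs
  below : ∀ c d y z → 0ℤ <ᶻ c → 0ℤ ≤ᶻ z → c * y + z <ᶻ c * d → y <ᶻ d
  below c d y z 0<c 0≤z lt = ℤ.≰⇒> (λ d≤y → ℤ.<⇒≱ lt (ℤ.≤-trans (*-monoˡ c (<⇒0≤ 0<c) d≤y) (≤-by 0≤z (e (c * y) z))))
    where
    e : ∀ x z → x + z - x ≡ z
    e = solve-∀
  half : + 2 * ∑ xs (λ x → b * A x + a * B x) ≡ b * (+ 2 * ∑ xs A) + a * (+ 2 * ∑ xs B)
  half = trans (cong (+ 2 *_) (trans (∑-+ xs _ _) (cong₂ _+_ (∑-*ˡ xs b A) (∑-*ˡ xs a B)))) (e a b (∑ xs A) (∑ xs B))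
    where
    e : ∀ a b x y → + 2 * (b * x + a * y) ≡ b * (+ 2 * x) + a * (+ 2 * y)
    e = solve-∀
  small : ∑ xs (λ x → b * A x + a * B x) <ᶻ l * (a * b)
  small = ℤ.*-cancelˡ-<-nonNeg (+ 2) (subst₂ _<ᶻ_ (sym half) (e l a b)
    (ℤ.+-mono-< (ℤ.*-monoˡ-<-pos b {{positive 0<b}} hA) (ℤ.*-monoˡ-<-pos a {{positive 0<a}} hB)))
    where
    e : ∀ l a b → b * (l * a) + a * (l * b) ≡ + 2 * (l * (a * b))
    e = solve-∀

-- Darts of a graph

darts-multiplicity-identity : ∀ t a b → t * (a + (b + 0ℤ)) ≡ a * t + b * t
darts-multiplicity-identity = solve-∀

darts-multiplicity-identity₂ : ∀ a → a + a ≡ + 2 * a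
darts-multiplicity-identity₂ = solve-∀

module Darts {n : ℕ} (T : Graph n) where

  open Trees T

  -- Edges with an orientation, to match `Swap.total`, which runs over ordered pairs and counts each
  -- edge twice.
  Dart : Set
  Dart = ∃[ x ] ∃[ y ] Adj T x y

  private
    dart : ∀ x y → Dec (Adj T x y) → List Dart
    dart x y (yes a) = (x , y , a) ∷ []
    dart x y (no _)  = []

  darts : List Dart
  darts = concatMap (λ x → concatMap (λ y → dart x y (adj? T x y)) (V n)) (V n)

  ∑-darts : ∀ (F : Fin n → Fin n → ℤ) → (∑[ e ∈ darts ] F (proj₁ e) (proj₁ (proj₂ e))) ≡ ∑[ x ∈ V n ] ∑[ y ∈ V n ] (τ x y * F x y)
  ∑-darts F = trans (∑-concatMap _ (V n) _) (∑-cong (V n) (λ x → trans (∑-concatMap _ (V n) _) (∑-cong (V n) (λ y → go x y (adj? T x y)))))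
    where
    go : ∀ x y (d : Dec (Adj T x y)) → ∑ (dart x y d) (λ e → F (proj₁ e) (proj₁ (proj₂ e))) ≡ ⟦ d ⟧ * F x y
    go x y (yes _) = trans (ℤ.+-identityʳ (F x y)) (sym (ℤ.*-identityˡ (F x y)))
    go x y (no _)  = refl

  ends₂ : Dart → List (Fin n)
  ends₂ (x , y , _) = x ∷ y ∷ []

  ends₂-distinct : ∀ e → Distinct (ends₂ e)
  ends₂-distinct (x , y , a) = (λ { (here refl) → irrefl T a }) ∷ (λ ()) ∷ []

  length-darts : + length darts ≡ ∑ (V n) deg
  length-darts = trans (length≡∑ darts) (trans (∑-darts (λ _ _ → 1ℤ)) (∑-cong (V n) (λ x → ∑-cong (V n) (λ y → ℤ.*-identityʳ (τ x y)))))

  darts-multiplicity : ∀ z → (∑[ e ∈ darts ] occurrences z (ends₂ e)) ≡ + 2 * deg z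
  darts-multiplicity z = trans (∑-darts (λ x y → ⟦ z Fin.≟ x ⟧ + (⟦ z Fin.≟ y ⟧ + 0ℤ)))
    (trans (∑-cong (V n) (λ x → trans (∑-cong (V n) (λ y → darts-multiplicity-identity (τ x y) ⟦ z Fin.≟ x ⟧ ⟦ z Fin.≟ y ⟧)) (∑-+ (V n) _ _)))
    (trans (∑-+ (V n) _ _) (trans (cong₂ _+_
      (trans (∑-cong (V n) (λ x → trans (∑-*ˡ (V n) ⟦ z Fin.≟ x ⟧ (τ x)) (cong (_* deg x) (flip z x)))) (∑-V-single z deg))
      (trans (∑-cong (V n) (λ x → trans (∑-cong (V n) (λ y → cong (_* τ x y) (flip z y))) (∑-V-single z (τ x)))) (∑-cong (V n) (λ x → τ-sym x z))))
      (darts-multiplicity-identity₂ (deg z)))))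
    where
    flip : ∀ z x → ⟦ z Fin.≟ x ⟧ ≡ ⟦ x Fin.≟ z ⟧
    flip z x = ⟦⟧-cong (z Fin.≟ x) (x Fin.≟ z) sym sym

-- Flagging an initial segment of a list

-- The flagged gadgets are those at which exchanges made only against colour i are allowed as well.
flag : ∀ {X : Set} → ℕ → List X → List (Bool × X)
flag k       []       = []
flag zero    (x ∷ xs) = (false , x) ∷ flag zero xs
flag (suc k) (x ∷ xs) = (true , x) ∷ flag k xs

flag-proj₂ : ∀ {X : Set} k (xs : List X) → map proj₂ (flag k xs) ≡ xs
flag-proj₂ k       []       = refl
flag-proj₂ zero    (x ∷ xs) = cong (x ∷_) (flag-proj₂ zero xs)
flag-proj₂ (suc k) (x ∷ xs) = cong (x ∷_) (flag-proj₂ k xs)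

∑-flag : ∀ {X : Set} k (xs : List X) → k ≤ length xs → (F : Bool → ℤ) (a b : ℤ) → F false ≡ a → F true ≡ a + b →
         (∑[ x ∈ flag k xs ] F (proj₁ x)) ≡ + length xs * a + + k * b
∑-flag zero    []       _ F a b p q = refl
∑-flag zero    (x ∷ xs) _ F a b p q = trans (cong₂ _+_ p (∑-flag zero xs z≤n F a b p q)) (e (+ length xs) a b)
  where
  e : ∀ l a b → a + (l * a + 0ℤ * b) ≡ (1ℤ + l) * a + 0ℤ * b
  e = solve-∀
∑-flag (suc k) (x ∷ xs) (s≤s h) F a b p q = trans (cong₂ _+_ q (∑-flag k xs h F a b p q)) (e (+ length xs) (+ k) a b)
  where
  e : ∀ l k a b → a + b + (l * a + k * b) ≡ (1ℤ + l) * a + (1ℤ + k) * b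
  e = solve-∀

-- Lower bounds for the totals of a family

total≥ : ∀ {n} k (φ : List (Fin n) → ℤ) b → (∀ v → Bounded (φ v) b) →
         ∑ (tuples n k) φ - b * stale {n} k [] ≤ᶻ ∑[ v ∈ tuples n k ] (⟦ fresh? {n} [] v ⟧ * φ v)
total≥ {n} k φ b h = subst (∑ (tuples n k) φ - b * stale {n} k [] ≤ᶻ_) refl
  (≤-by (subst (0ℤ ≤ᶻ_) (∑-- (tuples n k) _ _) (∑-≥0 (tuples n k) (λ v → gap (step v (fresh? {n} [] v)))))
    (trans (cong (λ s → T - (∑ (tuples n k) φ - s)) (sym (∑-*ˡ (tuples n k) b _)))
    (trans (e T (∑ (tuples n k) φ) S) (cong (λ s → S - s) (sym (∑-- (tuples n k) φ _))))))
  where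
  T = ∑[ v ∈ tuples n k ] (⟦ fresh? {n} [] v ⟧ * φ v)
  S = ∑[ v ∈ tuples n k ] (b * (1ℤ - ⟦ fresh? {n} [] v ⟧))
  e : ∀ T F S → T - (F - S) ≡ S - (F - T)
  e = solve-∀
  step : ∀ v (d : Dec (Fresh [] v)) → φ v - ⟦ d ⟧ * φ v ≤ᶻ b * (1ℤ - ⟦ d ⟧)
  step v (yes _) = ≡⇒≤ (e₁ (φ v) b)
    where
    e₁ : ∀ f b → f - 1ℤ * f ≡ b * (1ℤ - 1ℤ)
    e₁ = solve-∀
  step v (no _) = ≤-by (ceiling (h v)) (e₀ (φ v) b)
    where
    e₀ : ∀ f b → b * (1ℤ - 0ℤ) - (f - 0ℤ * f) ≡ b - f
    e₀ = solve-∀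

-- Before any exchange the surplus is at least -2 N/H: a loss of N/H by deviation, N/(2 H) by
-- imbalance of the colours, and N/(2 H) by tuples with repetitions, the latter since 32 H ≤ N.
X-arith : ∀ N H P X tot len W s → 0ℤ <ᶻ N → 0ℤ ≤ᶻ H → 0ℤ <ᶻ P → 0ℤ ≤ᶻ len → len ≤ᶻ + 2 * N →
  - (P * N) ≤ᶻ H * (P * X - tot) → len * (W - s) ≤ᶻ tot → - (N * N) ≤ᶻ + 8 * H * W → N * s ≤ᶻ N * (+ 4 * N) →
  + 32 * H ≤ᶻ N → N * N ≤ᶻ + 2 * P → - + 2 * N ≤ᶻ H * X
X-arith N H P X tot len W s 0<N 0≤H 0<P 0≤len len≤ h₁ h₂ h₃ h₄ h₅ h₆ = *-cancel (+ 8 * P) (0<* {+ 8} (+<+ (s≤s z≤n)) 0<P)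
  (≤-by (0≤+ 8 ⊗ gap h₁ ⊕ 0≤+ 8 ⊗ 0≤H ⊗ gap h₂ ⊕ 0≤len ⊗ (gap h₃ ⊕ 0≤+ 8 ⊗ 0≤H ⊗ gap (*-cancel N 0<N h₄) ⊕ <⇒0≤ 0<N ⊗ gap h₅)
         ⊕ 0≤+ 2 ⊗ (sq N) ⊗ gap len≤ ⊕ 0≤+ 4 ⊗ <⇒0≤ 0<N ⊗ gap h₆)
    (e N H P X tot len W s))
  where
  e : ∀ N H P X tot len W s → + 8 * P * (H * X) - + 8 * P * (- + 2 * N) ≡
      + 8 * (H * (P * X - tot) - - (P * N)) + + 8 * H * (tot - len * (W - s))
      + len * ((+ 8 * H * W - - (N * N)) + + 8 * H * (+ 4 * N - s) + N * (N - + 32 * H))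
      + + 2 * (N * N) * (+ 2 * N - len) + + 4 * N * (+ 2 * P - N * N)
  e = solve-∀

-- The mean gain is at least m/c, of which tuples with repetitions destroy at most half by `8cs≤p`.
-- Multiplied by H = h c, the remainder is h m/2 ≥ 20 N, and the deviation takes N from it.
G-arith : ∀ N H h c P G tot m Ψ s p → 0ℤ <ᶻ N → 0ℤ <ᶻ c → 0ℤ <ᶻ P → 0ℤ ≤ᶻ m → 0ℤ ≤ᶻ H → H ≡ h * c → + 9 ≤ᶻ h →
  - (P * N) ≤ᶻ H * (P * G - tot) → Ψ - m * (+ 4 * s) ≤ᶻ tot → p * m ≤ᶻ c * Ψ → N * s ≤ᶻ + 36 * p → 0ℤ ≤ᶻ p →
  + 32 * H ≤ᶻ N → P ≤ᶻ p → + 40 * N ≤ᶻ h * m → + 19 * N ≤ᶻ H * G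
G-arith N H h c P G tot m Ψ s p 0<N 0<c 0<P 0≤m 0≤H H≡ 9≤h h₁ h₂ h₃ h₄ 0≤p h₅ h₆ h₇ = *-cancel (+ 2 * c * P) (0<* (0<* {+ 2} (+<+ (s≤s z≤n)) 0<c) 0<P)
  (≤-by (0≤+ 2 ⊗ 0≤c ⊗ gap h₁ ⊕ 0≤+ 2 ⊗ 0≤c ⊗ 0≤H ⊗ gap h₂ ⊕ 0≤+ 2 ⊗ 0≤H ⊗ gap h₃ ⊕ 0≤H ⊗ 0≤m ⊗ gap 8cs≤p ⊕ 0≤H ⊗ 0≤m ⊗ gap h₆
         ⊕ <⇒0≤ 0<P ⊗ gap 40cN≤Hm)
    (e N H c P G tot m Ψ s p))
  where
  0≤c = <⇒0≤ 0<c
  40cN≤Hm : + 40 * c * N ≤ᶻ H * m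
  40cN≤Hm = ≤-by (0≤c ⊗ gap h₇) (trans (cong (λ x → x * m - + 40 * c * N) H≡) (e₂ h c m N))
    where
    e₂ : ∀ h c m N → h * c * m - + 40 * c * N ≡ c * (h * m - + 40 * N)
    e₂ = solve-∀
  8cs≤p : + 8 * c * s ≤ᶻ p
  8cs≤p = *-cancel N 0<N (≤-by (0≤+ 8 ⊗ 0≤c ⊗ gap h₄ ⊕ 0≤p ⊗ (gap (subst (λ x → + 32 * x ≤ᶻ N) H≡ h₅) ⊕ 0≤+ 32 ⊗ (gap 9≤h ⊗ 0≤c))) (e₁ N h c s p))
    where
    e₁ : ∀ N h c s p → N * p - N * (+ 8 * c * s) ≡ + 8 * c * (+ 36 * p - N * s) + p * ((N - + 32 * (h * c)) + + 32 * ((h - + 9) * c))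
    e₁ = solve-∀
  e : ∀ N H c P G tot m Ψ s p → + 2 * c * P * (H * G) - + 2 * c * P * (+ 19 * N) ≡
      + 2 * c * (H * (P * G - tot) - - (P * N)) + + 2 * c * H * (tot - (Ψ - m * (+ 4 * s)))
      + + 2 * H * (c * Ψ - p * m) + H * m * (p - + 8 * c * s) + H * m * (p - P)
      + P * (H * m - + 40 * c * N)
  e = solve-∀

-- A good permutation and the exchanges on it

20L≤8H-identity : ∀ h c L → + 8 * (h * c) - + 20 * L ≡ + 8 * (h - + 9) * c + + 52 * c + + 20 * (c - L)
20L≤8H-identity = solve-∀

L≤c-identity : ∀ u R L → u * R * (L * L) - L ≡ L * (u * R * L - 1ℤ)
L≤c-identity = solve-∀

20L≤n-identity : ∀ N H → N - + 8 * H ≡ (N - + 32 * H) + + 24 * H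
20L≤n-identity = solve-∀

balance′-identity : ∀ l h x y m → h * (l * y + m) - h * (l * x) ≡ l * (h * y + m - h * x) + m * (h - l)
balance′-identity = solve-∀

m≤n-identity : ∀ N m → N - m ≡ (N - + 40 * m) + + 39 * m
m≤n-identity = solve-∀

m≤2n-identity : ∀ N m → + 2 * N - m ≡ (N - m) + N
m≤2n-identity = solve-∀

q<Q-identity : ∀ s k D Δ → + 2 * s * (+ 2 * (1ℤ + Δ)) + + 16 * (s * s) + 1ℤ - (+ 2 * k * D + + 16 * (k * k) + 1ℤ) ≡
     + 2 * (s - k) * (+ 2 * (1ℤ + Δ)) + + 2 * k * (+ 2 * (1ℤ + Δ) - D) + + 16 * ((s - k) * (s + k))
q<Q-identity = solve-∀

huge-identity : ∀ N h R b f q Q → N - (1ℤ + + 8 * h * R * b * q) ≡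
    (N - + 8 * (h * R) * f * Q) + + 8 * (h * R) * f * (Q - (q + 1ℤ)) + + 8 * (h * R) * (f - b) * q + (+ 8 * (h * R) * f - 1ℤ)
huge-identity = solve-∀

w-bounded-identity : ∀ x y → (1ℤ - y) + x ≡ 1ℤ + (x - y)
w-bounded-identity = solve-∀

w-bounded-identity₂ : ∀ x y → (1ℤ - x) + y ≡ 1ℤ - (x - y)
w-bounded-identity₂ = solve-∀

γ-bounded-identity : ∀ g h → (g - - + 2) + (+ 2 - h) ≡ + 4 + (g - h)
γ-bounded-identity = solve-∀

γ-bounded-identity₂ : ∀ g h → (+ 2 - g) + (h - - + 2) ≡ + 4 - (g - h)
γ-bounded-identity₂ = solve-∀

gadget-spread-identity : ∀ Δ → + 2 * (1ℤ + Δ) - (1ℤ + Δ) ≡ 1ℤ + Δ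
gadget-spread-identity = solve-∀

surplus-bound-identity : ∀ H x y m → + 8 * H * (x - y) - - m ≡ + 8 * H * x + m - + 8 * H * y
surplus-bound-identity = solve-∀

surplus-bound-identity₂ : ∀ N → + 2 * + 2 * (N * (N * 1ℤ)) ≡ N * (+ 4 * N)
surplus-bound-identity₂ = solve-∀

surplus-bound-identity₃ : ∀ N → N * N ≡ N * (N * 1ℤ)
surplus-bound-identity₃ = solve-∀

gains-bound-identity : ∀ k p → + 36 * p - k * k * p ≡ (+ 6 - k) * (+ 6 + k) * p
gains-bound-identity = solve-∀

result-identity : ∀ H N X G → H * (X + + 2 * G) - + 36 * N ≡ (H * X - - + 2 * N) + + 2 * (H * G - + 19 * N)
result-identity = solve-∀

module Assembly {n r : ℕ} (0<n : 0ℤ <ᶻ + n) (C : Fin n → Fin n → Fin r) (C-sym : ∀ a b → C a b ≡ C b a) (one : Fin r)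
  (T : Graph n) (acyclic : ¬ Cycle T) (connected : Connected T) (u L t m : ℕ) (h H Δ Q : ℤ) (u≡20 : u ≡ 20)
  (3≤r : + 3 ≤ᶻ + r) (2≤L : + 2 ≤ᶻ + L) (r≤L : + r ≤ᶻ + L) (1≤t : 1 ≤ t) (t≤m : t ≤ m)
  (t≡ : + t ≡ + 16 * (+ u * + u) * (+ r * + r * (+ r * + r)))
  (L-large : + 2 * + t * (+ r * + r) + + r * + r ≤ᶻ + L * + L)
  (H≡ : H ≡ h * (+ 8 * (+ u * + u) * (+ r * + r) * (+ L * + L))) (9≤h : + 9 ≤ᶻ h)
  (40m≤n : + 40 * + m ≤ᶻ + n) (40n≤hm : + 40 * + n ≤ᶻ h * + m)
  (deg≤Δ : ∀ x → Trees.deg T x ≤ᶻ Δ) (40Δ≤n : + 40 * Δ ≤ᶻ + n)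
  (Q-large : + 2 * + 6 * (+ 2 * (1ℤ + Δ)) + + 16 * (+ 6 * + 6) + 1ℤ ≤ᶻ Q)
  (n-huge : + 8 * (H * H * + r) * (+ 4 * + 4) * Q ≤ᶻ + n)
  (H≤n : + 32 * H ≤ᶻ + n) (144≤n : + 144 ≤ᶻ + n)
  (lo : + n * + n ≤ᶻ + 2 * + r * Colours.count C C-sym one)
  (hi : + 2 * Colours.count C C-sym one ≤ᶻ + n * + n)
  (balance : ∀ i j → + 8 * H * Colours.count C C-sym i ≤ᶻ + 8 * H * Colours.count C C-sym j + + n * + n)
  (standard : ∀ i → i ≢ one → ∀ S → ∣ S ∣ ≡ ∣ ∁ S ∣ ⊎ ∣ S ∣ ≡ suc ∣ ∁ S ∣ →
     + n * + n ≤ᶻ + L * Colours.miscoloured C C-sym one S ⊎ + n * + n ≤ᶻ + L * Colours.miscoloured C C-sym i (∁ S))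
  where

  open Colours C C-sym using (χ; count; w; w-sym)
  open Gains C C-sym one using (G; γ; σ₁; σ₂; G-≤2; G-≥-2; χ≥0; χ≤1)
  open Tuples C using (∑ʷ; ∑ʷ-+; ∑-tuples₂; lift; lift-bounded; ∑-lift; weight; weight≥0; weight≤scale; weight-sym; scale; scale≥0; scale-arity; scale≤weight)
  open Trees T using (deg; τ≥0; ofKind)
  open Gadgets T using (Gadget; tuple; tuple-length; tuple-distinct; Independent; multiplicity≤)
  open Darts T

  private
    N = + n
    R = + r
    c = + 8 * (+ u * + u) * (R * R) * (+ L * + L)

    1≤r : 1 ≤ r
    1≤r = ℤ.drop‿+≤+ (ℤ.≤-trans (+≤+ (s≤s z≤n)) 3≤r)

    0<R : 0ℤ <ᶻ R
    0<R = +<+ 1≤r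

    0<L : 0ℤ <ᶻ + L
    0<L = ℤ.<-≤-trans (+<+ (s≤s z≤n)) 2≤L

    0<8uu : 0ℤ <ᶻ + 8 * (+ u * + u)
    0<8uu = subst (λ v → 0ℤ <ᶻ + 8 * (+ v * + v)) (sym u≡20) (+<+ (s≤s z≤n))

    0<c : 0ℤ <ᶻ c
    0<c = 0<* (0<* 0<8uu (0<* 0<R 0<R)) (0<* 0<L 0<L)

    0<H : 0ℤ <ᶻ H
    0<H = subst (0ℤ <ᶻ_) (sym H≡) (0<* {h} {c} (ℤ.<-≤-trans (+<+ (s≤s z≤n)) 9≤h) 0<c)

    0≤H : 0ℤ ≤ᶻ H
    0≤H = <⇒0≤ 0<H

    0≤Δ : 0ℤ ≤ᶻ Δ
    0≤Δ = go n 0<n deg≤Δ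
      where
      go : ∀ k → 0ℤ <ᶻ + k → ((x : Fin n) → deg x ≤ᶻ Δ) → 0ℤ ≤ᶻ Δ
      go k _ h = ℤ.≤-trans (∑-≥0 (V n) (τ≥0 x₀)) (h x₀)
        where
        x₀ : Fin n
        x₀ = Fin.fromℕ< (ℤ.drop‿+<+ 0<n)

    20L≤8H : + 20 * + L ≤ᶻ + 8 * H
    20L≤8H = ≤-by (0≤+ 8 ⊗ gap 9≤h ⊗ <⇒0≤ 0<c ⊕ 0≤+ 52 ⊗ <⇒0≤ 0<c ⊕ 0≤+ 20 ⊗ gap L≤c)
        (trans (cong (λ x → + 8 * x - + 20 * + L) H≡) (20L≤8H-identity h c (+ L)))
      where
      1≤uRRL : 1ℤ ≤ᶻ + 8 * (+ u * + u) * (R * R) * + L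
      1≤uRRL = ℤ.i<j⇒suc[i]≤j (0<* (0<* 0<8uu (0<* 0<R 0<R)) 0<L)
      L≤c : + L ≤ᶻ c
      L≤c = ≤-by (0≤+ L ⊗ gap 1≤uRRL) (L≤c-identity (+ 8 * (+ u * + u)) (R * R) (+ L))

    20L≤n : + 20 * + L ≤ᶻ N
    20L≤n = ℤ.≤-trans 20L≤8H (≤-by (gap H≤n ⊕ 0≤+ 24 ⊗ 0≤H) (20L≤n-identity N H))

    -- The colours are balanced to within N²/(8 H), which is finer than the N²/(20 L) needed against
    -- standardness.
    balance′ : ∀ i j → + 20 * + L * count i ≤ᶻ + 20 * + L * count j + N * N
    balance′ i j = *-cancel (+ 8 * H) (0<* {+ 8} (+<+ (s≤s z≤n)) 0<H)
      (≤-by (0≤+ 20 ⊗ 0≤+ L ⊗ gap (balance i j) ⊕ 0≤+ n ⊗ 0≤+ n ⊗ gap 20L≤8H) (balance′-identity (+ 20 * + L) (+ 8 * H) (count i) (count j) (N * N)))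

    U₁ : N * N * (N * N) ≤ᶻ + 2 * ((+ u * R) * (+ u * R)) * unbalancedCount (χ one)
    U₁ = subst (λ v → N * N * (N * N) ≤ᶻ + 2 * ((+ v * R) * (+ v * R)) * unbalancedCount (χ one)) (sym u≡20) $
      ℤ.<⇒≤ (ℤ.≰⇒> (ManyUnbalanced.many-unbalanced-one 0<n C C-sym one 3≤r lo hi))

    Uᵢ : ∀ i (i≢ : i ≢ one) → N * N * (N * N) ≤ᶻ + 2 * ((+ u * + L) * (+ u * + L)) * unbalancedCount (w one i)
    Uᵢ i i≢ = subst (λ v → N * N * (N * N) ≤ᶻ + 2 * ((+ v * + L) * (+ v * + L)) * unbalancedCount (w one i)) (sym u≡20) $
      ℤ.<⇒≤ (ℤ.≰⇒> (ManyUnbalanced.Versus.Contradiction.many-unbalanced 0<n C C-sym one i i≢ L 2≤L r≤L 20L≤n lo (balance′ one i) (balance′ i one) (standard i i≢)))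

  Result : Set
  Result = Σ[ π ∈ Permutation′ n ] (∀ j → j ≢ one → + 36 * N ≤ᶻ H * Swap.total T (w one j) (w-sym one j) ⟪ π ⟫)

  α : Kind → Fin r → ℤ
  α d j = ∑ʷ (weight d) (λ a b p q → σ₁ a b p q * γ j a b p q)

  δ : Kind → Fin r → Fin r → ℤ
  δ d i j = ∑ʷ (weight d) (λ a b p q → σ₂ i a b p q * γ j a b p q)

  module WithGadgets (d : Kind) (gs : List (Gadget d)) (len : length gs ≡ m) (ind : Independent gs)
    (i : Fin r) (m₂ : ℕ) (m₂≤m : m₂ ≤ m)
    (gain : ∀ j → j ≢ one → scale d * (N * N * (N * N)) * + m ≤ᶻ c * (+ m * α d j + + m₂ * δ d i j)) where

    open Swaps C C-sym one i T using (φ; ω; ω-values; surplus; improve-all)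

    k = arity d

    k≤6 : + k ≤ᶻ + 6
    k≤6 = go d
      where
      go : ∀ d → + arity d ≤ᶻ + 6
      go leaf = +≤+ (s≤s (s≤s (s≤s (s≤s z≤n))))
      go path = ℤ.≤-refl

    flagged : List (Bool × Gadget d)
    flagged = flag m₂ gs

    ∑-flagged : ∀ (F : Gadget d → ℤ) → (∑[ g ∈ flagged ] F (proj₂ g)) ≡ ∑ gs F
    ∑-flagged F = trans (sym (∑-map proj₂ flagged F)) (cong (λ l → ∑ l F) (flag-proj₂ m₂ gs))

    length-flagged : + length flagged ≡ + m
    length-flagged = trans (length≡∑ flagged) (trans (∑-flagged (λ _ → 1ℤ)) (trans (sym (length≡∑ gs)) (cong +_ len)))

    m≤n : + m ≤ᶻ N
    m≤n = ≤-by (gap 40m≤n ⊕ 0≤+ 39 ⊗ 0≤+ m) (m≤n-identity N (+ m))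

    m≤2n : + length flagged ≤ᶻ + 2 * N
    m≤2n = subst (_≤ᶻ + 2 * N) (sym length-flagged) (≤-by (gap m≤n ⊕ 0≤+ n) (m≤2n-identity N (+ m)))

    k-large : + 2 * (+ k * (+ k + + k)) ≤ᶻ N
    k-large = go d
      where
      go : ∀ d → + 2 * (+ arity d * (+ arity d + + arity d)) ≤ᶻ N
      go leaf = ℤ.≤-trans (+≤+ (ℕ.m≤m+n 64 80)) 144≤n
      go path = 144≤n

    -- One condition on n covers both families: `Q` is built from the arity 6 and the multiplicity
    -- bound 2 (1 + Δ), and 16 bounds the square of either bound on the statistic.
    huge : ∀ k b D → 0ℤ ≤ᶻ k → k ≤ᶻ + 6 → b ≤ᶻ + 4 * + 4 → 0ℤ ≤ᶻ D → D ≤ᶻ + 2 * (1ℤ + Δ) →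
           + 8 * (H * H) * R * b * (+ 2 * k * D + + 16 * (k * k)) <ᶻ N
    huge k b D 0≤k k≤6 b≤ 0≤D D≤ = ℤ.suc[i]≤j⇒i<j (≤-by
        (gap n-huge ⊕ 0≤+ 8 ⊗ y≥0 ⊗ 0≤+ 16 ⊗ gap q<Q ⊕ 0≤+ 8 ⊗ y≥0 ⊗ gap b≤ ⊗ q≥0 ⊕ gap 1≤8y16)
        (huge-identity N (H * H) R b (+ 4 * + 4) q Q))
      where
      q = + 2 * k * D + + 16 * (k * k)
      y≥0 = 0≤H ⊗ 0≤H ⊗ 0≤+ r
      q≥0 : 0ℤ ≤ᶻ q
      q≥0 = 0≤+ 2 ⊗ 0≤k ⊗ 0≤D ⊕ 0≤+ 16 ⊗ (0≤k ⊗ 0≤k)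
      1≤8y16 : 1ℤ ≤ᶻ + 8 * (H * H * R) * (+ 4 * + 4)
      1≤8y16 = ℤ.i<j⇒suc[i]≤j (0<* {+ 8 * (H * H * R)} {+ 4 * + 4} (0<* {+ 8} (+<+ (s≤s z≤n)) (0<* (0<* 0<H 0<H) 0<R)) (+<+ (s≤s z≤n)))
      q<Q : q + 1ℤ ≤ᶻ Q
      q<Q = ℤ.≤-trans (≤-by (0≤+ 2 ⊗ gap k≤6 ⊗ (0≤+ 2 ⊗ (0≤+ 1 ⊕ 0≤Δ)) ⊕ 0≤+ 2 ⊗ 0≤k ⊗ gap D≤ ⊕ 0≤+ 16 ⊗ (gap k≤6 ⊗ (0≤+ 6 ⊕ 0≤k))) (q<Q-identity (+ 6) k D Δ)) Q-large

    w-bounded : ∀ j a b → Bounded (w one j a b) 1ℤ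
    w-bounded j a b = subst (0ℤ ≤ᶻ_) (w-bounded-identity (χ one a b) (χ j a b)) (gap (χ≤1 j a b) ⊕ χ≥0 one a b)
                    ∣ subst (0ℤ ≤ᶻ_) (w-bounded-identity₂ (χ one a b) (χ j a b)) (gap (χ≤1 one a b) ⊕ χ≥0 j a b)

    pairWeight : Fin r → List (Fin n) → ℤ
    pairWeight j (a ∷ b ∷ []) = w one j a b
    pairWeight j _            = 0ℤ

    pairWeight-bounded : ∀ j v → Bounded (pairWeight j v) 1ℤ
    pairWeight-bounded j []              = bounded-0 1ℤ (0≤+ 1)
    pairWeight-bounded j (_ ∷ [])        = bounded-0 1ℤ (0≤+ 1)
    pairWeight-bounded j (a ∷ b ∷ [])    = w-bounded j a b
    pairWeight-bounded j (_ ∷ _ ∷ _ ∷ _) = bounded-0 1ℤ (0≤+ 1)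

    γ-bounded : ∀ j a b p q → Bounded (γ j a b p q) (+ 4)
    γ-bounded j a b p q = subst (0ℤ ≤ᶻ_) (γ-bounded-identity (G one a b p q) (G j a b p q)) (gap (G-≥-2 one a b p q) ⊕ gap (G-≤2 j a b p q))
                        ∣ subst (0ℤ ≤ᶻ_) (γ-bounded-identity₂ (G one a b p q) (G j a b p q)) (gap (G-≤2 one a b p q) ⊕ gap (G-≥-2 j a b p q))

    φ-bounded : ∀ s j v → Bounded (φ d s j v) (+ 4)
    φ-bounded s j = lift-bounded d _ (0≤+ 4) (λ a b p q → go a b p q (ω-values s a b p q))
      where
      go : ∀ a b p q → ω s a b p q ≡ 0ℤ ⊎ ω s a b p q ≡ 1ℤ → Bounded (ω s a b p q * γ j a b p q) (+ 4)
      go a b p q (inj₁ eq) = subst (λ x → Bounded (x * γ j a b p q) (+ 4)) (sym eq) (bounded-0 (+ 4) (0≤+ 4))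
      go a b p q (inj₂ eq) = subst (λ x → Bounded (x * γ j a b p q) (+ 4)) (sym eq)
        (subst (λ x → Bounded x (+ 4)) (sym (ℤ.*-identityˡ (γ j a b p q))) (γ-bounded j a b p q))

    k₂-large : + 2 * (+ 2 * (+ 2 + + 2)) ≤ᶻ N
    k₂-large = ℤ.≤-trans (+≤+ (ℕ.m≤m+n 16 128)) 144≤n

    module FX = FreshCount n 2 0<n k₂-large
    module FG = FreshCount n k 0<n k-large

    dartTotal gadgetTotal : Fin r → ℤ
    dartTotal j   = ∑[ x ∈ darts ] ∑[ v ∈ tuples n 2 ] (⟦ fresh? {n} [] v ⟧ * pairWeight j v)
    gadgetTotal j = ∑[ g ∈ flagged ] ∑[ v ∈ tuples n k ] (⟦ fresh? {n} [] v ⟧ * φ d (proj₁ g) j v)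

    dartSum gains : Fin r → (Fin n → Fin n) → ℤ
    dartSum j f = ∑[ x ∈ darts ] pairWeight j (map f (ends₂ x))
    gains j f   = ∑[ g ∈ flagged ] φ d (proj₁ g) j (map f (tuple (proj₂ g)))

    Spread : ℤ → (Fin r → (Fin n → Fin n) → ℤ) → (Fin r → ℤ) → Set
    Spread P Z total = Σ[ σ ∈ (Fin (n !) → ℤ) ] ((∀ i → 0ℤ ≤ᶻ σ i) × + 2 * ∑ (V (n !)) σ <ᶻ + (n !) * (P * N * (P * N)) ×
      (∀ i → σ i <ᶻ P * N * (P * N) → ∀ j → - (P * N) ≤ᶻ H * (P * Z j ⟪ decode n i ⟫ - total j)))

    dart-spread : Spread FX.P dartSum dartTotal
    dart-spread = Family.Simultaneous.summary n 2 0<n k₂-large darts ends₂ 1ℤ (+ 2 * Δ) (0≤+ 1)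
      (λ _ → refl) ends₂-distinct (subst (_≤ᶻ + 2 * N) (sym length-darts) (Trees.Acyclic.∑-deg≤ T acyclic)) (0≤+ 2 ⊗ 0≤Δ)
      (λ z → subst (_≤ᶻ + 2 * Δ) (sym (darts-multiplicity z)) (*-monoˡ (+ 2) (0≤+ 2) (deg≤Δ z)))
      r (λ j _ → pairWeight j) (λ j _ → pairWeight-bounded j) H 0≤H
      (huge (+ 2) (1ℤ * 1ℤ) (+ 2 * Δ) (0≤+ 2) (+≤+ (s≤s (s≤s z≤n))) (+≤+ (s≤s z≤n)) (0≤+ 2 ⊗ 0≤Δ) (*-monoˡ (+ 2) (0≤+ 2) (ℤ.i≤suc[i] Δ)))

    gadget-spread : Spread FG.P gains gadgetTotal
    gadget-spread = Family.Simultaneous.summary n k 0<n k-large flagged (λ g → tuple (proj₂ g)) (+ 4) (1ℤ + Δ) (0≤+ 4)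
      (λ g → tuple-length (proj₂ g)) (λ g → tuple-distinct (proj₂ g)) m≤2n (0≤+ 1 ⊕ 0≤Δ)
      (λ z → ℤ.≤-trans (≡⇒≤ (∑-flagged (λ g → occurrences z (tuple g)))) (ℤ.≤-trans (multiplicity≤ ind z) (ℤ.+-monoʳ-≤ 1ℤ (deg≤Δ z))))
      r (λ j g → φ d (proj₁ g) j) (λ j g → φ-bounded (proj₁ g) j) H 0≤H
      (huge (+ k) (+ 4 * + 4) (1ℤ + Δ) (0≤+ k) k≤6 ℤ.≤-refl (0≤+ 1 ⊕ 0≤Δ) (≤-by (0≤+ 1 ⊕ 0≤Δ) (gadget-spread-identity Δ)))

    surplus-bound : ∀ π j → - (FX.P * N) ≤ᶻ H * (FX.P * dartSum j ⟪ π ⟫ - dartTotal j) → - + 2 * N ≤ᶻ H * surplus j ⟪ π ⟫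
    surplus-bound π j dev = X-arith N H FX.P (surplus j ⟪ π ⟫) (dartTotal j) (+ length darts) (count one - count j) FX.stale₀
      0<n 0≤H FX.0<P (0≤+ (length darts)) (subst (_≤ᶻ + 2 * N) (sym length-darts) (Trees.Acyclic.∑-deg≤ T acyclic))
      (subst (λ s → - (FX.P * N) ≤ᶻ H * (FX.P * s - dartTotal j)) (∑-darts (λ x y → w one j (⟪ π ⟫ x) (⟪ π ⟫ y))) dev)
      (ℤ.≤-trans (≡⇒≤ (sym (∑-const darts (count one - count j - FX.stale₀)))) (∑-mono darts (λ _ → each)))
      (≤-by (gap (balance j one)) (surplus-bound-identity H (count one) (count j) (N * N)))
      (ℤ.≤-trans FX.n*stale₀≤ (≡⇒≤ (surplus-bound-identity₂ N)))
      H≤n (ℤ.≤-trans (≡⇒≤ (surplus-bound-identity₃ N)) FX.2P≥)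
      where
      all : ∑ (tuples n 2) (pairWeight j) ≡ count one - count j
      all = trans (∑-tuples₂ 0 (pairWeight j)) (trans (∑-cong (V n) (λ a → trans (∑-cong (V n) (λ b → ℤ.+-identityʳ (w one j a b))) (∑-- (V n) _ _))) (∑-- (V n) _ _))
      each : count one - count j - FX.stale₀ ≤ᶻ ∑[ v ∈ tuples n 2 ] (⟦ fresh? {n} [] v ⟧ * pairWeight j v)
      each = subst (_≤ᶻ ∑[ v ∈ tuples n 2 ] (⟦ fresh? {n} [] v ⟧ * pairWeight j v)) (cong₂ _-_ all (ℤ.*-identityˡ FX.stale₀))
        (total≥ 2 (pairWeight j) 1ℤ (pairWeight-bounded j))

    gains-bound : ∀ π j → j ≢ one → - (FG.P * N) ≤ᶻ H * (FG.P * gains j ⟪ π ⟫ - gadgetTotal j) → + 19 * N ≤ᶻ H * gains j ⟪ π ⟫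
    gains-bound π j j≢ dev = G-arith N H h c FG.P (gains j ⟪ π ⟫) (gadgetTotal j) (+ m) Ψ FG.stale₀ (n ↑ k) 0<n 0<c FG.0<P (0≤+ m) 0≤H H≡ 9≤h dev
      (ℤ.≤-trans (≡⇒≤ Ψ≡) (∑-mono flagged (λ g → total≥ k (φ d (proj₁ g) j) (+ 4) (φ-bounded (proj₁ g) j))))
      (subst (λ s → s * + m ≤ᶻ c * Ψ) (scale-arity d) (gain j j≢))
      (ℤ.≤-trans FG.n*stale₀≤ (≤-by (gap k≤6 ⊗ (0≤+ 6 ⊕ 0≤+ k) ⊗ 0≤↑ n k) (gains-bound-identity (+ k) (n ↑ k))))
      (0≤↑ n k) H≤n FG.P≤ 40n≤hm
      where
      Ψ : ℤ
      Ψ = + m * α d j + + m₂ * δ d i j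
      F : Bool → ℤ
      F s = ∑ (tuples n k) (φ d s j)
      F-true : F true ≡ α d j + δ d i j
      F-true = trans (∑-lift d _) (trans (∑-cong (V n) (λ a → ∑-cong (V n) (λ b → cong (weight d a b *_)
        (∑-cong (V n) (λ p → ∑-cong (V n) (λ q → ℤ.*-distribʳ-+ (γ j a b p q) (σ₁ a b p q) (σ₂ i a b p q))))))) (∑ʷ-+ (weight d) _ _))
      Ψ≡ : Ψ - + m * (+ 4 * FG.stale₀) ≡ ∑[ g ∈ flagged ] (F (proj₁ g) - + 4 * FG.stale₀)
      Ψ≡ = sym (trans (∑-- flagged _ _) (cong₂ _-_
        (trans (∑-flag m₂ gs (subst (m₂ ≤_) (sym len) m₂≤m) F (α d j) (δ d i j) (∑-lift d _) F-true) (cong (λ l → + l * α d j + + m₂ * δ d i j) len))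
        (trans (∑-const flagged (+ 4 * FG.stale₀)) (cong (_* (+ 4 * FG.stale₀)) length-flagged))))

    σX σG : Fin (n !) → ℤ
    σX = proj₁ dart-spread
    σG = proj₁ gadget-spread

    good : ∃[ x ] (σX x <ᶻ FX.P * N * (FX.P * N) × σG x <ᶻ FG.P * N * (FG.P * N))
    good = two-averages (V (n !)) σX σG (FX.P * N * (FX.P * N)) (FG.P * N * (FG.P * N)) (proj₁ (proj₂ dart-spread)) (proj₁ (proj₂ gadget-spread))
      (0<* (0<* FX.0<P 0<n) (0<* FX.0<P 0<n)) (0<* (0<* FG.0<P 0<n) (0<* FG.0<P 0<n))
      (subst (λ l → + 2 * ∑ (V (n !)) σX <ᶻ l * (FX.P * N * (FX.P * N))) (sym (+length-V (n !))) (proj₁ (proj₂ (proj₂ dart-spread))))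
      (subst (λ l → + 2 * ∑ (V (n !)) σG <ᶻ l * (FG.P * N * (FG.P * N))) (sym (+length-V (n !))) (proj₁ (proj₂ (proj₂ gadget-spread))))

    result : Result
    result = finish good
      where
      finish : ∃[ x ] (σX x <ᶻ FX.P * N * (FX.P * N) × σG x <ᶻ FG.P * N * (FG.P * N)) → Result
      finish (x , ltX , ltG) = conclude (improve-all flagged (subst Independent (sym (flag-proj₂ m₂ gs)) ind) π)
        where
        π = decode n x
        conclude : Σ[ π′ ∈ Permutation′ n ] (∀ j → surplus j ⟪ π′ ⟫ ≡ surplus j ⟪ π ⟫ + + 2 * gains j ⟪ π ⟫) → Result
        -- 36 = 2 · 19 - 2: each gain enters twice because `surplus` counts ordered pairs.
        conclude (π′ , eq) = π′ , λ j j≢ → ≤-by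
          (gap (surplus-bound π j (proj₂ (proj₂ (proj₂ dart-spread)) x ltX j)) ⊕ 0≤+ 2 ⊗ gap (gains-bound π j j≢ (proj₂ (proj₂ (proj₂ gadget-spread)) x ltG j)))
          (trans (cong (λ s → H * s - + 36 * N) (eq j)) (result-identity H N (surplus j ⟪ π ⟫) (gains j ⟪ π ⟫)))

  result : Result
  result = kinds (Trees.low-degree-vertices T acyclic connected (ℕ.≤-trans (ℕ.m≤m+n 2 142) (ℤ.drop‿+≤+ 144≤n)))
    where
    kinds : ∃[ d ] (N ≤ᶻ + 4 * ofKind d) → Result
    kinds (d , many) = select (Gadgets.Greedy.greedy T Δ deg≤Δ 40Δ≤n d many m 40m≤n)
      where
      select : Σ[ gs ∈ List (Gadget d) ] (length gs ≡ m × Independent gs) → Result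
      select (gs , len , ind) = finish (Policy.Weighted.Select.selection C C-sym one
          (weight d) (scale d) (weight≥0 d) (weight-sym d) (scale≤weight 1≤r d) (weight≤scale d) (scale≥0 d)
          u L m t 1≤r 1≤t t≤m t≡ L-large U₁ Uᵢ)
        where
        finish : ∃[ i ] ∃[ m₂ ] (m₂ ≤ m × (∀ j → j ≢ one → scale d * (N * N * (N * N)) * + m ≤ᶻ c * (+ m * α d j + + m₂ * δ d i j))) → Result
        finish (i , m₂ , m₂≤m , gain) = WithGadgets.result d gs len ind i m₂ m₂≤m gain

open import Defs

-- Edge counts as sums over ordered pairs

⟦_⟧ᴳ : Graph n → Fin n → Fin n → ℤ
⟦ G ⟧ᴳ u v = ⟦ adj? G u v ⟧

module _ (G : Graph n) (s : Fin n → Fin n → ℤ) (s-sym : ∀ {u v} → Adj G u v → s u v ≡ s v u) where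

  private
    listed : ∀ u v → Dec (u Fin.< v × Adj G u v)
    listed u v = (u Fin.<? v) ×-dec adj? G u v

    both : ∀ u v → ⟦ listed u v ⟧ * s u v + ⟦ listed v u ⟧ * s v u ≡ ⟦ G ⟧ᴳ u v * s u v
    both u v = go (adj? G u v)
      where
      zero-case : ¬ Adj G u v → ⟦ listed u v ⟧ * s u v + ⟦ listed v u ⟧ * s v u ≡ 0ℤ
      zero-case ¬a = cong₂ (λ x y → x * s u v + y * s v u) (⟦⟧-no (listed u v) (¬a ∘ proj₂)) (⟦⟧-no (listed v u) (¬a ∘ adj-sym G ∘ proj₂))
      go : (d : Dec (Adj G u v)) → ⟦ listed u v ⟧ * s u v + ⟦ listed v u ⟧ * s v u ≡ ⟦ d ⟧ * s u v
      go (no ¬a) = zero-case ¬a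
      go (yes a) with Fin.<-cmp u v
      ... | tri< u<v _ v≮u = trans (cong₂ (λ x y → x * s u v + y * s v u) (⟦⟧-yes (listed u v) (u<v , a)) (⟦⟧-no (listed v u) (v≮u ∘ proj₁))) (ℤ.+-identityʳ _)
      ... | tri≈ _ refl _ = ⊥-elim (irrefl G a)
      ... | tri> u≮v _ v<u = trans (cong₂ (λ x y → x * s u v + y * s v u) (⟦⟧-no (listed u v) (u≮v ∘ proj₁)) (⟦⟧-yes (listed v u) (v<u , adj-sym G a)))
              (trans (ℤ.+-identityˡ _) (cong (1ℤ *_) (sym (s-sym a))))

  ∑-edges : + 2 * ∑ (edges G) (uncurry s) ≡ ∑[ u ∈ V n ] ∑[ v ∈ V n ] (⟦ G ⟧ᴳ u v * s u v)
  ∑-edges = begin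
    + 2 * ∑ (edges G) (uncurry s)
      ≡⟨ cong (+ 2 *_) (trans (∑-filter (λ (u , v) → listed u v) (cartesianProduct (V n) (V n)) (uncurry s)) (∑-product _,_ (V n) (V n) _)) ⟩
    + 2 * E
      ≡⟨ e E ⟩
    E + E
      ≡⟨ cong (λ x → E + x) (∑-comm (V n) (V n) _) ⟩
    E + (∑[ u ∈ V n ] ∑[ v ∈ V n ] (⟦ listed v u ⟧ * s v u))
      ≡⟨ sym (∑∑-split (V n) _ _) ⟩
    (∑[ u ∈ V n ] ∑[ v ∈ V n ] (⟦ listed u v ⟧ * s u v + ⟦ listed v u ⟧ * s v u))
      ≡⟨ ∑-cong (V n) (λ u → ∑-cong (V n) (both u)) ⟩
    (∑[ u ∈ V n ] ∑[ v ∈ V n ] (⟦ G ⟧ᴳ u v * s u v)) ∎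
    where
    open ≡-Reasoning
    E = ∑[ u ∈ V n ] ∑[ v ∈ V n ] (⟦ listed u v ⟧ * s u v)
    e : ∀ x → + 2 * x ≡ x + x
    e = solve-∀

module Counting {n r : ℕ} (c : Colouring (K n) r) where

  C : Fin n → Fin n → Fin r
  C = colour c

  -- The colouring is symmetric on edges by assumption, and on the diagonal, where colours are
  -- arbitrary, for trivial reasons.
  C-sym : ∀ a b → C a b ≡ C b a
  C-sym a b with a Fin.≟ b
  ... | yes refl = refl
  ... | no a≢b   = colour-sym c a≢b

  open Colours C C-sym

  2countEdges : ∀ (G : Graph n) {P : Fin r → Set} (P? : Decidable P) →
                + 2 * + countEdges c G P? ≡ ∑[ u ∈ V n ] ∑[ v ∈ V n ] (⟦ G ⟧ᴳ u v * ⟦ P? (C u v) ⟧)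
  2countEdges G P? = trans (cong (+ 2 *_) (length-filter≡∑ (P? ∘ uncurry C) (edges G)))
    (∑-edges G (λ u v → ⟦ P? (C u v) ⟧) (λ {u} {v} _ → cong (λ x → ⟦ P? x ⟧) (C-sym u v)))

  2edgeCount : + 2 * + edgeCount (K n) ≡ + n * + n - + n
  2edgeCount = trans (cong (+ 2 *_) (sym (trans (∑-const (edges (K n)) 1ℤ) (ℤ.*-identityʳ (+ edgeCount (K n))))))
    (trans (∑-edges (K n) (λ _ _ → 1ℤ) (λ _ → refl))
    (trans (∑-cong (V n) (λ u → trans (∑-cong (V n) (λ v → trans (ℤ.*-identityʳ _) (⟦⟧-¬ (u Fin.≟ v)))) (trans (∑-- (V n) _ _)
      (cong₂ _-_ (∑-V-const n 1ℤ) (trans (∑-cong (V n) (λ v → ⟦⟧-cong (u Fin.≟ v) (v Fin.≟ u) sym sym)) (∑-V-indicator u))))))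
    (trans (∑-V-const n _) (e (+ n)))))
    where
    e : ∀ n → n * (n * 1ℤ - 1ℤ) ≡ n * n - n
    e = solve-∀

  count≥ : ∀ i → + 2 * + (# i coloured c inside K n) ≤ᶻ count i
  count≥ i = subst (_≤ᶻ count i) (sym (2countEdges (K n) (Fin._≟ i)))
    (∑∑-mono (V n) (λ u v → ≤-by (gap (⟦⟧-≤1 (¬? (u Fin.≟ v))) ⊗ ⟦⟧-≥0 (C u v Fin.≟ i)) (e (χ i u v) ⟦ ¬? (u Fin.≟ v) ⟧)))
    where
    e : ∀ x t → x - t * x ≡ (1ℤ - t) * x
    e = solve-∀

  count≤ : ∀ i → count i ≤ᶻ + 2 * + (# i coloured c inside K n) + + n
  count≤ i = ℤ.≤-trans (∑∑-mono (V n) (λ u v → at u v (u Fin.≟ v)))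
    (≡⇒≤ (trans (∑∑-split (V n) _ _) (cong₂ _+_ (sym (2countEdges (K n) (Fin._≟ i)))
      (trans (∑-cong (V n) (λ u → trans (∑-cong (V n) (λ v → ⟦⟧-cong (u Fin.≟ v) (v Fin.≟ u) sym sym)) (∑-V-indicator u))) (trans (∑-V-const n 1ℤ) (ℤ.*-identityʳ (+ n)))))))
    where
    at : ∀ u v (d : Dec (u ≡ v)) → χ i u v ≤ᶻ ⟦ ¬? d ⟧ * χ i u v + ⟦ d ⟧
    at u v (yes _) = χ≤1
      where
      χ≤1 = ⟦⟧-≤1 (C u v Fin.≟ i)
    at u v (no _)  = ≡⇒≤ (sym (trans (ℤ.+-identityʳ _) (ℤ.*-identityˡ (χ i u v))))

  inside≤ : ∀ i S → + (#≢ i coloured c inside (K n [ S ])) ≤ᶻ miscoloured i S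
  inside≤ i S = ℤ.≤-trans (≤-by (0≤+ x) (e (+ x))) (subst (_≤ᶻ miscoloured i S) (sym (2countEdges (K n [ S ]) (λ j → ¬? (j Fin.≟ i))))
      (∑∑-mono (V n) at))
    where
    x = #≢ i coloured c inside (K n [ S ])
    e : ∀ x → + 2 * x - x ≡ x
    e = solve-∀
    at : ∀ u v → ⟦ K n [ S ] ⟧ᴳ u v * ⟦ ¬? (C u v Fin.≟ i) ⟧ ≤ᶻ ⟦ u ∈ˢ? S ⟧ * ⟦ v ∈ˢ? S ⟧ * (1ℤ - χ i u v)
    at u v = subst₂ _≤ᶻ_
      (cong (⟦ K n [ S ] ⟧ᴳ u v *_) (sym (⟦⟧-¬ (C u v Fin.≟ i)))) refl
      (≤-by (⟦⟧-≥0 (u ∈ˢ? S) ⊗ ⟦⟧-≥0 (v ∈ˢ? S) ⊗ gap (⟦⟧-≤1 (¬? (u Fin.≟ v))) ⊗ gap (⟦⟧-≤1 (C u v Fin.≟ i)))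
        (trans (cong (λ s → ⟦ u ∈ˢ? S ⟧ * ⟦ v ∈ˢ? S ⟧ * (1ℤ - χ i u v) - s * (1ℤ - χ i u v))
          (trans (⟦⟧-× (u ∈ˢ? S) ((v ∈ˢ? S) ×-dec ¬? (u Fin.≟ v))) (cong (⟦ u ∈ˢ? S ⟧ *_) (⟦⟧-× (v ∈ˢ? S) (¬? (u Fin.≟ v))))))
          (e₁ ⟦ u ∈ˢ? S ⟧ ⟦ v ∈ˢ? S ⟧ ⟦ ¬? (u Fin.≟ v) ⟧ (χ i u v))))
      where
      e₁ : ∀ a b c x → a * b * (1ℤ - x) - a * (b * c) * (1ℤ - x) ≡ a * b * (1ℤ - c) * (1ℤ - x)
      e₁ = solve-∀

-- The copy of a graph under a permutation of the vertices

module _ (T : Graph n) (π : Permutation′ n) where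

  image : Graph n
  image = record
    { Adj     = λ u v → Adj T (π ⟨$⟩ˡ u) (π ⟨$⟩ˡ v)
    ; adj?    = λ u v → adj? T (π ⟨$⟩ˡ u) (π ⟨$⟩ˡ v)
    ; adj-sym = adj-sym T
    ; irrefl  = irrefl T
    }

  copy : Copy T (K n)
  copy = record
    { graph    = image
    ; subgraph = λ { a refl → irrefl T a }
    ; iso      = π , λ u v → mk⇔ (subst₂ (Adj T) (sym (Perm.inverseˡ π)) (sym (Perm.inverseˡ π)))
                                 (subst₂ (Adj T) (Perm.inverseˡ π) (Perm.inverseˡ π))
    }

  ∑-image : ∀ (F : Fin n → Fin n → ℤ) → (∑[ u ∈ V n ] ∑[ v ∈ V n ] (⟦ image ⟧ᴳ u v * F u v)) ≡
            ∑[ x ∈ V n ] ∑[ y ∈ V n ] (⟦ T ⟧ᴳ x y * F (π ⟨$⟩ʳ x) (π ⟨$⟩ʳ y))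
  ∑-image F = trans (sym (∑-permute π _)) (∑-cong (V n) (λ x → trans (sym (∑-permute π _)) (∑-cong (V n) (λ y →
    cong₂ (λ a b → ⟦ T ⟧ᴳ a b * F (π ⟨$⟩ʳ x) (π ⟨$⟩ʳ y)) (Perm.inverseˡ π) (Perm.inverseˡ π)))))

-- Choice of the parameters

-- Opaque, so that no numeral multiplying a variable is ever unfolded.
abstract
  u h q₀ : ℕ
  u  = 20
  h  = 3200
  q₀ = 601

  u≡20 : u ≡ 20
  u≡20 = refl

  -- With m the integer part of n/40, at least n/80, this value gives h m ≥ 40 n, as `G-arith`
  -- needs.
  h≡ : + h ≡ + 40 * + 80
  h≡ = refl

  9≤h : + 9 ≤ᶻ + h
  9≤h = +≤+ (ℕ.m≤m+n 9 3191)

  q₀≡ : + q₀ ≡ + 2 * + 6 * + 2 + + 16 * (+ 6 * + 6) + 1ℤ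
  q₀≡ = refl

  1≤u : 1 ≤ u
  1≤u = s≤s z≤n

  -- The doubled surplus 36 n/H has to exceed twice the margin. Using L² ≤ 2 (l + 1)² and r³ ≥ 3 r²,
  -- this becomes an inequality between numerals, with 108 = 36 · 3; it fixes how wasteful `u` and
  -- `h` may be.
  margin-constant : + 2 * (+ 2 * + h * (+ 8 * (+ u * + u))) ≤ᶻ + 108 * + (10 ℕ.^ 6)
  margin-constant = +≤+ (ℕ.m≤m+n 40960000 67040000)

L-large-identity : ∀ L → L * L - L ≡ L * (L - 1ℤ)
L-large-identity = solve-∀

0<κ-identity : ∀ x y z w → x + y + z + w - y ≡ x + z + w
0<κ-identity = solve-∀

144≤N-identity : ∀ N x y z w → N - w ≡ N - (x + w + y + z) + x + y + z
144≤N-identity = solve-∀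

32H≤N-identity : ∀ N x y z w → N - w ≡ N - (x + y + w + z) + x + y + z
32H≤N-identity = solve-∀

40t≤N-identity : ∀ N x y z w → N - w ≡ N - (x + y + z + w) + x + y + z
40t≤N-identity = solve-∀

Q≡-identity : ∀ D z → + 2 * + 6 * (+ 2 * (1ℤ + D)) + z + 1ℤ ≡ + 24 * D + (+ 2 * + 6 * + 2 + z + 1ℤ)
Q≡-identity = solve-∀

n-huge-identity : ∀ N a D q x y z v w → + 2 * N - + 2 * (a * (+ 24 * D + q)) ≡
    (N - (+ 48 * a + x + y + z) * D) + (x + y + z) * D + (N - (+ 2 * q * a + v + y + w)) + v + y + w
n-huge-identity = solve-∀

40Δ≤N-identity : ∀ N x y z w D → N - w * D ≡ (N - (x + w + y + z) * D) + (x + y + z) * D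
40Δ≤N-identity = solve-∀

κ≥4R-identity : ∀ x y z w → x + y + z + w - w ≡ x + y + z
κ≥4R-identity = solve-∀

κ≥40-identity : ∀ x y z w → x + y + z + w - y ≡ x + z + w
κ≥40-identity = solve-∀

κ≥32H-identity : ∀ x y z w → x + y + z + w - z ≡ x + y + w
κ≥32H-identity = solve-∀

count-lower-identity : ∀ k R c x e N → + 2 * k * (+ 2 * R * c) - + 2 * k * (N * N) ≡
    + 4 * k * R * (c - + 2 * x) + + 8 * (R * k * x - (k - R) * e) + (+ 4 * (k - R) * (+ 2 * e) - + 2 * k * (N * N))
count-lower-identity = solve-∀

count-lower-identity₂ : ∀ k R c x e N → + 4 * k * R * (c - + 2 * x) + + 8 * (R * k * x - (k - R) * e) + (+ 4 * (k - R) * (N * N - N) - + 2 * k * (N * N)) ≡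
    + 4 * k * R * (c - + 2 * x) + + 8 * (R * k * x - (k - R) * e) + N * ((N - 1ℤ) * (k - + 4 * R) + k * (N - + 3))
count-lower-identity₂ = solve-∀

count-upper-identity : ∀ k R c x e N → + 6 * (R * k) * (N * N) - + 6 * (R * k) * (+ 2 * c) ≡
    + 12 * (R * k) * (+ 2 * x + N - c) + + 24 * ((k + R) * e - R * k * x)
    + (+ 6 * (R * k) * (N * N) - + 12 * (R * k) * N - + 12 * (k + R) * (+ 2 * e))
count-upper-identity = solve-∀

count-upper-identity₂ : ∀ k R c x e N → + 12 * (R * k) * (+ 2 * x + N - c) + + 24 * ((k + R) * e - R * k * x)
    + (+ 6 * (R * k) * (N * N) - + 12 * (R * k) * N - + 12 * (k + R) * (N * N - N)) ≡
    + 12 * (R * k) * (+ 2 * x + N - c) + + 24 * ((k + R) * e - R * k * x)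
    + (+ 4 * k * (N * N) * (R - + 3) + N * N * R * (k - + 12) + R * k * N * (N - + 12) + + 12 * (k + R) * N)
count-upper-identity₂ = solve-∀

NN≡-identity : ∀ N → N * N ≡ N * N - N + N
NN≡-identity = solve-∀

balance-identity : ∀ R k x y e N → R * (+ 2 * e + N) - R * (k * (x - y)) ≡ ((k + R) * e - R * k * x) + (R * k * y - (k - R) * e) + R * N
balance-identity = solve-∀

balance-identity₂ : ∀ k H c d x y N → + 2 * k * (+ 8 * H * d + N * N) - + 2 * k * (+ 8 * H * c) ≡
    + 16 * k * H * ((+ 2 * x + N - c) + (d - + 2 * y)) + + 32 * H * (N * N - k * (x - y))
    + N * N * (k - + 32 * H) + k * N * ((N - + 32 * H) + + 16 * H)
balance-identity₂ = solve-∀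

N≤80m-identity : ∀ N m → + 80 * m - N ≡ (+ 40 + m * + 40 - N) + + 40 * (m - 1ℤ)
N≤80m-identity = solve-∀

module Parameters (r : ℕ) (3≤r : 3 ≤ r) where

  R : ℤ
  R = + r

  1≤r : 1 ≤ r
  1≤r = ℕ.≤-trans (s≤s z≤n) 3≤r

  0<R : 0ℤ <ᶻ R
  0<R = +<+ 1≤r

  0<u : 0ℤ <ᶻ + u
  0<u = +<+ 1≤u

  tᶻ : ℤ
  tᶻ = + 16 * (+ u * + u) * (R * R * (R * R))

  0<tᶻ : 0ℤ <ᶻ tᶻ
  0<tᶻ = 0<* (0<* {+ 16} (+<+ (s≤s z≤n)) (0<* 0<u 0<u)) (0<* (0<* 0<R 0<R) (0<* 0<R 0<R))

  abstract
    t : ℕ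
    t = ℤ.∣ tᶻ ∣

    t≡ : + t ≡ tᶻ
    t≡ = ℤ.0≤i⇒+∣i∣≡i (<⇒0≤ 0<tᶻ)

  1≤t : 1 ≤ t
  1≤t = ℤ.drop‿+<+ (subst (0ℤ <ᶻ_) (sym t≡) 0<tᶻ)

  -- Here η has to be small in terms of r: once `L` is at least this number, `L-large` holds and the
  -- density that does not depend on η outweighs the exchanges made against one colour.
  threshold : ℕ
  threshold = 2 ℕ.* t ℕ.* (r ℕ.* r) ℕ.+ r ℕ.* r

  module Scales (L : ℕ) (threshold≤L : threshold ≤ L) where

    +threshold : + threshold ≡ + 2 * + t * (R * R) + R * R
    +threshold = trans (ℤ.pos-+ (2 ℕ.* t ℕ.* (r ℕ.* r)) (r ℕ.* r)) (cong₂ _+_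
      (trans (ℤ.pos-* (2 ℕ.* t) (r ℕ.* r)) (cong₂ _*_ (ℤ.pos-* 2 t) (ℤ.pos-* r r))) (ℤ.pos-* r r))

    rr≤L : r ℕ.* r ≤ L
    rr≤L = ℕ.≤-trans (ℕ.m≤n+m (r ℕ.* r) (2 ℕ.* t ℕ.* (r ℕ.* r))) threshold≤L

    r≤L : r ≤ L
    r≤L = ℕ.≤-trans (ℕ.m≤m*n r r {{ℕ.>-nonZero 1≤r}}) rr≤L

    3≤L : 3 ≤ L
    3≤L = ℕ.≤-trans 3≤r r≤L

    0<L : 0ℤ <ᶻ + L
    0<L = +<+ (ℕ.≤-trans (s≤s z≤n) 3≤L)

    L-large : + 2 * + t * (R * R) + R * R ≤ᶻ + L * + L
    L-large = ℤ.≤-trans (subst (_≤ᶻ + L) +threshold (+≤+ threshold≤L))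
      (≤-by (<⇒0≤ 0<L ⊗ gap (ℤ.i<j⇒suc[i]≤j 0<L)) (L-large-identity (+ L)))

    c H a Kᶻ : ℤ
    c  = + 8 * (+ u * + u) * (R * R) * (+ L * + L)
    H  = + h * c
    a  = + 8 * (H * H * R) * (+ 4 * + 4)
    -- This becomes 1/ε. Its summands serve, in order, the variance (the part of `Q` proportional to
    -- Δ), the condition 40 Δ ≤ n, the balance of the counts, and the lower bound on each colour.
    Kᶻ = + 48 * a + + 40 + + 32 * H + + 4 * R

    0<c : 0ℤ <ᶻ c
    0<c = 0<* (0<* (0<* {+ 8} (+<+ (s≤s z≤n)) (0<* 0<u 0<u)) (0<* 0<R 0<R)) (0<* 0<L 0<L)

    0≤H : 0ℤ ≤ᶻ H
    0≤H = 0≤+ h ⊗ <⇒0≤ 0<c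

    0≤a : 0ℤ ≤ᶻ a
    0≤a = 0≤+ 8 ⊗ (0≤H ⊗ 0≤H ⊗ 0≤+ r) ⊗ 0≤+ 16

    0≤Kᶻ : 0ℤ ≤ᶻ Kᶻ
    0≤Kᶻ = 0≤+ 48 ⊗ 0≤a ⊕ 0≤+ 40 ⊕ 0≤+ 32 ⊗ 0≤H ⊕ 0≤+ 4 ⊗ 0≤+ r

    abstract
      κ : ℕ
      κ = ℤ.∣ Kᶻ ∣

      κ≡ : + κ ≡ Kᶻ
      κ≡ = ℤ.0≤i⇒+∣i∣≡i 0≤Kᶻ

    0<κ : 0ℤ <ᶻ + κ
    0<κ = subst (0ℤ <ᶻ_) (sym κ≡) (ℤ.<-≤-trans {j = + 40} (+<+ (s≤s z≤n))
      (≤-by (0≤+ 48 ⊗ 0≤a ⊕ 0≤+ 32 ⊗ 0≤H ⊕ 0≤+ 4 ⊗ 0≤+ r) (0<κ-identity (+ 48 * a) (+ 40) (+ 32 * H) (+ 4 * R))))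

    -- The summands serve the constant part of `Q`, tuples of arity 6 (2 · 6 · 12 = 144), the terms
    -- compared with 32 H, and the existence of at least `t` gadgets.
    N₀ᶻ : ℤ
    N₀ᶻ = + 2 * + q₀ * a + + 144 + + 32 * H + + 40 * + t

    0≤N₀ᶻ : 0ℤ ≤ᶻ N₀ᶻ
    0≤N₀ᶻ = 0≤+ 2 ⊗ 0≤+ q₀ ⊗ 0≤a ⊕ 0≤+ 144 ⊕ 0≤+ 32 ⊗ 0≤H ⊕ 0≤+ 40 ⊗ 0≤+ t

    abstract
      N₀ : ℕ
      N₀ = ℤ.∣ N₀ᶻ ∣

      N₀≡ : + N₀ ≡ N₀ᶻ
      N₀≡ = ℤ.0≤i⇒+∣i∣≡i 0≤N₀ᶻ

    module Large (n : ℕ) (N₀≤n : N₀ ≤ n) (T : Graph n) (acyclic : ¬ Cycle T) (connected : Connected T)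
      (Δ : ℕ) (deg≤Δ : ∀ x → Trees.deg T x ≤ᶻ + Δ) (κΔ≤n : + κ * + Δ ≤ᶻ + n)
      (col : Colouring (K n) r) (one : Fin r)
      (lower-balance : ∀ i → (+ κ - R) * + edgeCount (K n) ≤ᶻ R * + κ * + (# i coloured col inside K n))
      (upper-balance : ∀ i → R * + κ * + (# i coloured col inside K n) ≤ᶻ (+ κ + R) * + edgeCount (K n))
      (standard : ∀ S → ∣ S ∣ ≡ ∣ ∁ S ∣ ⊎ ∣ S ∣ ≡ suc ∣ ∁ S ∣ → ∀ i → i ≢ one →
        + n * + n ≤ᶻ + L * + (#≢ one coloured col inside (K n [ S ])) ⊎ + n * + n ≤ᶻ + L * + (#≢ i coloured col inside (K n [ ∁ S ])))
      where

      N : ℤ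
      N = + n

      N≥ : N₀ᶻ ≤ᶻ N
      N≥ = subst (_≤ᶻ N) N₀≡ (+≤+ N₀≤n)

      144≤N : + 144 ≤ᶻ N
      144≤N = ≤-by (gap N≥ ⊕ 0≤+ 2 ⊗ 0≤+ q₀ ⊗ 0≤a ⊕ 0≤+ 32 ⊗ 0≤H ⊕ 0≤+ 40 ⊗ 0≤+ t) (144≤N-identity N (+ 2 * + q₀ * a) (+ 32 * H) (+ 40 * + t) (+ 144))

      32H≤N : + 32 * H ≤ᶻ N
      32H≤N = ≤-by (gap N≥ ⊕ 0≤+ 2 ⊗ 0≤+ q₀ ⊗ 0≤a ⊕ 0≤+ 144 ⊕ 0≤+ 40 ⊗ 0≤+ t) (32H≤N-identity N (+ 2 * + q₀ * a) (+ 144) (+ 40 * + t) (+ 32 * H))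

      40t≤N : + 40 * + t ≤ᶻ N
      40t≤N = ≤-by (gap N≥ ⊕ 0≤+ 2 ⊗ 0≤+ q₀ ⊗ 0≤a ⊕ 0≤+ 144 ⊕ 0≤+ 32 ⊗ 0≤H) (40t≤N-identity N (+ 2 * + q₀ * a) (+ 144) (+ 32 * H) (+ 40 * + t))

      0<N : 0ℤ <ᶻ N
      0<N = ℤ.<-≤-trans (+<+ (s≤s z≤n)) 144≤N

      open Counting col
      open Colours C C-sym

      Q : ℤ
      Q = + 2 * + 6 * (+ 2 * (1ℤ + + Δ)) + + 16 * (+ 6 * + 6) + 1ℤ

      Q≡ : Q ≡ + 24 * + Δ + + q₀
      Q≡ = trans (Q≡-identity (+ Δ) (+ 16 * (+ 6 * + 6))) (cong (λ x → + 24 * + Δ + x) (sym q₀≡))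

      KΔ≤N : Kᶻ * + Δ ≤ᶻ N
      KΔ≤N = subst (λ x → x * + Δ ≤ᶻ N) κ≡ κΔ≤n

      n-huge : a * Q ≤ᶻ N
      n-huge = *-cancel (+ 2) (+<+ (s≤s z≤n)) (≤-by
        (gap KΔ≤N ⊕ (0≤+ 40 ⊕ 0≤+ 32 ⊗ 0≤H ⊕ 0≤+ 4 ⊗ 0≤+ r) ⊗ 0≤+ Δ ⊕ gap N≥ ⊕ 0≤+ 144 ⊕ 0≤+ 32 ⊗ 0≤H ⊕ 0≤+ 40 ⊗ 0≤+ t)
        (trans (cong (λ x → + 2 * N - + 2 * (a * x)) Q≡) (n-huge-identity N a (+ Δ) (+ q₀) (+ 40) (+ 32 * H) (+ 4 * R) (+ 144) (+ 40 * + t))))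

      40Δ≤N : + 40 * + Δ ≤ᶻ N
      40Δ≤N = ≤-by (gap KΔ≤N ⊕ (0≤+ 48 ⊗ 0≤a ⊕ 0≤+ 32 ⊗ 0≤H ⊕ 0≤+ 4 ⊗ 0≤+ r) ⊗ 0≤+ Δ) (40Δ≤N-identity N (+ 48 * a) (+ 32 * H) (+ 4 * R) (+ 40) (+ Δ))

      private
        e₂ : ℤ
        e₂ = + edgeCount (K n)

      2e≡ : + 2 * e₂ ≡ N * N - N
      2e≡ = 2edgeCount

      κ≥4R : + 4 * R ≤ᶻ + κ
      κ≥4R = subst (+ 4 * R ≤ᶻ_) (sym κ≡) (≤-by (0≤+ 48 ⊗ 0≤a ⊕ 0≤+ 40 ⊕ 0≤+ 32 ⊗ 0≤H) (κ≥4R-identity (+ 48 * a) (+ 40) (+ 32 * H) (+ 4 * R)))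

      κ≥40 : + 40 ≤ᶻ + κ
      κ≥40 = subst (+ 40 ≤ᶻ_) (sym κ≡) (≤-by (0≤+ 48 ⊗ 0≤a ⊕ 0≤+ 32 ⊗ 0≤H ⊕ 0≤+ 4 ⊗ 0≤+ r) (κ≥40-identity (+ 48 * a) (+ 40) (+ 32 * H) (+ 4 * R)))

      κ≥32H : + 32 * H ≤ᶻ + κ
      κ≥32H = subst (+ 32 * H ≤ᶻ_) (sym κ≡) (≤-by (0≤+ 48 ⊗ 0≤a ⊕ 0≤+ 40 ⊕ 0≤+ 4 ⊗ 0≤+ r) (κ≥32H-identity (+ 48 * a) (+ 40) (+ 32 * H) (+ 4 * R)))

      at-least : ∀ k → + k ≤ᶻ + 144 → + k ≤ᶻ N
      at-least k le = ℤ.≤-trans le 144≤N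

      #ᶻ : Fin r → ℤ
      #ᶻ i = + (# i coloured col inside K n)

      -- As 4 r ≤ κ, a colour has at least a share 3/(4 r) of the edges; passing from N² - N to N²
      -- ordered pairs brings this down to 1/(2 r) at worst, since N ≥ 3.
      count-lower : ∀ i → N * N ≤ᶻ + 2 * R * count i
      count-lower i = *-cancel (+ 2 * + κ) (0<* {+ 2} (+<+ (s≤s z≤n)) 0<κ)
        (≤-by (0≤+ 4 ⊗ 0≤+ κ ⊗ 0≤+ r ⊗ gap (count≥ i) ⊕ 0≤+ 8 ⊗ gap (lower-balance i)
               ⊕ <⇒0≤ 0<N ⊗ (gap (at-least 1 (+≤+ (s≤s z≤n))) ⊗ gap κ≥4R ⊕ 0≤+ κ ⊗ gap (at-least 3 (+≤+ (s≤s (s≤s (s≤s z≤n)))))))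
          (trans (count-lower-identity (+ κ) R (count i) (#ᶻ i) e₂ N)
            (cong (λ s → + 4 * + κ * R * (count i - + 2 * #ᶻ i) + + 8 * (R * + κ * #ᶻ i - (+ κ - R) * e₂) + (+ 4 * (+ κ - R) * s - + 2 * + κ * (N * N))) 2e≡ ∙
             count-lower-identity₂ (+ κ) R (count i) (#ᶻ i) e₂ N)))
        where
        infixr 5 _∙_
        _∙_ : ∀ {x y z : ℤ} → x ≡ y → y ≡ z → x ≡ z
        _∙_ = trans

      -- The share is at most 1/r + 1/κ + 1/N ≤ 1/3 + 1/12 + 1/12 = 1/2, with 1/N for the diagonal.
      count-upper : ∀ i → + 2 * count i ≤ᶻ N * N
      count-upper i = *-cancel (+ 6 * (R * + κ)) (0<* {+ 6} (+<+ (s≤s z≤n)) (0<* 0<R 0<κ))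
        (≤-by (0≤+ 12 ⊗ (0≤+ r ⊗ 0≤+ κ) ⊗ gap (count≤ i) ⊕ 0≤+ 24 ⊗ gap (upper-balance i)
               ⊕ (0≤+ 4 ⊗ 0≤+ κ ⊗ sq N ⊗ gap (+≤+ 3≤r) ⊕ sq N ⊗ 0≤+ r ⊗ gap (ℤ.≤-trans (+≤+ (ℕ.m≤m+n 12 28)) κ≥40)
                  ⊕ 0≤+ r ⊗ 0≤+ κ ⊗ <⇒0≤ 0<N ⊗ gap (at-least 12 (+≤+ (ℕ.m≤m+n 12 132))) ⊕ 0≤+ 12 ⊗ (0≤+ κ ⊕ 0≤+ r) ⊗ <⇒0≤ 0<N))
          (trans (count-upper-identity (+ κ) R (count i) (#ᶻ i) e₂ N)
          (trans (cong (λ s → + 12 * (R * + κ) * (+ 2 * #ᶻ i + N - count i) + + 24 * ((+ κ + R) * e₂ - R * + κ * #ᶻ i)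
                    + (+ 6 * (R * + κ) * (N * N) - + 12 * (R * + κ) * N - + 12 * (+ κ + R) * s)) 2e≡)
            (count-upper-identity₂ (+ κ) R (count i) (#ᶻ i) e₂ N))))

      -- Two shares differ by at most 2/κ, and the diagonal adds at most N pairs; the bounds κ ≥ 32
      -- H and N ≥ 32 H keep the sum below N²/(8 H).
      balance : ∀ i j → + 8 * H * count i ≤ᶻ + 8 * H * count j + N * N
      balance i j = *-cancel (+ 2 * + κ) (0<* {+ 2} (+<+ (s≤s z≤n)) 0<κ)
        (≤-by (0≤+ 16 ⊗ 0≤+ κ ⊗ 0≤H ⊗ (gap (count≤ i) ⊕ gap (count≥ j)) ⊕ 0≤+ 32 ⊗ 0≤H ⊗ gap near
               ⊕ sq N ⊗ gap κ≥32H ⊕ 0≤+ κ ⊗ <⇒0≤ 0<N ⊗ (gap 32H≤N ⊕ 0≤+ 16 ⊗ 0≤H))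
          (balance-identity₂ (+ κ) H (count i) (count j) (#ᶻ i) (#ᶻ j) N))
        where
        near : + κ * (#ᶻ i - #ᶻ j) ≤ᶻ N * N
        near = *-cancel R 0<R (≤-by (gap (upper-balance i) ⊕ gap (lower-balance j) ⊕ 0≤+ r ⊗ <⇒0≤ 0<N)
          (trans (cong (λ s → R * s - R * (+ κ * (#ᶻ i - #ᶻ j))) NN≡) (balance-identity R (+ κ) (#ᶻ i) (#ᶻ j) e₂ N)))
          where
          NN≡ : N * N ≡ + 2 * e₂ + N
          NN≡ = trans (NN≡-identity N) (cong (_+ N) (sym 2e≡))

      m : ℕ
      m = n ℕ./ 40

      40m≤N : + 40 * + m ≤ᶻ N
      40m≤N = subst (_≤ᶻ N) (trans (ℤ.pos-* m 40) (ℤ.*-comm (+ m) (+ 40))) (+≤+ (ℕ.m/n*n≤m n 40))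

      t≤m : t ≤ m
      t≤m = subst (_≤ m) (ℕ.m*n/n≡m t 40) (ℕ./-monoˡ-≤ 40 (ℤ.drop‿+≤+ (subst (_≤ᶻ N) (trans (ℤ.*-comm (+ 40) (+ t)) (sym (ℤ.pos-* t 40))) 40t≤N)))

      N≤80m : N ≤ᶻ + 80 * + m
      N≤80m = ≤-by (gap rem ⊕ 0≤+ 40 ⊗ gap (+≤+ (ℕ.≤-trans 1≤t t≤m))) (N≤80m-identity N (+ m))
        where
        rem : N ≤ᶻ + 40 + + m * + 40
        rem = subst₂ _≤ᶻ_ (cong +_ (sym (ℕ.m≡m%n+[m/n]*n n 40))) (cong (λ s → + 40 + s) (ℤ.pos-* m 40))
          (+≤+ (ℕ.+-monoˡ-≤ (m ℕ.* 40) (ℕ.<⇒≤ (ℕ.m%n<n n 40))))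

      40N≤hm : + 40 * N ≤ᶻ + h * + m
      40N≤hm = subst (+ 40 * N ≤ᶻ_) (trans (e (+ m)) (cong (_* + m) (sym h≡))) (*-monoˡ (+ 40) (0≤+ 40) N≤80m)
        where
        e : ∀ m → + 40 * (+ 80 * m) ≡ + 40 * + 80 * m
        e m = sym (ℤ.*-assoc (+ 40) (+ 80) m)

      standard′ : ∀ i → i ≢ one → ∀ S → ∣ S ∣ ≡ ∣ ∁ S ∣ ⊎ ∣ S ∣ ≡ suc ∣ ∁ S ∣ →
        N * N ≤ᶻ + L * miscoloured one S ⊎ N * N ≤ᶻ + L * miscoloured i (∁ S)
      standard′ i i≢ S size = Sum.map
        (λ le → ℤ.≤-trans le (*-monoˡ (+ L) (0≤+ L) (inside≤ one S)))
        (λ le → ℤ.≤-trans le (*-monoˡ (+ L) (0≤+ L) (inside≤ i (∁ S))))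
        (standard S size i i≢)

      Result : Set
      Result = Σ[ π ∈ Permutation′ n ] (∀ j → j ≢ one →
        + 36 * N ≤ᶻ H * Swap.total T (w one j) (w-sym one j) ⟪ π ⟫)

      result : Result
      result = Assembly.result 0<N C C-sym one T acyclic connected u L t m (+ h) H (+ Δ) Q u≡20
        (+≤+ 3≤r) (ℤ.≤-trans (+≤+ (s≤s (s≤s z≤n))) (+≤+ 3≤L)) (+≤+ r≤L) 1≤t t≤m t≡ L-large refl 9≤h 40m≤N 40N≤hm
        deg≤Δ 40Δ≤N ℤ.≤-refl n-huge 32H≤N 144≤N (count-lower one) (count-upper one) balance standard′

      surplus-copy : ∃[ S ] (∀ j → j ≢ one → + 36 * N ≤ᶻ H * (+ 2 * + (# one coloured col inside graph {T = T} {G = K n} S) - + 2 * + (# j coloured col inside graph S)))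
      surplus-copy = finish result
        where
        finish : Result → ∃[ S ] (∀ j → j ≢ one → + 36 * N ≤ᶻ H * (+ 2 * + (# one coloured col inside graph {T = T} {G = K n} S) - + 2 * + (# j coloured col inside graph S)))
        finish (π , le) = copy T π , λ j j≢ → subst (λ s → + 36 * N ≤ᶻ H * s) (total≡ j) (le j j≢)
          where
          total≡ : ∀ j → (∑[ x ∈ V n ] ∑[ y ∈ V n ] (⟦ T ⟧ᴳ x y * (χ one (π ⟨$⟩ʳ x) (π ⟨$⟩ʳ y) - χ j (π ⟨$⟩ʳ x) (π ⟨$⟩ʳ y)))) ≡
                   + 2 * + (# one coloured col inside image T π) - + 2 * + (# j coloured col inside image T π)
          total≡ j = trans (sym (∑-image T π (λ a b → χ one a b - χ j a b)))
            (trans (∑-cong (V n) (λ x → trans (∑-cong (V n) (λ y → distrib (⟦ image T π ⟧ᴳ x y) (χ one x y) (χ j x y))) (∑-- (V n) _ _)))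
            (trans (∑-- (V n) _ _) (cong₂ _-_ (sym (2countEdges (image T π) (Fin._≟ one))) (sym (2countEdges (image T π) (Fin._≟ j))))))
            where
            distrib : ∀ t a b → t * (a - b) ≡ t * a - t * b
            distrib = solve-∀

degree≤maxDegree : ∀ {n} (T : Graph n) x → Trees.deg T x ≤ᶻ + maxDegree T
degree≤maxDegree {n} T x = subst (_≤ᶻ + maxDegree T) (Trees.length-nbrs T x)
  (+≤+ (All.lookup (xs≤max 0 (map (degree T) (V n))) (∈-map⁺ (degree T) (∈-allFin x))))

-- Rational inequalities as integer inequalities

-- Reduced fractions do not compute when numerators are variables. Each rational is therefore paired
-- with an unreduced fraction, whose cross products are plain integer expressions.
Fraction : ℚ → ℚᵘ → Set
Fraction p P = toℚᵘ p ≃ P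

/-fraction : ∀ a d .{{_ : NonZero d}} → Fraction (a / d) (a ℚᵘ./ d)
/-fraction a (suc d) = ℚ.toℚᵘ-fromℚᵘ (mkℚᵘ a d)

*-fraction : ∀ {p q P Q} → Fraction p P → Fraction q Q → Fraction (p ℚ.* q) (P ℚᵘ.* Q)
*-fraction {p} {q} f g = ℚᵘ.≃-trans (ℚ.toℚᵘ-homo-* p q) (ℚᵘ.*-cong f g)

+-fraction : ∀ {p q P Q} → Fraction p P → Fraction q Q → Fraction (p ℚ.+ q) (P ℚᵘ.+ Q)
+-fraction {p} {q} f g = ℚᵘ.≃-trans (ℚ.toℚᵘ-homo-+ p q) (ℚᵘ.+-cong f g)

minus-fraction : ∀ {p q P Q} → Fraction p P → Fraction q Q → Fraction (p ℚ.- q) (P ℚᵘ.- Q)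
minus-fraction {p} {q} f g = +-fraction {p} {ℚ.- q} f (ℚᵘ.≃-trans (ℚ.toℚᵘ-homo‿- q) (ℚᵘ.-‿cong g))

cross-multiply : ∀ {p q P Q} → Fraction p P → Fraction q Q → p ℚ.≤ q → ↥ P * ↧ Q ≤ᶻ ↥ Q * ↧ P
cross-multiply f g le = ℚᵘ.drop-*≤* (ℚᵘ.≤-respʳ-≃ g (ℚᵘ.≤-respˡ-≃ f (ℚ.toℚᵘ-mono-≤ le)))

cross-divide : ∀ {p q P Q} → Fraction p P → Fraction q Q → ↥ P * ↧ Q ≤ᶻ ↥ Q * ↧ P → p ℚ.≤ q
cross-divide f g le = ℚ.toℚᵘ-cancel-≤ (ℚᵘ.≤-respʳ-≃ (ℚᵘ.≃-sym g) (ℚᵘ.≤-respˡ-≃ (ℚᵘ.≃-sym f) (*≤* le)))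

cross-divide-< : ∀ {p q P Q} → Fraction p P → Fraction q Q → ↥ P * ↧ Q <ᶻ ↥ Q * ↧ P → p ℚ.< q
cross-divide-< f g lt = ℚ.toℚᵘ-cancel-< (ℚᵘ.<-respʳ-≃ (ℚᵘ.≃-sym g) (ℚᵘ.<-respˡ-≃ (ℚᵘ.≃-sym f) (*<* lt)))

private
  ⌜⌝-fraction : ∀ n → Fraction ⌜ n ⌝ (mkℚᵘ (+ n) 0)
  ⌜⌝-fraction n = /-fraction (+ n) 1

unit-fraction-product : ∀ d .{{_ : NonZero d}} x y → (+ 1 / d) ℚ.* ⌜ x ⌝ ℚ.≤ ⌜ y ⌝ → + x ≤ᶻ + d * + y
unit-fraction-product d@(suc _) x y le = subst₂ _≤ᶻ_ (e₁ (+ x)) (trans (cong (λ s → + y * s) (ℤ.pos-* d 1)) (e₂ (+ d) (+ y)))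
  (cross-multiply (*-fraction {+ 1 / d} {⌜ x ⌝} (/-fraction (+ 1) d) (⌜⌝-fraction x)) (⌜⌝-fraction y) le)
  where
  e₁ : ∀ x → 1ℤ * x * 1ℤ ≡ x
  e₁ = solve-∀
  e₂ : ∀ d y → y * (d * 1ℤ) ≡ d * y
  e₂ = solve-∀

unit-fraction-bound : ∀ d .{{_ : NonZero d}} x y → ⌜ x ⌝ ℚ.≤ (+ 1 / d) ℚ.* ⌜ y ⌝ → + d * + x ≤ᶻ + y
unit-fraction-bound d@(suc _) x y le = subst₂ _≤ᶻ_ (trans (cong (λ s → + x * s) (ℤ.pos-* d 1)) (e₁ (+ d) (+ x))) (e₂ (+ y))
  (cross-multiply (⌜⌝-fraction x) (*-fraction {+ 1 / d} {⌜ y ⌝} (/-fraction (+ 1) d) (⌜⌝-fraction y)) le)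
  where
  e₁ : ∀ d x → x * (d * 1ℤ) ≡ d * x
  e₁ = solve-∀
  e₂ : ∀ y → 1ℤ * y * 1ℤ ≡ y
  e₂ = solve-∀

lower-proportion : ∀ r k .{{_ : NonZero r}} .{{_ : NonZero k}} e x →
  ((+ 1 / r) ℚ.- (+ 1 / k)) ℚ.* ⌜ e ⌝ ℚ.≤ ⌜ x ⌝ → (+ k - + r) * + e ≤ᶻ + r * + k * + x
lower-proportion r@(suc _) k@(suc _) e x le = subst₂ _≤ᶻ_ (e₁ (+ r) (+ k) (+ e))
  (trans (cong (λ s → + x * s) (trans (ℤ.pos-* (r ℕ.* k) 1) (cong (_* 1ℤ) (ℤ.pos-* r k)))) (e₂ (+ r) (+ k) (+ x)))
  (cross-multiply (*-fraction {(+ 1 / r) ℚ.- (+ 1 / k)} {⌜ e ⌝} (minus-fraction {+ 1 / r} {+ 1 / k} (/-fraction (+ 1) r) (/-fraction (+ 1) k)) (⌜⌝-fraction e)) (⌜⌝-fraction x) le)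
  where
  e₁ : ∀ r k e → (1ℤ * k + - 1ℤ * r) * e * 1ℤ ≡ (k - r) * e
  e₁ = solve-∀
  e₂ : ∀ r k x → x * (r * k * 1ℤ) ≡ r * k * x
  e₂ = solve-∀

upper-proportion : ∀ r k .{{_ : NonZero r}} .{{_ : NonZero k}} e x →
  ⌜ x ⌝ ℚ.≤ ((+ 1 / r) ℚ.+ (+ 1 / k)) ℚ.* ⌜ e ⌝ → + r * + k * + x ≤ᶻ (+ k + + r) * + e
upper-proportion r@(suc _) k@(suc _) e x le = subst₂ _≤ᶻ_
  (trans (cong (λ s → + x * s) (trans (ℤ.pos-* (r ℕ.* k) 1) (cong (_* 1ℤ) (ℤ.pos-* r k)))) (e₂ (+ r) (+ k) (+ x)))
  (e₁ (+ r) (+ k) (+ e))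
  (cross-multiply (⌜⌝-fraction x) (*-fraction {(+ 1 / r) ℚ.+ (+ 1 / k)} {⌜ e ⌝} (+-fraction {+ 1 / r} {+ 1 / k} (/-fraction (+ 1) r) (/-fraction (+ 1) k)) (⌜⌝-fraction e)) le)
  where
  e₁ : ∀ r k e → (1ℤ * k + 1ℤ * r) * e * 1ℤ ≡ (k + r) * e
  e₁ = solve-∀
  e₂ : ∀ r k x → x * (r * k * 1ℤ) ≡ r * k * x
  e₂ = solve-∀

square-bound : ∀ l D .{{_ : NonZero l}} .{{_ : NonZero D}} n x y → + n ≤ᶻ (+ x - + y) * (+ l * + l * + D) →
  (+ 1 / l) ℚ.* (+ 1 / l) ℚ.* (+ n / D) ℚ.≤ ⌜ x ⌝ ℚ.- ⌜ y ⌝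
square-bound l@(suc _) D@(suc _) n x y le = cross-divide
  (*-fraction {(+ 1 / l) ℚ.* (+ 1 / l)} {+ n / D} (*-fraction {+ 1 / l} {+ 1 / l} (/-fraction (+ 1) l) (/-fraction (+ 1) l)) (/-fraction (+ n) D))
  (minus-fraction {⌜ x ⌝} {⌜ y ⌝} (⌜⌝-fraction x) (⌜⌝-fraction y))
  (subst₂ _≤ᶻ_ (e₁ (+ n)) (trans (e₂ (+ x) (+ y) (+ l * + l * + D)) (cong (λ s → (+ x * 1ℤ + - + y * 1ℤ) * s) (sym (trans (ℤ.pos-* (l ℕ.* l) D) (cong (_* + D) (ℤ.pos-* l l)))))) le)
  where
  e₁ : ∀ n → n ≡ 1ℤ * 1ℤ * n * 1ℤ
  e₁ = solve-∀
  e₂ : ∀ x y z → (x - y) * z ≡ (x * 1ℤ + - y * 1ℤ) * z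
  e₂ = solve-∀

0<unit-fraction : ∀ d .{{_ : NonZero d}} → 0ℚ ℚ.< + 1 / d
0<unit-fraction d@(suc _) = cross-divide-< (⌜⌝-fraction 0) (/-fraction (+ 1) d) (+<+ (s≤s z≤n))

unit-fraction-anti : ∀ k → + 1 / suc (suc k) ℚ.< + 1 / suc k
unit-fraction-anti k = cross-divide-< (/-fraction (+ 1) (suc (suc k))) (/-fraction (+ 1) (suc k))
  (subst₂ _<ᶻ_ (sym (ℤ.*-identityˡ (+ suc k))) (sym (ℤ.*-identityˡ (+ suc (suc k)))) (+<+ ℕ.≤-refl))

unit-fraction≤ : ∀ q → 0ℚ ℚ.< q → ∀ k → ℚ.↧ₙ q ≤ suc k → + 1 / suc k ℚ.≤ q
unit-fraction≤ q@(mkℚ a d-1 _) 0<q k le = cross-divide {Q = toℚᵘ q} (/-fraction (+ 1) (suc k)) ℚᵘ.≃-refl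
  (*-mono {1ℤ} {a} {+ suc d-1} {+ suc k} (0≤+ 1) (0≤+ (suc k)) 1≤a (+≤+ le))
  where
  1≤a : 1ℤ ≤ᶻ a
  1≤a = ℤ.i<j⇒suc[i]≤j (ℤ.positive⁻¹ a {{ℚ.positive 0<q}})

unit-fraction-null : ∀ q → 0ℚ ℚ.< q → ∃[ b ] (∀ k → b ≤ k → + 1 / suc k ℚ.≤ q)
unit-fraction-null q 0<q = ℚ.↧ₙ q , λ k b≤k → unit-fraction≤ q 0<q k (ℕ.≤-trans b≤k (ℕ.n≤1+n k))

-- Locating a real between reciprocals

module _ (η : ℝ) where

  lower<upper : ∀ {p q} → lower η p → upper η q → p ℚ.< q
  lower<upper {p} {q} lp uq with ℚ.<-cmp p q
  ... | tri< p<q _ _  = p<q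
  ... | tri≈ _ refl _ = ⊥-elim (ℝ.disjoint η (lp , uq))
  ... | tri> _ _ q<p  = ⊥-elim (ℝ.disjoint η (Equivalence.from (ℝ.lower-rounded η) (p , q<p , lp) , uq))

  -- Locatedness only decides between being above `a (k + 2)` and being below `a (k + 1)`, so the
  -- enclosure spans two steps of the sequence. The search ends because the sequence falls below
  -- some positive rational less than η.
  bracket : ∀ (a : ℕ → ℚ) → (∀ k → a (suc k) ℚ.< a k) → (∀ q → 0ℚ ℚ.< q → ∃[ b ] (∀ k → b ≤ k → a k ℚ.≤ q)) →
            lower η 0ℚ → ∀ k → upper η (a k) → ∃[ l ] (k ≤ l × upper η (a l) × lower η (a (suc (suc l))))
  bracket a anti vanishing l0 k uk = start (Equivalence.to (ℝ.lower-rounded η) l0)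
    where
    Bracket : ℕ → Set
    Bracket k = ∃[ l ] (k ≤ l × upper η (a l) × lower η (a (suc (suc l))))
    widen : ∀ {k} → Bracket (suc k) → Bracket k
    widen (l , k<l , ul , ll) = l , ℕ.<⇒≤ k<l , ul , ll
    module _ {q} (lq : lower η q) {b} (small : ∀ k → b ≤ k → a k ℚ.≤ q) where
      search : ∀ fuel k → upper η (a k) → b ≤ fuel ℕ.+ k → Bracket k
      search zero       k uk le = ⊥-elim (ℚ.<-irrefl refl (ℚ.<-≤-trans (lower<upper lq uk) (small k le)))
      search (suc fuel) k uk le = Sum.[ (λ lo → k , ℕ.≤-refl , uk , lo)
                                      , (λ up → widen (search fuel (suc k) up (subst (b ≤_) (sym (ℕ.+-suc fuel k)) le))) ]
                                    (ℝ.located η (anti (suc k)))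
    start : (∃[ q ] (0ℚ ℚ.< q × lower η q)) → Bracket k
    start (q , 0<q , lq) = let (b , small) = vanishing q 0<q in search lq small b k uk (ℕ.m≤m+n b k)

-- From the integer surplus to the margin

square-margin-mono : ∀ q b μ → 0ℚ ℚ.≤ q → 0ℚ ℚ.≤ μ → q ℚ.≤ b → q ℚ.* q ℚ.* μ ℚ.≤ b ℚ.* b ℚ.* μ
square-margin-mono q b μ 0≤q 0≤μ q≤b = ℚ.*-monoʳ-≤-nonNeg μ {{ℚ.nonNegative 0≤μ}}
  (ℚ.≤-trans (ℚ.*-monoˡ-≤-nonNeg q {{ℚ.nonNegative 0≤q}} q≤b) (ℚ.*-monoʳ-≤-nonNeg b {{ℚ.nonNegative (ℚ.≤-trans 0≤q q≤b)}} q≤b))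

0≤/ : ∀ n d .{{_ : NonZero d}} → 0ℚ ℚ.≤ + n / d
0≤/ n d@(suc _) = cross-divide (⌜⌝-fraction 0) (/-fraction (+ n) d) (subst (0ℤ ≤ᶻ_) (sym (ℤ.*-identityʳ (+ n))) (0≤+ n))

-- Here `l` stands for the reciprocal of the upper bound for η and `L` for that of the lower bound,
-- `z` for the surplus in edges, and `μ` for 10⁶. One factor r of the margin is given away through r
-- ≥ 3.
margin-arith : ∀ N R L l z H h u μ → 0ℤ ≤ᶻ N → + 3 ≤ᶻ R → 0ℤ ≤ᶻ L → 0ℤ <ᶻ H → 0ℤ ≤ᶻ μ →
  H ≡ h * (+ 8 * (u * u) * (R * R) * (L * L)) → + 2 * (+ 2 * h * (+ 8 * (u * u))) ≤ᶻ + 108 * μ →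
  L * L ≤ᶻ + 2 * (l * l) → + 36 * N ≤ᶻ H * (+ 2 * z) → N ≤ᶻ z * (l * l * (μ * (R * (R * (R * 1ℤ)))))
margin-arith N R L l z H h u μ 0≤N 3≤R 0≤L 0<H 0≤μ H≡ const sq≤ main = *-cancel (+ 72) (+<+ (s≤s z≤n)) (≤-by
    (0≤+ 36 ⊗ 0≤μ ⊗ (0≤R ⊗ 0≤R ⊗ 0≤R) ⊗ 0≤z ⊗ gap sq≤ ⊕ 0≤+ 36 ⊗ 0≤μ ⊗ (0≤R ⊗ 0≤R) ⊗ (0≤L ⊗ 0≤L) ⊗ 0≤z ⊗ gap 3≤R
      ⊕ 0≤R ⊗ 0≤R ⊗ (0≤L ⊗ 0≤L) ⊗ 0≤z ⊗ gap const ⊕ 0≤+ 2 ⊗ gap (subst (λ x → + 36 * N ≤ᶻ x * (+ 2 * z)) H≡ main))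
    (e N R L l z h u μ))
  where
  0≤R = ℤ.≤-trans (0≤+ 3) 3≤R
  0≤z : 0ℤ ≤ᶻ z
  0≤z = *-cancel (+ 2) (+<+ (s≤s z≤n)) (*-cancel H 0<H (ℤ.≤-trans (≡⇒≤ (ℤ.*-zeroʳ H)) (ℤ.≤-trans (0≤+ 36 ⊗ 0≤N) main)))
  e : ∀ N R L l z h u μ → + 72 * (z * (l * l * (μ * (R * (R * (R * 1ℤ)))))) - + 72 * N ≡
      + 36 * μ * (R * R * R) * z * (+ 2 * (l * l) - L * L) + + 36 * μ * (R * R) * (L * L) * z * (R - + 3)
      + R * R * (L * L) * z * (+ 108 * μ - + 2 * (+ 2 * h * (+ 8 * (u * u))))
      + + 2 * (h * (+ 8 * (u * u) * (R * R) * (L * L)) * (+ 2 * z) - + 36 * N)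
  e = solve-∀

-- Both ends of the enclosure of η agree up to a factor below the square root of 2, so replacing one
-- by the other at most doubles the square.
square-shift : ∀ l → 4 ≤ l → + suc (suc (suc l)) * + suc (suc (suc l)) ≤ᶻ + 2 * (+ suc l * + suc l)
square-shift l 4≤l = ≤-by (gap (+≤+ 4≤l) ⊗ (0≤+ l ⊕ 0≤+ 2) ⊕ 0≤+ 1) (e (+ l))
  where
  e : ∀ l → + 2 * ((1ℤ + l) * (1ℤ + l)) - (+ 3 + l) * (+ 3 + l) ≡ (l - + 4) * (l + + 2) + 1ℤ
  e = solve-∀

pos-cube : ∀ a r → + (a ℕ.* r ℕ.^ 3) ≡ + a * (+ r * (+ r * (+ r * 1ℤ)))
pos-cube a r = trans (ℤ.pos-* a (r ℕ.^ 3)) (cong (+ a *_) (trans (ℤ.pos-* r (r ℕ.^ 2)) (cong (+ r *_)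
  (trans (ℤ.pos-* r (r ℕ.^ 1)) (cong (+ r *_) (ℤ.pos-* r 1))))))

module Conclusion (r : ℕ) .{{_ : NonZero r}} (3≤r : 3 ≤ r) (η : ℝ) (l : ℕ) (large : 4 ℕ.+ Parameters.threshold r 3≤r ≤ l)
  (η< : upper η (+ 1 / suc l)) (<η : lower η (+ 1 / suc (suc (suc l)))) where

  L : ℕ
  L = suc (suc (suc l))

  threshold≤L : Parameters.threshold r 3≤r ≤ L
  threshold≤L = ℕ.≤-trans (ℕ.m≤n+m (Parameters.threshold r 3≤r) 4) (ℕ.≤-trans large (ℕ.m≤n+m l 3))

  κ N₀ : ℕ
  κ  = Parameters.Scales.κ r 3≤r L threshold≤L
  N₀ = Parameters.Scales.N₀ r 3≤r L threshold≤L

  c H : ℤ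
  c = + 8 * (+ u * + u) * (+ r * + r) * (+ L * + L)
  H = + h * c

  0<c : 0ℤ <ᶻ c
  0<c = Parameters.Scales.0<c r 3≤r L threshold≤L

  0<H : 0ℤ <ᶻ H
  0<H = 0<* {+ h} {c} (ℤ.<-≤-trans {j = + 9} (+<+ (s≤s z≤n)) 9≤h) 0<c

  instance
    κ≢0 : NonZero κ
    κ≢0 = ℕ.>-nonZero (ℤ.drop‿+<+ (Parameters.Scales.0<κ r 3≤r L threshold≤L))

  module _ {n : ℕ} (col : Colouring (K n) r) where

    standard-counts : Standard η col → ∀ S → ∣ S ∣ ≡ ∣ ∁ S ∣ ⊎ ∣ S ∣ ≡ suc ∣ ∁ S ∣ → ∀ i → i ≢ colour₁ →
      + n * + n ≤ᶻ + L * + (#≢ colour₁ coloured col inside (K n [ S ])) ⊎ + n * + n ≤ᶻ + L * + (#≢ i coloured col inside (K n [ ∁ S ]))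
    standard-counts standard S size i i≢ = Sum.map
        (λ le → subst (_≤ᶻ + L * + (#≢ colour₁ coloured col inside (K n [ S ]))) n²≡
                  (unit-fraction-product L (n ℕ.^ 2) (#≢ colour₁ coloured col inside (K n [ S ])) (le (+ 1 / L) <η)))
        (λ le → subst (_≤ᶻ + L * + (#≢ i coloured col inside (K n [ ∁ S ]))) n²≡
                  (unit-fraction-product L (n ℕ.^ 2) (#≢ i coloured col inside (K n [ ∁ S ])) (le (+ 1 / L) <η)))
        (standard S size i i≢)
      where
      n²≡ : + (n ℕ.^ 2) ≡ + n * + n
      n²≡ = trans (ℤ.pos-* n (n ℕ.* 1)) (cong (λ s → + n * + s) (ℕ.*-identityʳ n))

    surplus : Fin r → {T : Graph n} → Copy T (K n) → ℤ
    surplus j S = + 2 * + (# colour₁ coloured col inside graph S) - + 2 * + (# j coloured col inside graph S)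

    copy-with-surplus : N₀ ≤ n → ∀ (T : Graph n) → IsTree T → ⌜ maxDegree T ⌝ ℚ.≤ (+ 1 / κ) ℚ.* ⌜ n ⌝ →
      Balanced (+ 1 / κ) col → Standard η col → Σ[ S ∈ Copy T (K n) ] (∀ j → j ≢ colour₁ → + 36 * + n ≤ᶻ H * surplus j S)
    copy-with-surplus N₀≤n T tree Δ≤ balanced standard = Parameters.Scales.Large.surplus-copy r 3≤r L threshold≤L n N₀≤n T
      (IsTree.acyclic tree) (IsTree.connected tree) (maxDegree T) (degree≤maxDegree T) (unit-fraction-bound κ (maxDegree T) n Δ≤) col colour₁
      (λ i → lower-proportion r κ (edgeCount (K n)) (# i coloured col inside K n) (proj₁ (balanced i)))
      (λ i → upper-proportion r κ (edgeCount (K n)) (# i coloured col inside K n) (proj₂ (balanced i)))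
      (standard-counts standard)

  -- Every rational below η is at most 1/(l + 1), so the margin only has to be verified at that
  -- value. The denominator is a variable with a known value, which keeps 10⁶ r³ from being
  -- unfolded.
  square-margin : ∀ D .{{_ : NonZero D}} → + D ≡ + (10 ℕ.^ 6) * (+ r * (+ r * (+ r * 1ℤ))) → ∀ n x y →
    + 36 * + n ≤ᶻ H * (+ 2 * + x - + 2 * + y) → η ²· + n / D ≼ (⌜ x ⌝ ℚ.- ⌜ y ⌝)
  square-margin D D≡ n x y le q 0≤q q<η = ℚ.≤-trans
      (square-margin-mono q (+ 1 / suc l) (+ n / D) 0≤q (0≤/ n D) (ℚ.<⇒≤ (lower<upper η q<η η<)))
      (square-bound (suc l) D n x y (subst (λ d → + n ≤ᶻ (+ x - + y) * (+ suc l * + suc l * d)) (sym D≡)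
        (margin-arith (+ n) (+ r) (+ L) (+ suc l) (+ x - + y) H (+ h) (+ u) (+ (10 ℕ.^ 6)) (0≤+ n) (+≤+ 3≤r) (0≤+ L) 0<H (0≤+ (10 ℕ.^ 6)) refl margin-constant
          (square-shift l (ℕ.≤-trans (ℕ.m≤m+n 4 (Parameters.threshold r 3≤r)) large))
          (subst (λ s → + 36 * + n ≤ᶻ H * s) (e (+ x) (+ y)) le))))
    where
    e : ∀ x y → + 2 * x - + 2 * y ≡ + 2 * (x - y)
    e = solve-∀

theorem1p7 :
    ∀ (r : ℕ) .{{_ : NonZero r}} → 3 ≤ r →
    ∃[ η₀ ] (0ℚ ℚ.< η₀ × (∀ (η : ℝ) → lower η 0ℚ → upper η η₀ →
    ∃[ ε ] (0ℚ ℚ.< ε × (∃[ N ] (∀ (n : ℕ) → N ≤ n →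
      ∀ (T : Graph n) → IsTree T → ⌜ maxDegree T ⌝ ℚ.≤ ε ℚ.* ⌜ n ⌝ →
      ∀ (c : Colouring (K n) r) → Balanced ε c → Standard η c →
      Σ[ S ∈ Copy T (K n) ] (∀ (i : Fin r) → i ≢ colour₁ →
        η ²· margin r n ≼
          (⌜ # colour₁ coloured c inside graph S ⌝ ℚ.- ⌜ # i coloured c inside graph S ⌝)))))))
theorem1p7 r 3≤r = + 1 / suc (4 ℕ.+ Parameters.threshold r 3≤r) , 0<unit-fraction (suc (4 ℕ.+ Parameters.threshold r 3≤r)) ,
  -- Starting at index 4 + `threshold` yields both that `L` reaches the threshold and that l ≥ 4, as
  -- `square-shift` requires.
  λ η 0<η η<η₀ → let (l , large , η< , <η) = bracket η (λ k → + 1 / suc k) unit-fraction-anti unit-fraction-null 0<η (4 ℕ.+ Parameters.threshold r 3≤r) η<η₀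
                     open Conclusion r 3≤r η l large η< <η
  in + 1 / κ , 0<unit-fraction κ , N₀ , λ n N₀≤n T tree Δ≤ c balanced standard →
     let (S , surplus≥) = copy-with-surplus c N₀≤n T tree Δ≤ balanced standard
     in S , λ i i≢ → square-margin (10 ℕ.^ 6 ℕ.* r ℕ.^ 3) {{ℕ.m*n≢0 (10 ℕ.^ 6) (r ℕ.^ 3) {{_}} {{ℕ.m^n≢0 r 3}}}} (pos-cube (10 ℕ.^ 6) r) n
                       (# colour₁ coloured c inside graph S) (# i coloured c inside graph S) (surplus≥ i i≢)
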